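{- Fix a non-zero integer $k$ that is not the square of a rational number. For each positive integer $B$ let $E_B$ be the curve $y^2=x^3+kB^2$ and $E_B(\mathbb{Z})=\{(x,y)\in\mathbb{Z}^2: y^2=x^3+kB^2\}$. Then for all $N\geq 3$, \[\#\{1\leq B\leq N:E_B(\mathbb{Z})\neq \varnothing\}\ll_k N\left(\frac{\log\log N}{\log N}\right)^{\frac{1}{2}},\] where the implied constant depends only on $k$.
   Context: $B$ ranges over positive integers. The notation $X\ll_k Y$ means $|X|\leq C_k Y$ for a constant $C_k$ depending only on $k$. -}

module Defs where

open import Data.Nat using (ℕ; _≤_; _*_; _^_)
open import Data.Nat.Logarithm using (⌈log₂_⌉)
open import Data.Integer as ℤ using (ℤ; +_)
open import Data.Rational as ℚ using (ℚ)
open import Data.Product using (_×_; ∃-syntax)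
open import Data.List using (List; length)
open import Data.List.Relation.Unary.All using (All)
open import Data.List.Relation.Unary.Unique.Propositional using (Unique)
open import Relation.Binary.PropositionalEquality using (_≡_; _≢_)

NonSquareRational : ℤ → Set
NonSquareRational k = ∀ (r : ℚ) → r ℚ.* r ≢ ℚ._/_ k 1

HasIntegralPoint : ℤ → ℕ → Set
HasIntegralPoint k B =
  ∃[ x ] ∃[ y ] (y ℤ.* y ≡ x ℤ.* x ℤ.* x ℤ.+ k ℤ.* (+ B) ℤ.* (+ B))

GoodList : ℤ → ℕ → List ℕ → Set
GoodList k N S = Unique S × All (λ B → (1 ≤ B) × (B ≤ N) × HasIntegralPoint k B) S

-- integer proxies for log N and log log N (valid up to constants for N ≥ 3)
Lg : ℕ → ℕ
Lg N = ⌈log₂ N ⌉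

LgLg : ℕ → ℕ
LgLg N = ⌈log₂ ⌈log₂ N ⌉ ⌉

-- count ≤ C · N · (LgLg N / Lg N)^(1/2), squared to avoid roots:
-- count² · Lg N ≤ C² · N² · LgLg N
Bound : ℕ → ℕ → ℕ → Set
Bound C N count = count ^ 2 * Lg N ≤ C ^ 2 * N ^ 2 * LgLg N

{-# OPTIONS --safe #-}
module Submission where

-- A point (x , y) on E_B reduces to B = n v³ m, x = n v² u with n u³ = y′² − k m² and y′ prime to m.
-- With T ≈ log N there are three cases.
--
-- (A) v³m ≤ T⁶. Every prime p ∣ n has k as a square modulo p, so B = s w with s composed of such primes and
-- w ≤ T⁶ free of them. A Hall–Tenenbaum argument bounds the number of these B by (N / log N) Σ 1/s Σ 1/w, and
-- (Σ 1/s)² ≪ log N, (Σ 1/w)² ≪ log T: the first because a pair of squarefree s-numbers is determined, up to a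
-- common factor, by a short vector (a , b) with a² − k b² a small multiple of their product, the second
-- because the values of a² − k b² supply many s-numbers.
--
-- (B) |x| ≤ N / T⁵. Short vectors modulo u and n give c³ β = α ξ³ in ℤ[√k] for β = y′ + m√k, and α factors
-- likewise; up to boundedly many units per dyadic range, the small factors determine B, so N / T such B occur.
--
-- (C) Otherwise (y′ , m) lies in the cusp, and solutions sharing α and c repel each other: moderate u are
-- separated by a gap principle, and large u by Thue's method (forms built from finite differences of cube
-- root binomial coefficients), which leaves boundedly many. Again ≪ N / T values B occur.

open import Defs
open import Data.Nat as ℕ using (ℕ; zero; suc; _+_; _*_; _∸_; _^_; _≤_; _<_; z≤n; s≤s; NonZero; _!; >-nonZero; ≢-nonZero)
open import Data.Nat.Properties
open import Data.Nat.Divisibility using (_∣_; divides; _∣?_)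
open import Data.Integer as ℤ using (ℤ; +_; -[1+_]; 0ℤ; 1ℤ) renaming (∣_∣ to abs; _*_ to _·_; _+_ to _⊕_; _-_ to _⊖_; -_ to ⊖_)
import Data.Integer.Properties as ℤP
import Data.Nat.Divisibility as ND
import Data.Nat.Tactic.RingSolver as NS
import Data.Integer.Tactic.RingSolver as ZS
open import Data.Product using (∃-syntax; Σ; _×_; _,_; proj₁; proj₂)
open import Data.Sum using (_⊎_; inj₁; inj₂; [_,_]′)
open import Data.Empty using (⊥; ⊥-elim)
open import Data.Unit using (⊤; tt)
open import Data.List using (List; []; _∷_; length; map; filter; _++_)
open import Data.List.Relation.Unary.All as All using (All; []; _∷_)
open import Data.List.Relation.Unary.AllPairs using (AllPairs; []; _∷_)
open import Relation.Nullary using (¬_; Dec; yes; no)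
open import Relation.Binary.PropositionalEquality using (_≡_; _≢_; refl; sym; trans; cong; cong₂; subst; subst₂; module ≡-Reasoning)
open import Function using (_∘_; id)
import Data.List.Properties as LP
import Data.List.Relation.Unary.All.Properties as AllP
open import Data.Nat.Coprimality using (Coprime; coprime-divisor; coprime-Bézout; coprime?) renaming (sym to coprime-sym)
open import Data.Nat.GCD using (module Bézout; gcd; gcd[m,n]∣m; gcd[m,n]∣n; gcd-greatest; gcd[m,n]≢0)
open import Data.Fin as Fin using (Fin; toℕ; fromℕ<; remQuot)
import Data.Fin.Properties as FinP
import Data.Integer.DivMod as ℤD
import Data.Integer.Divisibility.Signed as ℤS
import Data.Rational as ℚ
import Data.Rational.Properties as ℚP
import Data.Rational.Unnormalised as ℚᵘ
import Data.Rational.Unnormalised.Properties as ℚᵘP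
import Data.List.Relation.Unary.AllPairs.Properties as APP
import Data.Nat.DivMod as DM
open import Relation.Unary using (Decidable)
open import Relation.Nullary.Decidable using (¬?; _×-dec_; decidable-stable)
open import Data.Nat.Primality using (Prime; prime?; euclidsLemma; prime⇒nonTrivial; prime⇒nonZero; prime⇒irreducible; ¬prime[1])
open import Data.Nat.Primality.Factorisation using (PrimeFactorisation; factorise)
open import Data.Nat.ListAction using (product)
open import Data.List using (cartesianProduct; downFrom)
open import Data.List.Relation.Unary.Unique.Propositional using (Unique)
import Data.List.Relation.Unary.Unique.Propositional.Properties as UP
open import Relation.Nullary.Decidable using (_→-dec_; map′)
open import Data.Nat.Combinatorics using (k![n∸k]!∣n!)
open import Data.Nat.Logarithm using (⌈log₂_⌉; ⌈log₂⌉-mono-≤; ⌈log₂2^n⌉≡n)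

-- The exponent 1/2 reflects that `k` should be a square modulo half of the primes. No
-- equidistribution of primes is invoked: (Σ 1/s)² is counted directly, as a sum over lattice
-- vectors, and Σ 1/w is then bounded through (Σ 1/s)(Σ 1/w) ≪ log z, by the uniqueness of n = s w,
-- together with a lower bound for Σ 1/s. In ℤ[√k] neither unique factorisation nor finiteness of
-- the unit group is at hand. The pigeonhole principle supplies elements in place of ideals, at the
-- cost of bounded integers `c`, and since `y` and `m` are coprime, every divisibility may be tested
-- after multiplication by a power of `m`. The powers of T come from the losses. Case (B) loses T⁴,
-- from three dyadic parameters and the dyadic size of a unit, so X₀ = N / T⁵. Case (C) loses T³, so
-- it needs n v ≪ N / T⁴ in each class; this follows from v³m > w³ with w = T², whence the cut at z
-- = w³ = T⁶. Everything stays inside the natural numbers: reciprocals are scaled by `N !`,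
-- logarithms are integer parts, and square roots are removed by squaring.

*-^ : ∀ n a b → (a * b) ^ n ≡ a ^ n * b ^ n
*-^ zero a b = refl
*-^ (suc n) a b = trans (cong (a * b *_) (*-^ n a b)) (l a b (a ^ n) (b ^ n))
  where
  l : ∀ a b x y → a * b * (x * y) ≡ a * x * (b * y)
  l = NS.solve-∀

-- Pascal's rule, cleared of denominators: the two induction hypotheses contribute equally and
-- double the power of 2. It is used for Chebyshev's bound and for n^n ≤ 4^n n!.
factorial-split : ∀ m n → (m + n) ! ≤ 2 ^ (m + n) * (m ! * n !)
factorial-split zero n = ≤-trans (m≤n*m (n !) (2 ^ n) {{>-nonZero (m^n>0 2 n)}}) (≤-reflexive (cong (2 ^ n *_) (sym (*-identityˡ (n !)))))
factorial-split (suc m) zero = begin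
  (suc m + 0) ! ≡⟨ cong _! (+-identityʳ (suc m)) ⟩
  suc m ! ≤⟨ m≤n*m (suc m !) (2 ^ (suc m + 0)) {{>-nonZero (m^n>0 2 (suc m + 0))}} ⟩
  2 ^ (suc m + 0) * suc m ! ≡⟨ cong (2 ^ (suc m + 0) *_) (sym (*-identityʳ (suc m !))) ⟩
  2 ^ (suc m + 0) * (suc m ! * 1) ∎
  where open ≤-Reasoning
factorial-split (suc m) (suc n) = begin
  (suc m + suc n) * (m + suc n) ! ≡⟨ *-distribʳ-+ ((m + suc n) !) (suc m) (suc n) ⟩
  suc m * (m + suc n) ! + suc n * (m + suc n) !
    ≤⟨ +-mono-≤ (*-monoʳ-≤ (suc m) (factorial-split m (suc n)))
                (*-monoʳ-≤ (suc n) (subst (λ i → i ! ≤ 2 ^ i * (suc m ! * n !)) (sym (+-suc m n)) (factorial-split (suc m) n))) ⟩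
  suc m * (2 ^ (m + suc n) * (m ! * suc n !)) + suc n * (2 ^ (m + suc n) * (suc m ! * n !))
    ≡⟨ l (suc m) (suc n) (2 ^ (m + suc n)) (m !) (n !) ⟩
  2 * 2 ^ (m + suc n) * (suc m ! * suc n !) ∎
  where
  open ≤-Reasoning
  l : ∀ a b p x y → a * (p * (x * (b * y))) + b * (p * (a * x * y)) ≡ 2 * p * (a * x * (b * y))
  l = NS.solve-∀

-- Counting by labels

module Counting {A : Set} (key : A → ℕ) where

  Distinct : List A → Set
  Distinct = AllPairs (λ x y → key x ≢ key y)

  -- At most K elements, up to equality of keys, satisfy P.
  Bdd : (A → Set) → ℕ → Set
  Bdd P K = ∀ xs → All P xs → Distinct xs → length xs ≤ K

  bdd-mono : ∀ {P Q K L} → (∀ x → P x → Q x) → K ≤ L → Bdd Q K → Bdd P L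
  bdd-mono h le b xs ps d = ≤-trans (b xs (All.map (λ {x} → h x) ps) d) le

  bdd-empty : ∀ {P} K → (∀ x → ¬ P x) → Bdd P K
  bdd-empty K h [] _ _ = z≤n
  bdd-empty K h (x ∷ xs) (p ∷ _) _ = ⊥-elim (h x p)

  bdd-unique : ∀ {P} → (∀ x y → P x → P y → key x ≡ key y) → Bdd P 1
  bdd-unique h [] _ _ = z≤n
  bdd-unique h (x ∷ []) _ _ = s≤s z≤n
  bdd-unique h (x ∷ y ∷ xs) (p ∷ q ∷ _) ((ne ∷ _) ∷ _) = ⊥-elim (ne (h x y p q))

  length-filter-split : ∀ {Q : A → Set} (Q? : Decidable Q) xs → length xs ≡ length (filter Q? xs) + length (filter (¬? ∘ Q?) xs)
  length-filter-split Q? [] = refl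
  length-filter-split Q? (x ∷ xs) with Q? x
  ... | yes _ = cong suc (length-filter-split Q? xs)
  ... | no _ = trans (cong suc (length-filter-split Q? xs)) (sym (+-suc _ _))

  bdd-split : ∀ {P Q : A → Set} {K L} (Q? : Decidable Q) → Bdd (λ x → P x × Q x) K → Bdd (λ x → P x × ¬ Q x) L → Bdd P (K + L)
  bdd-split Q? b c xs ps d = ≤-trans (≤-reflexive (length-filter-split Q? xs)) (+-mono-≤
    (b (filter Q? xs) (All.zip (AllP.filter⁺ Q? ps , AllP.all-filter Q? xs)) (APP.filter⁺ Q? d))
    (c (filter (¬? ∘ Q?) xs) (All.zip (AllP.filter⁺ (¬? ∘ Q?) ps , AllP.all-filter (¬? ∘ Q?) xs)) (APP.filter⁺ (¬? ∘ Q?) d)))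

  bdd-fibre : ∀ {P : A → Set} {K} (f : A → ℕ) L → (∀ x → P x → f x < L) → (∀ l → l < L → Bdd (λ x → P x × f x ≡ l) K) → Bdd P (L * K)
  bdd-fibre f zero h b = bdd-empty 0 (λ x p → n≮0 (h x p))
  bdd-fibre {P} {K} f (suc L) h b = bdd-split (λ x → f x ≟ L) (b L ≤-refl)
    (bdd-fibre f L (λ x (p , ne) → ≤∧≢⇒< (ℕ.s≤s⁻¹ (h x p)) ne) (λ l lt → bdd-mono (λ x ((p , _) , e) → p , e) ≤-refl (b l (m≤n⇒m≤1+n lt))))

  find-min : ∀ {P : A → Set} (f : A → ℕ) x xs → All P (x ∷ xs) → ∃[ a ] (P a × All (λ y → f a ≤ f y) (x ∷ xs))
  find-min f x [] (p ∷ []) = x , p , ≤-refl ∷ []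
  find-min f x (y ∷ ys) (p ∷ ps) with find-min f y ys ps
  ... | a , pa , h with f x ≤? f a
  ...   | yes le = x , p , ≤-refl ∷ All.map (≤-trans le) h
  ...   | no gt = a , pa , <⇒≤ (≰⇒> gt) ∷ h

  -- Lets a counting argument start from an element with least `f`. In case (C) this is the smallest
  -- solution of a class, against which all others are measured.
  bdd-min : ∀ {P : A → Set} {K} (f : A → ℕ) → (∀ a → P a → Bdd (λ x → P x × f a ≤ f x) K) → Bdd P K
  bdd-min f h [] _ _ = z≤n
  bdd-min f h (x ∷ xs) ps d with find-min f x xs ps
  ... | a , pa , g = h a pa (x ∷ xs) (All.zip (ps , g)) d

  Labels : Set
  Labels = List ((A → ℕ) × ℕ)

  count : Labels → ℕ
  count [] = 1
  count ((_ , L) ∷ ls) = L * count ls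

  bdd-labels : ∀ {P : A → Set} (ls : Labels) → (∀ x → P x → All (λ l → proj₁ l x < proj₂ l) ls) →
    (∀ x y → P x → P y → All (λ l → proj₁ l x ≡ proj₁ l y) ls → key x ≡ key y) → Bdd P (count ls)
  bdd-labels [] h u = bdd-unique (λ x y p q → u x y p q [])
  bdd-labels ((f , L) ∷ ls) h u = bdd-fibre f L (λ x p → All.head (h x p))
    (λ l lt → bdd-labels ls (λ x (p , _) → All.tail (h x p)) (λ x y (p , e) (q , e') al → u x y p q (trans e (sym e') ∷ al)))

  -- Unlike in `bdd-labels`, the labels need not determine the key. A fibre is described as
  -- agreement with one of its members `a`, and the bound inside it may be proved with `a` at hand.
  bdd-labels-ref : ∀ {P : A → Set} {K} (ls : Labels) → (∀ x → P x → All (λ l → proj₁ l x < proj₂ l) ls) →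
    (∀ a → P a → Bdd (λ x → P x × All (λ l → proj₁ l x ≡ proj₁ l a) ls) K) → Bdd P (count ls * K)
  bdd-labels-ref {K = K} [] h u [] _ _ = z≤n
  bdd-labels-ref {K = K} [] h u (x ∷ xs) ps d = ≤-trans (u x (All.head ps) (x ∷ xs) (All.map (λ p → p , []) ps) d) (m≤m+n K 0)
  bdd-labels-ref {P} {K} ((f , L) ∷ ls) h u = bdd-mono (λ x p → p) (≤-reflexive (sym (*-assoc L (count ls) K))) (bdd-fibre f L (λ x p → All.head (h x p))
    (λ l lt → bdd-labels-ref ls (λ x (p , _) → All.tail (h x p)) (λ a (pa , ea) → bdd-mono (λ x ((p , e) , al) → p , trans e (sym ea) ∷ al) ≤-refl (u a pa))))

zlabel : ℤ → ℕ
zlabel (+ n) = 2 * n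
zlabel -[1+ n ] = 1 + 2 * n

zlabel< : ∀ z M → abs z ≤ M → zlabel z < 2 * M + 1
zlabel< (+ n) M p = ≤-trans (s≤s (*-monoʳ-≤ 2 p)) (≤-reflexive (+-comm 1 (2 * M)))
zlabel< -[1+ n ] M p = ≤-trans (s≤s (≤-trans (n≤1+n _) (≤-trans (≤-reflexive (l n)) (*-monoʳ-≤ 2 p)))) (≤-reflexive (+-comm 1 (2 * M)))
  where
  l : ∀ n → suc (1 + 2 * n) ≡ 2 * suc n
  l = NS.solve-∀

zlabel-injective : ∀ x y → zlabel x ≡ zlabel y → x ≡ y
zlabel-injective (+ m) (+ n) e = cong +_ (*-cancelˡ-≡ m n 2 e)
zlabel-injective -[1+ m ] -[1+ n ] e = cong -[1+_] (*-cancelˡ-≡ m n 2 (suc-injective e))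
zlabel-injective (+ m) -[1+ n ] e = ⊥-elim (even≢odd m n e)
zlabel-injective -[1+ m ] (+ n) e = ⊥-elim (even≢odd n m (sym e))

-- Integer logarithms

plog : ∀ b x → 2 ≤ b → 1 ≤ x → ∃[ e ] (b ^ e ≤ x × x < b ^ suc e)
plog b (suc zero) b≥2 _ = 0 , s≤s z≤n , ≤-trans b≥2 (≤-reflexive (sym (*-identityʳ b)))
plog b (suc (suc x)) b≥2 _ with plog b (suc x) b≥2 (s≤s z≤n)
... | e , lo , hi with b ^ suc e ≤? suc (suc x)
...   | yes p = suc e , p , ≤-trans (s≤s hi) (≤-trans (m<m+n (b ^ suc e) (m^n>0 b {{>-nonZero (≤-trans (s≤s z≤n) b≥2)}} (suc e))) (≤-trans (≤-reflexive (l (b ^ suc e))) (*-monoˡ-≤ (b ^ suc e) b≥2)))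
  where
  l : ∀ a → a + a ≡ 2 * a
  l = NS.solve-∀
...   | no p = e , ≤-trans lo (n≤1+n _) , ≰⇒> p

ilog : ℕ → ℕ
ilog zero = 0
ilog (suc x) = proj₁ (plog 2 (suc x) ≤-refl (s≤s z≤n))

2^ilog≤ : ∀ x → 1 ≤ x → 2 ^ ilog x ≤ x
2^ilog≤ (suc x) _ = proj₁ (proj₂ (plog 2 (suc x) ≤-refl (s≤s z≤n)))

<2^ilog : ∀ x → x < 2 ^ suc (ilog x)
<2^ilog zero = s≤s z≤n
<2^ilog (suc x) = proj₂ (proj₂ (plog 2 (suc x) ≤-refl (s≤s z≤n)))

^-cancel-< : ∀ b m n → 2 ≤ b → b ^ m < b ^ n → m < n
^-cancel-< b m n b≥2 lt with m <? n
... | yes p = p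
... | no p = ⊥-elim (<⇒≱ lt (^-monoʳ-≤ b {{>-nonZero (≤-trans (s≤s z≤n) b≥2)}} (≮⇒≥ p)))

ilog-≤ : ∀ {x} e → x < 2 ^ suc e → ilog x ≤ e
ilog-≤ {zero} e lt = z≤n
ilog-≤ {suc x} e lt = ℕ.s≤s⁻¹ (^-cancel-< 2 (ilog (suc x)) (suc e) ≤-refl (≤-<-trans (2^ilog≤ (suc x) (s≤s z≤n)) lt))

ilog-mono : ∀ {x y} → x ≤ y → ilog x ≤ ilog y
ilog-mono {x} {y} p = ilog-≤ (ilog y) (≤-<-trans p (<2^ilog y))

<2^n : ∀ n → n < 2 ^ n
<2^n zero = s≤s z≤n
<2^n (suc n) = ≤-trans (s≤s (<2^n n)) (≤-trans (+-monoˡ-≤ (2 ^ n) (m^n>0 2 n)) (≤-reflexive (l (2 ^ n))))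
  where
  l : ∀ a → a + a ≡ 2 * a
  l = NS.solve-∀

ilog-poly : ∀ E e N x → x ≤ E * N ^ e → ilog x ≤ E + e * suc (ilog N)
ilog-poly E e N x p = ilog-≤ _ (begin-strict
  x ≤⟨ p ⟩
  E * N ^ e ≤⟨ *-monoʳ-≤ E (^-monoˡ-≤ e (<⇒≤ (<2^ilog N))) ⟩
  E * (2 ^ suc (ilog N)) ^ e ≡⟨ cong (E *_) (trans (^-*-assoc 2 (suc (ilog N)) e) (cong (2 ^_) (*-comm (suc (ilog N)) e))) ⟩
  E * 2 ^ (e * suc (ilog N)) <⟨ *-monoˡ-< (2 ^ (e * suc (ilog N))) {{>-nonZero (m^n>0 2 (e * suc (ilog N)))}} (<2^n E) ⟩
  2 ^ E * 2 ^ (e * suc (ilog N)) ≡⟨ sym (^-distribˡ-+-* 2 E (e * suc (ilog N))) ⟩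
  2 ^ (E + e * suc (ilog N)) ≤⟨ ^-monoʳ-≤ 2 (n≤1+n (E + e * suc (ilog N))) ⟩
  2 ^ suc (E + e * suc (ilog N)) ∎)
  where open ≤-Reasoning

-- Taking logarithms to base b² makes the exponent even. The resulting `r` is the degree of the Thue
-- form that will rule out `x`, and b^12 ≤ x is what forces r ≥ 6.
even-exponent : ∀ b x → 2 ≤ b → 1 ≤ x → b ^ 12 ≤ x → ∃[ r ] (6 ≤ r × b ^ (r + r) ≤ x × x ≤ b ^ (r + r + 2))
even-exponent b x b≥2 x≥1 h = go (plog (b * b) x bb≥2 x≥1)
  where
  bb≥2 : 2 ≤ b * b
  bb≥2 = ≤-trans b≥2 (m≤m*n b b {{>-nonZero (≤-trans (s≤s z≤n) b≥2)}})
  sq-pow : ∀ r → b ^ (r + r) ≡ (b * b) ^ r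
  sq-pow r = trans (^-distribˡ-+-* b r r) (sym (*-^ r b b))
  go : ∃[ r ] ((b * b) ^ r ≤ x × x < (b * b) ^ suc r) → ∃[ r ] (6 ≤ r × b ^ (r + r) ≤ x × x ≤ b ^ (r + r + 2))
  go (r , lo , hi) = r , ℕ.s≤s⁻¹ (^-cancel-< (b * b) 6 (suc r) bb≥2 (≤-<-trans (≤-trans (≤-reflexive (sym (sq-pow 6))) h) hi)) ,
    ≤-trans (≤-reflexive (sq-pow r)) lo ,
    ≤-trans (<⇒≤ hi) (≤-reflexive (sym (trans (^-distribˡ-+-* b (r + r) 2) (trans (cong₂ _*_ (sq-pow r) (cong (b *_) (*-identityʳ b))) (*-comm _ (b * b))))))

square-<-pow : ∀ b x → x < b ^ 12 → x * x < b ^ 24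
square-<-pow b x h = <-≤-trans (*-mono-< h h) (≤-reflexive (sym (^-distribˡ-+-* b 12 12)))

power-split : ∀ c N → 4 * ((c * (N * N)) ^ 24 * (c * (N * N)) ^ 24) ≡ 4 * c ^ 48 * N ^ 96
power-split c N = trans (cong (4 *_) (trans (sym (^-distribˡ-+-* (c * (N * N)) 24 24)) (trans (*-^ 48 c (N * N)) (cong (c ^ 48 *_) (trans (*-^ 48 N N) (sym (^-distribˡ-+-* N 48 48))))))) (sym (*-assoc 4 (c ^ 48) (N ^ 96)))

-- Finite sums and weighted counting

sumTo : (ℕ → ℕ) → ℕ → ℕ
sumTo f zero = 0
sumTo f (suc L) = f L + sumTo f L

sumTo-mono : ∀ {f g} L → (∀ l → l < L → f l ≤ g l) → sumTo f L ≤ sumTo g L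
sumTo-mono zero h = z≤n
sumTo-mono (suc L) h = +-mono-≤ (h L ≤-refl) (sumTo-mono L (λ l lt → h l (m≤n⇒m≤1+n lt)))

sumTo-cong : ∀ {f g} L → (∀ l → l < L → f l ≡ g l) → sumTo f L ≡ sumTo g L
sumTo-cong zero h = refl
sumTo-cong (suc L) h = cong₂ _+_ (h L ≤-refl) (sumTo-cong L (λ l lt → h l (m≤n⇒m≤1+n lt)))

sumTo-*ˡ : ∀ c f L → sumTo (λ l → c * f l) L ≡ c * sumTo f L
sumTo-*ˡ c f zero = sym (*-zeroʳ c)
sumTo-*ˡ c f (suc L) = trans (cong (λ i → c * f L + i) (sumTo-*ˡ c f L)) (sym (*-distribˡ-+ c (f L) (sumTo f L)))

sumTo-*ʳ : ∀ c f L → sumTo (λ l → f l * c) L ≡ sumTo f L * c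
sumTo-*ʳ c f L = trans (sumTo-cong L (λ l _ → *-comm (f l) c)) (trans (sumTo-*ˡ c f L) (*-comm c (sumTo f L)))

sumTo-const : ∀ c L → sumTo (λ _ → c) L ≡ L * c
sumTo-const c zero = refl
sumTo-const c (suc L) = cong (λ i → c + i) (sumTo-const c L)

sumTo-0 : ∀ L → sumTo (λ _ → 0) L ≡ 0
sumTo-0 L = trans (sumTo-const 0 L) (*-zeroʳ L)

sumTo-+ : ∀ f g L → sumTo (λ l → f l + g l) L ≡ sumTo f L + sumTo g L
sumTo-+ f g zero = refl
sumTo-+ f g (suc L) = trans (cong (λ i → f L + g L + i) (sumTo-+ f g L)) (l (f L) (g L) (sumTo f L) (sumTo g L))
  where
  l : ∀ a b c d → a + b + (c + d) ≡ a + c + (b + d)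
  l = NS.solve-∀

sumTo-swap : ∀ (f : ℕ → ℕ → ℕ) L M → sumTo (λ a → sumTo (f a) M) L ≡ sumTo (λ b → sumTo (λ a → f a b) L) M
sumTo-swap f zero M = sym (sumTo-0 M)
sumTo-swap f (suc L) M = trans (cong (λ i → sumTo (f L) M + i) (sumTo-swap f L M)) (sym (sumTo-+ (f L) (λ b → sumTo (λ a → f a b) L) M))

sumTo-extend : ∀ f {L M} → L ≤ M → sumTo f L ≤ sumTo f M
sumTo-extend f {M = zero} z≤n = z≤n
sumTo-extend f {L} {suc M} p with m≤n⇒m<n∨m≡n p
... | inj₁ lt = ≤-trans (sumTo-extend f (ℕ.s≤s⁻¹ lt)) (m≤n+m _ (f M))
... | inj₂ refl = ≤-refl

sumTo-term : ∀ f {i} L → i < L → f i ≤ sumTo f L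
sumTo-term f {i} (suc L) p with m≤n⇒m<n∨m≡n (ℕ.s≤s⁻¹ p)
... | inj₁ lt = ≤-trans (sumTo-term f L lt) (m≤n+m _ (f L))
... | inj₂ refl = m≤m+n _ _

sumTo-bump : ∀ {f g} L i d → i < L → (∀ l → f l ≤ g l) → f i + d ≤ g i → sumTo f L + d ≤ sumTo g L
sumTo-bump {f} {g} (suc L) i d p h b with m≤n⇒m<n∨m≡n (ℕ.s≤s⁻¹ p)
... | inj₁ lt = ≤-trans (≤-reflexive (+-assoc (f L) _ d)) (+-mono-≤ (h L) (sumTo-bump L i d lt h b))
... | inj₂ refl = ≤-trans (≤-reflexive (l (f L) (sumTo f L) d)) (+-mono-≤ b (sumTo-mono L (λ l _ → h l)))
  where
  l : ∀ a b d → a + b + d ≡ a + d + b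
  l = NS.solve-∀

sumTo-split : ∀ f L M → sumTo f (M + L) ≡ sumTo (λ i → f (i + L)) M + sumTo f L
sumTo-split f L zero = refl
sumTo-split f L (suc M) = trans (cong (λ i → f (M + L) + i) (sumTo-split f L M)) (sym (+-assoc (f (M + L)) _ _))

⟦_⟧ : ∀ {P : Set} → Dec P → ℕ
⟦ yes _ ⟧ = 1
⟦ no _ ⟧ = 0

⟦⟧-yes : ∀ {P : Set} (d : Dec P) → P → ⟦ d ⟧ ≡ 1
⟦⟧-yes (yes _) p = refl
⟦⟧-yes (no n) p = ⊥-elim (n p)

⟦⟧-no : ∀ {P : Set} (d : Dec P) → ¬ P → ⟦ d ⟧ ≡ 0
⟦⟧-no (yes p) n = ⊥-elim (n p)
⟦⟧-no (no _) n = refl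

⟦⟧≤1 : ∀ {P : Set} (d : Dec P) → ⟦ d ⟧ ≤ 1
⟦⟧≤1 (yes _) = ≤-refl
⟦⟧≤1 (no _) = z≤n

⟦⟧-mono : ∀ {P R : Set} (d : Dec P) (e : Dec R) → (P → R) → ⟦ d ⟧ ≤ ⟦ e ⟧
⟦⟧-mono (yes p) e h = ≤-reflexive (sym (⟦⟧-yes e (h p)))
⟦⟧-mono (no _) e h = z≤n

-- The weighted counterpart of `Counting`. In `wb-fibre` the bound may vary with the label, and this
-- is how sums such as Σ 1/s over label values arise.
module Keyed {A X : Set} (key : A → X) (w : A → ℕ) where

  Distinct : List A → Set
  Distinct = AllPairs (λ x y → key x ≢ key y)

  weight : List A → ℕ
  weight [] = 0
  weight (x ∷ xs) = w x + weight xs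

  WB : (A → Set) → ℕ → Set
  WB P K = ∀ xs → All P xs → Distinct xs → weight xs ≤ K

  wb-mono : ∀ {P R K L} → (∀ x → P x → R x) → K ≤ L → WB R K → WB P L
  wb-mono h le b xs ps d = ≤-trans (b xs (All.map (λ {x} → h x) ps) d) le

  wb-empty : ∀ {P} K → (∀ x → ¬ P x) → WB P K
  wb-empty K h [] _ _ = z≤n
  wb-empty K h (x ∷ xs) (p ∷ _) _ = ⊥-elim (h x p)

  wb-unique : ∀ {P} K → (∀ x → P x → w x ≤ K) → (∀ x y → P x → P y → key x ≡ key y) → WB P K
  wb-unique K hw h [] _ _ = z≤n
  wb-unique K hw h (x ∷ []) (p ∷ _) _ = ≤-trans (≤-reflexive (+-identityʳ (w x))) (hw x p)
  wb-unique K hw h (x ∷ y ∷ xs) (p ∷ q ∷ _) ((ne ∷ _) ∷ _) = ⊥-elim (ne (h x y p q))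

  weight-filter : ∀ {R : A → Set} (R? : Decidable R) xs → weight xs ≡ weight (filter R? xs) + weight (filter (¬? ∘ R?) xs)
  weight-filter R? [] = refl
  weight-filter R? (x ∷ xs) with R? x
  ... | yes _ = trans (cong (λ i → w x + i) (weight-filter R? xs)) (sym (+-assoc (w x) _ _))
  ... | no _ = trans (cong (λ i → w x + i) (weight-filter R? xs)) (l (w x) (weight (filter R? xs)) (weight (filter (¬? ∘ R?) xs)))
    where
    l : ∀ a b c → a + (b + c) ≡ b + (a + c)
    l = NS.solve-∀

  wb-fibre : ∀ {P : A → Set} (f : A → ℕ) (K : ℕ → ℕ) L → (∀ x → P x → f x < L) → (∀ l → l < L → WB (λ x → P x × f x ≡ l) (K l)) → WB P (sumTo K L)
  wb-fibre f K zero h b = wb-empty 0 (λ x p → n≮0 (h x p))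
  wb-fibre {P} f K (suc L) h b xs ps d = ≤-trans (≤-reflexive (weight-filter R? xs)) (+-mono-≤
    (b L ≤-refl (filter R? xs) (All.zip (AllP.filter⁺ R? ps , AllP.all-filter R? xs)) (APP.filter⁺ R? d))
    (wb-fibre {λ x → P x × f x ≢ L} f K L (λ x (p , ne) → ≤∧≢⇒< (ℕ.s≤s⁻¹ (h x p)) ne) (λ l lt → wb-mono (λ x ((p , _) , e) → p , e) ≤-refl (b l (m≤n⇒m≤1+n lt)))
      (filter (¬? ∘ R?) xs) (All.zip (AllP.filter⁺ (¬? ∘ R?) ps , AllP.all-filter (¬? ∘ R?) xs)) (APP.filter⁺ (¬? ∘ R?) d)))
    where
    R? : Decidable (λ x → f x ≡ L)
    R? x = f x ≟ L

  -- When every label is known to satisfy `R`, the sum may be restricted to such values; this yields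
  -- sums over good numbers instead of full harmonic sums.
  wb-fibre? : ∀ {P : A → Set} {R : ℕ → Set} (R? : Decidable R) (f : A → ℕ) (K : ℕ → ℕ) L → (∀ x → P x → f x < L) → (∀ x → P x → R (f x)) →
    (∀ l → l < L → WB (λ x → P x × f x ≡ l) (K l)) → WB P (sumTo (λ l → ⟦ R? l ⟧ * K l) L)
  wb-fibre? {P} {R} R? f K L h r b = wb-fibre f (λ l → ⟦ R? l ⟧ * K l) L h go
    where
    go : ∀ l → l < L → WB (λ x → P x × f x ≡ l) (⟦ R? l ⟧ * K l)
    go l lt with R? l
    ... | yes _ = wb-mono (λ x p → p) (m≤m+n (K l) 0) (b l lt)
    ... | no ne = wb-empty 0 (λ { x (p , refl) → ne (r x p) })

  Labels : Set
  Labels = List ((A → ℕ) × ℕ)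

  count : Labels → ℕ
  count [] = 1
  count ((_ , L) ∷ ls) = L * count ls

  wb-labels : ∀ {P : A → Set} (ls : Labels) K → (∀ x → P x → w x ≤ K) → (∀ x → P x → All (λ l → proj₁ l x < proj₂ l) ls) →
    (∀ x y → P x → P y → All (λ l → proj₁ l x ≡ proj₁ l y) ls → key x ≡ key y) → WB P (count ls * K)
  wb-labels [] K hw h u = wb-mono (λ x p → p) (m≤m+n K 0) (wb-unique K hw (λ x y p q → u x y p q []))
  wb-labels ((f , L) ∷ ls) K hw h u = wb-mono (λ x p → p) (≤-reflexive (trans (sumTo-const (count ls * K) L) (sym (*-assoc L (count ls) K))))
    (wb-fibre f (λ _ → count ls * K) L (λ x p → All.head (h x p))
      (λ l lt → wb-labels ls K (λ x (p , _) → hw x p) (λ x (p , _) → All.tail (h x p)) (λ x y (p , e) (q , e') al → u x y p q (trans e (sym e') ∷ al))))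

module Weighted {A : Set} (w : A → ℕ) = Keyed {A} {A} id w

module _ {X : Set} {P : X → Set} where

  attach : ∀ xs → All P xs → List (Σ X P)
  attach [] [] = []
  attach (x ∷ xs) (p ∷ ps) = (x , p) ∷ attach xs ps

  attach-length : ∀ xs ps → length (attach xs ps) ≡ length xs
  attach-length [] [] = refl
  attach-length (x ∷ xs) (p ∷ ps) = cong suc (attach-length xs ps)

  attach-distinct : ∀ xs ps → Unique xs → AllPairs (λ a c → proj₁ a ≢ proj₁ c) (attach xs ps)
  attach-distinct [] [] [] = []
  attach-distinct (x ∷ xs) (p ∷ ps) (ne ∷ u) = avoid xs ps ne ∷ attach-distinct xs ps u
    where
    avoid : ∀ ys qs → All (x ≢_) ys → All (λ a → x ≢ proj₁ a) (attach ys qs)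
    avoid [] [] [] = []
    avoid (y ∷ ys) (q ∷ qs) (ne ∷ nes) = ne ∷ avoid ys qs nes

  -- Bounding a weight by labels that are computed from witnesses of P.
  weight-witnessed : ∀ (w : X → ℕ) {K} → Keyed.WB {Σ X P} {X} proj₁ (λ a → w (proj₁ a)) (λ _ → ⊤) K →
    ∀ xs → All P xs → Unique xs → Weighted.weight w xs ≤ K
  weight-witnessed w {K} b xs ps u = ≤-trans (≤-reflexive (sym (same xs ps))) (b (attach xs ps) (All.universal (λ _ → tt) _) (attach-distinct xs ps u))
    where
    same : ∀ xs ps → Keyed.weight {Σ X P} {X} proj₁ (λ a → w (proj₁ a)) (attach xs ps) ≡ Weighted.weight w xs
    same [] [] = refl
    same (x ∷ xs) (p ∷ ps) = cong (λ i → w x + i) (same xs ps)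

weight-filter-downFrom : ∀ {R : ℕ → Set} (R? : Decidable R) (g : ℕ → ℕ) L →
  Weighted.weight g (filter R? (downFrom L)) ≡ sumTo (λ l → ⟦ R? l ⟧ * g l) L
weight-filter-downFrom R? g zero = refl
weight-filter-downFrom R? g (suc L) with R? L
... | yes _ = cong₂ _+_ (sym (+-identityʳ (g L))) (weight-filter-downFrom R? g L)
... | no _ = weight-filter-downFrom R? g L

weight-product : ∀ {A B : Set} (f : A → ℕ) (g : B → ℕ) xs ys →
  Weighted.weight (λ p → f (proj₁ p) * g (proj₂ p)) (cartesianProduct xs ys) ≡ Weighted.weight f xs * Weighted.weight g ys
weight-product f g [] ys = refl
weight-product {A} {B} f g (x ∷ xs) ys = trans (weight-++ (map (x ,_) ys) (cartesianProduct xs ys)) (trans (cong₂ _+_ (row ys) (weight-product f g xs ys)) (sym (*-distribʳ-+ (Weighted.weight g ys) (f x) (Weighted.weight f xs))))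
  where
  h : A × B → ℕ
  h p = f (proj₁ p) * g (proj₂ p)
  weight-++ : ∀ us vs → Weighted.weight h (us ++ vs) ≡ Weighted.weight h us + Weighted.weight h vs
  weight-++ [] vs = refl
  weight-++ (u ∷ us) vs = trans (cong (λ i → h u + i) (weight-++ us vs)) (sym (+-assoc (h u) _ _))
  row : ∀ ys → Weighted.weight h (map (x ,_) ys) ≡ f x * Weighted.weight g ys
  row [] = sym (*-zeroʳ (f x))
  row (y ∷ ys) = trans (cong (λ i → f x * g y + i) (row ys)) (sym (*-distribˡ-+ (f x) (g y) _))

downFrom-unique : ∀ L → Unique (downFrom L)
downFrom-unique = UP.downFrom⁺

∈-downFrom : ∀ L → All (_< L) (downFrom L)
∈-downFrom zero = []
∈-downFrom (suc L) = ≤-refl ∷ All.map m≤n⇒m≤1+n (∈-downFrom L)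

-- Primes and the splitting of n into a good and a bad part

prime≥2 : ∀ {p} → Prime p → 2 ≤ p
prime≥2 {p} pr = ℕ.nonTrivial⇒n>1 p {{prime⇒nonTrivial pr}}

prime-induction : ∀ {P : ℕ → Set} → P 1 → (∀ p n → Prime p → 1 ≤ n → P n → P (p * n)) → ∀ n → 1 ≤ n → P n
prime-induction {P} base step n n≥1 = subst P (sym (PrimeFactorisation.isFactorisation F)) (proj₂ (go (PrimeFactorisation.factors F) (PrimeFactorisation.factorsPrime F)))
  where
  instance _ = >-nonZero n≥1
  F = factorise n
  go : ∀ ps → All Prime ps → (1 ≤ product ps) × P (product ps)
  go [] [] = ≤-refl , base
  go (p ∷ ps) (pr ∷ prs) with go ps prs
  ... | ge , h = *-mono-≤ (≤-trans (s≤s z≤n) (prime≥2 pr)) ge , step p (product ps) pr ge h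

prime-∣-prime : ∀ {p q} → Prime p → Prime q → p ∣ q → p ≡ q
prime-∣-prime {p} {q} pp pq d with prime⇒irreducible pq d
... | inj₁ refl = ⊥-elim (¬prime[1] pp)
... | inj₂ e = e

prime-coprime : ∀ {p n} → Prime p → ¬ p ∣ n → Coprime p n
prime-coprime {p} pp ne {d} (a , b) with prime⇒irreducible pp a
... | inj₁ e = e
... | inj₂ refl = ⊥-elim (ne b)

exists-prime : ∀ n → 2 ≤ n → ∃[ p ] (Prime p × p ∣ n)
exists-prime n n≥2 = [ (λ e → ⊥-elim (<⇒≱ n≥2 (≤-reflexive e))) , id ]′ (prime-induction {λ n → n ≡ 1 ⊎ ∃[ p ] (Prime p × p ∣ n)} (inj₁ refl) (λ p n pp _ _ → inj₂ (p , pp , ND.m∣m*n n)) n (≤-trans (s≤s z≤n) n≥2))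

coprime-by-primes : ∀ {a b} → 1 ≤ a → (∀ p → Prime p → p ∣ a → p ∣ b → ⊥) → Coprime a b
coprime-by-primes {a} {b} a≥1 h {d} (da , db) with d ≟ 1
... | yes e = e
... | no ne with exists-prime d (≤∧≢⇒< (n≢0⇒n>0 (λ { refl → n>0⇒n≢0 a≥1 (ND.0∣⇒≡0 da) })) (ne ∘ sym))
...   | p , pp , pd = ⊥-elim (h p pp (ND.∣-trans pd da) (ND.∣-trans pd db))

module Good {χ : ℕ → Set} (χ? : Decidable χ) where

  -- With `χ` the primes modulo which `k` is a square these are the s-numbers of the overview; with
  -- the complement of `χ` they are the w-numbers.
  GoodNum : ℕ → Set
  GoodNum n = 1 ≤ n × (∀ p → Prime p → p ∣ n → χ p)

  goodNum? : Decidable GoodNum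
  goodNum? n = map′ (λ (a , h) → a , λ p pp pn → h {p} (s≤s (ND.∣⇒≤ {{>-nonZero a}} pn)) pp pn) (λ (a , h) → a , λ {p} _ → h p)
    ((1 ≤? n) ×-dec (allUpTo? (λ p → prime? p →-dec ((p ∣? n) →-dec χ? p)) (suc n)))

  good-1 : GoodNum 1
  good-1 = ≤-refl , λ { p pp p1 → ⊥-elim (<⇒≱ (prime≥2 pp) (ND.∣⇒≤ p1)) }

  good-∣ : ∀ {d n} → d ∣ n → GoodNum n → GoodNum d
  good-∣ {d} {n} dn (a , h) = n≢0⇒n>0 (λ { refl → n>0⇒n≢0 a (ND.0∣⇒≡0 dn) }) , λ p pp pd → h p pp (ND.∣-trans pd dn)

  good-* : ∀ {a b} → GoodNum a → GoodNum b → GoodNum (a * b)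
  good-* {a} {b} (a≥1 , ha) (b≥1 , hb) = *-mono-≤ a≥1 b≥1 , λ p pp d → [ ha p pp , hb p pp ]′ (euclidsLemma a b pp d)

  good-prime : ∀ {p} → Prime p → χ p → GoodNum p
  good-prime {p} pp c = ≤-trans (s≤s z≤n) (prime≥2 pp) , λ q pq d → subst χ (sym (prime-∣-prime pq pp d)) c

module Decompose {χ : ℕ → Set} (χ? : Decidable χ) where
  open Good χ? public
  module Bad = Good (¬? ∘ χ?)

  decompose : ∀ n → 1 ≤ n → ∃[ s ] ∃[ w ] (n ≡ s * w × GoodNum s × Bad.GoodNum w)
  decompose = prime-induction (1 , 1 , refl , good-1 , Bad.good-1) step
    where
    step : ∀ p n → Prime p → 1 ≤ n → ∃[ s ] ∃[ w ] (n ≡ s * w × GoodNum s × Bad.GoodNum w) → ∃[ s ] ∃[ w ] (p * n ≡ s * w × GoodNum s × Bad.GoodNum w)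
    step p n pp _ (s , w , e , gs , gw) with χ? p
    ... | yes c = p * s , w , trans (cong (p *_) e) (sym (*-assoc p s w)) , good-* (good-prime pp c) gs , gw
    ... | no c = s , p * w , trans (cong (p *_) e) (l p s w) , gs , Bad.good-* (Bad.good-prime pp c) gw
      where
      l : ∀ p s w → p * (s * w) ≡ s * (p * w)
      l = NS.solve-∀

  good-bad-coprime : ∀ {s w} → GoodNum s → Bad.GoodNum w → Coprime s w
  good-bad-coprime (s≥1 , hs) (_ , hw) = coprime-by-primes s≥1 (λ p pp a b → hw p pp b (hs p pp a))

  decompose-unique : ∀ {s w s' w'} → GoodNum s → Bad.GoodNum w → GoodNum s' → Bad.GoodNum w' → s * w ≡ s' * w' → s ≡ s' × w ≡ w'
  decompose-unique {s} {w} {s'} {w'} gs gw gs' gw' e = s≡ , *-cancelˡ-≡ w w' s {{>-nonZero (proj₁ gs)}} (trans e (cong (_* w') (sym s≡)))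
    where
    s≡ : s ≡ s'
    s≡ = ND.∣-antisym (coprime-divisor (good-bad-coprime gs gw') (subst (s ∣_) (trans e (*-comm s' w')) (ND.m∣m*n w))) (coprime-divisor (good-bad-coprime gs' gw) (subst (s' ∣_) (trans (sym e) (*-comm s w)) (ND.m∣m*n w')))

-- Chebyshev's upper bound

product-distinct-primes : ∀ ps K → 1 ≤ K → All Prime ps → Unique ps → All (_∣ K) ps → product ps ∣ K
product-distinct-primes [] K _ _ _ _ = ND.1∣ K
product-distinct-primes (p ∷ ps) K K≥1 (pp ∷ pps) (ne ∷ u) (d ∷ ds) with d
... | divides q e = subst (p * product ps ∣_) (trans (*-comm p q) (sym e)) (ND.*-monoʳ-∣ p (product-distinct-primes ps q q≥1 pps u (All.map (λ (pr , (n , dv)) → [ (λ x → ⊥-elim (n (sym (prime-∣-prime pr pp x)))) , id ]′ (euclidsLemma p q pr (subst (_ ∣_) (trans e (*-comm q p)) dv))) (All.zip (pps , All.zip (ne , ds))))))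
  where
  q≥1 : 1 ≤ q
  q≥1 = n≢0⇒n>0 (λ { refl → n>0⇒n≢0 K≥1 e })

product-≥ : ∀ m ps → All (m ≤_) ps → m ^ length ps ≤ product ps
product-≥ m [] [] = ≤-refl
product-≥ m (p ∷ ps) (h ∷ hs) = *-mono-≤ h (product-≥ m ps hs)

prime∤! : ∀ {p} m → Prime p → m < p → ¬ p ∣ m !
prime∤! zero pp lt d = <⇒≱ (prime≥2 pp) (ND.∣⇒≤ d)
prime∤! (suc m) pp lt d with euclidsLemma (suc m) (m !) pp d
... | inj₁ x = <⇒≱ lt (ND.∣⇒≤ x)
... | inj₂ x = prime∤! m pp (<-trans (n<1+n m) lt) x

-- Every prime in (m, 2m] divides the central binomial coefficient (2m)! / (m!)², so the product of
-- all of them does, and that coefficient is at most 2^(2m).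
primes-in-octave : ∀ m ps → All Prime ps → Unique ps → All (λ p → m < p × p ≤ m + m) ps → m ^ length ps ≤ 2 ^ (m + m)
primes-in-octave m ps pps u rng = go (subst (λ i → m ! * i ! ∣ (m + m) !) (m+n∸m≡n m m) (k![n∸k]!∣n! (m≤m+n m m)))
  where
  go : m ! * m ! ∣ (m + m) ! → m ^ length ps ≤ 2 ^ (m + m)
  go (divides K e) = ≤-trans (product-≥ m ps (All.map (<⇒≤ ∘ proj₁) rng)) (≤-trans (ND.∣⇒≤ {{>-nonZero K≥1}} (product-distinct-primes ps K K≥1 pps u (All.map each (All.zip (pps , rng))))) K≤)
    where
    K≥1 : 1 ≤ K
    K≥1 = n≢0⇒n>0 (λ { refl → n>0⇒n≢0 (1≤n! (m + m)) e })
    K≤ : K ≤ 2 ^ (m + m)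
    K≤ = *-cancelʳ-≤ K _ (m ! * m !) {{m !* m !≢0}} (≤-trans (≤-reflexive (sym e)) (factorial-split m m))
    each : ∀ {p} → Prime p × (m < p × p ≤ m + m) → p ∣ K
    each {p} (pp , lo , hi) with euclidsLemma K (m ! * m !) pp (subst (p ∣_) e (ND.∣-trans (ND.m∣m*n {p} (ℕ.pred p !)) (subst (_∣ (m + m) !) (trans (cong _! (sym (suc-pred p {{prime⇒nonZero pp}}))) (cong (_* ℕ.pred p !) (suc-pred p {{prime⇒nonZero pp}}))) (ND.m≤n⇒m!∣n! hi))))
    ... | inj₁ x = x
    ... | inj₂ x = ⊥-elim ([ prime∤! m pp lo , prime∤! m pp lo ]′ (euclidsLemma (m !) (m !) pp x))

π : ℕ → ℕ
π L = sumTo (λ p → ⟦ prime? p ⟧) L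

between? : ∀ a → Decidable (λ p → Prime p × a < p)
between? a p = prime? p ×-dec (a <? p)

primesBetween : ℕ → ℕ → List ℕ
primesBetween a L = filter (between? a) (downFrom L)

π-diff : ∀ a L → π L ≤ π (suc a) + length (primesBetween a L)
π-diff a zero = z≤n
π-diff a (suc L) = step (between? a L)
  where
  step : Dec (Prime L × a < L) → ⟦ prime? L ⟧ + π L ≤ π (suc a) + length (primesBetween a (suc L))
  step (yes p) = ≤-trans (+-mono-≤ (⟦⟧≤1 (prime? L)) (π-diff a L)) (≤-reflexive (trans (sym (+-suc (π (suc a)) (length (primesBetween a L)))) (cong (λ xs → π (suc a) + length xs) (sym (LP.filter-accept (between? a) p)))))
  step (no ne) = below (L ≤? a)
    where
    below : Dec (L ≤ a) → ⟦ prime? L ⟧ + π L ≤ π (suc a) + length (primesBetween a (suc L))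
    below (yes le) = ≤-trans (sumTo-extend (λ p → ⟦ prime? p ⟧) (s≤s le)) (m≤m+n _ _)
    below (no gt) = ≤-trans (≤-reflexive (cong (_+ π L) (⟦⟧-no (prime? L) (λ pp → ne (pp , ≰⇒> gt))))) (≤-trans (π-diff a L) (≤-reflexive (cong (λ xs → π (suc a) + length xs) (sym (LP.filter-reject (between? a) ne)))))

π-octave : ∀ i → i * length (primesBetween (2 ^ i) (suc (2 ^ suc i))) ≤ 2 * 2 ^ i
π-octave i = ≮⇒≥ (λ lt → <⇒≱ (^-monoʳ-< 2 ≤-refl lt) (begin
  2 ^ (i * length ps) ≡⟨ sym (^-*-assoc 2 i (length ps)) ⟩
  (2 ^ i) ^ length ps ≤⟨ primes-in-octave (2 ^ i) ps (All.map proj₁ sel) (UP.filter⁺ P? (downFrom-unique (suc (2 ^ suc i)))) (All.zipWith (λ ((_ , lo) , hi) → lo , ≤-trans (ℕ.s≤s⁻¹ hi) (≤-reflexive (l (2 ^ i)))) (sel , AllP.filter⁺ P? (∈-downFrom (suc (2 ^ suc i))))) ⟩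
  2 ^ (2 ^ i + 2 ^ i) ≡⟨ cong (2 ^_) (sym (l (2 ^ i))) ⟩
  2 ^ (2 * 2 ^ i) ∎))
  where
  open ≤-Reasoning
  P? = between? (2 ^ i)
  ps = primesBetween (2 ^ i) (suc (2 ^ suc i))
  sel = AllP.all-filter P? (downFrom (suc (2 ^ suc i)))
  l : ∀ a → 2 * a ≡ a + a
  l = NS.solve-∀

-- By octaves: from 2^e to 2^(e+1) at most 2 · 2^e / e new primes appear. The induction step needs
-- 8e + 8 ≤ 12e, that is e ≥ 2, hence the three base cases.
π-chebyshev : ∀ e → e * π (suc (2 ^ e)) ≤ 6 * 2 ^ e
π-chebyshev 0 = z≤n
π-chebyshev 1 = ≤-trans (≤-reflexive (+-identityʳ _)) (≤-trans π3 (s≤s (s≤s (s≤s z≤n))))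
  where
  π3 : π 3 ≤ 3
  π3 = ≤-trans (sumTo-mono 3 (λ l _ → ⟦⟧≤1 (prime? l))) (≤-reflexive (sumTo-const 1 3))
π-chebyshev 2 = ≤-trans (*-monoʳ-≤ 2 (≤-trans (sumTo-mono 5 (λ l _ → ⟦⟧≤1 (prime? l))) (≤-reflexive (sumTo-const 1 5)))) (m≤m+n 10 14)
π-chebyshev (suc e@(suc (suc e'))) = *-cancelˡ-≤ e (begin
  e * (suc e * π (suc (2 ^ suc e))) ≤⟨ *-monoʳ-≤ e (*-monoʳ-≤ (suc e) (π-diff (2 ^ e) (suc (2 ^ suc e)))) ⟩
  e * (suc e * (π (suc (2 ^ e)) + len)) ≡⟨ l₁ e (π (suc (2 ^ e))) len ⟩
  suc e * (e * π (suc (2 ^ e)) + e * len) ≤⟨ *-monoʳ-≤ (suc e) (+-mono-≤ (π-chebyshev e) (π-octave e)) ⟩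
  suc e * (6 * 2 ^ e + 2 * 2 ^ e) ≡⟨ l₂ e (2 ^ e) ⟩
  (8 * e + 8) * 2 ^ e ≤⟨ *-monoˡ-≤ (2 ^ e) (≤-trans (m≤m+n (8 * e + 8) (4 * e')) (≤-reflexive (l₃ e'))) ⟩
  12 * e * 2 ^ e ≡⟨ l₄ e (2 ^ e) ⟩
  e * (6 * (2 * 2 ^ e)) ∎)
  where
  open ≤-Reasoning
  len = length (primesBetween (2 ^ e) (suc (2 ^ suc e)))
  l₁ : ∀ e p q → e * (suc e * (p + q)) ≡ suc e * (e * p + e * q)
  l₁ = NS.solve-∀
  l₂ : ∀ e a → suc e * (6 * a + 2 * a) ≡ (8 * e + 8) * a
  l₂ = NS.solve-∀
  l₃ : ∀ e → 8 * suc (suc e) + 8 + 4 * e ≡ 12 * suc (suc e)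
  l₃ = NS.solve-∀
  l₄ : ∀ e a → 12 * e * a ≡ e * (6 * (2 * a))
  l₄ = NS.solve-∀

π-bound : ∀ x → ilog x * π (suc x) ≤ 12 * x
π-bound zero = z≤n
π-bound x@(suc _) = begin
  ilog x * π (suc x) ≤⟨ *-mono-≤ (n≤1+n (ilog x)) (sumTo-extend (λ p → ⟦ prime? p ⟧) (s≤s (<⇒≤ (<2^ilog x)))) ⟩
  suc (ilog x) * π (suc (2 ^ suc (ilog x))) ≤⟨ π-chebyshev (suc (ilog x)) ⟩
  6 * (2 * 2 ^ ilog x) ≤⟨ *-monoʳ-≤ 6 (*-monoʳ-≤ 2 (2^ilog≤ x (s≤s z≤n))) ⟩
  6 * (2 * x) ≡⟨ sym (*-assoc 6 2 x) ⟩
  12 * x ∎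
  where open ≤-Reasoning

sumTo-restrict : ∀ f {M} L → (∀ l → M ≤ l → f l ≡ 0) → sumTo f L ≤ sumTo f M
sumTo-restrict f zero h = z≤n
sumTo-restrict f {M} (suc L) h with M ≤? L
... | yes le = ≤-trans (≤-reflexive (cong (_+ sumTo f L) (h L le))) (sumTo-restrict f L h)
... | no gt = sumTo-extend f (≰⇒> gt)

sumTo-weighted-swap : ∀ (c d : ℕ → ℕ) (F : ℕ → ℕ → ℕ) L M →
  sumTo (λ a → c a * sumTo (λ b → d b * F a b) M) L ≡ sumTo (λ b → d b * sumTo (λ a → c a * F a b) L) M
sumTo-weighted-swap c d F L M = begin
  sumTo (λ a → c a * sumTo (λ b → d b * F a b) M) L ≡⟨ sumTo-cong L (λ a _ → sym (sumTo-*ˡ (c a) (λ b → d b * F a b) M)) ⟩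
  sumTo (λ a → sumTo (λ b → c a * (d b * F a b)) M) L ≡⟨ sumTo-swap (λ a b → c a * (d b * F a b)) L M ⟩
  sumTo (λ b → sumTo (λ a → c a * (d b * F a b)) L) M ≡⟨ sumTo-cong M (λ b _ → trans (sumTo-cong L (λ a _ → l (c a) (d b) (F a b))) (sumTo-*ˡ (d b) (λ a → c a * F a b) L)) ⟩
  sumTo (λ b → d b * sumTo (λ a → c a * F a b) L) M ∎
  where
  open ≡-Reasoning
  l : ∀ x y z → x * (y * z) ≡ y * (x * z)
  l = NS.solve-∀

weight-0 : ∀ {A : Set} (xs : List A) → Weighted.weight (λ _ → 0) xs ≡ 0
weight-0 [] = refl
weight-0 (x ∷ xs) = weight-0 xs

weight-1 : ∀ {A : Set} (xs : List A) → Weighted.weight (λ _ → 1) xs ≡ length xs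
weight-1 [] = refl
weight-1 (x ∷ xs) = cong suc (weight-1 xs)

weight-+ : ∀ {A : Set} (f g : A → ℕ) xs → Weighted.weight (λ x → f x + g x) xs ≡ Weighted.weight f xs + Weighted.weight g xs
weight-+ f g [] = refl
weight-+ f g (x ∷ xs) = trans (cong (λ i → f x + g x + i) (weight-+ f g xs)) (l (f x) (g x) (Weighted.weight f xs) (Weighted.weight g xs))
  where
  l : ∀ a b c d → a + b + (c + d) ≡ a + c + (b + d)
  l = NS.solve-∀

weight-*ˡ : ∀ {A : Set} c (f : A → ℕ) xs → Weighted.weight (λ x → c * f x) xs ≡ c * Weighted.weight f xs
weight-*ˡ c f [] = sym (*-zeroʳ c)
weight-*ˡ c f (x ∷ xs) = trans (cong (λ i → c * f x + i) (weight-*ˡ c f xs)) (sym (*-distribˡ-+ c (f x) _))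

weight-*ʳ : ∀ {A : Set} c (f : A → ℕ) xs → Weighted.weight (λ x → f x * c) xs ≡ Weighted.weight f xs * c
weight-*ʳ c f [] = refl
weight-*ʳ c f (x ∷ xs) = trans (cong (λ i → f x * c + i) (weight-*ʳ c f xs)) (sym (*-distribʳ-+ c (f x) _))

weight-sumTo : ∀ {A : Set} (f : A → ℕ → ℕ) L xs → Weighted.weight (λ x → sumTo (f x) L) xs ≡ sumTo (λ l → Weighted.weight (λ x → f x l) xs) L
weight-sumTo f zero xs = weight-0 xs
weight-sumTo f (suc L) xs = trans (weight-+ (λ x → f x L) (λ x → sumTo (f x) L) xs) (cong (λ i → Weighted.weight (λ x → f x L) xs + i) (weight-sumTo f L xs))

weight-mono : ∀ {A : Set} {f g : A → ℕ} {xs} → All (λ x → f x ≤ g x) xs → Weighted.weight f xs ≤ Weighted.weight g xs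
weight-mono [] = z≤n
weight-mono (h ∷ hs) = +-mono-≤ h (weight-mono hs)

weight-indicator : ∀ {A : Set} {R : A → Set} (R? : Decidable R) xs → Weighted.weight (λ x → ⟦ R? x ⟧) xs ≡ Weighted.weight (λ _ → 1) (filter R? xs)
weight-indicator R? [] = refl
weight-indicator R? (x ∷ xs) with R? x
... | yes _ = cong suc (weight-indicator R? xs)
... | no _ = weight-indicator R? xs

-- Applied to the predicate p^v ∣ n, this produces the exponent of p in n.
last-true : ∀ {P : ℕ → Set} → Decidable P → P 0 → ∀ K → ¬ P K → ∃[ v ] (P v × ¬ P (suc v))
last-true P? p0 zero nk = ⊥-elim (nk p0)
last-true P? p0 (suc K) nk with P? K
... | yes pK = K , pK , nk
... | no nK = last-true P? p0 K nK

m∣n! : ∀ m n → 1 ≤ m → m ≤ n → m ∣ n !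
m∣n! (suc m) n _ h = ND.∣-trans (ND.m∣m*n (m !)) (ND.m≤n⇒m!∣n! h)

-- The Hall-Tenenbaum argument

module Reciprocal (N : ℕ) where

  -- n ↦ 1/n, scaled by N! so as to be integral for 1 ≤ n ≤ N
  inv : ℕ → ℕ
  inv zero = 0
  inv (suc n) = N ! DM./ suc n

  inv-* : ∀ {n} → 1 ≤ n → n ≤ N → n * inv n ≡ N !
  inv-* {suc n} h le = trans (*-comm (suc n) (inv (suc n))) (DM.m/n*n≡m (m∣n! (suc n) N h le))

  inv-≤ : ∀ n → n * inv n ≤ N !
  inv-≤ zero = z≤n
  inv-≤ (suc n) = ≤-trans (≤-reflexive (*-comm (suc n) (inv (suc n)))) (DM.m/n*n≤m (N !) (suc n))

prime-powers : ∀ p x J → 2 ≤ p → sumTo (λ j → ilog p * ⟦ p ^ suc j ≤? x ⟧) J ≤ ilog x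
prime-powers p x zero _ = z≤n
prime-powers p x (suc J) p≥2 with p ^ suc J ≤? x
... | no _ = ≤-trans (≤-reflexive (cong (_+ sumTo (λ j → ilog p * ⟦ p ^ suc j ≤? x ⟧) J) (*-zeroʳ (ilog p)))) (prime-powers p x J p≥2)
... | yes le = begin
  ilog p * 1 + sumTo (λ j → ilog p * ⟦ p ^ suc j ≤? x ⟧) J ≤⟨ +-mono-≤ (≤-reflexive (*-identityʳ (ilog p))) (sumTo-mono J (λ j _ → ≤-trans (*-monoʳ-≤ (ilog p) (⟦⟧≤1 (p ^ suc j ≤? x))) (≤-reflexive (*-identityʳ (ilog p))))) ⟩
  ilog p + sumTo (λ _ → ilog p) J ≡⟨ cong (λ i → ilog p + i) (sumTo-const (ilog p) J) ⟩
  suc J * ilog p ≤⟨ ℕ.s≤s⁻¹ (^-cancel-< 2 (suc J * ilog p) (suc (ilog x)) ≤-refl (≤-<-trans (begin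
      2 ^ (suc J * ilog p) ≡⟨ trans (cong (2 ^_) (*-comm (suc J) (ilog p))) (sym (^-*-assoc 2 (ilog p) (suc J))) ⟩
      (2 ^ ilog p) ^ suc J ≤⟨ ^-monoˡ-≤ (suc J) (2^ilog≤ p (≤-trans (s≤s z≤n) p≥2)) ⟩
      p ^ suc J ≤⟨ le ⟩
      x ∎) (<2^ilog x))) ⟩
  ilog x ∎
  where open ≤-Reasoning

-- Chebyshev's function ψ(x) with `ilog p` for log p; `L` and `J` truncate the primes and the
-- exponents.
Ψ : ℕ → ℕ → ℕ → ℕ
Ψ L J x = sumTo (λ p → ⟦ prime? p ⟧ * sumTo (λ j → ilog p * ⟦ p ^ suc j ≤? x ⟧) J) L

-- All powers of one prime p ≤ x together contribute at most `ilog x`, so the sum is at most ilog x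
-- · π(x).
Ψ-bound : ∀ L J x → Ψ L J x ≤ 12 * x
Ψ-bound L J x = begin
  Ψ L J x ≤⟨ sumTo-mono L (λ p _ → term p) ⟩
  sumTo (λ p → ilog x * (⟦ prime? p ⟧ * ⟦ p ≤? x ⟧)) L ≡⟨ sumTo-*ˡ (ilog x) _ L ⟩
  ilog x * sumTo (λ p → ⟦ prime? p ⟧ * ⟦ p ≤? x ⟧) L ≤⟨ *-monoʳ-≤ (ilog x) (≤-trans (sumTo-restrict _ L (λ p lt → trans (cong (⟦ prime? p ⟧ *_) (⟦⟧-no (p ≤? x) (<⇒≱ lt))) (*-zeroʳ ⟦ prime? p ⟧))) (sumTo-mono (suc x) (λ p _ → ≤-trans (*-monoʳ-≤ ⟦ prime? p ⟧ (⟦⟧≤1 (p ≤? x))) (≤-reflexive (*-identityʳ _))))) ⟩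
  ilog x * π (suc x) ≤⟨ π-bound x ⟩
  12 * x ∎
  where
  open ≤-Reasoning
  inner : ∀ p → Prime p → Dec (p ≤ x) → sumTo (λ j → ilog p * ⟦ p ^ suc j ≤? x ⟧) J ≤ ilog x * ⟦ p ≤? x ⟧
  inner p pp (yes le) = ≤-trans (prime-powers p x J (prime≥2 pp)) (≤-reflexive (sym (trans (cong (ilog x *_) (⟦⟧-yes (p ≤? x) le)) (*-identityʳ (ilog x)))))
  inner p pp (no gt) = ≤-trans (≤-reflexive (trans (sumTo-cong J (λ j _ → trans (cong (ilog p *_) (⟦⟧-no (p ^ suc j ≤? x) (λ h → gt (≤-trans (m≤m*n p (p ^ j) {{>-nonZero (m^n>0 p {{prime⇒nonZero pp}} j)}}) h)))) (*-zeroʳ (ilog p)))) (sumTo-0 J))) z≤n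
  term : ∀ p → ⟦ prime? p ⟧ * sumTo (λ j → ilog p * ⟦ p ^ suc j ≤? x ⟧) J ≤ ilog x * (⟦ prime? p ⟧ * ⟦ p ≤? x ⟧)
  term p with prime? p
  ... | no _ = z≤n
  ... | yes pp = ≤-trans (≤-reflexive (+-identityʳ _)) (≤-trans (inner p pp (p ≤? x)) (*-monoʳ-≤ (ilog x) (≤-reflexive (sym (+-identityʳ _)))))

-- A lower approximation to log₂ B, as the sum of ⌊log₂ p⌋ over the prime powers dividing B.
primeLog : ℕ → ℕ → ℕ → ℕ
primeLog L J B = sumTo (λ p → ⟦ prime? p ⟧ * sumTo (λ j → ilog p * ⟦ p ^ suc j ∣? B ⟧) J) L

-- If v is the exponent of p in n, then passing from n to p n switches on the term j = v at p and
-- switches off none. The hypothesis p n < 2^J places v below the truncation `J`.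
primeLog-* : ∀ L J p n → Prime p → 1 ≤ n → p * n < L → p * n < 2 ^ J → primeLog L J n + ilog p ≤ primeLog L J (p * n)
primeLog-* L J p n pp n≥1 pL pJ = go (last-true (λ v → p ^ v ∣? n) (ND.1∣ n) n (λ d → <⇒≱ (<-≤-trans (<2^n n) (^-monoˡ-≤ n (prime≥2 pp))) (ND.∣⇒≤ {{>-nonZero n≥1}} d)))
  where
  go : ∃[ v ] (p ^ v ∣ n × ¬ p ^ suc v ∣ n) → primeLog L J n + ilog p ≤ primeLog L J (p * n)
  go (v , dv , ndv) = sumTo-bump L p (ilog p) (≤-<-trans (m≤m*n p n {{>-nonZero n≥1}}) pL)
    (λ q → *-monoʳ-≤ ⟦ prime? q ⟧ (sumTo-mono J (λ j _ → weak q j)))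
    (≤-trans (≤-reflexive (cong (λ a → a * sumTo (λ j → ilog p * ⟦ p ^ suc j ∣? n ⟧) J + ilog p) one)) (≤-trans (≤-reflexive (cong (_+ ilog p) (+-identityʳ _)))
      (≤-trans (sumTo-bump J v (ilog p) v<J (weak p) (≤-reflexive (cong₂ _+_ (trans (cong (ilog p *_) (⟦⟧-no (p ^ suc v ∣? n) ndv)) (*-zeroʳ (ilog p))) (sym (trans (cong (ilog p *_) (⟦⟧-yes (p ^ suc v ∣? (p * n)) (ND.*-monoʳ-∣ p dv))) (*-identityʳ (ilog p)))))))
        (≤-reflexive (sym (trans (cong (_* sumTo (λ j → ilog p * ⟦ p ^ suc j ∣? (p * n) ⟧) J) one) (+-identityʳ _)))))))
    where
    one : ⟦ prime? p ⟧ ≡ 1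
    one = ⟦⟧-yes (prime? p) pp
    weak : ∀ q j → ilog q * ⟦ q ^ suc j ∣? n ⟧ ≤ ilog q * ⟦ q ^ suc j ∣? (p * n) ⟧
    weak q j = *-monoʳ-≤ (ilog q) (⟦⟧-mono (q ^ suc j ∣? n) (q ^ suc j ∣? (p * n)) (ND.∣n⇒∣m*n p))
    v<J : v < J
    v<J = <-trans (n<1+n v) (^-cancel-< 2 (suc v) J ≤-refl (≤-<-trans (^-monoˡ-≤ (suc v) (prime≥2 pp)) (≤-<-trans (*-monoʳ-≤ p (ND.∣⇒≤ {{>-nonZero n≥1}} dv)) pJ)))

-- Base 4 makes up for rounding: p < 2 · 2^(ilog p) ≤ 4^(ilog p), since ilog p ≥ 1 for a prime.
≤4^primeLog : ∀ L J B → 1 ≤ B → B < L → B < 2 ^ J → B ≤ 4 ^ primeLog L J B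
≤4^primeLog L J = prime-induction {λ B → B < L → B < 2 ^ J → B ≤ 4 ^ primeLog L J B} (λ _ _ → m^n>0 4 (primeLog L J 1)) step
  where
  open ≤-Reasoning
  step : ∀ p n → Prime p → 1 ≤ n → (n < L → n < 2 ^ J → n ≤ 4 ^ primeLog L J n) → p * n < L → p * n < 2 ^ J → p * n ≤ 4 ^ primeLog L J (p * n)
  step p n pp n≥1 ih pL pJ = begin
    p * n ≤⟨ *-mono-≤ p≤ (ih (≤-<-trans n≤pn pL) (≤-<-trans n≤pn pJ)) ⟩
    4 ^ ilog p * 4 ^ primeLog L J n ≡⟨ trans (*-comm (4 ^ ilog p) _) (sym (^-distribˡ-+-* 4 (primeLog L J n) (ilog p))) ⟩
    4 ^ (primeLog L J n + ilog p) ≤⟨ ^-monoʳ-≤ 4 (primeLog-* L J p n pp n≥1 pL pJ) ⟩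
    4 ^ primeLog L J (p * n) ∎
    where
    n≤pn : n ≤ p * n
    n≤pn = m≤n*m n p {{prime⇒nonZero pp}}
    il≥1 : 1 ≤ ilog p
    il≥1 = ℕ.s≤s⁻¹ (^-cancel-< 2 1 (suc (ilog p)) ≤-refl (≤-<-trans (prime≥2 pp) (<2^ilog p)))
    p≤ : p ≤ 4 ^ ilog p
    p≤ = begin
      p ≤⟨ <⇒≤ (<2^ilog p) ⟩
      2 * 2 ^ ilog p ≤⟨ *-monoˡ-≤ (2 ^ ilog p) (^-monoʳ-≤ 2 il≥1) ⟩
      2 ^ ilog p * 2 ^ ilog p ≡⟨ sym (*-^ (ilog p) 2 2) ⟩
      4 ^ ilog p ∎

module HallTenenbaum {χ : ℕ → Set} (χ? : Decidable χ) (N z : ℕ) (z≤N : z ≤ N) where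
  open Decompose χ?
  open Reciprocal N

  goodPart badPart : ℕ → ℕ
  goodPart zero = 1
  goodPart (suc n) = proj₁ (decompose (suc n) (s≤s z≤n))
  badPart zero = 1
  badPart (suc n) = proj₁ (proj₂ (decompose (suc n) (s≤s z≤n)))

  parts : ∀ n → 1 ≤ n → n ≡ goodPart n * badPart n × GoodNum (goodPart n) × Bad.GoodNum (badPart n)
  parts (suc n) _ = proj₂ (proj₂ (decompose (suc n) (s≤s z≤n)))

  -- The bad part of d divides s w and is prime to s. Thus the condition w ≤ z passes to divisors of
  -- B, which is what makes the quotients in `multiples` countable.
  badPart-∣ : ∀ d B s w → 1 ≤ d → d ∣ B → B ≡ s * w → GoodNum s → Bad.GoodNum w → badPart d ∣ w
  badPart-∣ d B s w d≥1 dB e gs gw = coprime-divisor (coprime-sym (good-bad-coprime gs (proj₂ (proj₂ (parts d d≥1))))) (subst (badPart d ∣_) e (ND.∣-trans (subst (badPart d ∣_) (sym (proj₁ (parts d d≥1))) (ND.n∣m*n (goodPart d))) dB))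

  Member : ℕ → Set
  Member B = ∃[ s ] ∃[ w ] (B ≡ s * w × GoodNum s × Bad.GoodNum w × w ≤ z × B ≤ N)

  J : ℕ
  J = suc (ilog N)

  -- For s, w ≥ 1 this is the indicator of p^(j+1) s w ≤ N; `suc (ℕ.pred _)` is a divisor that is
  -- visibly nonzero.
  cell : ℕ → ℕ → ℕ → ℕ → ℕ
  cell p j s w = ⟦ p ^ suc j ≤? (N DM./ suc (ℕ.pred (s * w))) ⟧

  goodSum badSum : ℕ
  goodSum = sumTo (λ s → ⟦ goodNum? s ⟧ * inv s) (suc N)
  badSum = sumTo (λ w → ⟦ Bad.goodNum? w ⟧ * inv w) (suc z)

  -- A member B divisible by p^(j+1) is recovered from the good and the bad part of its quotient.
  -- The bad part is at most z, and the product of both is at most N / p^(j+1).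
  multiples : ∀ p j → Prime p → ∀ S → All Member S → Unique S →
    Weighted.weight (λ B → ⟦ p ^ suc j ∣? B ⟧) S ≤ sumTo (λ s → ⟦ goodNum? s ⟧ * sumTo (λ w → ⟦ Bad.goodNum? w ⟧ * cell p j s w) (suc z)) (suc N)
  multiples p j pp S ms u = ≤-trans (≤-reflexive (weight-indicator D? S))
    (wb-fibre? goodNum? (λ B → goodPart (quot B)) _ (suc N) (λ B h → s≤s (good≤ B h)) (λ B h → proj₁ (proj₂ (parts (quot B) (quot≥1 B h))))
      (λ s _ → wb-fibre? Bad.goodNum? (λ B → badPart (quot B)) _ (suc z) (λ B h → s≤s (bad≤ B (proj₁ h))) (λ B h → proj₂ (proj₂ (parts (quot B) (quot≥1 B (proj₁ h)))))
        (λ w _ → wb-unique _ (λ { B ((h , refl) , refl) → ≤-reflexive (sym (⟦⟧-yes (p ^ suc j ≤? _) (fits B h))) })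
          (λ { B B' ((h , e₁) , e₂) ((h' , e₁') , e₂') → trans (B≡ B h) (trans (cong₂ (λ a b → a * b * d) (trans e₁ (sym e₁')) (trans e₂ (sym e₂'))) (sym (B≡ B' h'))) })))
      (filter D? S) (All.zip (AllP.filter⁺ D? ms , AllP.all-filter D? S)) (UP.filter⁺ D? u))
    where
    d : ℕ
    d = p ^ suc j
    d≥1 : 1 ≤ d
    d≥1 = m^n>0 p {{prime⇒nonZero pp}} (suc j)
    instance _ = >-nonZero d≥1
    D? : Decidable (d ∣_)
    D? B = d ∣? B
    open Weighted {ℕ} (λ _ → 1)
    quot : ℕ → ℕ
    quot B = B DM./ d
    P : ℕ → Set
    P B = Member B × d ∣ B
    mem≥1 : ∀ B → P B → 1 ≤ B
    mem≥1 B ((s , w , refl , gs , gw , _) , _) = *-mono-≤ (proj₁ gs) (proj₁ gw)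
    mem≤ : ∀ B → P B → B ≤ N
    mem≤ B ((s , w , e , gs , gw , _ , le) , _) = le
    split : ∀ B → P B → B ≡ quot B * d
    split B h = sym (DM.m/n*n≡m (proj₂ h))
    quot≥1 : ∀ B → P B → 1 ≤ quot B
    quot≥1 B h = n≢0⇒n>0 (λ e → n>0⇒n≢0 (mem≥1 B h) (trans (split B h) (cong (_* d) e)))
    B≡ : ∀ B → P B → B ≡ goodPart (quot B) * badPart (quot B) * d
    B≡ B h = trans (split B h) (cong (_* d) (proj₁ (parts (quot B) (quot≥1 B h))))
    good≤ : ∀ B → P B → goodPart (quot B) ≤ N
    good≤ B h = ≤-trans (m≤m*n (goodPart (quot B)) (badPart (quot B)) {{>-nonZero (proj₁ (proj₂ (proj₂ (parts (quot B) (quot≥1 B h)))))}}) (≤-trans (≤-reflexive (sym (proj₁ (parts (quot B) (quot≥1 B h))))) (≤-trans (≤-trans (m≤m*n (quot B) d) (≤-reflexive (sym (split B h)))) (mem≤ B h)))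
    bad≤ : ∀ B → P B → badPart (quot B) ≤ z
    bad≤ B h@((s , w , e , gs , gw , le , _) , _) = ≤-trans (ND.∣⇒≤ {{>-nonZero (proj₁ gw)}} (badPart-∣ (quot B) B s w (quot≥1 B h) (divides d (trans (split B h) (*-comm (quot B) d))) e gs gw)) le
    fits : ∀ B → P B → d ≤ N DM./ suc (ℕ.pred (goodPart (quot B) * badPart (quot B)))
    fits B h = ≤-trans (≤-reflexive (sym (DM.m*n/n≡m d (suc (ℕ.pred m))))) (DM./-monoˡ-≤ (suc (ℕ.pred m)) (≤-trans (≤-reflexive (trans (*-comm d _) (trans (cong (_* d) (suc-pred m {{>-nonZero m≥1}})) (sym (B≡ B h))))) (mem≤ B h)))
      where
      m = goodPart (quot B) * badPart (quot B)
      m≥1 : 1 ≤ m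
      m≥1 = subst (1 ≤_) (proj₁ (parts (quot B) (quot≥1 B h))) (quot≥1 B h)

  interchange : ∀ (X : ℕ → ℕ) (l : ℕ → ℕ) (G D : ℕ → ℕ) (I : ℕ → ℕ → ℕ → ℕ → ℕ) a b c d →
    sumTo (λ p → X p * sumTo (λ j → l p * sumTo (λ s → G s * sumTo (λ w → D w * I p j s w) d) c) b) a ≡
    sumTo (λ s → G s * sumTo (λ w → D w * sumTo (λ p → X p * sumTo (λ j → l p * I p j s w) b) a) d) c
  interchange X l G D I a b c d = begin
    sumTo (λ p → X p * sumTo (λ j → l p * sumTo (λ s → G s * sumTo (λ w → D w * I p j s w) d) c) b) a
      ≡⟨ sumTo-cong a (λ p _ → cong (X p *_) (trans (sumTo-weighted-swap (λ _ → l p) G (λ j s → sumTo (λ w → D w * I p j s w) d) b c) (sumTo-cong c (λ s _ → cong (G s *_) (sumTo-weighted-swap (λ _ → l p) D (λ j w → I p j s w) b d))))) ⟩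
    sumTo (λ p → X p * sumTo (λ s → G s * sumTo (λ w → D w * sumTo (λ j → l p * I p j s w) b) d) c) a
      ≡⟨ sumTo-weighted-swap X G (λ p s → sumTo (λ w → D w * sumTo (λ j → l p * I p j s w) b) d) a c ⟩
    sumTo (λ s → G s * sumTo (λ p → X p * sumTo (λ w → D w * sumTo (λ j → l p * I p j s w) b) d) a) c
      ≡⟨ sumTo-cong c (λ s _ → cong (G s *_) (sumTo-weighted-swap X D (λ p w → sumTo (λ j → l p * I p j s w) b) a d)) ⟩
    sumTo (λ s → G s * sumTo (λ w → D w * sumTo (λ p → X p * sumTo (λ j → l p * I p j s w) b) a) d) c ∎
    where open ≡-Reasoning

  -- The sum of log B over the set counts the multiples of each prime power. Once `multiples` has
  -- bounded these, interchanging the sums collects, for fixed s and w, all prime powers up to N /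
  -- (s w), which is `Ψ`.
  total-primeLog : ∀ S → All Member S → Unique S → Weighted.weight (primeLog (suc N) J) S ≤
    sumTo (λ s → ⟦ goodNum? s ⟧ * sumTo (λ w → ⟦ Bad.goodNum? w ⟧ * Ψ (suc N) J (N DM./ suc (ℕ.pred (s * w)))) (suc z)) (suc N)
  total-primeLog S ms u = ≤-trans (≤-reflexive expand) (≤-trans (sumTo-mono (suc N) bound) (≤-reflexive (interchange (λ p → ⟦ prime? p ⟧) ilog (λ s → ⟦ goodNum? s ⟧) (λ w → ⟦ Bad.goodNum? w ⟧) cell (suc N) J (suc N) (suc z))))
    where
    W : ℕ → ℕ → ℕ
    W p j = Weighted.weight (λ B → ⟦ p ^ suc j ∣? B ⟧) S
    expand : Weighted.weight (primeLog (suc N) J) S ≡ sumTo (λ p → ⟦ prime? p ⟧ * sumTo (λ j → ilog p * W p j) J) (suc N)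
    expand = trans (weight-sumTo (λ B p → ⟦ prime? p ⟧ * sumTo (λ j → ilog p * ⟦ p ^ suc j ∣? B ⟧) J) (suc N) S)
      (sumTo-cong (suc N) (λ p _ → trans (weight-*ˡ ⟦ prime? p ⟧ (λ B → sumTo (λ j → ilog p * ⟦ p ^ suc j ∣? B ⟧) J) S) (cong (⟦ prime? p ⟧ *_)
        (trans (weight-sumTo (λ B j → ilog p * ⟦ p ^ suc j ∣? B ⟧) J S) (sumTo-cong J (λ j _ → weight-*ˡ (ilog p) (λ B → ⟦ p ^ suc j ∣? B ⟧) S))))))
    bound : ∀ p → p < suc N → ⟦ prime? p ⟧ * sumTo (λ j → ilog p * W p j) J ≤ ⟦ prime? p ⟧ * sumTo (λ j → ilog p * sumTo (λ s → ⟦ goodNum? s ⟧ * sumTo (λ w → ⟦ Bad.goodNum? w ⟧ * cell p j s w) (suc z)) (suc N)) J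
    bound p _ with prime? p
    ... | no _ = z≤n
    ... | yes pp = *-monoʳ-≤ 1 (sumTo-mono J (λ j _ → *-monoʳ-≤ (ilog p) (multiples p j pp S ms u)))

  Ψ-sum : N ! * N ! * sumTo (λ s → ⟦ goodNum? s ⟧ * sumTo (λ w → ⟦ Bad.goodNum? w ⟧ * Ψ (suc N) J (N DM./ suc (ℕ.pred (s * w)))) (suc z)) (suc N) ≤ 12 * N * (goodSum * badSum)
  Ψ-sum = begin
    Q * Q * sumTo (λ s → ⟦ goodNum? s ⟧ * sumTo (λ w → ⟦ Bad.goodNum? w ⟧ * Ψ (suc N) J (N DM./ suc (ℕ.pred (s * w)))) (suc z)) (suc N)
      ≡⟨ sym (sumTo-*ˡ (Q * Q) _ (suc N)) ⟩
    sumTo (λ s → Q * Q * (⟦ goodNum? s ⟧ * sumTo (λ w → ⟦ Bad.goodNum? w ⟧ * Ψ (suc N) J (N DM./ suc (ℕ.pred (s * w)))) (suc z))) (suc N)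
      ≤⟨ sumTo-mono (suc N) row ⟩
    sumTo (λ s → (12 * N * badSum) * (⟦ goodNum? s ⟧ * inv s)) (suc N) ≡⟨ sumTo-*ˡ (12 * N * badSum) _ (suc N) ⟩
    12 * N * badSum * goodSum ≡⟨ l₁ N badSum goodSum ⟩
    12 * N * (goodSum * badSum) ∎
    where
    open ≤-Reasoning
    Q = N !
    l₁ : ∀ n b g → 12 * n * b * g ≡ 12 * n * (g * b)
    l₁ = NS.solve-∀
    point : ∀ s w → GoodNum s → s ≤ N → Bad.GoodNum w → w ≤ z → Q * Q * Ψ (suc N) J (N DM./ suc (ℕ.pred (s * w))) ≤ 12 * N * (inv s * inv w)
    point s w gs s≤ gw w≤ = begin
      Q * Q * Ψ (suc N) J x ≤⟨ *-monoʳ-≤ (Q * Q) (Ψ-bound (suc N) J x) ⟩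
      Q * Q * (12 * x) ≡⟨ cong₂ (λ a b → a * b * (12 * x)) (sym (inv-* (proj₁ gs) s≤)) (sym (inv-* (proj₁ gw) (≤-trans w≤ z≤N))) ⟩
      (s * inv s) * (w * inv w) * (12 * x) ≡⟨ l₂ s (inv s) w (inv w) x ⟩
      12 * (x * (s * w)) * (inv s * inv w) ≤⟨ *-monoˡ-≤ (inv s * inv w) (*-monoʳ-≤ 12 (≤-trans (≤-reflexive (cong (x *_) (sym (suc-pred (s * w) {{>-nonZero (*-mono-≤ (proj₁ gs) (proj₁ gw))}})))) (DM.m/n*n≤m N (suc (ℕ.pred (s * w)))))) ⟩
      12 * N * (inv s * inv w) ∎
      where
      x = N DM./ suc (ℕ.pred (s * w))
      l₂ : ∀ s i w j x → (s * i) * (w * j) * (12 * x) ≡ 12 * (x * (s * w)) * (i * j)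
      l₂ = NS.solve-∀
    entry : ∀ s w → GoodNum s → s ≤ N → w < suc z → Q * Q * (⟦ Bad.goodNum? w ⟧ * Ψ (suc N) J (N DM./ suc (ℕ.pred (s * w)))) ≤ (12 * N * inv s) * (⟦ Bad.goodNum? w ⟧ * inv w)
    entry s w gs s≤ w≤ with Bad.goodNum? w
    ... | no _ = ≤-trans (≤-reflexive (*-zeroʳ (Q * Q))) z≤n
    ... | yes gw = ≤-trans (≤-reflexive (cong (Q * Q *_) (+-identityʳ _))) (≤-trans (point s w gs s≤ gw (ℕ.s≤s⁻¹ w≤)) (≤-reflexive (l₃ N (inv s) (inv w))))
      where
      l₃ : ∀ n i j → 12 * n * (i * j) ≡ (12 * n * i) * (1 * j)
      l₃ = NS.solve-∀
    row : ∀ s → s < suc N → Q * Q * (⟦ goodNum? s ⟧ * sumTo (λ w → ⟦ Bad.goodNum? w ⟧ * Ψ (suc N) J (N DM./ suc (ℕ.pred (s * w)))) (suc z)) ≤ (12 * N * badSum) * (⟦ goodNum? s ⟧ * inv s)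
    row s s≤ with goodNum? s
    ... | no _ = ≤-trans (≤-reflexive (*-zeroʳ (Q * Q))) z≤n
    ... | yes gs = begin
      Q * Q * (1 * sumTo F (suc z)) ≡⟨ cong (Q * Q *_) (+-identityʳ _) ⟩
      Q * Q * sumTo F (suc z) ≡⟨ sym (sumTo-*ˡ (Q * Q) F (suc z)) ⟩
      sumTo (λ w → Q * Q * F w) (suc z) ≤⟨ sumTo-mono (suc z) (λ w w≤ → entry s w gs (ℕ.s≤s⁻¹ s≤) w≤) ⟩
      sumTo (λ w → (12 * N * inv s) * (⟦ Bad.goodNum? w ⟧ * inv w)) (suc z) ≡⟨ sumTo-*ˡ (12 * N * inv s) _ (suc z) ⟩
      12 * N * inv s * badSum ≡⟨ l₄ N (inv s) badSum ⟩
      (12 * N * badSum) * (1 * inv s) ∎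
      where
      F : ℕ → ℕ
      F w = ⟦ Bad.goodNum? w ⟧ * Ψ (suc N) J (N DM./ suc (ℕ.pred (s * w)))
      l₄ : ∀ n i b → 12 * n * i * b ≡ (12 * n * b) * (1 * i)
      l₄ = NS.solve-∀

  -- For B² > N, log N is at most a constant times log B. So the number of B times log N is bounded
  -- by the sum of the log B, which `total-primeLog` and `Ψ-sum` estimate.
  hall-tenenbaum : ∀ S → All Member S → Unique S → All (λ B → N < B * B) S →
    N ! * N ! * (length S * ilog N) ≤ 48 * N * (goodSum * badSum)
  hall-tenenbaum S ms u big = begin
    N ! * N ! * (length S * ilog N) ≤⟨ *-monoʳ-≤ (N ! * N !) lower ⟩
    N ! * N ! * (4 * Weighted.weight (primeLog (suc N) J) S) ≡⟨ l₁ (N ! * N !) (Weighted.weight (primeLog (suc N) J) S) ⟩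
    4 * (N ! * N ! * Weighted.weight (primeLog (suc N) J) S) ≤⟨ *-monoʳ-≤ 4 (≤-trans (*-monoʳ-≤ (N ! * N !) (total-primeLog S ms u)) Ψ-sum) ⟩
    4 * (12 * N * (goodSum * badSum)) ≡⟨ l₂ N (goodSum * badSum) ⟩
    48 * N * (goodSum * badSum) ∎
    where
    open ≤-Reasoning
    l₁ : ∀ q w → q * (4 * w) ≡ 4 * (q * w)
    l₁ = NS.solve-∀
    l₂ : ∀ n g → 4 * (12 * n * g) ≡ 48 * n * g
    l₂ = NS.solve-∀
    each : ∀ B → Member B → N < B * B → ilog N ≤ 4 * primeLog (suc N) J B
    each B (s , w , e , gs , gw , _ , le) lt = ilog-≤ (4 * f) (<-≤-trans lt (begin
      B * B ≤⟨ *-mono-≤ B≤ B≤ ⟩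
      4 ^ f * 4 ^ f ≡⟨ cong₂ _*_ (^-*-assoc 2 2 f) (^-*-assoc 2 2 f) ⟩
      2 ^ (2 * f) * 2 ^ (2 * f) ≡⟨ sym (^-distribˡ-+-* 2 (2 * f) (2 * f)) ⟩
      2 ^ (2 * f + 2 * f) ≤⟨ ^-monoʳ-≤ 2 (≤-trans (≤-reflexive (l₃ f)) (n≤1+n _)) ⟩
      2 ^ suc (4 * f) ∎))
      where
      f = primeLog (suc N) J B
      l₃ : ∀ f → 2 * f + 2 * f ≡ 4 * f
      l₃ = NS.solve-∀
      B≤ : B ≤ 4 ^ f
      B≤ = ≤4^primeLog (suc N) J B (subst (1 ≤_) (sym e) (*-mono-≤ (proj₁ gs) (proj₁ gw))) (s≤s le) (≤-<-trans le (<2^ilog N))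
    lower : length S * ilog N ≤ 4 * Weighted.weight (primeLog (suc N) J) S
    lower = begin
      length S * ilog N ≡⟨ sym (trans (weight-*ʳ (ilog N) (λ _ → 1) S) (cong (_* ilog N) (weight-1 S))) ⟩
      Weighted.weight (λ _ → 1 * ilog N) S ≤⟨ weight-mono (All.zipWith (λ {B} (m , b) → ≤-trans (≤-reflexive (+-identityʳ (ilog N))) (each B m b)) (ms , big)) ⟩
      Weighted.weight (λ B → 4 * primeLog (suc N) J B) S ≡⟨ weight-*ˡ 4 (primeLog (suc N) J) S ⟩
      4 * Weighted.weight (primeLog (suc N) J) S ∎

-- Harmonic sums

module ReciprocalSums (N : ℕ) where
  open Reciprocal N public

  inv-anti : ∀ {m n} → 1 ≤ m → m ≤ n → inv n ≤ inv m
  inv-anti {suc m} {suc n} _ h = DM./-monoʳ-≤ (N !) h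

  inv-1 : inv 1 ≡ N !
  inv-1 = DM.n/1≡n (N !)

  harmonic : ∀ j → sumTo inv (2 ^ j) ≤ j * N !
  harmonic zero = z≤n
  harmonic (suc j) = begin
    sumTo inv (2 * 2 ^ j) ≡⟨ cong (sumTo inv) (cong (λ i → 2 ^ j + i) (+-identityʳ (2 ^ j))) ⟩
    sumTo inv (2 ^ j + 2 ^ j) ≡⟨ sumTo-split inv (2 ^ j) (2 ^ j) ⟩
    sumTo (λ i → inv (i + 2 ^ j)) (2 ^ j) + sumTo inv (2 ^ j)
      ≤⟨ +-mono-≤ (sumTo-mono (2 ^ j) (λ i _ → inv-anti (m^n>0 2 j) (m≤n+m (2 ^ j) i))) (harmonic j) ⟩
    sumTo (λ _ → inv (2 ^ j)) (2 ^ j) + j * N ! ≡⟨ cong (_+ j * N !) (sumTo-const (inv (2 ^ j)) (2 ^ j)) ⟩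
    2 ^ j * inv (2 ^ j) + j * N ! ≤⟨ +-monoˡ-≤ (j * N !) (inv-≤ (2 ^ j)) ⟩
    suc j * N ! ∎
    where open ≤-Reasoning

  harmonic-≤ : ∀ x → sumTo inv (suc x) ≤ suc (ilog x) * N !
  harmonic-≤ x = ≤-trans (sumTo-extend inv (<2^ilog x)) (harmonic (suc (ilog x)))

  harmonic-≥ : ∀ r → 2 ^ r ≤ N → r * N ! ≤ 2 * sumTo inv (2 ^ r)
  harmonic-≥ zero _ = z≤n
  harmonic-≥ (suc r) h = begin
    N ! + r * N ! ≤⟨ +-mono-≤ (≤-reflexive (sym (inv-* (m^n>0 2 (suc r)) h))) (harmonic-≥ r (≤-trans (m≤m+n (2 ^ r) _) h)) ⟩
    2 * 2 ^ r * inv (2 ^ suc r) + 2 * sumTo inv (2 ^ r) ≡⟨ l (2 ^ r) (inv (2 ^ suc r)) (sumTo inv (2 ^ r)) ⟩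
    2 * (2 ^ r * inv (2 ^ suc r) + sumTo inv (2 ^ r)) ≡⟨ cong (λ i → 2 * (i + sumTo inv (2 ^ r))) (sym (sumTo-const (inv (2 ^ suc r)) (2 ^ r))) ⟩
    2 * (sumTo (λ _ → inv (2 ^ suc r)) (2 ^ r) + sumTo inv (2 ^ r))
      ≤⟨ *-monoʳ-≤ 2 (+-monoˡ-≤ _ (sumTo-mono (2 ^ r) (λ i lt → inv-anti (≤-trans (m^n>0 2 r) (m≤n+m (2 ^ r) i)) (≤-trans (+-monoˡ-≤ (2 ^ r) (<⇒≤ lt)) (≤-reflexive (cong (λ i → 2 ^ r + i) (sym (+-identityʳ (2 ^ r))))))))) ⟩
    2 * (sumTo (λ i → inv (i + 2 ^ r)) (2 ^ r) + sumTo inv (2 ^ r)) ≡⟨ cong (2 *_) (sym (sumTo-split inv (2 ^ r) (2 ^ r))) ⟩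
    2 * sumTo inv (2 ^ r + 2 ^ r) ≡⟨ cong (λ i → 2 * sumTo inv i) (cong (λ i → 2 ^ r + i) (sym (+-identityʳ (2 ^ r)))) ⟩
    2 * sumTo inv (2 ^ suc r) ∎
    where
    open ≤-Reasoning
    l : ∀ a b c → 2 * a * b + 2 * c ≡ 2 * (a * b + c)
    l = NS.solve-∀

  inv² : ℕ → ℕ
  inv² n = inv n * inv n

  -- The inequality 1/(L+1)² ≤ 1/L - 1/(L+1), scaled by the square of `N !`.
  inv²-telescope : ∀ L → 1 ≤ L → suc L ≤ N → inv² (suc L) + N ! * inv (suc L) ≤ N ! * inv L
  inv²-telescope L L≥1 h = *-cancelˡ-≤ L {{>-nonZero L≥1}} (begin
    L * (i * i + N ! * i) ≡⟨ cong (λ q → L * (i * i + q * i)) (sym (inv-* (s≤s z≤n) h)) ⟩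
    L * (i * i + suc L * i * i) ≤⟨ m≤m+n _ (i * i) ⟩
    L * (i * i + suc L * i * i) + i * i ≡⟨ l₁ L i ⟩
    (suc L * i) * (suc L * i) ≡⟨ cong₂ _*_ (inv-* (s≤s z≤n) h) (inv-* (s≤s z≤n) h) ⟩
    N ! * N ! ≡⟨ cong (N ! *_) (sym (inv-* L≥1 (≤-trans (n≤1+n L) h))) ⟩
    N ! * (L * inv L) ≡⟨ l₂ (N !) L (inv L) ⟩
    L * (N ! * inv L) ∎)
    where
    open ≤-Reasoning
    i = inv (suc L)
    l₁ : ∀ L i → L * (i * i + suc L * i * i) + i * i ≡ (suc L * i) * (suc L * i)
    l₁ = NS.solve-∀
    l₂ : ∀ q L j → q * (L * j) ≡ L * (q * j)
    l₂ = NS.solve-∀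

  inv²-sum : ∀ L → L ≤ N → sumTo inv² (suc L) ≤ 2 * (N ! * N !)
  inv²-sum zero h = z≤n
  inv²-sum (suc L) h = ≤-trans (m≤m+n _ _) (strong L h)
    where
    open ≤-Reasoning
    strong : ∀ L → suc L ≤ N → sumTo inv² (suc (suc L)) + N ! * inv (suc L) ≤ 2 * (N ! * N !)
    strong zero h = ≤-reflexive (trans (cong (λ i → i * i + (0 + 0) + N ! * i) inv-1) (l (N ! * N !)))
      where
      l : ∀ a → a + (0 + 0) + a ≡ 2 * a
      l = NS.solve-∀
    strong (suc L) h = begin
      inv² (suc (suc L)) + sumTo inv² (suc (suc L)) + N ! * inv (suc (suc L)) ≡⟨ l (inv² (suc (suc L))) (sumTo inv² (suc (suc L))) (N ! * inv (suc (suc L))) ⟩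
      sumTo inv² (suc (suc L)) + (inv² (suc (suc L)) + N ! * inv (suc (suc L))) ≤⟨ +-monoʳ-≤ (sumTo inv² (suc (suc L))) (inv²-telescope (suc L) (s≤s z≤n) h) ⟩
      sumTo inv² (suc (suc L)) + N ! * inv (suc L) ≤⟨ strong L (≤-trans (n≤1+n _) h) ⟩
      2 * (N ! * N !) ∎
      where
      l : ∀ a b c → a + b + c ≡ b + (a + c)
      l = NS.solve-∀

-- Squarefree numbers and congruences

SquareFree : ℕ → Set
SquareFree n = 1 ≤ n × (∀ p → Prime p → ¬ p * p ∣ n)

squareFree? : Decidable SquareFree
squareFree? n = map′ (λ (a , h) → a , λ p pp pn → h {p} (s≤s (≤-trans (m≤m*n p p {{prime⇒nonZero pp}}) (ND.∣⇒≤ {{>-nonZero a}} pn))) pp pn) (λ (a , h) → a , λ {p} _ → h p)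
  ((1 ≤? n) ×-dec allUpTo? (λ p → prime? p →-dec ¬? (p * p ∣? n)) (suc n))

squareFree-∣ : ∀ {d n} → d ∣ n → SquareFree n → SquareFree d
squareFree-∣ {d} dn (a , h) = n≢0⇒n>0 (λ { refl → n>0⇒n≢0 a (ND.0∣⇒≡0 dn) }) , λ p pp pd → h p pp (ND.∣-trans pd dn)

squareFree-by-primes : ∀ a → SquareFree a → ∀ b → (∀ p → Prime p → p ∣ a → p ∣ b) → a ∣ b
squareFree-by-primes a sf = prime-induction {λ a → SquareFree a → ∀ b → (∀ p → Prime p → p ∣ a → p ∣ b) → a ∣ b} (λ _ b _ → ND.1∣ b) step a (proj₁ sf) sf
  where
  step : ∀ p n → Prime p → 1 ≤ n → (SquareFree n → ∀ b → (∀ q → Prime q → q ∣ n → q ∣ b) → n ∣ b) → SquareFree (p * n) → ∀ b → (∀ q → Prime q → q ∣ p * n → q ∣ b) → p * n ∣ b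
  step p n pp n≥1 ih sf b h with h p pp (ND.m∣m*n n)
  ... | divides b' e = subst (p * n ∣_) (trans (*-comm p b') (sym e)) (ND.*-monoʳ-∣ p (ih (squareFree-∣ (ND.n∣m*n p) sf) b' other))
    where
    other : ∀ q → Prime q → q ∣ n → q ∣ b'
    other q pq d with euclidsLemma b' p pq (subst (q ∣_) e (h q pq (ND.∣n⇒∣m*n p d)))
    ... | inj₁ x = x
    ... | inj₂ x = ⊥-elim (proj₂ sf p pp (ND.*-monoʳ-∣ p (subst (_∣ n) (prime-∣-prime pq pp x) d)))

squareFree-decompose : ∀ n → 1 ≤ n → ∃[ m ] ∃[ f ] (n ≡ m * (f * f) × SquareFree m × 1 ≤ f)
squareFree-decompose = prime-induction (1 , 1 , refl , (≤-refl , λ p pp d → <⇒≱ (prime≥2 pp) (≤-trans (m≤m*n p p {{prime⇒nonZero pp}}) (ND.∣⇒≤ d))) , ≤-refl) step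
  where
  step : ∀ p n → Prime p → 1 ≤ n → ∃[ m ] ∃[ f ] (n ≡ m * (f * f) × SquareFree m × 1 ≤ f) → ∃[ m ] ∃[ f ] (p * n ≡ m * (f * f) × SquareFree m × 1 ≤ f)
  step p n pp n≥1 (m , f , e , sf , f≥1) with p ∣? m
  ... | yes (divides m' em) = m' , p * f , trans (cong (p *_) (trans e (cong (_* (f * f)) em))) (l p m' f) , squareFree-∣ (divides p (trans em (*-comm m' p))) sf , *-mono-≤ (≤-trans (s≤s z≤n) (prime≥2 pp)) f≥1
    where
    l : ∀ p m f → p * (m * p * (f * f)) ≡ m * (p * f * (p * f))
    l = NS.solve-∀
  ... | no np = p * m , f , trans (cong (p *_) e) (sym (*-assoc p m (f * f))) , (*-mono-≤ (≤-trans (s≤s z≤n) (prime≥2 pp)) (proj₁ sf) , free) , f≥1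
    where
    free : ∀ q → Prime q → ¬ q * q ∣ p * m
    free q pq d with q ≟ p
    ... | yes refl = np (ND.*-cancelˡ-∣ q {{prime⇒nonZero pq}} d)
    ... | no ne = proj₂ sf q pq (coprime-divisor {q * q} {p} {m} (λ (a , b) → cop a b) d)
      where
      cop : ∀ {i} → i ∣ q * q → i ∣ p → i ≡ 1
      cop {i} a b with prime⇒irreducible pp b
      ... | inj₁ x = x
      ... | inj₂ refl = ⊥-elim ([ (λ x → ne (sym (prime-∣-prime pp pq x))) , (λ x → ne (sym (prime-∣-prime pp pq x))) ]′ (euclidsLemma q q pp a))

∣-abs-+ : ∀ {p} x y → p ∣ abs x → p ∣ abs y → p ∣ abs (x ⊕ y)
∣-abs-+ {p} x y a b = ℤS.∣⇒∣ᵤ (ℤS.∣m∣n⇒∣m+n {+ p} {x} {y} (ℤS.∣ᵤ⇒∣ a) (ℤS.∣ᵤ⇒∣ b))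

∣-abs-*ˡ : ∀ {p} c x → p ∣ abs x → p ∣ abs (c · x)
∣-abs-*ˡ {p} c x a = subst (p ∣_) (sym (ℤP.abs-* c x)) (ND.∣n⇒∣m*n (abs c) a)

∣-abs-*ʳ : ∀ {p} x c → p ∣ abs x → p ∣ abs (x · c)
∣-abs-*ʳ {p} x c a = subst (p ∣_) (sym (ℤP.abs-* x c)) (ND.∣m⇒∣m*n (abs c) a)

coprime-inverse : ∀ {p n} → Coprime p n → ∃[ x ] (p ∣ abs ((+ n) · x ⊖ 1ℤ))
coprime-inverse {p} {n} cop = go (coprime-Bézout cop)
  where
  go : Bézout.Identity 1 p n → ∃[ x ] (p ∣ abs ((+ n) · x ⊖ 1ℤ))
  go (Bézout.+- x y e) = ⊖ (+ y) , subst (p ∣_) (sym (trans (cong abs (trans (l (+ n) (+ y)) (cong ⊖_ (trans (cong (λ i → 1ℤ ⊕ i) (sym (ℤP.pos-* y n))) (cong +_ e))))) (ℤP.∣-i∣≡∣i∣ (+ (x * p))))) (ND.n∣m*n x)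
    where
    l : ∀ n y → n · (⊖ y) ⊖ 1ℤ ≡ ⊖ (1ℤ ⊕ y · n)
    l = ZS.solve-∀
  go (Bézout.-+ x y e) = + y , subst (p ∣_) (sym (cong abs (trans (cong (λ i → i ⊖ 1ℤ) (trans (ℤP.*-comm (+ n) (+ y)) (trans (sym (ℤP.pos-* y n)) (cong +_ (sym e))))) (l (+ (x * p)))))) (ND.n∣m*n x)
    where
    l : ∀ a → (1ℤ ⊕ a) ⊖ 1ℤ ≡ a
    l = ZS.solve-∀

-- Squarefreeness keeps each further prime coprime to the modulus already treated. The target
-- residues are given by a function on primes, so that the choice of signs in `pairVector` is a
-- choice of `τ`.
chinese-remainder : ∀ n → SquareFree n → ∀ (τ : ℕ → ℤ) → ∃[ t ] (∀ p → Prime p → p ∣ n → p ∣ abs (t ⊖ τ p))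
chinese-remainder n sf τ = prime-induction {λ n → SquareFree n → ∃[ t ] (∀ p → Prime p → p ∣ n → p ∣ abs (t ⊖ τ p))} (λ _ → 0ℤ , λ p pp d → ⊥-elim (<⇒≱ (prime≥2 pp) (ND.∣⇒≤ d))) step n (proj₁ sf) sf
  where
  step : ∀ p n → Prime p → 1 ≤ n → (SquareFree n → ∃[ t ] (∀ q → Prime q → q ∣ n → q ∣ abs (t ⊖ τ q))) → SquareFree (p * n) → ∃[ t ] (∀ q → Prime q → q ∣ p * n → q ∣ abs (t ⊖ τ q))
  step p n pp n≥1 ih sf = glue (ih (squareFree-∣ (ND.n∣m*n p) sf)) (coprime-inverse (prime-coprime pp (λ d → proj₂ sf p pp (ND.*-monoʳ-∣ p d))))
    where
    glue : ∃[ t ] (∀ q → Prime q → q ∣ n → q ∣ abs (t ⊖ τ q)) → ∃[ x ] (p ∣ abs ((+ n) · x ⊖ 1ℤ)) → ∃[ t ] (∀ q → Prime q → q ∣ p * n → q ∣ abs (t ⊖ τ q))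
    glue (t , ht) (x , hx) = t ⊕ (+ n) · x · (τ p ⊖ t) , each
      where
      l₁ : ∀ t n x a → (t ⊕ n · x · (a ⊖ t)) ⊖ a ≡ (a ⊖ t) · (n · x ⊖ 1ℤ)
      l₁ = ZS.solve-∀
      l₂ : ∀ t n x a b → (t ⊕ n · x · (a ⊖ t)) ⊖ b ≡ (t ⊖ b) ⊕ n · (x · (a ⊖ t))
      l₂ = ZS.solve-∀
      each : ∀ q → Prime q → q ∣ p * n → q ∣ abs ((t ⊕ (+ n) · x · (τ p ⊖ t)) ⊖ τ q)
      each q pq d with euclidsLemma p n pq d
      ... | inj₂ dn = subst (λ i → q ∣ abs i) (sym (l₂ t (+ n) x (τ p) (τ q))) (∣-abs-+ (t ⊖ τ q) ((+ n) · (x · (τ p ⊖ t))) (ht q pq dn) (∣-abs-*ʳ (+ n) (x · (τ p ⊖ t)) dn))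
      ... | inj₁ dp = subst (λ i → q ∣ abs i) (sym (trans (cong (λ i → (t ⊕ (+ n) · x · (τ p ⊖ t)) ⊖ τ i) (prime-∣-prime pq pp dp)) (l₁ t (+ n) x (τ p)))) (∣-abs-*ˡ (τ p ⊖ t) ((+ n) · x ⊖ 1ℤ) (subst (_∣ abs ((+ n) · x ⊖ 1ℤ)) (sym (prime-∣-prime pq pp dp)) hx))

-- The map may use the proof of `P x`; this hands points of the curve over to cases (B) and (C) as
-- records containing their defining inequalities.
bdd-via : ∀ {A A' : Set} (key : A → ℕ) (key' : A' → ℕ) {P : A → Set} {K} (f : ∀ x → P x → A') → (∀ x p → key' (f x p) ≡ key x) →
  Counting.Bdd key' (λ _ → ⊤) K → Counting.Bdd key P K
bdd-via {A} {A'} key key' {P} {K} f e b xs ps d = ≤-trans (≤-reflexive (sym (len xs ps))) (b (image xs ps) (All.universal (λ _ → tt) _) (distinct xs ps d))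
  where
  image : ∀ xs → All P xs → List A'
  image [] [] = []
  image (x ∷ xs) (p ∷ ps) = f x p ∷ image xs ps
  len : ∀ xs ps → length (image xs ps) ≡ length xs
  len [] [] = refl
  len (x ∷ xs) (p ∷ ps) = cong suc (len xs ps)
  distinct : ∀ xs ps → Counting.Distinct key xs → Counting.Distinct key' (image xs ps)
  distinct [] [] [] = []
  distinct (x ∷ xs) (p ∷ ps) (ne ∷ u) = avoid xs ps ne ∷ distinct xs ps u
    where
    avoid : ∀ ys qs → All (λ y → key x ≢ key y) ys → All (λ y → key' (f x p) ≢ key' y) (image ys qs)
    avoid [] [] [] = []
    avoid (y ∷ ys) (q ∷ qs) (n ∷ ns) = (λ h → n (trans (sym (e x p)) (trans h (e y q)))) ∷ avoid ys qs ns

bdd-key : ∀ {A : Set} (key : A → ℕ) L → Counting.Bdd key (λ x → key x < L) L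
bdd-key key L = bdd-mono (λ x p → p) (≤-reflexive (*-identityʳ L)) (bdd-fibre key L (λ x p → p) (λ l _ → bdd-unique (λ x y (_ , e) (_ , e') → trans e (sym e'))))
  where open Counting key

-- Comparison of logarithms and the final inequalities

Lg≤ : ∀ N → Lg N ≤ suc (ilog N)
Lg≤ N = ≤-trans (⌈log₂⌉-mono-≤ (<⇒≤ (<2^ilog N))) (≤-reflexive (⌈log₂2^n⌉≡n (suc (ilog N))))

ilog≤⌈log₂⌉ : ∀ x → 1 ≤ x → ilog x ≤ ⌈log₂ x ⌉
ilog≤⌈log₂⌉ x x≥1 = ≤-trans (≤-reflexive (sym (⌈log₂2^n⌉≡n (ilog x)))) (⌈log₂⌉-mono-≤ (2^ilog≤ x x≥1))

2≤Lg : ∀ N → 3 ≤ N → 2 ≤ Lg N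
2≤Lg N h = ≤-trans (≤-reflexive refl) (⌈log₂⌉-mono-≤ h)

1≤LgLg : ∀ N → 3 ≤ N → 1 ≤ LgLg N
1≤LgLg N h = ≤-trans (≤-reflexive (sym (⌈log₂2^n⌉≡n 1))) (⌈log₂⌉-mono-≤ (2≤Lg N h))

ilog-ilog≤ : ∀ N → 3 ≤ N → ilog (suc (ilog N)) ≤ 2 * LgLg N
ilog-ilog≤ N h = begin
  ilog (suc (ilog N)) ≤⟨ ilog-mono (≤-trans (s≤s (ilog≤⌈log₂⌉ N (≤-trans (s≤s z≤n) h))) (+-monoˡ-≤ (Lg N) (≤-trans (s≤s z≤n) (2≤Lg N h)))) ⟩
  ilog (Lg N + Lg N) ≤⟨ ilog-≤ (suc (ilog (Lg N))) (<-≤-trans (+-mono-< (<2^ilog (Lg N)) (<2^ilog (Lg N))) (≤-reflexive (cong (λ i → 2 ^ suc (ilog (Lg N)) + i) (sym (+-identityʳ _))))) ⟩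
  suc (ilog (Lg N)) ≤⟨ s≤s (ilog≤⌈log₂⌉ (Lg N) (≤-trans (s≤s z≤n) (2≤Lg N h))) ⟩
  1 + LgLg N ≤⟨ +-monoˡ-≤ (LgLg N) (1≤LgLg N h) ⟩
  LgLg N + LgLg N ≡⟨ cong (λ i → LgLg N + i) (sym (+-identityʳ _)) ⟩
  2 * LgLg N ∎
  where open ≤-Reasoning

opaque
  threshold : ℕ → ℕ → ℕ
  threshold E G = suc E * suc (G * suc E ^ E)

  -- With m = ⌊T/(E+1)⌋ one has 2^T ≥ 2^(m(E+1)), while T^E ≤ (E+1)^E 2^(mE). The quotient 2^m is
  -- therefore below G (E+1)^E, which bounds m and so T.
  exponential-beats-power : ∀ E G T → 2 ^ T < G * T ^ E → T ≤ threshold E G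
  exponential-beats-power E G T lt = ≤-trans (<⇒≤ T<) (*-monoʳ-≤ (suc E) (s≤s (<⇒≤ (<-trans (<2^n m) small))))
    where
    open ≤-Reasoning
    m : ℕ
    m = T DM./ suc E
    T< : T < suc E * suc m
    T< = <-≤-trans (≤-<-trans (≤-reflexive (DM.m≡m%n+[m/n]*n T (suc E))) (+-monoˡ-< (m * suc E) (DM.m%n<n T (suc E)))) (≤-reflexive (*-comm (suc m) (suc E)))
    T^E : T ^ E ≤ suc E ^ E * 2 ^ (m * E)
    T^E = begin
      T ^ E ≤⟨ ^-monoˡ-≤ E (<⇒≤ T<) ⟩
      (suc E * suc m) ^ E ≡⟨ *-^ E (suc E) (suc m) ⟩
      suc E ^ E * suc m ^ E ≤⟨ *-monoʳ-≤ (suc E ^ E) (^-monoˡ-≤ E (<2^n m)) ⟩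
      suc E ^ E * (2 ^ m) ^ E ≡⟨ cong (suc E ^ E *_) (^-*-assoc 2 m E) ⟩
      suc E ^ E * 2 ^ (m * E) ∎
    small : 2 ^ m < G * suc E ^ E
    small = *-cancelʳ-< (2 ^ (m * E)) _ _ (begin-strict
      2 ^ m * 2 ^ (m * E) ≡⟨ trans (sym (^-distribˡ-+-* 2 m (m * E))) (cong (2 ^_) (sym (*-suc m E))) ⟩
      2 ^ (m * suc E) ≤⟨ ^-monoʳ-≤ 2 (DM.m/n*n≤m T (suc E)) ⟩
      2 ^ T <⟨ lt ⟩
      G * T ^ E ≤⟨ *-monoʳ-≤ G T^E ⟩
      G * (suc E ^ E * 2 ^ (m * E)) ≡⟨ sym (*-assoc G (suc E ^ E) (2 ^ (m * E))) ⟩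
      G * suc E ^ E * 2 ^ (m * E) ∎)

2ab≤a²+b² : ∀ a b → 2 * (a * b) ≤ a * a + b * b
2ab≤a²+b² a b = [ (λ le → ordered a b (m≤n⇒∃[o]m+o≡n le)) , (λ le → ≤-trans (≤-reflexive (cong (2 *_) (*-comm a b))) (≤-trans (ordered b a (m≤n⇒∃[o]m+o≡n le)) (≤-reflexive (+-comm (b * b) (a * a))))) ]′ (≤-total a b)
  where
  l : ∀ a d → a * a + (a + d) * (a + d) ≡ 2 * (a * (a + d)) + d * d
  l = NS.solve-∀
  ordered : ∀ a b → ∃[ d ] (a + d ≡ b) → 2 * (a * b) ≤ a * a + b * b
  ordered a _ (d , refl) = ≤-trans (m≤m+n _ (d * d)) (≤-reflexive (sym (l a d)))

add-bound : ∀ {a b T p q F} → a * a * T ≤ p * F → b * b * T ≤ q * F → (a + b) * (a + b) * T ≤ 2 * (p + q) * F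
add-bound {a} {b} {T} {p} {q} {F} h₁ h₂ = begin
  (a + b) * (a + b) * T ≤⟨ *-monoˡ-≤ T (≤-trans (≤-reflexive (l₁ a b)) (≤-trans (+-monoʳ-≤ (a * a + b * b) (2ab≤a²+b² a b)) (≤-reflexive (l₂ (a * a + b * b))))) ⟩
  2 * (a * a + b * b) * T ≡⟨ l₃ (a * a) (b * b) T ⟩
  2 * (a * a * T + b * b * T) ≤⟨ *-monoʳ-≤ 2 (+-mono-≤ h₁ h₂) ⟩
  2 * (p * F + q * F) ≡⟨ l₄ p q F ⟩
  2 * (p + q) * F ∎
  where
  open ≤-Reasoning
  l₁ : ∀ a b → (a + b) * (a + b) ≡ a * a + b * b + 2 * (a * b)
  l₁ = NS.solve-∀
  l₂ : ∀ s → s + s ≡ 2 * s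
  l₂ = NS.solve-∀
  l₃ : ∀ a b t → 2 * (a + b) * t ≡ 2 * (a * t + b * t)
  l₃ = NS.solve-∀
  l₄ : ∀ p q f → 2 * (p * f + q * f) ≡ 2 * (p + q) * f
  l₄ = NS.solve-∀

linear-bound : ∀ {x T p N L} → 1 ≤ T → 1 ≤ L → x * T ≤ p * N → x * x * T ≤ p * p * (N * N * L)
linear-bound {x} {T} {p} {N} {L} T≥1 L≥1 h = begin
  x * x * T ≤⟨ m≤m*n (x * x * T) T {{>-nonZero T≥1}} ⟩
  x * x * T * T ≡⟨ l₁ x T ⟩
  x * T * (x * T) ≤⟨ *-mono-≤ h h ⟩
  p * N * (p * N) ≤⟨ m≤m*n (p * N * (p * N)) L {{>-nonZero L≥1}} ⟩
  p * N * (p * N) * L ≡⟨ l₂ p N L ⟩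
  p * p * (N * N * L) ∎
  where
  open ≤-Reasoning
  l₁ : ∀ x t → x * x * t * t ≡ x * t * (x * t)
  l₁ = NS.solve-∀
  l₂ : ∀ p n l → p * n * (p * n) * l ≡ p * p * (n * n * l)
  l₂ = NS.solve-∀

floor-lower : ∀ N d .{{_ : NonZero d}} → d ≤ N → N ≤ 2 * (d * (N DM./ d))
floor-lower N d h = begin
  N ≡⟨ DM.m≡m%n+[m/n]*n N d ⟩
  N DM.% d + q * d ≤⟨ +-monoˡ-≤ (q * d) (≤-trans (<⇒≤ (DM.m%n<n N d)) (m≤n*m d q {{>-nonZero (DM.m≥n⇒m/n>0 h)}})) ⟩
  q * d + q * d ≡⟨ l q d ⟩
  2 * (d * q) ∎
  where
  open ≤-Reasoning
  q = N DM./ d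
  l : ∀ q d → q * d + q * d ≡ 2 * (d * q)
  l = NS.solve-∀

-- Here `Λ` is (N!)², and `g`, `b` are the scaled Σ 1/s and Σ 1/w. Squaring turns g² b² into T r,
-- while the left side acquires ℓ². One factor ℓ cancels against T ≤ 2ℓ; the other is the saving in
-- the theorem.
sieve-numeric : ∀ c₁ c₂ c₃ Λ N L ℓ T r g b → 1 ≤ Λ → Λ * (L * ℓ) ≤ c₁ * N * (g * b) → g * g ≤ c₂ * (T * Λ) → b * b ≤ c₃ * (r * Λ) → 1 ≤ ℓ → T ≤ 2 * ℓ →
  L * L * T ≤ 4 * (c₁ * c₁ * (c₂ * c₃)) * (N * N * r)
sieve-numeric c₁ c₂ c₃ Λ N L ℓ T r g b Λ≥1 h hg hb ℓ≥1 T≤ = begin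
  L * L * T ≤⟨ *-monoʳ-≤ (L * L) T≤ ⟩
  L * L * (2 * ℓ) ≡⟨ l₁ L ℓ ⟩
  2 * (L * L * ℓ) ≤⟨ *-monoʳ-≤ 2 (*-cancelʳ-≤ (L * L * ℓ) (2 * (c₁ * c₁ * (c₂ * c₃)) * (N * N * r)) ℓ {{>-nonZero ℓ≥1}} mid) ⟩
  2 * (2 * (c₁ * c₁ * (c₂ * c₃)) * (N * N * r)) ≡⟨ l₂ (c₁ * c₁ * (c₂ * c₃)) (N * N * r) ⟩
  4 * (c₁ * c₁ * (c₂ * c₃)) * (N * N * r) ∎
  where
  open ≤-Reasoning
  l₁ : ∀ L ℓ → L * L * (2 * ℓ) ≡ 2 * (L * L * ℓ)
  l₁ = NS.solve-∀
  l₂ : ∀ c n → 2 * (2 * c * n) ≡ 4 * c * n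
  l₂ = NS.solve-∀
  l₃ : ∀ q L ℓ → q * q * (L * L * ℓ * ℓ) ≡ q * (L * ℓ) * (q * (L * ℓ))
  l₃ = NS.solve-∀
  l₄ : ∀ c n g b → c * n * (g * b) * (c * n * (g * b)) ≡ c * c * (n * n) * ((g * g) * (b * b))
  l₄ = NS.solve-∀
  l₅ : ∀ c n d t q e r → c * c * (n * n) * ((d * (t * q)) * (e * (r * q))) ≡ q * q * (c * c * (d * e) * (n * n * r) * t)
  l₅ = NS.solve-∀
  l₆ : ∀ c n ℓ → c * n * (2 * ℓ) ≡ 2 * c * n * ℓ
  l₆ = NS.solve-∀
  mid : L * L * ℓ * ℓ ≤ 2 * (c₁ * c₁ * (c₂ * c₃)) * (N * N * r) * ℓ
  mid = *-cancelˡ-≤ (Λ * Λ) {{>-nonZero (*-mono-≤ Λ≥1 Λ≥1)}} (begin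
    Λ * Λ * (L * L * ℓ * ℓ) ≡⟨ l₃ Λ L ℓ ⟩
    Λ * (L * ℓ) * (Λ * (L * ℓ)) ≤⟨ *-mono-≤ h h ⟩
    c₁ * N * (g * b) * (c₁ * N * (g * b)) ≡⟨ l₄ c₁ N g b ⟩
    c₁ * c₁ * (N * N) * ((g * g) * (b * b)) ≤⟨ *-monoʳ-≤ (c₁ * c₁ * (N * N)) (*-mono-≤ hg hb) ⟩
    c₁ * c₁ * (N * N) * ((c₂ * (T * Λ)) * (c₃ * (r * Λ))) ≡⟨ l₅ c₁ N c₂ T Λ c₃ r ⟩
    Λ * Λ * (c₁ * c₁ * (c₂ * c₃) * (N * N * r) * T) ≤⟨ *-monoʳ-≤ (Λ * Λ) (*-monoʳ-≤ (c₁ * c₁ * (c₂ * c₃) * (N * N * r)) T≤) ⟩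
    Λ * Λ * (c₁ * c₁ * (c₂ * c₃) * (N * N * r) * (2 * ℓ)) ≡⟨ cong (Λ * Λ *_) (l₆ (c₁ * c₁ * (c₂ * c₃)) (N * N * r) ℓ) ⟩
    Λ * Λ * (2 * (c₁ * c₁ * (c₂ * c₃)) * (N * N * r) * ℓ) ∎)

-- Arithmetic of ℤ[√k]

module Curve (k : ℤ) where

 infixl 6 _⊞_ _⊟_
 infixl 7 _⊠_
 infixr 8 _⋆_ _↑_

 -- re + im √k
 record Q : Set where
   constructor _,√_
   field
     re im : ℤ
 open Q public

 Q-ext : ∀ {x y : Q} → re x ≡ re y → im x ≡ im y → x ≡ y
 Q-ext refl refl = refl

 0Q 1Q : Q
 0Q = 0ℤ ,√ 0ℤ
 1Q = 1ℤ ,√ 0ℤ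

 κ : ℕ
 κ = (abs k)

 m≤m*m : ∀ m → m ≤ m * m
 m≤m*m zero = z≤n
 m≤m*m (suc m) = m≤m*n (suc m) (suc m)

 opaque
   _⊞_ _⊟_ _⊠_ : Q → Q → Q
   (a ,√ b) ⊞ (c ,√ d) = (a ⊕ c) ,√ (b ⊕ d)
   (a ,√ b) ⊟ (c ,√ d) = (a ⊖ c) ,√ (b ⊖ d)
   (a ,√ b) ⊠ (c ,√ d) = (a · c ⊕ k · b · d) ,√ (a · d ⊕ b · c)

   _⋆_ : ℤ → Q → Q
   n ⋆ (a ,√ b) = (n · a) ,√ (n · b)

   conj : Q → Q
   conj (a ,√ b) = a ,√ (⊖ b)

   norm : Q → ℤ
   norm (a ,√ b) = a · a ⊖ k · b · b

   -- Plays the part of an absolute value. The weight κ on the coefficient of √k makes it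
   -- submultiplicative, because κ ≤ κ², and for κ ≥ 1 every nonzero element has size at least 1.
   size : Q → ℕ
   size (a ,√ b) = (abs a) + κ * (abs b)

 _↑_ : Q → ℕ → Q
 x ↑ zero = 1Q
 x ↑ suc n = x ⊠ (x ↑ n)

 opaque
   unfolding _⊞_

   ⊠-comm : ∀ x y → x ⊠ y ≡ y ⊠ x
   ⊠-comm (a ,√ b) (c ,√ d) = Q-ext (l k a b c d) (l' a b c d)
     where
     l : ∀ k a b c d → a · c ⊕ k · b · d ≡ c · a ⊕ k · d · b
     l = ZS.solve-∀
     l' : ∀ a b c d → a · d ⊕ b · c ≡ c · b ⊕ d · a
     l' = ZS.solve-∀

   ⊠-assoc : ∀ x y z → (x ⊠ y) ⊠ z ≡ x ⊠ (y ⊠ z)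
   ⊠-assoc (a ,√ b) (c ,√ d) (e ,√ f) = Q-ext (l k a b c d e f) (l' k a b c d e f)
     where
     l : ∀ k a b c d e f →
       (a · c ⊕ k · b · d) · e ⊕ k · (a · d ⊕ b · c) · f ≡
       a · (c · e ⊕ k · d · f) ⊕ k · b · (c · f ⊕ d · e)
     l = ZS.solve-∀
     l' : ∀ k a b c d e f →
       (a · c ⊕ k · b · d) · f ⊕ (a · d ⊕ b · c) · e ≡
       a · (c · f ⊕ d · e) ⊕ b · (c · e ⊕ k · d · f)
     l' = ZS.solve-∀

   ⊠-identityˡ : ∀ x → 1Q ⊠ x ≡ x
   ⊠-identityˡ (a ,√ b) = Q-ext (l k a b) (l' a b)
     where
     l : ∀ k a b → 1ℤ · a ⊕ k · 0ℤ · b ≡ a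
     l = ZS.solve-∀
     l' : ∀ a b → 1ℤ · b ⊕ 0ℤ · a ≡ b
     l' = ZS.solve-∀

   ⊠-identityʳ : ∀ x → x ⊠ 1Q ≡ x
   ⊠-identityʳ x = trans (⊠-comm x 1Q) (⊠-identityˡ x)

   ⊠-distribˡ-⊟ : ∀ x y z → x ⊠ (y ⊟ z) ≡ x ⊠ y ⊟ x ⊠ z
   ⊠-distribˡ-⊟ (a ,√ b) (c ,√ d) (e ,√ f) = Q-ext (l k a b c d e f) (l' a b c d e f)
     where
     l : ∀ k a b c d e f → a · (c ⊖ e) ⊕ k · b · (d ⊖ f) ≡
         (a · c ⊕ k · b · d) ⊖ (a · e ⊕ k · b · f)
     l = ZS.solve-∀
     l' : ∀ a b c d e f → a · (d ⊖ f) ⊕ b · (c ⊖ e) ≡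
         (a · d ⊕ b · c) ⊖ (a · f ⊕ b · e)
     l' = ZS.solve-∀

   ⊠-distribˡ-⊞ : ∀ x y z → x ⊠ (y ⊞ z) ≡ x ⊠ y ⊞ x ⊠ z
   ⊠-distribˡ-⊞ (a ,√ b) (c ,√ d) (e ,√ f) = Q-ext (l k a b c d e f) (l' a b c d e f)
     where
     l : ∀ k a b c d e f → a · (c ⊕ e) ⊕ k · b · (d ⊕ f) ≡
         (a · c ⊕ k · b · d) ⊕ (a · e ⊕ k · b · f)
     l = ZS.solve-∀
     l' : ∀ a b c d e f → a · (d ⊕ f) ⊕ b · (c ⊕ e) ≡
         (a · d ⊕ b · c) ⊕ (a · f ⊕ b · e)
     l' = ZS.solve-∀

   ⊠-interchange : ∀ w x y z → (w ⊠ x) ⊠ (y ⊠ z) ≡ (w ⊠ y) ⊠ (x ⊠ z)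
   ⊠-interchange w x y z = begin
     (w ⊠ x) ⊠ (y ⊠ z) ≡⟨ ⊠-assoc w x (y ⊠ z) ⟩
     w ⊠ (x ⊠ (y ⊠ z)) ≡⟨ cong (w ⊠_) (sym (⊠-assoc x y z)) ⟩
     w ⊠ ((x ⊠ y) ⊠ z) ≡⟨ cong (λ t → w ⊠ (t ⊠ z)) (⊠-comm x y) ⟩
     w ⊠ ((y ⊠ x) ⊠ z) ≡⟨ cong (w ⊠_) (⊠-assoc y x z) ⟩
     w ⊠ (y ⊠ (x ⊠ z)) ≡⟨ sym (⊠-assoc w y (x ⊠ z)) ⟩
     (w ⊠ y) ⊠ (x ⊠ z) ∎
     where open ≡-Reasoning

   ⋆-assoc : ∀ m n x → (m · n) ⋆ x ≡ m ⋆ (n ⋆ x)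
   ⋆-assoc m n (a ,√ b) = Q-ext (ℤP.*-assoc m n a) (ℤP.*-assoc m n b)

   ⋆-identity : ∀ x → 1ℤ ⋆ x ≡ x
   ⋆-identity (a ,√ b) = Q-ext (ℤP.*-identityˡ a) (ℤP.*-identityˡ b)

   ⋆-comm : ∀ m n x → m ⋆ (n ⋆ x) ≡ n ⋆ (m ⋆ x)
   ⋆-comm m n x = trans (sym (⋆-assoc m n x)) (trans (cong (_⋆ x) (ℤP.*-comm m n)) (⋆-assoc n m x))

   ⋆-⊠ˡ : ∀ n x y → (n ⋆ x) ⊠ y ≡ n ⋆ (x ⊠ y)
   ⋆-⊠ˡ n (a ,√ b) (c ,√ d) = Q-ext (l k n a b c d) (l' n a b c d)
     where
     l : ∀ k n a b c d → n · a · c ⊕ k · (n · b) · d ≡ n · (a · c ⊕ k · b · d)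
     l = ZS.solve-∀
     l' : ∀ n a b c d → n · a · d ⊕ n · b · c ≡ n · (a · d ⊕ b · c)
     l' = ZS.solve-∀

   ⋆-⊠ʳ : ∀ n x y → x ⊠ (n ⋆ y) ≡ n ⋆ (x ⊠ y)
   ⋆-⊠ʳ n x y = trans (⊠-comm x (n ⋆ y)) (trans (⋆-⊠ˡ n y x) (cong (n ⋆_) (⊠-comm y x)))

   ⋆-distrib-⊟ : ∀ n x y → n ⋆ (x ⊟ y) ≡ n ⋆ x ⊟ n ⋆ y
   ⋆-distrib-⊟ n (a ,√ b) (c ,√ d) = Q-ext (l n a c) (l n b d)
     where
     l : ∀ n a c → n · (a ⊖ c) ≡ n · a ⊖ n · c
     l = ZS.solve-∀

   ⋆-distrib-⊞ : ∀ n x y → n ⋆ (x ⊞ y) ≡ n ⋆ x ⊞ n ⋆ y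
   ⋆-distrib-⊞ n (a ,√ b) (c ,√ d) = Q-ext (ℤP.*-distribˡ-+ n a c) (ℤP.*-distribˡ-+ n b d)

   +-⋆ : ∀ m n x → (m ⊕ n) ⋆ x ≡ m ⋆ x ⊞ n ⋆ x
   +-⋆ m n (a ,√ b) = Q-ext (ℤP.*-distribʳ-+ a m n) (ℤP.*-distribʳ-+ b m n)

   ⋆-zeroʳ : ∀ n → n ⋆ 0Q ≡ 0Q
   ⋆-zeroʳ n = Q-ext (ℤP.*-zeroʳ n) (ℤP.*-zeroʳ n)

   ⋆-cancel : ∀ n x y → n ≢ 0ℤ → n ⋆ x ≡ n ⋆ y → x ≡ y
   ⋆-cancel n (a ,√ b) (c ,√ d) n≢0 e =
     Q-ext (ℤP.*-cancelˡ-≡ n a c {{ℤ.≢-nonZero n≢0}} (cong re e)) (ℤP.*-cancelˡ-≡ n b d {{ℤ.≢-nonZero n≢0}} (cong im e))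

   ⊟-self : ∀ x → x ⊟ x ≡ 0Q
   ⊟-self (a ,√ b) = Q-ext (ℤP.+-inverseʳ a) (ℤP.+-inverseʳ b)

   ⊟⊞ : ∀ x y → (x ⊟ y) ⊞ y ≡ x
   ⊟⊞ (a ,√ b) (c ,√ d) = Q-ext (l a c) (l b d)
     where
     l : ∀ a c → (a ⊖ c) ⊕ c ≡ a
     l = ZS.solve-∀

   conj-⊠ : ∀ x y → conj (x ⊠ y) ≡ conj x ⊠ conj y
   conj-⊠ (a ,√ b) (c ,√ d) = Q-ext (l k a b c d) (l' a b c d)
     where
     l : ∀ k a b c d → a · c ⊕ k · b · d ≡ a · c ⊕ k · (⊖ b) · (⊖ d)
     l = ZS.solve-∀
     l' : ∀ a b c d → ⊖ (a · d ⊕ b · c) ≡ a · (⊖ d) ⊕ (⊖ b) · c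
     l' = ZS.solve-∀

   conj-1Q : conj 1Q ≡ 1Q
   conj-1Q = refl

   conj-conj : ∀ x → conj (conj x) ≡ x
   conj-conj (a ,√ b) = Q-ext refl (ℤP.neg-involutive b)

   conj-⋆ : ∀ n x → conj (n ⋆ x) ≡ n ⋆ conj x
   conj-⋆ n (a ,√ b) = Q-ext refl (ℤP.neg-distribʳ-* n b)

   ⊠-conj : ∀ x → x ⊠ conj x ≡ norm x ⋆ 1Q
   ⊠-conj (a ,√ b) = Q-ext (l k a b) (l' k a b)
     where
     l : ∀ k a b → a · a ⊕ k · b · (⊖ b) ≡ (a · a ⊖ k · b · b) · 1ℤ
     l = ZS.solve-∀
     l' : ∀ k a b → a · (⊖ b) ⊕ b · a ≡ (a · a ⊖ k · b · b) · 0ℤ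
     l' = ZS.solve-∀

   norm-⊠ : ∀ x y → norm (x ⊠ y) ≡ norm x · norm y
   norm-⊠ (a ,√ b) (c ,√ d) = l k a b c d
     where
     l : ∀ k a b c d → (a · c ⊕ k · b · d) · (a · c ⊕ k · b · d)
         ⊖ k · (a · d ⊕ b · c) · (a · d ⊕ b · c)
         ≡ (a · a ⊖ k · b · b) · (c · c ⊖ k · d · d)
     l = ZS.solve-∀

   norm-⋆ : ∀ n x → norm (n ⋆ x) ≡ n · n · norm x
   norm-⋆ n (a ,√ b) = l k n a b
     where
     l : ∀ k n a b → n · a · (n · a) ⊖ k · (n · b) · (n · b)
         ≡ n · n · (a · a ⊖ k · b · b)
     l = ZS.solve-∀

   norm-conj : ∀ x → norm (conj x) ≡ norm x
   norm-conj (a ,√ b) = l k a b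
     where
     l : ∀ k a b → a · a ⊖ k · (⊖ b) · (⊖ b) ≡ a · a ⊖ k · b · b
     l = ZS.solve-∀

   size-⊞ : ∀ x y → size (x ⊞ y) ≤ size x + size y
   size-⊞ (a ,√ b) (c ,√ d) = begin
     (abs (a ⊕ c)) + κ * (abs (b ⊕ d))
       ≤⟨ +-mono-≤ (ℤP.∣i+j∣≤∣i∣+∣j∣ a c) (*-monoʳ-≤ κ (ℤP.∣i+j∣≤∣i∣+∣j∣ b d)) ⟩
     ((abs a) + (abs c)) + κ * ((abs b) + (abs d)) ≡⟨ l κ (abs a) (abs b) (abs c) (abs d) ⟩
     ((abs a) + κ * (abs b)) + ((abs c) + κ * (abs d)) ∎
     where
     open ≤-Reasoning
     l : ∀ κ a b c d → (a + c) + κ * (b + d) ≡ (a + κ * b) + (c + κ * d)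
     l = NS.solve-∀

   size-⊟ : ∀ x y → size (x ⊟ y) ≤ size x + size y
   size-⊟ (a ,√ b) (c ,√ d) = begin
     (abs (a ⊖ c)) + κ * (abs (b ⊖ d))
       ≤⟨ +-mono-≤ (ℤP.∣i-j∣≤∣i∣+∣j∣ a c) (*-monoʳ-≤ κ (ℤP.∣i-j∣≤∣i∣+∣j∣ b d)) ⟩
     ((abs a) + (abs c)) + κ * ((abs b) + (abs d)) ≡⟨ l κ (abs a) (abs b) (abs c) (abs d) ⟩
     ((abs a) + κ * (abs b)) + ((abs c) + κ * (abs d)) ∎
     where
     open ≤-Reasoning
     l : ∀ κ a b c d → (a + c) + κ * (b + d) ≡ (a + κ * b) + (c + κ * d)
     l = NS.solve-∀

   size-⋆ : ∀ n x → size (n ⋆ x) ≡ (abs n) * size x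
   size-⋆ n (a ,√ b) = begin
     (abs (n · a)) + κ * (abs (n · b)) ≡⟨ cong₂ (λ s t → s + κ * t) (ℤP.abs-* n a) (ℤP.abs-* n b) ⟩
     (abs n) * (abs a) + κ * ((abs n) * (abs b)) ≡⟨ l κ (abs n) (abs a) (abs b) ⟩
     (abs n) * ((abs a) + κ * (abs b)) ∎
     where
     open ≡-Reasoning
     l : ∀ κ n a b → n * a + κ * (n * b) ≡ n * (a + κ * b)
     l = NS.solve-∀

   size-⊠ : ∀ x y → size (x ⊠ y) ≤ size x * size y
   size-⊠ (a ,√ b) (c ,√ d) = begin
     (abs (a · c ⊕ k · b · d)) + κ * (abs (a · d ⊕ b · c))
       ≤⟨ +-mono-≤ (ℤP.∣i+j∣≤∣i∣+∣j∣ (a · c) (k · b · d))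
                   (*-monoʳ-≤ κ (ℤP.∣i+j∣≤∣i∣+∣j∣ (a · d) (b · c))) ⟩
     ((abs (a · c)) + (abs (k · b · d))) + κ * ((abs (a · d)) + (abs (b · c)))
       ≡⟨ cong₂ (λ s t → s + κ * t)
            (cong₂ _+_ (ℤP.abs-* a c) (trans (ℤP.abs-* (k · b) d) (cong (_* (abs d)) (ℤP.abs-* k b))))
            (cong₂ _+_ (ℤP.abs-* a d) (ℤP.abs-* b c)) ⟩
     ((abs a) * (abs c) + κ * (abs b) * (abs d)) + κ * ((abs a) * (abs d) + (abs b) * (abs c))
       ≤⟨ +-monoˡ-≤ _ (+-monoʳ-≤ ((abs a) * (abs c)) (*-monoˡ-≤ (abs d) (*-monoˡ-≤ (abs b) (m≤m*m κ)))) ⟩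
     ((abs a) * (abs c) + κ * κ * (abs b) * (abs d)) + κ * ((abs a) * (abs d) + (abs b) * (abs c))
       ≡⟨ l κ (abs a) (abs b) (abs c) (abs d) ⟩
     ((abs a) + κ * (abs b)) * ((abs c) + κ * (abs d)) ∎
     where
     open ≤-Reasoning
     l : ∀ κ a b c d → (a * c + κ * κ * b * d) + κ * (a * d + b * c) ≡ (a + κ * b) * (c + κ * d)
     l = NS.solve-∀

   size-conj : ∀ x → size (conj x) ≡ size x
   size-conj (a ,√ b) = cong (λ t → (abs a) + κ * t) (ℤP.∣-i∣≡∣i∣ b)

   size-1Q : size 1Q ≡ 1
   size-1Q = cong suc (*-zeroʳ κ)

   ∣norm∣≤ : ∀ x → (abs (norm x)) ≤ (abs (re x)) * (abs (re x)) + κ * ((abs (im x)) * (abs (im x)))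
   ∣norm∣≤ (a ,√ b) = begin
     (abs (a · a ⊖ k · b · b)) ≤⟨ ℤP.∣i-j∣≤∣i∣+∣j∣ (a · a) (k · b · b) ⟩
     (abs (a · a)) + (abs (k · b · b))
       ≡⟨ cong₂ _+_ (ℤP.abs-* a a) (trans (ℤP.abs-* (k · b) b) (trans (cong (_* (abs b)) (ℤP.abs-* k b)) (*-assoc κ (abs b) (abs b)))) ⟩
     (abs a) * (abs a) + κ * ((abs b) * (abs b)) ∎
     where open ≤-Reasoning

 ↑-⊠ : ∀ x y n → (x ⊠ y) ↑ n ≡ x ↑ n ⊠ y ↑ n
 ↑-⊠ x y zero = sym (⊠-identityˡ 1Q)
 ↑-⊠ x y (suc n) = trans (cong ((x ⊠ y) ⊠_) (↑-⊠ x y n)) (⊠-interchange x y (x ↑ n) (y ↑ n))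

 ↑-+ : ∀ x m n → x ↑ (m + n) ≡ x ↑ m ⊠ x ↑ n
 ↑-+ x zero n = sym (⊠-identityˡ (x ↑ n))
 ↑-+ x (suc m) n = trans (cong (x ⊠_) (↑-+ x m n)) (sym (⊠-assoc x (x ↑ m) (x ↑ n)))

 conj-↑ : ∀ x n → conj (x ↑ n) ≡ conj x ↑ n
 conj-↑ x zero = conj-1Q
 conj-↑ x (suc n) = trans (conj-⊠ x (x ↑ n)) (cong (conj x ⊠_) (conj-↑ x n))

 size-↑ : ∀ x n → size (x ↑ n) ≤ size x ^ n
 size-↑ x zero = ≤-reflexive size-1Q
 size-↑ x (suc n) = ≤-trans (size-⊠ x (x ↑ n)) (*-monoʳ-≤ (size x) (size-↑ x n))

 -- Finite differences

 D : ℕ → (ℕ → Q) → Q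
 D zero V = V 0
 D (suc N) V = D N V ⊟ D N (V ∘ suc)

 D-cong : ∀ N {V W} → (∀ e → e ≤ N → V e ≡ W e) → D N V ≡ D N W
 D-cong zero h = h 0 z≤n
 D-cong (suc N) h = cong₂ _⊟_ (D-cong N (λ e p → h e (m≤n⇒m≤1+n p))) (D-cong N (λ e p → h (suc e) (s≤s p)))

 D-cong′ : ∀ N {V W} → (∀ e → V e ≡ W e) → D N V ≡ D N W
 D-cong′ N h = D-cong N (λ e _ → h e)

 D-⋆ : ∀ N c V → D N (λ e → c ⋆ V e) ≡ c ⋆ D N V
 D-⋆ zero c V = refl
 D-⋆ (suc N) c V = trans (cong₂ _⊟_ (D-⋆ N c V) (D-⋆ N c (V ∘ suc))) (sym (⋆-distrib-⊟ c _ _))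

 D-⊠ : ∀ N x V → D N (λ e → x ⊠ V e) ≡ x ⊠ D N V
 D-⊠ zero x V = refl
 D-⊠ (suc N) x V = trans (cong₂ _⊟_ (D-⊠ N x V) (D-⊠ N x (V ∘ suc))) (sym (⊠-distribˡ-⊟ x _ _))

 opaque
   unfolding _⊞_
   ⊞⊟-interchange : ∀ a b c d → (a ⊞ b) ⊟ (c ⊞ d) ≡ (a ⊟ c) ⊞ (b ⊟ d)
   ⊞⊟-interchange (a ,√ a') (b ,√ b') (c ,√ c') (d ,√ d') = Q-ext (l a b c d) (l a' b' c' d')
     where
     l : ∀ a b c d → (a ⊕ b) ⊖ (c ⊕ d) ≡ (a ⊖ c) ⊕ (b ⊖ d)
     l = ZS.solve-∀

 D-⊞ : ∀ N V W → D N (λ e → V e ⊞ W e) ≡ D N V ⊞ D N W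
 D-⊞ zero V W = refl
 D-⊞ (suc N) V W = trans (cong₂ _⊟_ (D-⊞ N V W) (D-⊞ N (V ∘ suc) (W ∘ suc))) (⊞⊟-interchange _ _ _ _)

 opaque
   unfolding _⊞_
   ⊟⊟-interchange : ∀ a b c d → (a ⊟ b) ⊟ (c ⊟ d) ≡ (a ⊟ c) ⊟ (b ⊟ d)
   ⊟⊟-interchange (a ,√ a') (b ,√ b') (c ,√ c') (d ,√ d') = Q-ext (l a b c d) (l a' b' c' d')
     where
     l : ∀ a b c d → (a ⊖ b) ⊖ (c ⊖ d) ≡ (a ⊖ c) ⊖ (b ⊖ d)
     l = ZS.solve-∀

 D-⊟ : ∀ N V W → D N (λ e → V e ⊟ W e) ≡ D N V ⊟ D N W
 D-⊟ zero V W = refl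
 D-⊟ (suc N) V W = trans (cong₂ _⊟_ (D-⊟ N V W) (D-⊟ N (V ∘ suc) (W ∘ suc))) (⊟⊟-interchange _ _ _ _)

 D-size : ∀ N V M → (∀ e → e ≤ N → size (V e) ≤ M) → size (D N V) ≤ 2 ^ N * M
 D-size zero V M h = ≤-trans (h 0 z≤n) (≤-reflexive (sym (*-identityˡ M)))
 D-size (suc N) V M h = begin
   size (D N V ⊟ D N (V ∘ suc)) ≤⟨ size-⊟ (D N V) (D N (V ∘ suc)) ⟩
   size (D N V) + size (D N (V ∘ suc))
     ≤⟨ +-mono-≤ (D-size N V M (λ e p → h e (m≤n⇒m≤1+n p))) (D-size N (V ∘ suc) M (λ e p → h (suc e) (s≤s p))) ⟩
   2 ^ N * M + 2 ^ N * M ≡⟨ l (2 ^ N) M ⟩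
   2 ^ suc N * M ∎
   where
   open ≤-Reasoning
   l : ∀ a m → a * m + a * m ≡ 2 * a * m
   l = NS.solve-∀

 opaque
   unfolding _⊞_

   D-mult-base : ∀ x y → (0ℤ ⋆ x) ⊟ (1ℤ ⋆ y) ≡ (⊖ 1ℤ) ⋆ y
   D-mult-base (a ,√ b) (c ,√ d) = Q-ext (z a c) (z b d)
     where
     z : ∀ a b → 0ℤ · a ⊖ 1ℤ · b ≡ ⊖ 1ℤ · b
     z = ZS.solve-∀

   D-mult-step : ∀ n x y → (⊖ n) ⋆ x ⊟ ((x ⊟ y) ⊞ (⊖ n) ⋆ y) ≡ (⊖ (1ℤ ⊕ n)) ⋆ (x ⊟ y)
   D-mult-step n (a ,√ b) (c ,√ d) = Q-ext (z n a c) (z n b d)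
     where
     z : ∀ n a b → (⊖ n) · a ⊖ ((a ⊖ b) ⊕ (⊖ n) · b) ≡ (⊖ (1ℤ ⊕ n)) · (a ⊖ b)
     z = ZS.solve-∀

   D-mult′-step : ∀ n x y → n ⋆ (x ⊟ y) ⊟ (⊖ n) ⋆ y ≡ n ⋆ x
   D-mult′-step n (a ,√ b) (c ,√ d) = Q-ext (z n a c) (z n b d)
     where
     z : ∀ n a b → n · (a ⊖ b) ⊖ (⊖ n) · b ≡ n · a
     z = ZS.solve-∀

 -- `D N V` is the sum of (-1)^e C(N,e) V(e). This is the absorption rule e C(N+1,e) = (N+1)
 -- C(N,e-1).
 D-mult : ∀ N V → D (suc N) (λ e → (+ e) ⋆ V e) ≡ (⊖ (+ suc N)) ⋆ D N (V ∘ suc)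
 D-mult zero V = D-mult-base (V 0) (V 1)
 D-mult (suc N) V = begin
   D (suc N) (λ e → (+ e) ⋆ V e) ⊟ D (suc N) (λ e → (+ suc e) ⋆ V (suc e))
     ≡⟨ cong₂ _⊟_ (D-mult N V)
         (trans (D-cong′ (suc N) (λ e → trans (+-⋆ 1ℤ (+ e) (V (suc e))) (cong (_⊞ (+ e) ⋆ V (suc e)) (⋆-identity _))))
         (trans (D-⊞ (suc N) (V ∘ suc) (λ e → (+ e) ⋆ V (suc e)))
                (cong (D (suc N) (V ∘ suc) ⊞_) (D-mult N (V ∘ suc))))) ⟩
   (⊖ (+ suc N)) ⋆ A ⊟ ((A ⊟ B) ⊞ (⊖ (+ suc N)) ⋆ B) ≡⟨ D-mult-step (+ suc N) A B ⟩
   (⊖ (1ℤ ⊕ (+ suc N))) ⋆ (A ⊟ B) ∎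
   where
   open ≡-Reasoning
   A = D N (V ∘ suc)
   B = D N (V ∘ suc ∘ suc)

 opaque
   unfolding _⊞_
   -⋆ : ∀ m n x → (m ⊖ n) ⋆ x ≡ m ⋆ x ⊟ n ⋆ x
   -⋆ m n (a ,√ b) = Q-ext (l m n a) (l m n b)
     where
     l : ∀ m n a → (m ⊖ n) · a ≡ m · a ⊖ n · a
     l = ZS.solve-∀

 -- The mirror rule (N+1-e) C(N+1,e) = (N+1) C(N,e), which lowers the order without shifting the
 -- index.
 D-mult′ : ∀ N V → D (suc N) (λ e → ((+ suc N) ⊖ (+ e)) ⋆ V e) ≡ (+ suc N) ⋆ D N V
 D-mult′ N V = begin
   D (suc N) (λ e → ((+ suc N) ⊖ (+ e)) ⋆ V e) ≡⟨ D-cong′ (suc N) (λ e → -⋆ (+ suc N) (+ e) (V e)) ⟩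
   D (suc N) (λ e → (+ suc N) ⋆ V e ⊟ (+ e) ⋆ V e) ≡⟨ D-⊟ (suc N) _ _ ⟩
   D (suc N) (λ e → (+ suc N) ⋆ V e) ⊟ D (suc N) (λ e → (+ e) ⋆ V e)
     ≡⟨ cong₂ _⊟_ (D-⋆ (suc N) (+ suc N) V) (D-mult N V) ⟩
   (+ suc N) ⋆ (A ⊟ B) ⊟ (⊖ (+ suc N)) ⋆ B ≡⟨ D-mult′-step (+ suc N) A B ⟩
   (+ suc N) ⋆ A ∎
   where
   open ≡-Reasoning
   A = D N V
   B = D N (V ∘ suc)

 -- The binomial theorem for (ξ - η)^N. This is the source of smallness: differences of the powers
 -- ξ^(N-e) η^e produce powers of ξ - η.
 D-binomial : ∀ ξ η N j → D N (λ e → ξ ↑ ((j + N) ∸ e) ⊠ η ↑ e) ≡ ξ ↑ j ⊠ (ξ ⊟ η) ↑ N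
 D-binomial ξ η zero j = cong (λ t → ξ ↑ t ⊠ 1Q) (+-identityʳ j)
 D-binomial ξ η (suc N) j = begin
   D N (λ e → ξ ↑ ((j + suc N) ∸ e) ⊠ η ↑ e) ⊟ D N (λ e → ξ ↑ ((j + suc N) ∸ suc e) ⊠ (η ⊠ η ↑ e))
     ≡⟨ cong₂ _⊟_
         (trans (D-cong′ N (λ e → cong (λ t → ξ ↑ (t ∸ e) ⊠ η ↑ e) (+-suc j N))) (D-binomial ξ η N (suc j)))
         (trans (D-cong′ N (λ e → trans (cong (λ t → ξ ↑ (t ∸ suc e) ⊠ (η ⊠ η ↑ e)) (+-suc j N)) (swap (ξ ↑ ((j + N) ∸ e)) (η ↑ e))))
         (trans (D-⊠ N η _) (cong (η ⊠_) (D-binomial ξ η N j)))) ⟩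
   (ξ ⊠ ξ ↑ j) ⊠ (ξ ⊟ η) ↑ N ⊟ η ⊠ (ξ ↑ j ⊠ (ξ ⊟ η) ↑ N)
     ≡⟨ cong₂ _⊟_ (trans (cong (_⊠ (ξ ⊟ η) ↑ N) (⊠-comm ξ (ξ ↑ j))) (trans (⊠-assoc (ξ ↑ j) ξ _) (cong (ξ ↑ j ⊠_) (⊠-comm ξ _))))
                  (trans (sym (⊠-assoc η (ξ ↑ j) _)) (trans (cong (_⊠ (ξ ⊟ η) ↑ N) (⊠-comm η (ξ ↑ j))) (trans (⊠-assoc (ξ ↑ j) η _) (cong (ξ ↑ j ⊠_) (⊠-comm η _))))) ⟩
   ξ ↑ j ⊠ ((ξ ⊟ η) ↑ N ⊠ ξ) ⊟ ξ ↑ j ⊠ ((ξ ⊟ η) ↑ N ⊠ η) ≡⟨ sym (⊠-distribˡ-⊟ (ξ ↑ j) _ _) ⟩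
   ξ ↑ j ⊠ ((ξ ⊟ η) ↑ N ⊠ ξ ⊟ (ξ ⊟ η) ↑ N ⊠ η) ≡⟨ cong (ξ ↑ j ⊠_) (sym (⊠-distribˡ-⊟ ((ξ ⊟ η) ↑ N) ξ η)) ⟩
   ξ ↑ j ⊠ ((ξ ⊟ η) ↑ N ⊠ (ξ ⊟ η)) ≡⟨ cong (ξ ↑ j ⊠_) (⊠-comm _ (ξ ⊟ η)) ⟩
   ξ ↑ j ⊠ ((ξ ⊟ η) ⊠ (ξ ⊟ η) ↑ N) ∎
   where
   open ≡-Reasoning
   swap : ∀ a b → a ⊠ (η ⊠ b) ≡ η ⊠ (a ⊠ b)
   swap a b = trans (sym (⊠-assoc a η b)) (trans (cong (_⊠ b) (⊠-comm a η)) (⊠-assoc η a b))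

 linProd : List ℤ → ℤ → ℤ
 linProd [] e = 1ℤ
 linProd (c ∷ cs) e = (e ⊕ c) · linProd cs e

 -- A polynomial factor of degree j costs at most j of the N factors ξ ⊟ η.
 D-linProd-size : ∀ (ξ η : Q) (d h K : ℕ) → size (ξ ⊟ η) ≤ d → size η ≤ h → d ≤ h →
   ∀ cs t o → All (λ c → abs c + o + (length cs + t) ≤ K) cs →
   size (D (length cs + t) (λ e → linProd cs (+ (o + e)) ⋆ (ξ ↑ ((length cs + t) ∸ e) ⊠ η ↑ e)))
     ≤ K ^ length cs * d ^ t * h ^ length cs
 D-linProd-size ξ η d h K p q r [] t o [] = begin
   size (D t (λ e → 1ℤ ⋆ (ξ ↑ (t ∸ e) ⊠ η ↑ e)))
     ≡⟨ cong size (trans (D-cong′ t (λ e → ⋆-identity _)) (trans (D-binomial ξ η t 0) (⊠-identityˡ _))) ⟩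
   size ((ξ ⊟ η) ↑ t) ≤⟨ size-↑ (ξ ⊟ η) t ⟩
   size (ξ ⊟ η) ^ t ≤⟨ ^-monoˡ-≤ t p ⟩
   d ^ t ≡⟨ l (d ^ t) ⟩
   1 * d ^ t * 1 ∎
   where
   open ≤-Reasoning
   l : ∀ a → a ≡ 1 * a * 1
   l = NS.solve-∀
 D-linProd-size ξ η d h K p q r (c ∷ cs) t o (hc ∷ hcs) = begin
   size (D N (λ e → ((+ (o + e) ⊕ c) · linProd cs (+ (o + e))) ⋆ M e))
     ≡⟨ cong size (trans (D-cong′ N expand) (trans (D-⊞ N _ _) (cong₂ _⊞_ (D-⋆ N c′ U) (D-mult N' U)))) ⟩
   size (c′ ⋆ D N U ⊞ (⊖ (+ N)) ⋆ D N' (U ∘ suc))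
     ≤⟨ size-⊞ (c′ ⋆ D N U) _ ⟩
   size (c′ ⋆ D N U) + size ((⊖ (+ N)) ⋆ D N' (U ∘ suc))
     ≡⟨ cong₂ _+_ (size-⋆ c′ _) (trans (size-⋆ (⊖ (+ N)) _) (cong₂ _*_ (ℤP.∣-i∣≡∣i∣ (+ N)) (cong size second))) ⟩
   abs c′ * size (D N U) + N * size (η ⊠ D N' U')
     ≤⟨ +-mono-≤ (*-mono-≤ (ℤP.∣i+j∣≤∣i∣+∣j∣ c (+ o)) ih1) (*-monoʳ-≤ N (≤-trans (size-⊠ η _) (*-mono-≤ q ih2))) ⟩
   (abs c + o) * (K ^ j * d ^ suc t * h ^ j) + N * (h * (K ^ j * d ^ t * h ^ j))
     ≤⟨ +-monoˡ-≤ _ (*-monoʳ-≤ (abs c + o) (*-monoˡ-≤ (h ^ j) (*-monoʳ-≤ (K ^ j) (*-monoˡ-≤ (d ^ t) r)))) ⟩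
   (abs c + o) * (K ^ j * (h * d ^ t) * h ^ j) + N * (h * (K ^ j * d ^ t * h ^ j))
     ≡⟨ l (abs c + o) N (K ^ j) h (d ^ t) (h ^ j) ⟩
   (abs c + o + N) * (K ^ j * d ^ t * (h * h ^ j))
     ≤⟨ *-monoˡ-≤ _ hc ⟩
   K * (K ^ j * d ^ t * (h * h ^ j)) ≡⟨ l' K (K ^ j) (d ^ t) (h * h ^ j) ⟩
   K * K ^ j * d ^ t * (h * h ^ j) ∎
   where
   open ≤-Reasoning
   j = length cs
   N' = j + t
   N = suc N'
   c′ = c ⊕ + o
   M : ℕ → Q
   M e = ξ ↑ (N ∸ e) ⊠ η ↑ e
   U : ℕ → Q
   U e = linProd cs (+ (o + e)) ⋆ M e
   U' : ℕ → Q
   U' e = linProd cs (+ (suc o + e)) ⋆ (ξ ↑ (N' ∸ e) ⊠ η ↑ e)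
   l : ∀ a n k h d g → a * (k * (h * d) * g) + n * (h * (k * d * g)) ≡ (a + n) * (k * d * (h * g))
   l = NS.solve-∀
   l' : ∀ a k d g → a * (k * d * g) ≡ a * k * d * g
   l' = NS.solve-∀
   expand : ∀ e → ((+ (o + e) ⊕ c) · linProd cs (+ (o + e))) ⋆ M e ≡ (c′ ⋆ U e) ⊞ ((+ e) ⋆ U e)
   expand e = trans (⋆-assoc _ _ _) (trans (cong (_⋆ U e) (z (+ o) (+ e) c)) (+-⋆ c′ (+ e) (U e)))
     where
     z : ∀ o e c → (o ⊕ e) ⊕ c ≡ (c ⊕ o) ⊕ e
     z = ZS.solve-∀
   swap : ∀ a b → a ⊠ (η ⊠ b) ≡ η ⊠ (a ⊠ b)
   swap a b = trans (sym (⊠-assoc a η b)) (trans (cong (_⊠ b) (⊠-comm a η)) (⊠-assoc η a b))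
   second : D N' (U ∘ suc) ≡ η ⊠ D N' U'
   second = trans (D-cong′ N' (λ e → trans (cong₂ _⋆_ (cong (λ n → linProd cs (+ n)) (+-suc o e)) (swap (ξ ↑ (N' ∸ e)) (η ↑ e))) (sym (⋆-⊠ʳ _ η _)))) (D-⊠ N' η U')
   ih1 : size (D N U) ≤ K ^ j * d ^ suc t * h ^ j
   ih1 = subst (λ n → size (D n (λ e → linProd cs (+ (o + e)) ⋆ (ξ ↑ (n ∸ e) ⊠ η ↑ e))) ≤ K ^ j * d ^ suc t * h ^ j) (+-suc j t)
           (D-linProd-size ξ η d h K p q r cs (suc t) o (All.map (λ {c} g → ≤-trans (≤-reflexive (cong (λ n → abs c + o + n) (+-suc j t))) g) hcs))
   ih2 : size (D N' U') ≤ K ^ j * d ^ t * h ^ j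
   ih2 = D-linProd-size ξ η d h K p q r cs t (suc o) (All.map (λ {c} g → ≤-trans (≤-reflexive (z (abs c) o N')) g) hcs)
     where
     z : ∀ a o n → a + suc o + n ≡ a + o + suc n
     z = NS.solve-∀

 -- Padé forms for the cube root and their non-vanishing

 thrice : ℕ → ℕ
 thrice zero = 0
 thrice (suc r) = suc (suc (suc (thrice r)))

 +thrice : ∀ r → + thrice r ≡ (+ 3) · (+ r)
 +thrice zero = refl
 +thrice (suc r) = trans (cong (λ t → (+ 3) ⊕ t) (+thrice r)) (l (+ r))
   where
   l : ∀ r → (+ 3) ⊕ (+ 3) · r ≡ (+ 3) · (1ℤ ⊕ r)
   l = ZS.solve-∀

 -- The roots 3i ∸ c, 1 ≤ i ≤ r, up to sign.
 steps : ℕ → ℤ → List ℤ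
 steps zero c = []
 steps (suc r) c = (c ⊖ (+ 3) · (+ suc r)) ∷ steps r c

 -- The product of e + c - 3i over 1 ≤ i ≤ r. For c = 1 it vanishes at e = 2, 5, ..., 3r - 1.
 -- Differences of gapProd(e) ξ^(3r+1-e) η^e thus involve only e ≡ 0, 1 modulo 3: they are ξ and η
 -- with coefficients that are polynomials in ξ³ and η³, a Padé approximation to a cube root.
 gapProd : ℕ → ℤ → ℤ → ℤ
 gapProd r c e = linProd (steps r c) e

 gapProd-suc : ∀ r c e → gapProd r c (1ℤ ⊕ e) ≡ gapProd r (1ℤ ⊕ c) e
 gapProd-suc zero c e = refl
 gapProd-suc (suc r) c e = cong₂ _·_ (l c e (+ suc r)) (gapProd-suc r c e)
   where
   l : ∀ c e r → (1ℤ ⊕ e) ⊕ (c ⊖ (+ 3) · r) ≡ e ⊕ ((1ℤ ⊕ c) ⊖ (+ 3) · r)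
   l = ZS.solve-∀

 gapProd-peel : ∀ r c e → gapProd (suc r) c e ≡ (e ⊕ (c ⊖ (+ 3))) · gapProd r (c ⊖ (+ 3)) e
 gapProd-peel zero c e = refl
 gapProd-peel (suc r) c e = trans (cong (λ t → (e ⊕ (c ⊖ (+ 3) · (+ suc (suc r)))) · t) (gapProd-peel r c e))
   (l c e (+ r) (gapProd r (c ⊖ (+ 3)) e))
   where
   l : ∀ c e r p → (e ⊕ (c ⊖ (+ 3) · (1ℤ ⊕ (1ℤ ⊕ r)))) · ((e ⊕ (c ⊖ (+ 3))) · p)
     ≡ (e ⊕ (c ⊖ (+ 3))) · ((e ⊕ (c ⊖ (+ 3) ⊖ (+ 3) · (1ℤ ⊕ r))) · p)
   l = ZS.solve-∀

 -- The monomials ξ^(3r+1∸e) η^e with ξ³, η³ replaced by X, Y and ξ, η by a₀, a₁; the index 2 mod 3 is never used.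
 monomial : (a₀ a₁ X Y : Q) → ℕ → ℕ → Q
 monomial a₀ a₁ X Y r 0 = a₀ ⊠ X ↑ r
 monomial a₀ a₁ X Y r 1 = a₁ ⊠ X ↑ r
 monomial a₀ a₁ X Y r 2 = 0Q
 monomial a₀ a₁ X Y zero (suc (suc (suc e))) = 0Q
 monomial a₀ a₁ X Y (suc r) (suc (suc (suc e))) = Y ⊠ monomial a₀ a₁ X Y r e

 opaque
   unfolding _⊞_

   ⊠-zeroʳ : ∀ x → x ⊠ 0Q ≡ 0Q
   ⊠-zeroʳ (a ,√ b) = Q-ext (l k a b) (l' a b)
     where
     l : ∀ k a b → a · 0ℤ ⊕ k · b · 0ℤ ≡ 0ℤ
     l = ZS.solve-∀
     l' : ∀ a b → a · 0ℤ ⊕ b · 0ℤ ≡ 0ℤ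
     l' = ZS.solve-∀

   ⊞-zeroʳ : ∀ x → x ⊞ 0Q ≡ x
   ⊞-zeroʳ (a ,√ b) = Q-ext (ℤP.+-identityʳ a) (ℤP.+-identityʳ b)

   ⊟-zeroʳ : ∀ x → x ⊟ 0Q ≡ x
   ⊟-zeroʳ (a ,√ b) = Q-ext (ℤP.+-identityʳ a) (ℤP.+-identityʳ b)

 ⊠-left-comm : ∀ x y z → x ⊠ (y ⊠ z) ≡ y ⊠ (x ⊠ z)
 ⊠-left-comm x y z = trans (sym (⊠-assoc x y z)) (trans (cong (_⊠ z) (⊠-comm x y)) (⊠-assoc y x z))

 ⋆-congˡ : ∀ {m n} x → m ≡ n → m ⋆ x ≡ n ⋆ x
 ⋆-congˡ x e = cong (_⋆ x) e

 ⋆-assoc₃ : ∀ a b c x → (a · (b · c)) ⋆ x ≡ a ⋆ (b ⋆ (c ⋆ x))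
 ⋆-assoc₃ a b c x = trans (⋆-assoc a (b · c) x) (cong (a ⋆_) (⋆-assoc b c x))

 ⋆-assoc₄ : ∀ a b c d x → (a · (b · (c · d))) ⋆ x ≡ a ⋆ (b ⋆ (c ⋆ (d ⋆ x)))
 ⋆-assoc₄ a b c d x = trans (⋆-assoc a (b · (c · d)) x) (cong (a ⋆_) (⋆-assoc₃ b c d x))

 module Monomials (a₀ a₁ X Y : Q) where

   private
     V = monomial a₀ a₁ X Y

   monomial-X : ∀ r e → e ≤ suc (thrice r) → V (suc r) e ≡ X ⊠ V r e
   monomial-X r 0 _ = ⊠-left-comm a₀ X _
   monomial-X r 1 _ = ⊠-left-comm a₁ X _
   monomial-X r 2 _ = sym (⊠-zeroʳ X)
   monomial-X zero (suc (suc (suc e))) (s≤s ())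
   monomial-X (suc r) (suc (suc (suc e))) (s≤s (s≤s (s≤s p))) = trans (cong (Y ⊠_) (monomial-X r e p)) (⊠-left-comm Y X _)

   Wᶠ : ℕ → ℕ → Q
   Wᶠ r e = gapProd r 1ℤ (+ e) ⋆ V r e

   drop : ℕ → ℤ
   drop r = ⊖ ((+ (4 + thrice r)) · (+ (3 + thrice r)) · (+ (2 + thrice r)))

   -- `gapProd (suc r)` contains the factor e - 2, so e (e - 1) completes three consecutive factors.
   -- Three absorptions lower the order by three and shift the index by three, which strips one
   -- factor `Y` off the monomial.
   D-drop-bottom : ∀ r (p : ℕ → ℤ) →
     D (4 + thrice r) (λ e → (((+ e) · ((+ e) ⊖ 1ℤ)) · p e) ⋆ Wᶠ (suc r) e)
       ≡ drop r ⋆ (Y ⊠ D (suc (thrice r)) (λ e → p (3 + e) ⋆ Wᶠ r e))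
   D-drop-bottom r p = begin
     D (4 + t) (λ e → (((+ e) · ((+ e) ⊖ 1ℤ)) · p e) ⋆ Wᶠ (suc r) e)
       ≡⟨ D-cong′ (4 + t) (λ e → trans (cong (_⋆ Wᶠ (suc r) e) (ℤP.*-assoc (+ e) ((+ e) ⊖ 1ℤ) (p e))) (⋆-assoc (+ e) (((+ e) ⊖ 1ℤ) · p e) _)) ⟩
     D (4 + t) (λ e → (+ e) ⋆ ((((+ e) ⊖ 1ℤ) · p e) ⋆ Wᶠ (suc r) e)) ≡⟨ D-mult (3 + t) _ ⟩
     (⊖ (+ (4 + t))) ⋆ D (3 + t) (λ e → (((+ suc e) ⊖ 1ℤ) · p (1 + e)) ⋆ Wᶠ (suc r) (1 + e))
       ≡⟨ cong ((⊖ (+ (4 + t))) ⋆_) (trans (D-cong′ (3 + t) (λ e → trans (cong (λ s → (s · p (1 + e)) ⋆ Wᶠ (suc r) (1 + e)) (l1 (+ e))) (⋆-assoc (+ e) (p (1 + e)) _))) (D-mult (2 + t) _)) ⟩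
     (⊖ (+ (4 + t))) ⋆ ((⊖ (+ (3 + t))) ⋆ D (2 + t) (λ e → p (2 + e) ⋆ Wᶠ (suc r) (2 + e)))
       ≡⟨ cong (λ s → (⊖ (+ (4 + t))) ⋆ ((⊖ (+ (3 + t))) ⋆ s)) (trans (D-cong′ (2 + t) peel) (D-mult (1 + t) _)) ⟩
     (⊖ (+ (4 + t))) ⋆ ((⊖ (+ (3 + t))) ⋆ ((⊖ (+ (2 + t))) ⋆ D (1 + t) (λ e → (p (3 + e) · gapProd r 0ℤ (+ suc e)) ⋆ V (suc r) (3 + e))))
       ≡⟨ cong (λ s → (⊖ (+ (4 + t))) ⋆ ((⊖ (+ (3 + t))) ⋆ ((⊖ (+ (2 + t))) ⋆ s))) (trans (D-cong′ (1 + t) top) (D-⊠ (1 + t) Y _)) ⟩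
     (⊖ (+ (4 + t))) ⋆ ((⊖ (+ (3 + t))) ⋆ ((⊖ (+ (2 + t))) ⋆ (Y ⊠ D (1 + t) (λ e → p (3 + e) ⋆ Wᶠ r e))))
       ≡⟨ trans (sym (⋆-assoc₃ (⊖ (+ (4 + t))) (⊖ (+ (3 + t))) (⊖ (+ (2 + t))) E)) (⋆-congˡ E (l2 (+ (4 + t)) (+ (3 + t)) (+ (2 + t)))) ⟩
     drop r ⋆ (Y ⊠ D (1 + t) (λ e → p (3 + e) ⋆ Wᶠ r e)) ∎
     where
     open ≡-Reasoning
     t = thrice r
     E = Y ⊠ D (1 + t) (λ e → p (3 + e) ⋆ Wᶠ r e)
     l1 : ∀ e → (1ℤ ⊕ e) ⊖ 1ℤ ≡ e
     l1 = ZS.solve-∀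
     l2 : ∀ a b c → (⊖ a) · ((⊖ b) · (⊖ c)) ≡ ⊖ (a · b · c)
     l2 = ZS.solve-∀
     l3 : ∀ p e g → p · ((e ⊕ 0ℤ) · g) ≡ e · (p · g)
     l3 = ZS.solve-∀
     peel : ∀ e → p (2 + e) ⋆ Wᶠ (suc r) (2 + e) ≡ (+ e) ⋆ ((p (2 + e) · gapProd r 0ℤ (+ e)) ⋆ V (suc r) (2 + e))
     peel e = begin
       p (2 + e) ⋆ (gapProd (suc r) 1ℤ (+ (2 + e)) ⋆ V (suc r) (2 + e)) ≡⟨ sym (⋆-assoc (p (2 + e)) (gapProd (suc r) 1ℤ (+ (2 + e))) _) ⟩
       (p (2 + e) · gapProd (suc r) 1ℤ (+ (2 + e))) ⋆ V (suc r) (2 + e)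
         ≡⟨ cong (λ s → (p (2 + e) · s) ⋆ V (suc r) (2 + e)) (trans (gapProd-suc (suc r) 1ℤ (+ (1 + e))) (trans (gapProd-suc (suc r) (+ 2) (+ e)) (gapProd-peel r (+ 3) (+ e)))) ⟩
       (p (2 + e) · (((+ e) ⊕ 0ℤ) · gapProd r 0ℤ (+ e))) ⋆ V (suc r) (2 + e)
         ≡⟨ trans (cong (_⋆ V (suc r) (2 + e)) (l3 (p (2 + e)) (+ e) (gapProd r 0ℤ (+ e)))) (⋆-assoc (+ e) (p (2 + e) · gapProd r 0ℤ (+ e)) _) ⟩
       (+ e) ⋆ ((p (2 + e) · gapProd r 0ℤ (+ e)) ⋆ V (suc r) (2 + e)) ∎
     top : ∀ e → (p (3 + e) · gapProd r 0ℤ (+ suc e)) ⋆ V (suc r) (3 + e) ≡ Y ⊠ (p (3 + e) ⋆ Wᶠ r e)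
     top e = trans (cong (λ s → (p (3 + e) · s) ⋆ (Y ⊠ V r e)) (gapProd-suc r 0ℤ (+ e)))
       (trans (⋆-assoc (p (3 + e)) (gapProd r 1ℤ (+ e)) _) (trans (cong (p (3 + e) ⋆_) (sym (⋆-⊠ʳ (gapProd r 1ℤ (+ e)) Y _))) (sym (⋆-⊠ʳ (p (3 + e)) Y _))))

   -- The mirror image. With N = 3r + 4 the factor e - (3r + 2) of the product joins (N - e)(N - 1 -
   -- e); the three absorptions leave the index alone and strip one factor `X`.
   D-drop-top : ∀ r (p : ℕ → ℤ) →
     D (4 + thrice r) (λ e → ((((+ (4 + thrice r)) ⊖ (+ e)) · ((+ (3 + thrice r)) ⊖ (+ e))) · p e) ⋆ Wᶠ (suc r) e)
       ≡ drop r ⋆ (X ⊠ D (suc (thrice r)) (λ e → p e ⋆ Wᶠ r e))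
   D-drop-top r p = begin
     D (4 + t) (λ e → ((((+ (4 + t)) ⊖ (+ e)) · ((+ (3 + t)) ⊖ (+ e))) · p e) ⋆ Wᶠ (suc r) e)
       ≡⟨ D-cong′ (4 + t) (λ e → trans (⋆-congˡ (Wᶠ (suc r) e) (ℤP.*-assoc ((+ (4 + t)) ⊖ (+ e)) ((+ (3 + t)) ⊖ (+ e)) (p e))) (⋆-assoc₃ ((+ (4 + t)) ⊖ (+ e)) ((+ (3 + t)) ⊖ (+ e)) (p e) _)) ⟩
     D (4 + t) (λ e → ((+ (4 + t)) ⊖ (+ e)) ⋆ (((+ (3 + t)) ⊖ (+ e)) ⋆ (p e ⋆ Wᶠ (suc r) e)))
       ≡⟨ D-mult′ (3 + t) _ ⟩
     (+ (4 + t)) ⋆ D (3 + t) (λ e → ((+ (3 + t)) ⊖ (+ e)) ⋆ (p e ⋆ Wᶠ (suc r) e))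
       ≡⟨ cong ((+ (4 + t)) ⋆_) (D-mult′ (2 + t) _) ⟩
     (+ (4 + t)) ⋆ ((+ (3 + t)) ⋆ D (2 + t) (λ e → p e ⋆ Wᶠ (suc r) e))
       ≡⟨ cong (λ s → (+ (4 + t)) ⋆ ((+ (3 + t)) ⋆ s)) (trans (D-cong′ (2 + t) peel) (D-mult′ (1 + t) _)) ⟩
     (+ (4 + t)) ⋆ ((+ (3 + t)) ⋆ ((+ (2 + t)) ⋆ D (1 + t) (λ e → (⊖ 1ℤ) ⋆ (p e ⋆ (gapProd r 1ℤ (+ e) ⋆ V (suc r) e)))))
       ≡⟨ cong (λ s → (+ (4 + t)) ⋆ ((+ (3 + t)) ⋆ ((+ (2 + t)) ⋆ s))) (trans (D-⋆ (1 + t) (⊖ 1ℤ) _)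
            (cong ((⊖ 1ℤ) ⋆_) (trans (D-cong (1 + t) bot) (D-⊠ (1 + t) X _)))) ⟩
     (+ (4 + t)) ⋆ ((+ (3 + t)) ⋆ ((+ (2 + t)) ⋆ ((⊖ 1ℤ) ⋆ (X ⊠ D (1 + t) (λ e → p e ⋆ Wᶠ r e)))))
       ≡⟨ trans (sym (⋆-assoc₄ (+ (4 + t)) (+ (3 + t)) (+ (2 + t)) (⊖ 1ℤ) E)) (⋆-congˡ E (l2 (+ (4 + t)) (+ (3 + t)) (+ (2 + t)))) ⟩
     drop r ⋆ (X ⊠ D (1 + t) (λ e → p e ⋆ Wᶠ r e)) ∎
     where
     open ≡-Reasoning
     t = thrice r
     E = X ⊠ D (1 + t) (λ e → p e ⋆ Wᶠ r e)
     l2 : ∀ a b c → a · (b · (c · ⊖ 1ℤ)) ≡ ⊖ (a · b · c)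
     l2 = ZS.solve-∀
     l3 : ∀ p r e g → p · ((e ⊕ (1ℤ ⊖ (+ 3) · (1ℤ ⊕ r))) · g) ≡ (((+ 2) ⊕ (+ 3) · r) ⊖ e) · (⊖ 1ℤ · (p · g))
     l3 = ZS.solve-∀
     peel : ∀ e → p e ⋆ Wᶠ (suc r) e ≡ ((+ (2 + t)) ⊖ (+ e)) ⋆ ((⊖ 1ℤ) ⋆ (p e ⋆ (gapProd r 1ℤ (+ e) ⋆ V (suc r) e)))
     peel e = begin
       p e ⋆ (gapProd (suc r) 1ℤ (+ e) ⋆ V (suc r) e) ≡⟨ sym (⋆-assoc (p e) (gapProd (suc r) 1ℤ (+ e)) _) ⟩
       (p e · gapProd (suc r) 1ℤ (+ e)) ⋆ V (suc r) e
         ≡⟨ cong (_⋆ V (suc r) e) (trans (l3 (p e) (+ r) (+ e) (gapProd r 1ℤ (+ e)))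
              (cong (λ s → (((+ 2) ⊕ s) ⊖ (+ e)) · (⊖ 1ℤ · (p e · gapProd r 1ℤ (+ e)))) (sym (+thrice r)))) ⟩
       (((+ (2 + t)) ⊖ (+ e)) · (⊖ 1ℤ · (p e · gapProd r 1ℤ (+ e)))) ⋆ V (suc r) e
         ≡⟨ ⋆-assoc₄ ((+ (2 + t)) ⊖ (+ e)) (⊖ 1ℤ) (p e) (gapProd r 1ℤ (+ e)) (V (suc r) e) ⟩
       ((+ (2 + t)) ⊖ (+ e)) ⋆ ((⊖ 1ℤ) ⋆ (p e ⋆ (gapProd r 1ℤ (+ e) ⋆ V (suc r) e))) ∎
     bot : ∀ e → e ≤ 1 + t → p e ⋆ (gapProd r 1ℤ (+ e) ⋆ V (suc r) e) ≡ X ⊠ (p e ⋆ Wᶠ r e)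
     bot e le = trans (cong (λ s → p e ⋆ (gapProd r 1ℤ (+ e) ⋆ s)) (monomial-X r e le))
       (trans (cong (p e ⋆_) (sym (⋆-⊠ʳ (gapProd r 1ℤ (+ e)) X _))) (sym (⋆-⊠ʳ (p e) X _)))

   drop≢0 : ∀ r → drop r ≢ 0ℤ
   drop≢0 r ()

   -- Two independent forms: if both vanish, the same holds for r ∸ 1, down to r = 0.
   forms-nonvanishing : (∀ a → X ⊠ a ≡ Y ⊠ a → a ≡ 0Q) → ∀ r →
     D (thrice r) (Wᶠ r) ≡ 0Q → D (thrice r) (Wᶠ r ∘ suc) ≡ 0Q → a₀ ≡ 0Q
   forms-nonvanishing cancel zero h0 h1 = trans (sym (trans (⋆-identity _) (⊠-identityʳ a₀))) h0
   forms-nonvanishing cancel (suc r) h0 h1 = forms-nonvanishing cancel r g0 g1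
     where
     open ≡-Reasoning
     t = thrice r
     N = + (4 + t)
     c₁ = (+ 2) · (N ⊖ 1ℤ)
     c₂ = N · (N ⊖ 1ℤ)
     w = Wᶠ (suc r)
     L : (ℕ → ℤ) → Q
     L p = D (4 + t) (λ e → p e ⋆ w e)
     K0 : L (λ e → 1ℤ) ≡ 0Q
     K0 = trans (D-cong′ (4 + t) (λ e → ⋆-identity (w e))) (trans (cong₂ _⊟_ h0 h1) (⊟-self 0Q))
     K1 : L (λ e → + e) ≡ 0Q
     K1 = trans (D-mult (3 + t) w) (trans (cong ((⊖ N) ⋆_) h1) (⋆-zeroʳ _))
     a = D (suc t) (λ e → 1ℤ ⋆ Wᶠ r e)
     b = D (suc t) (λ e → (+ e) ⋆ Wᶠ r e)
     -- The two quadratics of `D-drop-bottom` and `D-drop-top` differ by a linear polynomial in e,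
     -- on which `L` vanishes by `K0` and `K1`. Hence Y a = X a, and `cancel` gives a = 0.
     p2 : ∀ e → ((+ e) · ((+ e) ⊖ 1ℤ)) · 1ℤ ≡ (((+ (4 + t)) ⊖ (+ e)) · ((+ (3 + t)) ⊖ (+ e))) · 1ℤ
          ⊕ (((+ 2) · (N ⊖ 1ℤ)) · (+ e) ⊖ (N · (N ⊖ 1ℤ)) · 1ℤ)
     p2 e = l (+ t) (+ e)
       where
       l : ∀ t e → (e · (e ⊖ 1ℤ)) · 1ℤ ≡ ((((+ 4) ⊕ t) ⊖ e) · (((+ 3) ⊕ t) ⊖ e)) · 1ℤ
          ⊕ (((+ 2) · (((+ 4) ⊕ t) ⊖ 1ℤ)) · e ⊖ (((+ 4) ⊕ t) · (((+ 4) ⊕ t) ⊖ 1ℤ)) · 1ℤ)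
       l = ZS.solve-∀
     L-+ : ∀ p q → L (λ e → p e ⊕ q e) ≡ L p ⊞ L q
     L-+ p q = trans (D-cong′ (4 + t) (λ e → +-⋆ (p e) (q e) (w e))) (D-⊞ (4 + t) _ _)
     L-- : ∀ p q → L (λ e → p e ⊖ q e) ≡ L p ⊟ L q
     L-- p q = trans (D-cong′ (4 + t) (λ e → -⋆ (p e) (q e) (w e))) (D-⊟ (4 + t) _ _)
     L-* : ∀ c p → L (λ e → c · p e) ≡ c ⋆ L p
     L-* c p = trans (D-cong′ (4 + t) (λ e → ⋆-assoc c (p e) (w e))) (D-⋆ (4 + t) c _)
     L-0 : ∀ c p → L p ≡ 0Q → L (λ e → c · p e) ≡ 0Q
     L-0 c p h = trans (L-* c p) (trans (cong (c ⋆_) h) (⋆-zeroʳ c))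
     L-cong : ∀ {p q} → (∀ e → p e ≡ q e) → L p ≡ L q
     L-cong h = D-cong′ (4 + t) (λ e → cong (_⋆ w e) (h e))
     ya=xa : drop r ⋆ (Y ⊠ a) ≡ drop r ⋆ (X ⊠ a)
     ya=xa = begin
       drop r ⋆ (Y ⊠ a) ≡⟨ sym (D-drop-bottom r (λ _ → 1ℤ)) ⟩
       L (λ e → ((+ e) · ((+ e) ⊖ 1ℤ)) · 1ℤ) ≡⟨ trans (L-cong p2) (L-+ _ _) ⟩
       L (λ e → (((+ (4 + t)) ⊖ (+ e)) · ((+ (3 + t)) ⊖ (+ e))) · 1ℤ) ⊞ L _
         ≡⟨ cong₂ _⊞_ (D-drop-top r (λ _ → 1ℤ)) (trans (L-- (λ e → c₁ · (+ e)) (λ _ → c₂ · 1ℤ)) (trans (cong₂ _⊟_ (L-0 c₁ (λ e → + e) K1) (L-0 c₂ (λ _ → 1ℤ) K0)) (⊟-self 0Q))) ⟩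
       drop r ⋆ (X ⊠ a) ⊞ 0Q ≡⟨ ⊞-zeroʳ _ ⟩
       drop r ⋆ (X ⊠ a) ∎
     a0 : a ≡ 0Q
     a0 = cancel a (sym (⋆-cancel _ _ _ (drop≢0 r) ya=xa))
     K2 : L (λ e → (+ e) · (+ e)) ≡ 0Q
     K2 = begin
       L (λ e → (+ e) · (+ e)) ≡⟨ trans (L-cong (λ e → l (+ e))) (L-+ _ _) ⟩
       L (λ e → ((+ e) · ((+ e) ⊖ 1ℤ)) · 1ℤ) ⊞ L (λ e → + e)
         ≡⟨ cong₂ _⊞_ (trans (D-drop-bottom r (λ _ → 1ℤ)) (trans (cong (λ s → drop r ⋆ (Y ⊠ s)) a0) (trans (cong (drop r ⋆_) (⊠-zeroʳ Y)) (⋆-zeroʳ _)))) K1 ⟩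
       0Q ⊞ 0Q ≡⟨ ⊞-zeroʳ 0Q ⟩
       0Q ∎
       where
       l : ∀ e → e · e ≡ (e · (e ⊖ 1ℤ)) · 1ℤ ⊕ e
       l = ZS.solve-∀
     b3 : D (suc t) (λ e → (+ (3 + e)) ⋆ Wᶠ r e) ≡ b
     b3 = trans (D-cong′ (suc t) (λ e → trans (cong (_⋆ Wᶠ r e) (l (+ e))) (+-⋆ (+ e) ((+ 3) · 1ℤ) (Wᶠ r e))))
         (trans (D-⊞ (suc t) _ _) (trans (cong (b ⊞_) (trans (D-cong′ (suc t) (λ e → ⋆-assoc (+ 3) 1ℤ (Wᶠ r e))) (trans (D-⋆ (suc t) (+ 3) _) (trans (cong ((+ 3) ⋆_) a0) (⋆-zeroʳ _))))) (⊞-zeroʳ b)))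
       where
       l : ∀ e → (+ 3) ⊕ e ≡ e ⊕ (+ 3) · 1ℤ
       l = ZS.solve-∀
     -- The identity `p2` multiplied by e. Its correction terms now involve e² and e, so `K2` is
     -- needed, and `K2` rests on a = 0.
     p3 : ∀ e → ((+ e) · ((+ e) ⊖ 1ℤ)) · (+ e) ≡ (((+ (4 + t)) ⊖ (+ e)) · ((+ (3 + t)) ⊖ (+ e))) · (+ e)
          ⊕ (((+ 2) · (N ⊖ 1ℤ)) · ((+ e) · (+ e)) ⊖ (N · (N ⊖ 1ℤ)) · (+ e))
     p3 e = l (+ t) (+ e)
       where
       l : ∀ t e → (e · (e ⊖ 1ℤ)) · e ≡ ((((+ 4) ⊕ t) ⊖ e) · (((+ 3) ⊕ t) ⊖ e)) · e
          ⊕ (((+ 2) · (((+ 4) ⊕ t) ⊖ 1ℤ)) · (e · e) ⊖ (((+ 4) ⊕ t) · (((+ 4) ⊕ t) ⊖ 1ℤ)) · e)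
       l = ZS.solve-∀
     yb=xb : drop r ⋆ (Y ⊠ b) ≡ drop r ⋆ (X ⊠ b)
     yb=xb = begin
       drop r ⋆ (Y ⊠ b) ≡⟨ cong (λ s → drop r ⋆ (Y ⊠ s)) (sym b3) ⟩
       drop r ⋆ (Y ⊠ D (suc t) (λ e → (+ (3 + e)) ⋆ Wᶠ r e)) ≡⟨ sym (D-drop-bottom r (λ e → + e)) ⟩
       L (λ e → ((+ e) · ((+ e) ⊖ 1ℤ)) · (+ e)) ≡⟨ trans (L-cong p3) (L-+ _ _) ⟩
       L (λ e → (((+ (4 + t)) ⊖ (+ e)) · ((+ (3 + t)) ⊖ (+ e))) · (+ e)) ⊞ L _
         ≡⟨ cong₂ _⊞_ (D-drop-top r (λ e → + e)) (trans (L-- (λ e → c₁ · ((+ e) · (+ e))) (λ e → c₂ · (+ e))) (trans (cong₂ _⊟_ (L-0 c₁ (λ e → (+ e) · (+ e)) K2) (L-0 c₂ (λ e → + e) K1)) (⊟-self 0Q))) ⟩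
       drop r ⋆ (X ⊠ b) ⊞ 0Q ≡⟨ ⊞-zeroʳ _ ⟩
       drop r ⋆ (X ⊠ b) ∎
     b0 : b ≡ 0Q
     b0 = cancel b (sym (⋆-cancel _ _ _ (drop≢0 r) yb=xb))
     -- The differences `a` and `b` of order t + 1, with weights 1 and e, carry the same information
     -- as the two forms of order t: `b` is a multiple of the shifted form, `a` the difference of
     -- both.
     g1 : D t (Wᶠ r ∘ suc) ≡ 0Q
     g1 = ⋆-cancel (⊖ (+ suc t)) _ _ (λ ()) (trans (sym (D-mult t (Wᶠ r))) (trans b0 (sym (⋆-zeroʳ _))))
     g0 : D t (Wᶠ r) ≡ 0Q
     g0 = trans (sym (⊟-zeroʳ _)) (trans (cong (D t (Wᶠ r) ⊟_) (sym g1)) (trans (sym (D-cong′ (suc t) (λ e → ⋆-identity (Wᶠ r e)))) a0))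

 open Monomials

 -- Integrality and size of the coefficients

 n!*n^m≤[m+n]! : ∀ m n → n ! * n ^ m ≤ (m + n) !
 n!*n^m≤[m+n]! zero n = ≤-reflexive (*-identityʳ (n !))
 n!*n^m≤[m+n]! (suc m) n = begin
   n ! * (n * n ^ m) ≡⟨ l (n !) n (n ^ m) ⟩
   n * (n ! * n ^ m) ≤⟨ *-mono-≤ (≤-trans (m≤n+m n m) (n≤1+n _)) (n!*n^m≤[m+n]! m n) ⟩
   suc (m + n) * (m + n) ! ∎
   where
   open ≤-Reasoning
   l : ∀ a b c → a * (b * c) ≡ b * (a * c)
   l = NS.solve-∀

 -- Compares n! n^n ≤ (2n)! with (2n)! ≤ 4^n (n!)²; a substitute for Stirling's formula.
 n^n≤4^n*n! : ∀ n → n ^ n ≤ 4 ^ n * n !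
 n^n≤4^n*n! n = *-cancelˡ-≤ (n !) {{n !≢0}} (begin
   n ! * n ^ n ≤⟨ n!*n^m≤[m+n]! n n ⟩
   (n + n) ! ≤⟨ factorial-split n n ⟩
   2 ^ (n + n) * (n ! * n !) ≡⟨ cong (_* (n ! * n !)) (trans (cong (2 ^_) (cong (λ i → n + i) (sym (+-identityʳ n)))) (sym (^-*-assoc 2 2 n))) ⟩
   4 ^ n * (n ! * n !) ≡⟨ l (4 ^ n) (n !) ⟩
   n ! * (4 ^ n * n !) ∎)
   where
   open ≤-Reasoning
   l : ∀ p a → p * (a * a) ≡ a * (p * a)
   l = NS.solve-∀

 -- The product (b - 1)(b - 2) ... (b - r), that is r! times the binomial coefficient of b - 1 over
 -- r.
 falling : ℕ → ℤ → ℤ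
 falling zero b = 1ℤ
 falling (suc r) b = (b ⊖ (+ suc r)) · falling r b

 falling-shift : ∀ r b → falling (suc r) (1ℤ ⊕ b) ≡ b · falling r b
 falling-shift zero b = l b
   where
   l : ∀ b → ((1ℤ ⊕ b) ⊖ 1ℤ) · 1ℤ ≡ b · 1ℤ
   l = ZS.solve-∀
 falling-shift (suc r) b = trans (cong (((1ℤ ⊕ b) ⊖ (+ suc (suc r))) ·_) (falling-shift r b)) (l b (+ suc r) (falling r b))
   where
   l : ∀ b r f → ((1ℤ ⊕ b) ⊖ (1ℤ ⊕ r)) · (b · f) ≡ b · ((b ⊖ r) · f)
   l = ZS.solve-∀

 falling-diff : ∀ r b → falling (suc r) (1ℤ ⊕ b) ≡ falling (suc r) b ⊕ (+ suc r) · falling r b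
 falling-diff r b = trans (falling-shift r b) (l b (+ suc r) (falling r b))
   where
   l : ∀ b s f → b · f ≡ (b ⊖ s) · f ⊕ s · f
   l = ZS.solve-∀

 DivBy : ℕ → ℤ → Set
 DivBy m x = ∃[ q ] (x ≡ q · (+ m))

 +!-suc : ∀ r → + (suc r !) ≡ (+ suc r) · (+ (r !))
 +!-suc r = ℤP.pos-* (suc r) (r !)

 falling-down : ∀ r b → DivBy (suc r !) (falling (suc r) (1ℤ ⊕ b)) → DivBy (r !) (falling r b) → DivBy (suc r !) (falling (suc r) b)
 falling-down r b (q , e) (q' , e') = q ⊖ q' , trans (l1 _ _ _ (trans (sym e) (falling-diff r b))) (trans (cong₂ (λ u v → q · u ⊖ (+ suc r) · v) (+!-suc r) e') (trans (l2 q q' (+ suc r) (+ (r !))) (cong ((q ⊖ q') ·_) (sym (+!-suc r)))))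
   where
   l0 : ∀ a b → a ≡ (a ⊕ b) ⊖ b
   l0 = ZS.solve-∀
   l1 : ∀ x a b → x ≡ a ⊕ b → a ≡ x ⊖ b
   l1 x a b refl = l0 a b
   l2 : ∀ q q' s f → q · (s · f) ⊖ s · (q' · f) ≡ (q ⊖ q') · (s · f)
   l2 = ZS.solve-∀

 -- Pascal's rule in the form `falling-diff` carries divisibility in both directions. The start is b
 -- = 1, where a factor vanishes, so negative b are covered too.
 falling-div : ∀ r b → DivBy (r !) (falling r b)
 falling-div zero b = 1ℤ , refl
 falling-div (suc r) (+ suc zero) = 0ℤ , falling-shift r 0ℤ
 falling-div (suc r) (+ zero) = falling-down r 0ℤ (0ℤ , falling-shift r 0ℤ) (falling-div r 0ℤ)
 falling-div (suc r) (+ suc (suc n)) with falling-div (suc r) (+ suc n) | falling-div r (+ suc n)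
 ... | q , e | q' , e' = q ⊕ q' , trans (falling-diff r (+ suc n)) (trans (cong₂ (λ u v → u ⊕ (+ suc r) · v) e e')
       (trans (cong (λ u → q · u ⊕ (+ suc r) · (q' · (+ (r !)))) (+!-suc r)) (trans (l q q' (+ suc r) (+ (r !))) (cong ((q ⊕ q') ·_) (sym (+!-suc r))))))
     where
     l : ∀ q q' s f → q · (s · f) ⊕ s · (q' · f) ≡ (q ⊕ q') · (s · f)
     l = ZS.solve-∀
 falling-div (suc r) -[1+ zero ] = falling-down r -[1+ zero ] (falling-down r 0ℤ (0ℤ , falling-shift r 0ℤ) (falling-div r 0ℤ)) (falling-div r -[1+ zero ])
 falling-div (suc r) -[1+ suc n ] = falling-down r -[1+ suc n ] (falling-div (suc r) -[1+ n ]) (falling-div r -[1+ suc n ])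

 data Unit₃ : ℕ → Set where
   unit₁ : ∀ q → Unit₃ (1 + 3 * q)
   unit₂ : ∀ q → Unit₃ (2 + 3 * q)

 unit₃-* : ∀ {a b} → Unit₃ a → Unit₃ b → Unit₃ (a * b)
 unit₃-* (unit₁ p) (unit₁ q) = subst Unit₃ (l p q) (unit₁ (p + q + 3 * p * q))
   where
   l : ∀ p q → 1 + 3 * (p + q + 3 * p * q) ≡ (1 + 3 * p) * (1 + 3 * q)
   l = NS.solve-∀
 unit₃-* (unit₁ p) (unit₂ q) = subst Unit₃ (l p q) (unit₂ (2 * p + q + 3 * p * q))
   where
   l : ∀ p q → 2 + 3 * (2 * p + q + 3 * p * q) ≡ (1 + 3 * p) * (2 + 3 * q)
   l = NS.solve-∀
 unit₃-* (unit₂ p) (unit₁ q) = subst Unit₃ (l p q) (unit₂ (2 * q + p + 3 * p * q))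
   where
   l : ∀ p q → 2 + 3 * (2 * q + p + 3 * p * q) ≡ (2 + 3 * p) * (1 + 3 * q)
   l = NS.solve-∀
 unit₃-* (unit₂ p) (unit₂ q) = subst Unit₃ (l p q) (unit₁ (1 + 2 * p + 2 * q + 3 * p * q))
   where
   l : ∀ p q → 1 + 3 * (1 + 2 * p + 2 * q + 3 * p * q) ≡ (2 + 3 * p) * (2 + 3 * q)
   l = NS.solve-∀

 unit₃-inverse : ∀ {h} → Unit₃ h → ∃[ t ] ∃[ w ] ((+ 3) · t ≡ 1ℤ ⊕ w · (+ h))
 unit₃-inverse (unit₁ q) = ⊖ (+ q) , ⊖ 1ℤ , trans (l (+ q)) (cong (λ s → 1ℤ ⊕ (⊖ 1ℤ) · (1ℤ ⊕ s)) (sym (ℤP.pos-* 3 q)))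
   where
   l : ∀ q → (+ 3) · (⊖ q) ≡ 1ℤ ⊕ (⊖ 1ℤ) · (1ℤ ⊕ (+ 3) · q)
   l = ZS.solve-∀
 unit₃-inverse (unit₂ q) = ⊖ (1ℤ ⊕ (+ 2) · (+ q)) , ⊖ (+ 2) , trans (l (+ q)) (cong (λ s → 1ℤ ⊕ (⊖ (+ 2)) · ((+ 2) ⊕ s)) (sym (ℤP.pos-* 3 q)))
   where
   l : ∀ q → (+ 3) · (⊖ (1ℤ ⊕ (+ 2) · q)) ≡ 1ℤ ⊕ (⊖ (+ 2)) · ((+ 2) ⊕ (+ 3) · q)
   l = ZS.solve-∀

 thrice≡ : ∀ m → thrice m ≡ 3 * m
 thrice≡ zero = refl
 thrice≡ (suc m) = trans (cong (λ i → 3 + i) (thrice≡ m)) (l m)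
   where
   l : ∀ m → 3 + 3 * m ≡ 3 * suc m
   l = NS.solve-∀

 thrice! : ∀ m → ∃[ h ] (Unit₃ h × thrice m ! ≡ 3 ^ m * m ! * h)
 thrice! zero = 1 , unit₁ 0 , refl
 thrice! (suc m) with thrice! m
 ... | h , u , e = (1 + 3 * m) * ((2 + 3 * m) * h) , unit₃-* (unit₁ m) (unit₃-* (unit₂ m) u) ,
       trans (cong (λ t → (3 + thrice m) * ((2 + thrice m) * ((1 + thrice m) * t))) e)
         (trans (cong (λ t → (3 + t) * ((2 + t) * ((1 + t) * (3 ^ m * m ! * h)))) (thrice≡ m)) (l m (3 ^ m) (m !) h))
   where
   l : ∀ m p f h → (3 + 3 * m) * ((2 + 3 * m) * ((1 + 3 * m) * (p * f * h))) ≡ 3 * p * (suc m * f) * ((1 + 3 * m) * ((2 + 3 * m) * h))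
   l = NS.solve-∀

 data Mod₃ : ℕ → Set where
   r0 : ∀ m → Mod₃ (thrice m)
   r1 : ∀ m → Mod₃ (1 + thrice m)
   r2 : ∀ m → Mod₃ (2 + thrice m)

 mod₃ : ∀ n → Mod₃ n
 mod₃ zero = r0 0
 mod₃ (suc n) with mod₃ n
 ... | r0 m = r1 m
 ... | r1 m = r2 m
 ... | r2 m = r0 (suc m)

 -- Separates the 3-part of r!. The bound s ≤ r is what allows the factor 3^r in `gapProd-div` to
 -- absorb it.
 Split! : ℕ → Set
 Split! r = ∃[ s ] ∃[ h ] (Unit₃ h × r ! ≡ 3 ^ s * h × s ≤ r)

 m≤thrice : ∀ m → m + m ≤ thrice m
 m≤thrice m = ≤-trans (m≤m+n (m + m) m) (≤-reflexive (trans (l m) (sym (thrice≡ m))))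
   where
   l : ∀ m → m + m + m ≡ 3 * m
   l = NS.solve-∀

 factorial-split₃ : ∀ fuel r → r ≤ fuel → Split! r
 factorial-split₃ fuel zero _ = 0 , 1 , unit₁ 0 , refl , z≤n
 factorial-split₃ (suc fuel) (suc r) (s≤s le) = go (mod₃ (suc r)) (s≤s le)
   where
   base : ∀ m → Split! m → ∃[ s ] ∃[ h ] (Unit₃ h × thrice m ! ≡ 3 ^ s * h × s ≤ thrice m)
   base m (s , h , u , e , s≤m) with thrice! m
   ... | h' , u' , e' = m + s , h * h' , unit₃-* u u' , trans e' (trans (cong (λ t → 3 ^ m * t * h') e) (trans (l (3 ^ m) (3 ^ s) h h') (cong (_* (h * h')) (sym (^-distribˡ-+-* 3 m s))))) ,
         ≤-trans (+-monoʳ-≤ m s≤m) (m≤thrice m)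
     where
     l : ∀ a b h h' → a * (b * h) * h' ≡ a * b * (h * h')
     l = NS.solve-∀
   up : ∀ n {a} → Unit₃ a → a ≡ suc n → Split! n → Split! (suc n)
   up n {a} ua refl (s , h , u , e , le) = s , suc n * h , unit₃-* ua u , trans (cong (suc n *_) e) (l (suc n) (3 ^ s) h) , ≤-trans le (n≤1+n n)
     where
     l : ∀ a b c → a * (b * c) ≡ b * (a * c)
     l = NS.solve-∀
   go : ∀ {n} → Mod₃ n → n ≤ suc fuel → Split! n
   go (r0 zero) p = 0 , 1 , unit₁ 0 , refl , z≤n
   go (r0 (suc m)) (s≤s p) = base (suc m) (factorial-split₃ fuel (suc m) (≤-trans (s≤s (≤-trans (m≤m+n m m) (≤-trans (m≤thrice m) (n≤1+n _)))) p))
   go (r1 m) (s≤s p) = up (thrice m) (unit₁ m) (cong suc (sym (thrice≡ m))) (base m (factorial-split₃ fuel m (≤-trans (≤-trans (m≤m+n m m) (m≤thrice m)) p)))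
   go (r2 m) (s≤s p) = up (1 + thrice m) (unit₂ m) (cong (λ i → 2 + i) (sym (thrice≡ m))) (up (thrice m) (unit₁ m) (cong suc (sym (thrice≡ m))) (base m (factorial-split₃ fuel m (≤-trans (≤-trans (m≤m+n m m) (≤-trans (m≤thrice m) (n≤1+n _))) p))))

 pow : ℤ → ℕ → ℤ
 pow x zero = 1ℤ
 pow x (suc n) = x · pow x n

 -- Modulo h the number t inverts 3, so a - 3i is congruent to 3 (t a - i) and the product becomes
 -- 3^r times one to which `falling-div` applies.
 gapProd-mod : ∀ (t w h a : ℤ) → (+ 3) · t ≡ 1ℤ ⊕ w · h → ∀ r →
   ∃[ z ] (gapProd r 0ℤ a ≡ pow (+ 3) r · falling r (t · a) ⊕ z · h)
 gapProd-mod t w h a inv zero = 0ℤ , l h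
   where
   l : ∀ h → 1ℤ ≡ 1ℤ · 1ℤ ⊕ 0ℤ · h
   l = ZS.solve-∀
 gapProd-mod t w h a inv (suc r) with gapProd-mod t w h a inv r
 ... | z , e = ((+ 3) · (t · a ⊖ (+ suc r)) ⊖ w · h · a) · z ⊖ w · a · (pow (+ 3) r · falling r (t · a)) , trans (cong₂ _·_ fac e) (l t w h a (+ suc r) (pow (+ 3) r) (falling r (t · a)) z)
   where
   fac : a ⊕ (0ℤ ⊖ (+ 3) · (+ suc r)) ≡ (+ 3) · (t · a ⊖ (+ suc r)) ⊖ w · h · a
   fac = trans (l1 a w h (+ suc r)) (trans (cong (λ s → s · a ⊖ (+ 3) · (+ suc r) ⊖ w · h · a) (sym inv)) (l2 t a w h (+ suc r)))
     where
     l1 : ∀ a w h r → a ⊕ (0ℤ ⊖ (+ 3) · r) ≡ (1ℤ ⊕ w · h) · a ⊖ (+ 3) · r ⊖ w · h · a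
     l1 = ZS.solve-∀
     l2 : ∀ t a w h r → (+ 3) · t · a ⊖ (+ 3) · r ⊖ w · h · a ≡ (+ 3) · (t · a ⊖ r) ⊖ w · h · a
     l2 = ZS.solve-∀
   l : ∀ t w h a r p f z → ((+ 3) · (t · a ⊖ r) ⊖ w · h · a) · (p · f ⊕ z · h) ≡
       (+ 3) · p · ((t · a ⊖ r) · f) ⊕ (((+ 3) · (t · a ⊖ r) ⊖ w · h · a) · z ⊖ w · a · (p · f)) · h
   l = ZS.solve-∀

 pos-^ : ∀ m n → + (m ^ n) ≡ pow (+ m) n
 pos-^ m zero = refl
 pos-^ m (suc n) = trans (ℤP.pos-* m (m ^ n)) (cong ((+ m) ·_) (pos-^ m n))

 -- 9^r times the binomial coefficient of (a/3 − 1) over r.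
 gapProd-div : ∀ r a → DivBy (r !) ((+ (3 ^ r)) · gapProd r 0ℤ a)
 gapProd-div r a with factorial-split₃ r r ≤-refl
 ... | s , h , u , e , s≤r with unit₃-inverse u
 ... | t , w , inv with gapProd-mod t w (+ h) a inv r | falling-div r (t · a)
 ... | z , ez | q , eq = (+ (3 ^ (r ∸ s))) · Z , (begin
   (+ (3 ^ r)) · gapProd r 0ℤ a ≡⟨ cong₂ _·_ (trans (cong (λ i → + (3 ^ i)) (sym (m∸n+n≡m s≤r))) (trans (cong +_ (^-distribˡ-+-* 3 (r ∸ s) s)) (ℤP.pos-* (3 ^ (r ∸ s)) (3 ^ s)))) g ⟩
   (+ (3 ^ (r ∸ s))) · (+ (3 ^ s)) · (Z · (+ h)) ≡⟨ l (+ (3 ^ (r ∸ s))) (+ (3 ^ s)) Z (+ h) ⟩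
   (+ (3 ^ (r ∸ s))) · Z · ((+ (3 ^ s)) · (+ h)) ≡⟨ cong ((+ (3 ^ (r ∸ s))) · Z ·_) (trans (sym (ℤP.pos-* (3 ^ s) h)) (cong +_ (sym e))) ⟩
   (+ (3 ^ (r ∸ s))) · Z · (+ (r !)) ∎)
   where
   open ≡-Reasoning
   Z = pow (+ 3) r · q · (+ (3 ^ s)) ⊕ z
   g : gapProd r 0ℤ a ≡ Z · (+ h)
   g = trans ez (trans (cong (λ f → pow (+ 3) r · f ⊕ z · (+ h)) (trans eq (cong (q ·_) (trans (cong +_ e) (ℤP.pos-* (3 ^ s) h)))))
         (l' (pow (+ 3) r) q (+ (3 ^ s)) (+ h) z))
     where
     l' : ∀ p q s h z → p · (q · (s · h)) ⊕ z · h ≡ (p · q · s ⊕ z) · h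
     l' = ZS.solve-∀
   l : ∀ a b z h → a · b · (z · h) ≡ a · z · (b · h)
   l = ZS.solve-∀

 coeff : ℕ → ℕ → ℤ
 coeff r e = proj₁ (gapProd-div r (+ suc e))

 coeff-eq : ∀ r e → (+ (r !)) · coeff r e ≡ (+ (3 ^ r)) · gapProd r 1ℤ (+ e)
 coeff-eq r e = trans (ℤP.*-comm (+ (r !)) (coeff r e)) (trans (sym (proj₂ (gapProd-div r (+ suc e)))) (cong ((+ (3 ^ r)) ·_) (gapProd-suc r 0ℤ (+ e))))

 steps-bound : ∀ r → All (λ c → abs c ≤ 1 + 3 * r) (steps r 1ℤ)
 steps-bound zero = []
 steps-bound (suc r) = ≤-trans (ℤP.∣i-j∣≤∣i∣+∣j∣ 1ℤ ((+ 3) · (+ suc r))) (≤-reflexive (cong suc (ℤP.abs-* (+ 3) (+ suc r))))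
   ∷ All.map (λ p → ≤-trans p (s≤s (*-monoʳ-≤ 3 (n≤1+n r)))) (steps-bound r)

 length-steps : ∀ r c → length (steps r c) ≡ r
 length-steps zero c = refl
 length-steps (suc r) c = cong suc (length-steps r c)

 linProd-bound : ∀ cs e M → All (λ c → e + abs c ≤ M) cs → abs (linProd cs (+ e)) ≤ M ^ length cs
 linProd-bound [] e M [] = ≤-refl
 linProd-bound (c ∷ cs) e M (p ∷ ps) = begin
   abs (((+ e) ⊕ c) · linProd cs (+ e)) ≡⟨ ℤP.abs-* ((+ e) ⊕ c) _ ⟩
   abs ((+ e) ⊕ c) * abs (linProd cs (+ e)) ≤⟨ *-mono-≤ (≤-trans (ℤP.∣i+j∣≤∣i∣+∣j∣ (+ e) c) p) (linProd-bound cs e M ps) ⟩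
   M * M ^ length cs ∎
   where open ≤-Reasoning

 [a*n]^n≤ : ∀ a n → (a * n) ^ n ≤ (a * 4) ^ n * n !
 [a*n]^n≤ a n = begin
   (a * n) ^ n ≡⟨ *-^ n a n ⟩
   a ^ n * n ^ n ≤⟨ *-monoʳ-≤ (a ^ n) (n^n≤4^n*n! n) ⟩
   a ^ n * (4 ^ n * n !) ≡⟨ trans (sym (*-assoc (a ^ n) (4 ^ n) (n !))) (cong (_* n !) (sym (*-^ n a 4))) ⟩
   (a * 4) ^ n * n ! ∎
   where open ≤-Reasoning

 -- Each of the r linear factors is at most 8r in absolute value, and (8r)^r ≤ 32^r r!. Together
 -- with the factor 3^r this gives 96^r.
 coeff-bound : ∀ r e → 1 ≤ r → e ≤ 1 + thrice r → abs (coeff r e) ≤ 96 ^ r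
 coeff-bound r e 1≤r e≤ = *-cancelˡ-≤ (r !) {{r !≢0}} (begin
   r ! * abs (coeff r e) ≡⟨ sym (ℤP.abs-* (+ (r !)) (coeff r e)) ⟩
   abs ((+ (r !)) · coeff r e) ≡⟨ cong abs (coeff-eq r e) ⟩
   abs ((+ (3 ^ r)) · gapProd r 1ℤ (+ e)) ≡⟨ ℤP.abs-* (+ (3 ^ r)) _ ⟩
   3 ^ r * abs (gapProd r 1ℤ (+ e)) ≤⟨ *-monoʳ-≤ (3 ^ r) (linProd-bound (steps r 1ℤ) e (8 * r) (All.map (λ p → ≤-trans (+-mono-≤ e≤ p) fin) (steps-bound r))) ⟩
   3 ^ r * (8 * r) ^ length (steps r 1ℤ) ≡⟨ cong (λ i → 3 ^ r * (8 * r) ^ i) (length-steps r 1ℤ) ⟩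
   3 ^ r * (8 * r) ^ r ≤⟨ *-monoʳ-≤ (3 ^ r) ([a*n]^n≤ 8 r) ⟩
   3 ^ r * (32 ^ r * r !) ≡⟨ trans (sym (*-assoc (3 ^ r) (32 ^ r) (r !))) (trans (cong (_* r !) (sym (*-^ r 3 32))) (*-comm (96 ^ r) (r !))) ⟩
   r ! * 96 ^ r ∎)
   where
   open ≤-Reasoning
   fin : 1 + thrice r + (1 + 3 * r) ≤ 8 * r
   fin = begin
     1 + thrice r + (1 + 3 * r) ≡⟨ cong (λ t → 1 + t + (1 + 3 * r)) (thrice≡ r) ⟩
     1 + 3 * r + (1 + 3 * r) ≤⟨ +-mono-≤ (+-monoˡ-≤ (3 * r) 1≤r) (+-monoˡ-≤ (3 * r) 1≤r) ⟩
     r + 3 * r + (r + 3 * r) ≡⟨ l r ⟩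
     8 * r ∎
     where
     l : ∀ r → r + 3 * r + (r + 3 * r) ≡ 8 * r
     l = NS.solve-∀

 -- Sizes and approximation of the monomials

 opaque
   unfolding _⊞_

   size-0Q : size 0Q ≡ 0
   size-0Q = *-zeroʳ κ

   size≥1 : 1 ≤ κ → ∀ x → x ≢ 0Q → 1 ≤ size x
   size≥1 κ≥1 ((+ suc a) ,√ b) ne = s≤s z≤n
   size≥1 κ≥1 (-[1+ a ] ,√ b) ne = s≤s z≤n
   size≥1 κ≥1 ((+ zero) ,√ (+ zero)) ne = ⊥-elim (ne refl)
   size≥1 κ≥1 ((+ zero) ,√ (+ suc b)) ne = *-mono-≤ κ≥1 (s≤s (z≤n {b}))
   size≥1 κ≥1 ((+ zero) ,√ -[1+ b ]) ne = *-mono-≤ κ≥1 (s≤s (z≤n {b}))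

   size-im≤ : ∀ a → size (0ℤ ,√ a) ≡ κ * abs a
   size-im≤ a = refl

   conj-diff : ∀ x → conj x ⊟ x ≡ 0ℤ ,√ (⊖ ((+ 2) · im x))
   conj-diff (a ,√ b) = Q-ext (ℤP.+-inverseʳ a) (l b)
     where
     l : ∀ b → (⊖ b) ⊖ b ≡ ⊖ ((+ 2) · b)
     l = ZS.solve-∀

   im≤size : 1 ≤ κ → ∀ x → κ * abs (im x) ≤ size x
   im≤size κ≥1 (a ,√ b) = m≤n+m _ _

   scalar-diff : ∀ y m → size ((+ y) ⋆ 1Q ⊟ ((+ y) ,√ m)) ≡ κ * abs m
   scalar-diff y m = cong₂ (λ a b → abs a + κ * b) (l (+ y)) (trans (cong abs (l' (+ y) m)) (ℤP.∣-i∣≡∣i∣ m))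
     where
     l : ∀ y → y · 1ℤ ⊖ y ≡ 0ℤ
     l = ZS.solve-∀
     l' : ∀ y m → y · 0ℤ ⊖ m ≡ ⊖ m
     l' = ZS.solve-∀

   conj-pair : ∀ a b → conj (a ,√ b) ≡ a ,√ (⊖ b)
   conj-pair a b = refl

   -- With β = y + m√k, β - conj β = 2m√k can be cancelled. This is the hypothesis `cancel` of
   -- `forms-nonvanishing` for X = β, Y = conj β.
   conj-cancel : k ≢ 0ℤ → ∀ (y m : ℤ) → m ≢ 0ℤ → ∀ a → (y ,√ m) ⊠ a ≡ conj (y ,√ m) ⊠ a → a ≡ 0Q
   conj-cancel k≢0 y m m≢0 (a ,√ b) e = Q-ext a0 b0
     where
     l1 : ∀ k y m a b → (+ 2) · k · m · b ≡ (y · a ⊕ k · m · b) ⊖ (y · a ⊕ k · (⊖ m) · b)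
     l1 = ZS.solve-∀
     l2 : ∀ y m a b → (+ 2) · m · a ≡ (y · b ⊕ m · a) ⊖ (y · b ⊕ (⊖ m) · a)
     l2 = ZS.solve-∀
     z : ∀ {x y : ℤ} → x ≡ y → x ⊖ y ≡ 0ℤ
     z {x} refl = ℤP.+-inverseʳ x
     nz : ∀ {i j : ℤ} → i ≢ 0ℤ → i · j ≡ 0ℤ → j ≡ 0ℤ
     nz {i} ni e with ℤP.i*j≡0⇒i≡0∨j≡0 i e
     ... | inj₁ p = ⊥-elim (ni p)
     ... | inj₂ p = p
     nz2 : ∀ {i : ℤ} → i ≢ 0ℤ → (+ 2) · i ≢ 0ℤ
     nz2 {i} ni e = ni (nz {+ 2} {i} (λ ()) e)
     b0 : b ≡ 0ℤ
     b0 = nz {(+ 2) · k · m} (λ e → m≢0 (nz {(+ 2) · k} {m} (nz2 k≢0) e)) (trans (l1 k y m a b) (z (cong re e)))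
     a0 : a ≡ 0ℤ
     a0 = nz {(+ 2) · m} (nz2 m≢0) (trans (l2 y m a b) (z (cong im e)))

   diff-step-id : ∀ (y p : ℤ) z T P P' →
     (y · p) ⋆ (T ⊠ P) ⊟ (z ⊠ T) ⊠ P' ≡ T ⊠ (y ⋆ (p ⋆ P ⊟ P') ⊞ (y ⋆ 1Q ⊟ z) ⊠ P')
   diff-step-id y p (z ,√ z') (a ,√ b) (c ,√ d) (e ,√ f) = Q-ext (l k y p z z' a b c d e f) (l' k y p z z' a b c d e f)
     where
     l : ∀ k y p z z' a b c d e f →
       (y · p) · (a · c ⊕ k · b · d) ⊖ ((z · a ⊕ k · z' · b) · e ⊕ k · (z · b ⊕ z' · a) · f)
       ≡ a · (y · (p · c ⊖ e) ⊕ ((y · 1ℤ ⊖ z) · e ⊕ k · (y · 0ℤ ⊖ z') · f))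
         ⊕ k · b · (y · (p · d ⊖ f) ⊕ ((y · 1ℤ ⊖ z) · f ⊕ (y · 0ℤ ⊖ z') · e))
     l = ZS.solve-∀
     l' : ∀ k y p z z' a b c d e f →
       (y · p) · (a · d ⊕ b · c) ⊖ ((z · a ⊕ k · z' · b) · f ⊕ (z · b ⊕ z' · a) · e)
       ≡ a · (y · (p · d ⊖ f) ⊕ ((y · 1ℤ ⊖ z) · f ⊕ (y · 0ℤ ⊖ z') · e))
         ⊕ b · (y · (p · c ⊖ e) ⊕ ((y · 1ℤ ⊖ z) · e ⊕ k · (y · 0ℤ ⊖ z') · f))
     l' = ZS.solve-∀

 _≟Q_ : (x y : Q) → Dec (x ≡ y)
 (a ,√ b) ≟Q (c ,√ d) with a ℤ.≟ c | b ℤ.≟ d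
 ... | yes refl | yes refl = yes refl
 ... | no ne | _ = no (λ { refl → ne refl })
 ... | _ | no ne = no (λ { refl → ne refl })

 -- One more factor y is replaced by z: y p T P - z T P′ = T (y (p P - P′) + (y - z) P′). The factor
 -- y in front of every size records a relative error of order ε / y without dividing.
 diff-step : ∀ (y ε Xs E B p : ℕ) z T P P' →
   size ((+ y) ⋆ 1Q ⊟ z) ≤ ε → size T ≤ Xs → size P' ≤ B → y * size ((+ p) ⋆ P ⊟ P') ≤ E →
   y * size ((+ (y * p)) ⋆ (T ⊠ P) ⊟ (z ⊠ T) ⊠ P') ≤ Xs * (y * E + y * (ε * B))
 diff-step y ε Xs E B p z T P P' hz hT hP hE = begin
   y * size ((+ (y * p)) ⋆ (T ⊠ P) ⊟ (z ⊠ T) ⊠ P')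
     ≡⟨ cong (y *_) (trans (cong (λ s → size (s ⋆ (T ⊠ P) ⊟ (z ⊠ T) ⊠ P')) (ℤP.pos-* y p)) (cong size (diff-step-id (+ y) (+ p) z T P P'))) ⟩
   y * size (T ⊠ ((+ y) ⋆ G ⊞ Z ⊠ P'))
     ≤⟨ *-monoʳ-≤ y (≤-trans (size-⊠ T _) (*-mono-≤ hT (≤-trans (size-⊞ _ _) (+-mono-≤ (≤-reflexive (size-⋆ (+ y) G)) (≤-trans (size-⊠ Z P') (*-mono-≤ hz hP)))))) ⟩
   y * (Xs * (y * size G + ε * B)) ≡⟨ l y Xs (size G) (ε * B) ⟩
   Xs * (y * (y * size G) + y * (ε * B)) ≤⟨ *-monoʳ-≤ Xs (+-monoˡ-≤ _ (*-monoʳ-≤ y hE)) ⟩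
   Xs * (y * E + y * (ε * B)) ∎
   where
   open ≤-Reasoning
   G = (+ p) ⋆ P ⊟ P'
   Z = (+ y) ⋆ 1Q ⊟ z
   l : ∀ y x g e → y * (x * (y * g + e)) ≡ x * (y * (y * g) + y * e)
   l = NS.solve-∀

 monomial-size : ∀ a₀ a₁ X Y Λ Xs → size a₀ ≤ Λ → size a₁ ≤ Λ → size X ≤ Xs → size Y ≤ Xs →
   ∀ r e → size (monomial a₀ a₁ X Y r e) ≤ Λ * Xs ^ r
 monomial-size a₀ a₁ X Y Λ Xs h0 h1 hX hY r 0 = ≤-trans (size-⊠ a₀ _) (*-mono-≤ h0 (≤-trans (size-↑ X r) (^-monoˡ-≤ r hX)))
 monomial-size a₀ a₁ X Y Λ Xs h0 h1 hX hY r 1 = ≤-trans (size-⊠ a₁ _) (*-mono-≤ h1 (≤-trans (size-↑ X r) (^-monoˡ-≤ r hX)))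
 monomial-size a₀ a₁ X Y Λ Xs h0 h1 hX hY r 2 = ≤-trans (≤-reflexive size-0Q) z≤n
 monomial-size a₀ a₁ X Y Λ Xs h0 h1 hX hY zero (suc (suc (suc e))) = ≤-trans (≤-reflexive size-0Q) z≤n
 monomial-size a₀ a₁ X Y Λ Xs h0 h1 hX hY (suc r) (suc (suc (suc e))) =
   ≤-trans (size-⊠ Y _) (≤-trans (*-mono-≤ hY (monomial-size a₀ a₁ X Y Λ Xs h0 h1 hX hY r e)) (≤-reflexive (l Xs Λ (Xs ^ r))))
   where
   l : ∀ x a b → x * (a * b) ≡ a * (x * b)
   l = NS.solve-∀

 size-self-diff : ∀ x → size (1ℤ ⋆ x ⊟ x) ≡ 0
 size-self-diff x = trans (cong size (trans (cong (_⊟ x) (⋆-identity x)) (⊟-self x))) size-0Q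

 module MonomialDiff (a₀ a₁ X Y z z̄ : Q) (Λ Xs y ε : ℕ)
   (h0 : size a₀ ≤ Λ) (h1 : size a₁ ≤ Λ) (hX : size X ≤ Xs) (hY : size Y ≤ Xs)
   (hz : size ((+ y) ⋆ 1Q ⊟ z) ≤ ε) (hz̄ : size ((+ y) ⋆ 1Q ⊟ z̄) ≤ ε)
   (sz : size z ≤ 2 * y) (sz̄ : size z̄ ≤ 2 * y) where

   private
     V V″ : ℕ → ℕ → Q
     V = monomial a₀ a₁ X Y
     V″ = monomial a₀ a₁ (z̄ ⊠ X) (z ⊠ Y)

   bound : ℕ → ℕ
   bound r = ε * (4 ^ r * y ^ r) * (Λ * Xs ^ r)

   size″ : ∀ r e → size (V″ r e) ≤ Λ * (2 * y * Xs) ^ r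
   size″ = monomial-size a₀ a₁ (z̄ ⊠ X) (z ⊠ Y) Λ (2 * y * Xs) h0 h1 (≤-trans (size-⊠ z̄ X) (*-mono-≤ sz̄ hX)) (≤-trans (size-⊠ z Y) (*-mono-≤ sz hY))

   combine : ∀ r → Xs * (y * bound r + y * (ε * (Λ * (2 * y * Xs) ^ r))) ≤ bound (suc r)
   combine r = begin
     Xs * (y * bound r + y * (ε * (Λ * (2 * y * Xs) ^ r)))
       ≡⟨ cong (λ t → Xs * (y * bound r + y * (ε * (Λ * t)))) (trans (*-^ r (2 * y) Xs) (cong (_* Xs ^ r) (*-^ r 2 y))) ⟩
     Xs * (y * (ε * (4 ^ r * y ^ r) * (Λ * Xs ^ r)) + y * (ε * (Λ * (2 ^ r * y ^ r * Xs ^ r))))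
       ≡⟨ l Xs y ε (4 ^ r) (2 ^ r) (y ^ r) Λ (Xs ^ r) ⟩
     ε * ((4 ^ r + 2 ^ r) * (y * y ^ r)) * (Λ * (Xs * Xs ^ r))
       ≤⟨ *-monoˡ-≤ _ (*-monoʳ-≤ ε (*-monoˡ-≤ (y * y ^ r) (+-monoʳ-≤ (4 ^ r) (≤-trans (^-monoˡ-≤ r (s≤s (s≤s (z≤n {2})))) (m≤m+n (4 ^ r) (2 * 4 ^ r)))))) ⟩
     bound (suc r) ∎
     where
     open ≤-Reasoning
     l : ∀ x y e f g p a q → x * (y * (e * (f * p) * (a * q)) + y * (e * (a * (g * p * q)))) ≡ e * ((f + g) * (y * p)) * (a * (x * q))
     l = NS.solve-∀

   -- Both z and z̄ lie within ε of the integer y. Multiplying the cubes by them, instead of the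
   -- monomials by y^r, therefore changes little; the induction telescopes over the r factors.
   monomial-diff : ∀ r e → y * size ((+ (y ^ r)) ⋆ V r e ⊟ V″ r e) ≤ bound r
   monomial-diff zero 0 = ≤-trans (≤-reflexive (trans (cong (y *_) (size-self-diff _)) (*-zeroʳ y))) z≤n
   monomial-diff zero 1 = ≤-trans (≤-reflexive (trans (cong (y *_) (size-self-diff _)) (*-zeroʳ y))) z≤n
   monomial-diff zero 2 = ≤-trans (≤-reflexive (trans (cong (y *_) (size-self-diff _)) (*-zeroʳ y))) z≤n
   monomial-diff zero (suc (suc (suc e))) = ≤-trans (≤-reflexive (trans (cong (y *_) (size-self-diff _)) (*-zeroʳ y))) z≤n
   monomial-diff (suc r) 0 = ≤-trans (≤-reflexive (cong (y *_) (cong size (cong₂ (λ s t → (+ (y ^ suc r)) ⋆ s ⊟ t) (⊠-left-comm a₀ X _) (⊠-left-comm a₀ (z̄ ⊠ X) _)))))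
     (≤-trans (diff-step y ε Xs _ _ (y ^ r) z̄ X (V r 0) (V″ r 0) hz̄ hX (size″ r 0) (monomial-diff r 0)) (combine r))
   monomial-diff (suc r) 1 = ≤-trans (≤-reflexive (cong (y *_) (cong size (cong₂ (λ s t → (+ (y ^ suc r)) ⋆ s ⊟ t) (⊠-left-comm a₁ X _) (⊠-left-comm a₁ (z̄ ⊠ X) _)))))
     (≤-trans (diff-step y ε Xs _ _ (y ^ r) z̄ X (V r 1) (V″ r 1) hz̄ hX (size″ r 1) (monomial-diff r 1)) (combine r))
   monomial-diff (suc r) 2 = ≤-trans (≤-reflexive (trans (cong (y *_) (trans (cong size (trans (cong (_⊟ 0Q) (⋆-zeroʳ (+ (y ^ suc r)))) (⊟-self 0Q))) size-0Q)) (*-zeroʳ y))) z≤n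
   monomial-diff (suc r) (suc (suc (suc e))) =
     ≤-trans (diff-step y ε Xs _ _ (y ^ r) z Y (V r e) (V″ r e) hz hY (size″ r e) (monomial-diff r e)) (combine r)

 ⋆-↑ : ∀ n x r → (n ⋆ x) ↑ r ≡ pow n r ⋆ (x ↑ r)
 ⋆-↑ n x zero = sym (⋆-identity 1Q)
 ⋆-↑ n x (suc r) = begin
   (n ⋆ x) ⊠ (n ⋆ x) ↑ r ≡⟨ cong ((n ⋆ x) ⊠_) (⋆-↑ n x r) ⟩
   (n ⋆ x) ⊠ (pow n r ⋆ (x ↑ r)) ≡⟨ trans (⋆-⊠ˡ n x _) (cong (n ⋆_) (⋆-⊠ʳ (pow n r) x _)) ⟩
   n ⋆ (pow n r ⋆ (x ⊠ x ↑ r)) ≡⟨ sym (⋆-assoc n (pow n r) _) ⟩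
   (n · pow n r) ⋆ (x ⊠ x ↑ r) ∎
   where open ≡-Reasoning

 ↑-thrice : ∀ x r → (x ↑ 3) ↑ r ≡ x ↑ thrice r
 ↑-thrice x zero = refl
 ↑-thrice x (suc r) = trans (cong (x ↑ 3 ⊠_) (↑-thrice x r)) (sym (↑-+ x 3 (thrice r)))

 -- If C⋆X = n⋆a₀³ and C⋆Y = n⋆a₁³, the monomials become honest powers, except where the coefficient vanishes.
 monomial-exact : ∀ a₀ a₁ X Y (C n : ℤ) → C ⋆ X ≡ n ⋆ (a₀ ↑ 3) → C ⋆ Y ≡ n ⋆ (a₁ ↑ 3) →
   ∀ r e → e ≤ 1 + thrice r →
   (pow C r ⋆ monomial a₀ a₁ X Y r e ≡ pow n r ⋆ (a₀ ↑ ((1 + thrice r) ∸ e) ⊠ a₁ ↑ e)) ⊎ gapProd r 1ℤ (+ e) ≡ 0ℤ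
 monomial-exact a₀ a₁ X Y C n hX hY r 0 _ = inj₁ (begin
   pow C r ⋆ (a₀ ⊠ X ↑ r) ≡⟨ trans (sym (⋆-⊠ʳ (pow C r) a₀ _)) (cong (a₀ ⊠_) (sym (⋆-↑ C X r))) ⟩
   a₀ ⊠ (C ⋆ X) ↑ r ≡⟨ cong (λ t → a₀ ⊠ t ↑ r) hX ⟩
   a₀ ⊠ (n ⋆ (a₀ ↑ 3)) ↑ r ≡⟨ trans (cong (a₀ ⊠_) (⋆-↑ n _ r)) (⋆-⊠ʳ (pow n r) a₀ _) ⟩
   pow n r ⋆ (a₀ ⊠ (a₀ ↑ 3) ↑ r) ≡⟨ cong (λ t → pow n r ⋆ (a₀ ⊠ t)) (↑-thrice a₀ r) ⟩
   pow n r ⋆ (a₀ ⊠ a₀ ↑ thrice r) ≡⟨ cong (pow n r ⋆_) (sym (⊠-identityʳ _)) ⟩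
   pow n r ⋆ ((a₀ ⊠ a₀ ↑ thrice r) ⊠ 1Q) ∎)
   where open ≡-Reasoning
 monomial-exact a₀ a₁ X Y C n hX hY r 1 _ = inj₁ (begin
   pow C r ⋆ (a₁ ⊠ X ↑ r) ≡⟨ trans (sym (⋆-⊠ʳ (pow C r) a₁ _)) (cong (a₁ ⊠_) (sym (⋆-↑ C X r))) ⟩
   a₁ ⊠ (C ⋆ X) ↑ r ≡⟨ cong (λ t → a₁ ⊠ t ↑ r) hX ⟩
   a₁ ⊠ (n ⋆ (a₀ ↑ 3)) ↑ r ≡⟨ trans (cong (a₁ ⊠_) (⋆-↑ n _ r)) (⋆-⊠ʳ (pow n r) a₁ _) ⟩
   pow n r ⋆ (a₁ ⊠ (a₀ ↑ 3) ↑ r) ≡⟨ cong (λ t → pow n r ⋆ (a₁ ⊠ t)) (↑-thrice a₀ r) ⟩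
   pow n r ⋆ (a₁ ⊠ a₀ ↑ thrice r) ≡⟨ cong (pow n r ⋆_) (trans (⊠-comm a₁ _) (cong (a₀ ↑ thrice r ⊠_) (sym (⊠-identityʳ a₁)))) ⟩
   pow n r ⋆ (a₀ ↑ thrice r ⊠ (a₁ ⊠ 1Q)) ∎)
   where open ≡-Reasoning
 monomial-exact a₀ a₁ X Y C n hX hY zero 2 (s≤s ())
 monomial-exact a₀ a₁ X Y C n hX hY (suc r) 2 _ = inj₂ (trans (gapProd-suc (suc r) 1ℤ 1ℤ) (trans (gapProd-suc (suc r) (+ 2) 0ℤ) (gapProd-peel r (+ 3) 0ℤ)))
 monomial-exact a₀ a₁ X Y C n hX hY zero (suc (suc (suc e))) (s≤s ())
 monomial-exact a₀ a₁ X Y C n hX hY (suc r) (suc (suc (suc e))) (s≤s (s≤s (s≤s le))) with monomial-exact a₀ a₁ X Y C n hX hY r e le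
 ... | inj₂ g = inj₂ (begin
   gapProd (suc r) 1ℤ (+ (3 + e)) ≡⟨ gapProd-suc (suc r) 1ℤ (+ (2 + e)) ⟩
   gapProd (suc r) (+ 2) (+ (2 + e)) ≡⟨ gapProd-suc (suc r) (+ 2) (+ (1 + e)) ⟩
   gapProd (suc r) (+ 3) (+ (1 + e)) ≡⟨ gapProd-suc (suc r) (+ 3) (+ e) ⟩
   gapProd (suc r) (+ 4) (+ e) ≡⟨ gapProd-peel r (+ 4) (+ e) ⟩
   ((+ e) ⊕ 1ℤ) · gapProd r 1ℤ (+ e) ≡⟨ trans (cong (((+ e) ⊕ 1ℤ) ·_) g) (ℤP.*-zeroʳ ((+ e) ⊕ 1ℤ)) ⟩
   0ℤ ∎)
   where open ≡-Reasoning
 ... | inj₁ g = inj₁ (begin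
   pow C (suc r) ⋆ (Y ⊠ V) ≡⟨ trans (⋆-assoc C (pow C r) _) (trans (cong (C ⋆_) (sym (⋆-⊠ʳ (pow C r) Y V))) (sym (⋆-⊠ˡ C Y _))) ⟩
   (C ⋆ Y) ⊠ (pow C r ⋆ V) ≡⟨ cong₂ _⊠_ hY g ⟩
   (n ⋆ (a₁ ↑ 3)) ⊠ (pow n r ⋆ (P ⊠ a₁ ↑ e)) ≡⟨ trans (⋆-⊠ˡ n (a₁ ↑ 3) _) (trans (cong (n ⋆_) (⋆-⊠ʳ (pow n r) (a₁ ↑ 3) _)) (sym (⋆-assoc n (pow n r) _))) ⟩
   pow n (suc r) ⋆ (a₁ ↑ 3 ⊠ (P ⊠ a₁ ↑ e)) ≡⟨ cong (pow n (suc r) ⋆_) (trans (⊠-left-comm (a₁ ↑ 3) P _) (cong (P ⊠_) (sym (↑-+ a₁ 3 e)))) ⟩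
   pow n (suc r) ⋆ (P ⊠ a₁ ↑ (3 + e)) ∎)
   where
   open ≡-Reasoning
   V = monomial a₀ a₁ X Y r e
   P = a₀ ↑ ((1 + thrice r) ∸ e)

 abs-pow : ∀ c r → abs (pow c r) ≡ abs c ^ r
 abs-pow c zero = refl
 abs-pow c (suc r) = trans (ℤP.abs-* c (pow c r)) (cong (abs c *_) (abs-pow c r))

 +!≢0 : ∀ r → + (r !) ≢ 0ℤ
 +!≢0 r e = n>0⇒n≢0 (1≤n! r) (ℤP.+-injective e)

 +^≢0 : ∀ r → + (3 ^ r) ≢ 0ℤ
 +^≢0 r e = n>0⇒n≢0 (m^n>0 3 r) (ℤP.+-injective e)

 coeff-zero : ∀ r e → gapProd r 1ℤ (+ e) ≡ 0ℤ → coeff r e ≡ 0ℤ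
 coeff-zero r e g = nz (ℤP.i*j≡0⇒i≡0∨j≡0 (+ (r !)) (trans (coeff-eq r e) (trans (cong ((+ (3 ^ r)) ·_) g) (ℤP.*-zeroʳ (+ (3 ^ r))))))
   where
   nz : + (r !) ≡ 0ℤ ⊎ coeff r e ≡ 0ℤ → coeff r e ≡ 0ℤ
   nz (inj₁ p) = ⊥-elim (+!≢0 r p)
   nz (inj₂ p) = p

 opaque
   unfolding _⊞_

   0⋆ : ∀ x → 0ℤ ⋆ x ≡ 0Q
   0⋆ (a ,√ b) = Q-ext (ℤP.*-zeroˡ a) (ℤP.*-zeroˡ b)

   pair-size : ∀ y m → size ((+ y) ,√ (+ m)) ≡ y + κ * m
   pair-size y m = refl

 -- Thue's inequality for a pair of solutions

 module ThueForms (k≢0 : k ≢ 0ℤ) (κ≥1 : 1 ≤ κ) (y₁ m₁ y₂ m₂ n : ℕ) (c : ℤ) (lam : Q) (Λ : ℕ)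
   (m₁≥1 : 1 ≤ m₁) (hy₁ : κ * m₁ ≤ y₁) (hy₂ : κ * m₂ ≤ y₂) (lam≢0 : lam ≢ 0Q) (hΛ : size lam ≤ Λ) where

   private
     β₁ β₂ X Y z z̄ a₀ a₁ : Q
     β₁ = (+ y₁) ,√ (+ m₁)
     β₂ = (+ y₂) ,√ (+ m₂)
     X = β₁
     Y = conj β₁
     z = β₂
     z̄ = conj β₂
     a₀ = conj lam
     a₁ = lam
     C : ℤ
     C = pow c 3
     ε Xs q d h : ℕ
     ε = κ * m₂
     Xs = 2 * y₁
     q = abs (im lam)
     d = 2 * (κ * q)
     h = 2 * Λ

   -- The first summand is the cost of replacing β₂ and its conjugate by y₂, the factor 2^(3r)
   -- coming from the sum of the binomial coefficients. The second bounds the exact form; there `d`,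
   -- which bounds λ - conj λ, occurs to the power 2r.
   thueBound : ℕ → ℕ
   thueBound r = abs C ^ r * (2 ^ thrice r * (96 ^ r * (ε * (4 ^ r * y₂ ^ r) * (Λ * Xs ^ r))))
     + y₂ * (n ^ r * (Λ * (96 ^ r * d ^ (r + r) * h ^ r)))

   module _ (rel : C ⋆ (conj β₁ ⊠ β₂) ≡ (+ n) ⋆ (lam ↑ 3)) where

     private
       size-β : ∀ y m → κ * m ≤ y → size ((+ y) ,√ (+ m)) ≤ 2 * y
       size-β y m p = ≤-trans (≤-reflexive (pair-size y m)) (≤-trans (+-monoʳ-≤ y p) (≤-reflexive (l y)))
         where
         l : ∀ y → y + y ≡ 2 * y
         l = NS.solve-∀
       relY : C ⋆ (z ⊠ Y) ≡ (+ n) ⋆ (a₁ ↑ 3)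
       relY = trans (cong (C ⋆_) (⊠-comm z Y)) rel
       relX : C ⋆ (z̄ ⊠ X) ≡ (+ n) ⋆ (a₀ ↑ 3)
       relX = begin
         C ⋆ (conj β₂ ⊠ β₁) ≡⟨ cong (C ⋆_) (trans (⊠-comm (conj β₂) β₁) (cong (_⊠ conj β₂) (sym (conj-conj β₁)))) ⟩
         C ⋆ (conj (conj β₁) ⊠ conj β₂) ≡⟨ trans (cong (C ⋆_) (sym (conj-⊠ (conj β₁) β₂))) (sym (conj-⋆ C _)) ⟩
         conj (C ⋆ (conj β₁ ⊠ β₂)) ≡⟨ cong conj rel ⟩
         conj ((+ n) ⋆ (lam ↑ 3)) ≡⟨ trans (conj-⋆ (+ n) _) (cong ((+ n) ⋆_) (conj-↑ lam 3)) ⟩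
         (+ n) ⋆ (conj lam ↑ 3) ∎
         where open ≡-Reasoning
       V V″ : ℕ → ℕ → Q
       V = monomial a₀ a₁ X Y
       V″ = monomial a₀ a₁ (z̄ ⊠ X) (z ⊠ Y)
       hz̄ : size ((+ y₂) ⋆ 1Q ⊟ z̄) ≤ ε
       hz̄ = ≤-reflexive (trans (cong (λ t → size ((+ y₂) ⋆ 1Q ⊟ t)) (conj-pair (+ y₂) (+ m₂))) (trans (scalar-diff y₂ (⊖ (+ m₂))) (cong (κ *_) (ℤP.∣-i∣≡∣i∣ (+ m₂)))))
       open MonomialDiff a₀ a₁ X Y z z̄ Λ Xs y₂ ε
         (≤-trans (≤-reflexive (size-conj lam)) hΛ) hΛ (size-β y₁ m₁ hy₁) (≤-trans (≤-reflexive (size-conj β₁)) (size-β y₁ m₁ hy₁))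
         (≤-reflexive (scalar-diff y₂ (+ m₂))) hz̄ (size-β y₂ m₂ hy₂) (≤-trans (≤-reflexive (size-conj β₂)) (size-β y₂ m₂ hy₂))

     -- Built from λ and β₁ alone with integral coefficients, so its size is at least 1 unless it
     -- vanishes. The two values of `s` give the two forms of `forms-nonvanishing`.
     form : ℕ → ℕ → Q
     form r s = D (thrice r) (λ e → coeff r (s + e) ⋆ V r (s + e))

     private
       form-W : ∀ r s → (+ (r !)) ⋆ form r s ≡ (+ (3 ^ r)) ⋆ D (thrice r) (λ e → Wᶠ a₀ a₁ X Y r (s + e))
       form-W r s = trans (sym (D-⋆ (thrice r) (+ (r !)) _)) (trans (D-cong′ (thrice r) (λ e → trans (sym (⋆-assoc (+ (r !)) (coeff r (s + e)) _)) (trans (⋆-congˡ (V r (s + e)) (coeff-eq r (s + e))) (⋆-assoc (+ (3 ^ r)) (gapProd r 1ℤ (+ (s + e))) _)))) (D-⋆ (thrice r) (+ (3 ^ r)) _))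
       form-0 : ∀ r s → form r s ≡ 0Q → D (thrice r) (λ e → Wᶠ a₀ a₁ X Y r (s + e)) ≡ 0Q
       form-0 r s e = ⋆-cancel (+ (3 ^ r)) _ _ (+^≢0 r) (trans (sym (form-W r s)) (trans (cong ((+ (r !)) ⋆_) e) (trans (⋆-zeroʳ (+ (r !))) (sym (⋆-zeroʳ (+ (3 ^ r)))))))

     form-nonzero : ∀ r → ∃[ s ] (s ≤ 1 × form r s ≢ 0Q)
     form-nonzero r with form r 0 ≟Q 0Q | form r 1 ≟Q 0Q
     ... | no ne | _ = 0 , z≤n , ne
     ... | yes _ | no ne = 1 , ≤-refl , ne
     ... | yes e0 | yes e1 = ⊥-elim (lam≢0 (trans (sym (conj-conj lam)) (trans (cong conj
           (forms-nonvanishing a₀ a₁ X Y (conj-cancel k≢0 (+ y₁) (+ m₁) (λ e → n>0⇒n≢0 m₁≥1 (ℤP.+-injective e))) r (form-0 r 0 e0) (form-0 r 1 e1))) (trans (cong conj (sym (0⋆ 1Q))) (trans (conj-⋆ 0ℤ 1Q) (0⋆ _))))))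

     private
       pick : ℕ → Q
       pick zero = a₀
       pick (suc _) = a₁

       Vex-split : ∀ t s e → s ≤ 1 → e ≤ t → a₀ ↑ ((1 + t) ∸ (s + e)) ⊠ a₁ ↑ (s + e) ≡ pick s ⊠ (a₀ ↑ (t ∸ e) ⊠ a₁ ↑ e)
       Vex-split t zero e _ p = trans (cong (λ i → a₀ ↑ i ⊠ a₁ ↑ e) (+-∸-assoc 1 p)) (⊠-assoc a₀ _ _)
       Vex-split t (suc zero) e _ p = ⊠-left-comm (a₀ ↑ (t ∸ e)) a₁ _
       Vex-split t (suc (suc s)) e (s≤s ()) p

       pick-size : ∀ s → size (pick s) ≤ Λ
       pick-size zero = ≤-trans (≤-reflexive (size-conj lam)) hΛ
       pick-size (suc _) = hΛ

       module _ (r s : ℕ) (r≥1 : 1 ≤ r) (s≤1 : s ≤ 1) where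
         t = thrice r
         yr : ℤ
         yr = + (y₂ ^ r)
         D1 D2 D3 : Q
         D1 = D t (λ e → coeff r (s + e) ⋆ (yr ⋆ V r (s + e) ⊟ V″ r (s + e)))
         D2 = D t (λ e → coeff r (s + e) ⋆ V″ r (s + e))
         Vex : ℕ → Q
         Vex e = a₀ ↑ ((1 + t) ∸ e) ⊠ a₁ ↑ e
         D3 = D t (λ e → coeff r (s + e) ⋆ Vex (s + e))

         e-range : ∀ e → e ≤ t → s + e ≤ 1 + t
         e-range e p = +-mono-≤ s≤1 p

         decomposition : yr ⋆ form r s ≡ D1 ⊞ D2
         decomposition = trans (sym (D-⋆ t yr _)) (trans (D-cong′ t (λ e → trans (⋆-comm yr (coeff r (s + e)) _) (trans (cong (coeff r (s + e) ⋆_) (sym (⊟⊞ (yr ⋆ V r (s + e)) (V″ r (s + e))))) (⋆-distrib-⊞ (coeff r (s + e)) _ _)))) (D-⊞ t _ _))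

         exact : pow C r ⋆ D2 ≡ pow (+ n) r ⋆ D3
         exact = trans (sym (D-⋆ t (pow C r) _)) (trans (D-cong t (λ e p → trans (⋆-comm (pow C r) (coeff r (s + e)) _) (trans (pt (s + e) (e-range e p)) (⋆-comm (coeff r (s + e)) (pow (+ n) r) _)))) (D-⋆ t (pow (+ n) r) _))
           where
           pt : ∀ e → e ≤ 1 + t → coeff r e ⋆ (pow C r ⋆ V″ r e) ≡ coeff r e ⋆ (pow (+ n) r ⋆ Vex e)
           pt e p with monomial-exact a₀ a₁ (z̄ ⊠ X) (z ⊠ Y) C (+ n) relX relY r e p
           ... | inj₁ g = cong (coeff r e ⋆_) g
           ... | inj₂ g = trans (⋆-congˡ _ (coeff-zero r e g)) (trans (0⋆ _) (sym (trans (⋆-congˡ _ (coeff-zero r e g)) (0⋆ _))))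

         D1-bound : y₂ * size D1 ≤ 2 ^ t * (96 ^ r * bound r)
         D1-bound = begin
           y₂ * size D1 ≡⟨ sym (size-⋆ (+ y₂) D1) ⟩
           size ((+ y₂) ⋆ D1) ≡⟨ cong size (sym (D-⋆ t (+ y₂) _)) ⟩
           size (D t (λ e → (+ y₂) ⋆ (coeff r (s + e) ⋆ (yr ⋆ V r (s + e) ⊟ V″ r (s + e)))))
             ≤⟨ D-size t _ (96 ^ r * bound r) (λ e p → pt (s + e) (e-range e p)) ⟩
           2 ^ t * (96 ^ r * bound r) ∎
           where
           open ≤-Reasoning
           pt : ∀ e → e ≤ 1 + t → size ((+ y₂) ⋆ (coeff r e ⋆ (yr ⋆ V r e ⊟ V″ r e))) ≤ 96 ^ r * bound r
           pt e p = begin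
             size ((+ y₂) ⋆ (coeff r e ⋆ G)) ≡⟨ trans (size-⋆ (+ y₂) _) (cong (y₂ *_) (size-⋆ (coeff r e) G)) ⟩
             y₂ * (abs (coeff r e) * size G) ≡⟨ l y₂ (abs (coeff r e)) (size G) ⟩
             abs (coeff r e) * (y₂ * size G) ≤⟨ *-mono-≤ (coeff-bound r e r≥1 p) (monomial-diff r e) ⟩
             96 ^ r * bound r ∎
             where
             G = yr ⋆ V r e ⊟ V″ r e
             l : ∀ a b c → a * (b * c) ≡ b * (a * c)
             l = NS.solve-∀

         aₛ : Q
         aₛ = pick s

         P : ℕ → Q
         P e = a₀ ↑ (t ∸ e) ⊠ a₁ ↑ e

         d-bound : size (a₀ ⊟ a₁) ≤ d
         d-bound = ≤-reflexive (trans (cong size (conj-diff lam)) (trans (size-im≤ (⊖ ((+ 2) · im lam))) (trans (cong (κ *_) (trans (ℤP.∣-i∣≡∣i∣ ((+ 2) · im lam)) (ℤP.abs-* (+ 2) (im lam)))) (l κ q))))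
           where
           l : ∀ a b → a * (2 * b) ≡ 2 * (a * b)
           l = NS.solve-∀

         -- The r linear factors of `gapProd` use up at most r of the 3r differences, so (conj λ -
         -- λ)^(2r) survives.
         core : size (D t (λ e → gapProd r 1ℤ (+ (s + e)) ⋆ P e)) ≤ (8 * r) ^ r * d ^ (r + r) * h ^ r
         core = subst₂ (λ N j → size (D N (λ e → gapProd r 1ℤ (+ (s + e)) ⋆ (a₀ ↑ (N ∸ e) ⊠ a₁ ↑ e))) ≤ (8 * r) ^ j * d ^ (r + r) * h ^ j) len (length-steps r 1ℤ)
           (D-linProd-size a₀ a₁ d h (8 * r) d-bound (≤-trans hΛ (m≤m+n Λ (Λ + 0))) (*-monoʳ-≤ 2 (≤-trans (im≤size κ≥1 lam) hΛ)) (steps r 1ℤ) (r + r) s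
             (All.map (λ {c} p → bnd c p) (steps-bound r)))
           where
           len : length (steps r 1ℤ) + (r + r) ≡ t
           len = trans (cong (λ i → i + (r + r)) (length-steps r 1ℤ)) (trans (l r) (sym (thrice≡ r)))
             where
             l : ∀ r → r + (r + r) ≡ 3 * r
             l = NS.solve-∀
           bnd : ∀ c → abs c ≤ 1 + 3 * r → abs c + s + (length (steps r 1ℤ) + (r + r)) ≤ 8 * r
           bnd c p = begin
             abs c + s + (length (steps r 1ℤ) + (r + r)) ≡⟨ cong (λ i → abs c + s + (i + (r + r))) (length-steps r 1ℤ) ⟩
             abs c + s + (r + (r + r)) ≤⟨ +-monoˡ-≤ (r + (r + r)) (+-mono-≤ (≤-trans p (+-monoˡ-≤ (3 * r) r≥1)) (≤-trans s≤1 r≥1)) ⟩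
             (r + 3 * r) + r + (r + (r + r)) ≡⟨ l r ⟩
             8 * r ∎
             where
             open ≤-Reasoning
             l : ∀ r → (r + 3 * r) + r + (r + (r + r)) ≡ 8 * r
             l = NS.solve-∀

         D3-bound : size D3 ≤ Λ * (96 ^ r * d ^ (r + r) * h ^ r)
         D3-bound = *-cancelˡ-≤ (r !) {{r !≢0}} (begin
           r ! * size D3 ≡⟨ sym (size-⋆ (+ (r !)) D3) ⟩
           size ((+ (r !)) ⋆ D3) ≡⟨ cong size eq ⟩
           size ((+ (3 ^ r)) ⋆ (aₛ ⊠ G)) ≡⟨ size-⋆ (+ (3 ^ r)) _ ⟩
           3 ^ r * size (aₛ ⊠ G) ≤⟨ *-monoʳ-≤ (3 ^ r) (≤-trans (size-⊠ aₛ G) (*-mono-≤ (pick-size s) core)) ⟩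
           3 ^ r * (Λ * ((8 * r) ^ r * d ^ (r + r) * h ^ r)) ≤⟨ *-monoʳ-≤ (3 ^ r) (*-monoʳ-≤ Λ (*-monoˡ-≤ (h ^ r) (*-monoˡ-≤ (d ^ (r + r)) ([a*n]^n≤ 8 r)))) ⟩
           3 ^ r * (Λ * (32 ^ r * r ! * d ^ (r + r) * h ^ r)) ≡⟨ l (3 ^ r) Λ (32 ^ r) (r !) (d ^ (r + r)) (h ^ r) ⟩
           r ! * (Λ * (3 ^ r * 32 ^ r * d ^ (r + r) * h ^ r)) ≡⟨ cong (λ i → r ! * (Λ * (i * d ^ (r + r) * h ^ r))) (sym (*-^ r 3 32)) ⟩
           r ! * (Λ * (96 ^ r * d ^ (r + r) * h ^ r)) ∎)
           where
           open ≤-Reasoning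
           G = D t (λ e → gapProd r 1ℤ (+ (s + e)) ⋆ P e)
           l : ∀ a b c f d h → a * (b * (c * f * d * h)) ≡ f * (b * (a * c * d * h))
           l = NS.solve-∀
           eq : (+ (r !)) ⋆ D3 ≡ (+ (3 ^ r)) ⋆ (aₛ ⊠ G)
           eq = trans (sym (D-⋆ t (+ (r !)) _)) (trans (D-cong t pt) (trans (D-⋆ t (+ (3 ^ r)) _) (cong ((+ (3 ^ r)) ⋆_) (D-⊠ t aₛ _))))
             where
             pt : ∀ e → e ≤ t → (+ (r !)) ⋆ (coeff r (s + e) ⋆ Vex (s + e)) ≡ (+ (3 ^ r)) ⋆ (aₛ ⊠ (gapProd r 1ℤ (+ (s + e)) ⋆ P e))
             pt e p = trans (sym (⋆-assoc (+ (r !)) (coeff r (s + e)) _)) (trans (⋆-congˡ _ (coeff-eq r (s + e))) (trans (⋆-assoc (+ (3 ^ r)) (gapProd r 1ℤ (+ (s + e))) _)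
               (cong ((+ (3 ^ r)) ⋆_) (trans (cong (gapProd r 1ℤ (+ (s + e)) ⋆_) (Vex-split t s e s≤1 p)) (sym (⋆-⊠ʳ (gapProd r 1ℤ (+ (s + e))) aₛ _))))))

         -- y₂^r times the form is D1 + D2, where D1 is the approximation error. After
         -- multiplication by C^r, D2 becomes n^r D3 with true powers of λ and conj λ, so that
         -- `core` applies. A nonzero left side has size at least y₂^r.
         estimate : form r s ≢ 0Q → y₂ * (abs C ^ r * y₂ ^ r) ≤ thueBound r
         estimate ne = begin
           y₂ * (A * y₂ ^ r) ≡⟨ cong (λ i → y₂ * (A * i)) (sym (*-identityʳ (y₂ ^ r))) ⟩
           y₂ * (A * (y₂ ^ r * 1)) ≤⟨ *-monoʳ-≤ y₂ (*-monoʳ-≤ A (*-monoʳ-≤ (y₂ ^ r) (size≥1 κ≥1 (form r s) ne))) ⟩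
           y₂ * (A * (y₂ ^ r * size (form r s))) ≡⟨ cong (λ i → y₂ * (A * i)) (trans (sym (size-⋆ yr (form r s))) (cong size decomposition)) ⟩
           y₂ * (A * size (D1 ⊞ D2)) ≤⟨ *-monoʳ-≤ y₂ (*-monoʳ-≤ A (size-⊞ D1 D2)) ⟩
           y₂ * (A * (size D1 + size D2)) ≡⟨ l y₂ A (size D1) (size D2) ⟩
           A * (y₂ * size D1) + y₂ * (A * size D2) ≡⟨ cong (λ i → A * (y₂ * size D1) + y₂ * i) e2 ⟩
           A * (y₂ * size D1) + y₂ * (n ^ r * size D3) ≤⟨ +-mono-≤ (*-monoʳ-≤ A D1-bound) (*-monoʳ-≤ y₂ (*-monoʳ-≤ (n ^ r) D3-bound)) ⟩
           thueBound r ∎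
           where
           open ≤-Reasoning
           A = abs C ^ r
           l : ∀ y a b c → y * (a * (b + c)) ≡ a * (y * b) + y * (a * c)
           l = NS.solve-∀
           e2 : A * size D2 ≡ n ^ r * size D3
           e2 = trans (cong (_* size D2) (sym (abs-pow C r))) (trans (sym (size-⋆ (pow C r) D2)) (trans (cong size exact) (trans (size-⋆ (pow (+ n) r) D3) (cong (_* size D3) (abs-pow (+ n) r)))))

     thue-inequality : ∀ r → 1 ≤ r → y₂ * (abs C ^ r * y₂ ^ r) ≤ thueBound r
     thue-inequality r r≥1 with form-nonzero r
     ... | s , s≤1 , ne = estimate r s r≥1 s≤1 ne

 open ThueForms

 -- Contradiction with Thue's inequality

 sq-cancel-≤ : ∀ {a b} → a * a ≤ b * b → a ≤ b
 sq-cancel-≤ {a} {b} p with a ≤? b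
 ... | yes q = q
 ... | no q = ⊥-elim (<⇒≱ (*-mono-< (≰⇒> q) (≰⇒> q)) p)

 2^thrice : ∀ r → 2 ^ thrice r ≡ 8 ^ r
 2^thrice zero = refl
 2^thrice (suc r) = trans (l (2 ^ thrice r)) (cong (8 *_) (2^thrice r))
   where
   l : ∀ a → 2 * (2 * (2 * a)) ≡ 8 * a
   l = NS.solve-∀

 ^-pos : ∀ {a} n → 1 ≤ a → 1 ≤ a ^ n
 ^-pos {a} n p = m^n>0 a {{>-nonZero p}} n

 -- `s₁` and `s₂` stand for √u₁ and √u₂; `P` absorbs all constants and powers of N. The exponent 24
 -- and r ≥ 6 are matched: the two terms need 2r + 7 < 24 (r - 1) and 10r + 4 < 24 (r - 3), and the
 -- latter fails at r = 5.
 module ThueNumeric (P s₁ s₂ r : ℕ) (P≥2 : 2 ≤ P) (s₁≥ : P ^ 24 ≤ s₁) (s₂≥1 : 1 ≤ s₂) (r≥6 : 6 ≤ r)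
   (low : s₁ ^ (r + r) ≤ P * s₂) (high : s₂ ≤ (P * s₁) ^ (r + r + 2)) where

   private
     P≥1 : 1 ≤ P
     P≥1 = ≤-trans (s≤s z≤n) P≥2
     s₁≥1 : 1 ≤ s₁
     s₁≥1 = ≤-trans (^-pos 24 P≥1) s₁≥

   no-power : ∀ a b → b < 24 * a → ¬ (s₁ ^ a ≤ P ^ b)
   no-power a b lt p = <⇒≱ (^-monoʳ-< P P≥2 lt) (≤-trans (≤-reflexive (sym (^-*-assoc P 24 a))) (≤-trans (^-monoˡ-≤ a s₁≥) p))

   -- Up to powers of `P` we have y₁ ≤ s₁³, Λ ≤ s₁ s₂ and y₂ ≥ s₂³, so the claim amounts to
   -- s₁^(3r+1) < s₂²; the lower bound s₂ ≥ s₁^(2r) gives that with s₁^(r-1) to spare. The number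
   -- 6144 is 8 · 96 · 4 · 2.
   term₁ : ∀ {y₁ y₂ ε Λ} → s₂ * s₂ * s₂ ≤ P * y₂ → y₁ ≤ P * (s₁ * s₁ * s₁) → ε ≤ P * P → Λ ≤ P * (s₁ * s₂) → 6144 ≤ P →
     2 * ((6144 * y₁) ^ r * (ε * Λ)) < y₂
   term₁ {y₁} {y₂} {ε} {Λ} hy₂ hy₁ hε hΛ hP = ≰⇒> (λ h → no-power (r ∸ 1) (2 * r + 7) lt (fin h))
     where
     open ≤-Reasoning
     lt : 2 * r + 7 < 24 * (r ∸ 1)
     lt = subst (λ i → 2 * i + 7 < 24 * (i ∸ 1)) (m+[n∸m]≡n r≥6) (≤-trans (m≤m+n _ (22 * (r ∸ 6) + 100)) (≤-reflexive (l (r ∸ 6))))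
       where
       l : ∀ j → suc (2 * (6 + j) + 7) + (22 * j + 100) ≡ 24 * (5 + j)
       l = NS.solve-∀
     x = s₁ ^ r
     p = P ^ r
     a : y₂ ≤ 2 * ((6144 * y₁) ^ r * (ε * Λ)) → s₂ * s₂ * s₂ ≤ P ^ 5 * p * p * (x * x * x) * s₁ * s₂
     a h = begin
       s₂ * s₂ * s₂ ≤⟨ hy₂ ⟩
       P * y₂ ≤⟨ *-monoʳ-≤ P h ⟩
       P * (2 * ((6144 * y₁) ^ r * (ε * Λ)))
         ≤⟨ *-monoʳ-≤ P (*-mono-≤ P≥2 (*-mono-≤ (^-monoˡ-≤ r (*-mono-≤ hP hy₁)) (*-mono-≤ hε hΛ))) ⟩
       P * (P * ((P * (P * (s₁ * s₁ * s₁))) ^ r * (P * P * (P * (s₁ * s₂)))))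
         ≡⟨ cong (λ t → P * (P * (t * (P * P * (P * (s₁ * s₂)))))) (trans (*-^ r P _) (cong (p *_) (trans (*-^ r P _) (cong (p *_) (trans (*-^ r (s₁ * s₁) s₁) (cong (_* x) (*-^ r s₁ s₁))))))) ⟩
       P * (P * (p * (p * (x * x * x)) * (P * P * (P * (s₁ * s₂))))) ≡⟨ l P p x s₁ s₂ ⟩
       P ^ 5 * p * p * (x * x * x) * s₁ * s₂ ∎
       where
       l : ∀ P p x s t → P * (P * (p * (p * (x * x * x)) * (P * P * (P * (s * t))))) ≡ P * (P * (P * (P * (P * 1)))) * p * p * (x * x * x) * s * t
       l = NS.solve-∀
     b : y₂ ≤ 2 * ((6144 * y₁) ^ r * (ε * Λ)) → s₂ * s₂ ≤ P ^ 5 * p * p * (x * x * x) * s₁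
     b h = *-cancelʳ-≤ (s₂ * s₂) _ s₂ {{>-nonZero s₂≥1}} (a h)
     c : y₂ ≤ 2 * ((6144 * y₁) ^ r * (ε * Λ)) → x * (x * x * x) ≤ P ^ 7 * p * p * s₁ * (x * x * x)
     c h = begin
       x * (x * x * x) ≡⟨ l x ⟩
       (x * x) * (x * x) ≡⟨ cong (λ t → t * t) (sym (^-distribˡ-+-* s₁ r r)) ⟩
       s₁ ^ (r + r) * s₁ ^ (r + r) ≤⟨ *-mono-≤ low low ⟩
       P * s₂ * (P * s₂) ≡⟨ l' P s₂ ⟩
       P * P * (s₂ * s₂) ≤⟨ *-monoʳ-≤ (P * P) (b h) ⟩
       P * P * (P ^ 5 * p * p * (x * x * x) * s₁) ≡⟨ l″ P (P ^ 5) p (x * x * x) s₁ ⟩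
       P ^ 7 * p * p * s₁ * (x * x * x) ∎
       where
       l : ∀ x → x * (x * x * x) ≡ (x * x) * (x * x)
       l = NS.solve-∀
       l' : ∀ P s → P * s * (P * s) ≡ P * P * (s * s)
       l' = NS.solve-∀
       l″ : ∀ P q p x s → P * P * (q * p * p * x * s) ≡ P * (P * q) * p * p * s * x
       l″ = NS.solve-∀
     x≥1 : 1 ≤ x * x * x
     x≥1 = *-mono-≤ (*-mono-≤ (^-pos r s₁≥1) (^-pos r s₁≥1)) (^-pos r s₁≥1)
     fin : y₂ ≤ 2 * ((6144 * y₁) ^ r * (ε * Λ)) → s₁ ^ (r ∸ 1) ≤ P ^ (2 * r + 7)
     fin h = *-cancelʳ-≤ (s₁ ^ (r ∸ 1)) _ s₁ {{>-nonZero s₁≥1}} (begin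
       s₁ ^ (r ∸ 1) * s₁ ≡⟨ *-comm _ s₁ ⟩
       s₁ ^ (1 + (r ∸ 1)) ≡⟨ cong (s₁ ^_) (m+[n∸m]≡n (≤-trans (s≤s z≤n) r≥6)) ⟩
       x ≤⟨ *-cancelʳ-≤ x _ (x * x * x) {{>-nonZero x≥1}} (c h) ⟩
       P ^ 7 * p * p * s₁ ≡⟨ cong (_* s₁) (trans (l (P ^ 7) p) (trans (cong (_* P ^ 7) (trans (sym (^-distribˡ-+-* P r r)) (cong (P ^_) (cong (λ i → r + i) (sym (+-identityʳ r)))))) (sym (^-distribˡ-+-* P (2 * r) 7)))) ⟩
       P ^ (2 * r + 7) * s₁ ∎)
       where
       l : ∀ q p → q * p * p ≡ p * p * q
       l = NS.solve-∀

   -- Up to powers of `P` we have q ≤ s₂ / s₁², hence q² Λ ≤ (s₂ / s₁)³, against y₂ ≥ s₂³. There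
   -- remains s₁ s₂ < s₁^(3r), where the upper bound s₂ ≤ s₁^(2r+2) enters. The number 768 is 96 · 4
   -- · 2.
   term₂ : ∀ {y₂ Λ q n κ'} → s₂ * s₂ * s₂ ≤ P * y₂ → Λ ≤ P * (s₁ * s₂) → q * (s₁ * s₁) ≤ P * s₂ → n ≤ P → κ' ≤ P → 768 ≤ P →
     2 * (n ^ r * (Λ * (96 ^ r * (2 * (κ' * q)) ^ (r + r) * (2 * Λ) ^ r))) < y₂ ^ r
   term₂ {y₂} {Λ} {q} {n} {κ'} hy₂ hΛ hq hn hκ hP = ≰⇒> (λ h → no-power (r ∸ 3) (10 * r + 4) lt (fin h))
     where
     open ≤-Reasoning
     lt : 10 * r + 4 < 24 * (r ∸ 3)
     lt = subst (λ i → 10 * i + 4 < 24 * (i ∸ 3)) (m+[n∸m]≡n r≥6) (≤-trans (m≤m+n _ (14 * (r ∸ 6) + 7)) (≤-reflexive (l (r ∸ 6))))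
       where
       l : ∀ j → suc (10 * (6 + j) + 4) + (14 * j + 7) ≡ 24 * (3 + j)
       l = NS.solve-∀
     d = 2 * (κ' * q)
     h' = 2 * Λ
     G = n * (96 * (d * d) * h')
     pw : n ^ r * (Λ * (96 ^ r * d ^ (r + r) * h' ^ r)) ≡ Λ * G ^ r
     pw = sym (trans (cong (Λ *_) (trans (*-^ r n _) (cong (n ^ r *_) (trans (*-^ r (96 * (d * d)) h') (cong (_* h' ^ r) (trans (*-^ r 96 (d * d)) (cong (96 ^ r *_) (trans (*-^ r d d) (sym (^-distribˡ-+-* d r r))))))))))
       (l Λ (n ^ r) (96 ^ r * d ^ (r + r) * h' ^ r)))
       where
       l : ∀ a b c → a * (b * c) ≡ b * (a * c)
       l = NS.solve-∀
     base : G * (s₁ * s₁ * s₁) ≤ P ^ 8 * y₂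
     base = *-cancelʳ-≤ _ _ s₁ {{>-nonZero s₁≥1}} (begin
       G * (s₁ * s₁ * s₁) * s₁ ≡⟨ l n κ' q Λ s₁ ⟩
       768 * (κ' * κ') * n * Λ * (q * (s₁ * s₁) * (q * (s₁ * s₁)))
         ≤⟨ *-mono-≤ (*-mono-≤ (*-mono-≤ (*-mono-≤ hP (*-mono-≤ hκ hκ)) hn) hΛ) (*-mono-≤ hq hq) ⟩
       P * (P * P) * P * (P * (s₁ * s₂)) * (P * s₂ * (P * s₂)) ≡⟨ l' P s₁ s₂ ⟩
       P ^ 7 * (s₂ * s₂ * s₂) * s₁ ≤⟨ *-monoˡ-≤ s₁ (*-monoʳ-≤ (P ^ 7) hy₂) ⟩
       P ^ 7 * (P * y₂) * s₁ ≡⟨ cong (_* s₁) (l″ P (P ^ 7) y₂) ⟩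
       P ^ 8 * y₂ * s₁ ∎)
       where
       l : ∀ n κ q Λ s → n * (96 * (2 * (κ * q) * (2 * (κ * q))) * (2 * Λ)) * (s * s * s) * s ≡ 768 * (κ * κ) * n * Λ * (q * (s * s) * (q * (s * s)))
       l = NS.solve-∀
       l' : ∀ P s t → P * (P * P) * P * (P * (s * t)) * (P * t * (P * t)) ≡ P * (P * (P * (P * (P * (P * (P * 1)))))) * (t * t * t) * s
       l' = NS.solve-∀
       l″ : ∀ P q y → q * (P * y) ≡ P * q * y
       l″ = NS.solve-∀
     x = s₁ ^ r
     e8 : (P ^ 8 * y₂) ^ r ≡ P ^ (8 * r) * y₂ ^ r
     e8 = trans (*-^ r (P ^ 8) y₂) (cong (_* y₂ ^ r) (^-*-assoc P 8 r))
     y₂≥1 : 1 ≤ y₂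
     y₂≥1 = n≢0⇒n>0 (λ e → <⇒≱ (*-mono-≤ (*-mono-≤ s₂≥1 s₂≥1) s₂≥1) (≤-trans hy₂ (≤-reflexive (trans (cong (P *_) e) (*-zeroʳ P)))))
     a : y₂ ^ r ≤ 2 * (n ^ r * (Λ * (96 ^ r * d ^ (r + r) * h' ^ r))) → x * x * x * y₂ ^ r ≤ 2 * Λ * P ^ (8 * r) * y₂ ^ r
     a h = begin
       x * x * x * y₂ ^ r ≤⟨ *-monoʳ-≤ (x * x * x) h ⟩
       x * x * x * (2 * (n ^ r * (Λ * (96 ^ r * d ^ (r + r) * h' ^ r)))) ≡⟨ cong (λ t → x * x * x * (2 * t)) pw ⟩
       x * x * x * (2 * (Λ * G ^ r)) ≡⟨ l (x * x * x) Λ (G ^ r) ⟩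
       2 * Λ * (G ^ r * (x * x * x)) ≡⟨ cong (λ t → 2 * Λ * (G ^ r * t)) (sym (trans (*-^ r (s₁ * s₁) s₁) (cong (_* x) (*-^ r s₁ s₁)))) ⟩
       2 * Λ * (G ^ r * (s₁ * s₁ * s₁) ^ r) ≡⟨ cong (2 * Λ *_) (sym (*-^ r G _)) ⟩
       2 * Λ * (G * (s₁ * s₁ * s₁)) ^ r ≤⟨ *-monoʳ-≤ (2 * Λ) (^-monoˡ-≤ r base) ⟩
       2 * Λ * (P ^ 8 * y₂) ^ r ≡⟨ trans (cong (2 * Λ *_) e8) (sym (*-assoc (2 * Λ) _ _)) ⟩
       2 * Λ * P ^ (8 * r) * y₂ ^ r ∎
       where
       l : ∀ a b c → a * (2 * (b * c)) ≡ 2 * b * (c * a)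
       l = NS.solve-∀
     b : y₂ ^ r ≤ 2 * (n ^ r * (Λ * (96 ^ r * d ^ (r + r) * h' ^ r))) → x * x * x ≤ 2 * Λ * P ^ (8 * r)
     b h = *-cancelʳ-≤ _ _ (y₂ ^ r) {{>-nonZero (^-pos r y₂≥1)}} (a h)
     Q' = P ^ (r + r + 2)
     fin : y₂ ^ r ≤ 2 * (n ^ r * (Λ * (96 ^ r * d ^ (r + r) * h' ^ r))) → s₁ ^ (r ∸ 3) ≤ P ^ (10 * r + 4)
     fin h = *-cancelʳ-≤ _ _ (s₁ * s₁ * s₁ * (x * x)) {{>-nonZero (*-mono-≤ (*-mono-≤ (*-mono-≤ s₁≥1 s₁≥1) s₁≥1) (*-mono-≤ (^-pos r s₁≥1) (^-pos r s₁≥1)))}} (begin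
       s₁ ^ (r ∸ 3) * (s₁ * s₁ * s₁ * (x * x)) ≡⟨ l (s₁ ^ (r ∸ 3)) s₁ x ⟩
       s₁ ^ (3 + (r ∸ 3)) * (x * x) ≡⟨ cong (λ t → s₁ ^ t * (x * x)) (m+[n∸m]≡n (≤-trans (s≤s (s≤s (s≤s z≤n))) r≥6)) ⟩
       x * (x * x) ≡⟨ sym (*-assoc x x x) ⟩
       x * x * x ≤⟨ b h ⟩
       2 * Λ * P ^ (8 * r) ≤⟨ *-monoˡ-≤ (P ^ (8 * r)) (*-mono-≤ P≥2 (≤-trans hΛ (*-monoʳ-≤ P (*-monoʳ-≤ s₁ high)))) ⟩
       P * (P * (s₁ * (P * s₁) ^ (r + r + 2))) * P ^ (8 * r)
         ≡⟨ cong (λ t → P * (P * (s₁ * t)) * P ^ (8 * r)) (trans (*-^ (r + r + 2) P s₁) (cong (Q' *_) (trans (^-distribˡ-+-* s₁ (r + r) 2) (cong (_* s₁ ^ 2) (^-distribˡ-+-* s₁ r r))))) ⟩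
       P * (P * (s₁ * (Q' * (x * x * s₁ ^ 2)))) * P ^ (8 * r) ≡⟨ l' P s₁ Q' x (P ^ (8 * r)) ⟩
       (P ^ 2 * Q') * P ^ (8 * r) * (s₁ * s₁ * s₁ * (x * x)) ≡⟨ cong (_* (s₁ * s₁ * s₁ * (x * x))) (trans (cong (_* P ^ (8 * r)) (sym (^-distribˡ-+-* P 2 (r + r + 2)))) (trans (sym (^-distribˡ-+-* P (2 + (r + r + 2)) (8 * r))) (cong (P ^_) (l″ r)))) ⟩
       P ^ (10 * r + 4) * (s₁ * s₁ * s₁ * (x * x)) ∎)
       where
       l : ∀ a s x → a * (s * s * s * (x * x)) ≡ s * (s * (s * a)) * (x * x)
       l = NS.solve-∀
       l' : ∀ P s q x e → P * (P * (s * (q * (x * x * (s * (s * 1)))))) * e ≡ (P * (P * 1) * q) * e * (s * s * s * (x * x))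
       l' = NS.solve-∀
       l″ : ∀ r → 2 + (r + r + 2) + 8 * r ≡ 10 * r + 4
       l″ = NS.solve-∀

   contradiction₁₂ : ∀ {y₁ y₂ m₂ n Λ q κ' A} → s₂ * s₂ * s₂ ≤ P * y₂ → y₁ ≤ P * (s₁ * s₁ * s₁) → m₂ ≤ P → κ' ≤ P → n ≤ P →
     Λ ≤ P * (s₁ * s₂) → q * (s₁ * s₁) ≤ P * s₂ → 6144 ≤ P → 1 ≤ A →
     ¬ (y₂ * (A ^ r * y₂ ^ r) ≤ A ^ r * (2 ^ thrice r * (96 ^ r * (κ' * m₂ * (4 ^ r * y₂ ^ r) * (Λ * (2 * y₁) ^ r))))
         + y₂ * (n ^ r * (Λ * (96 ^ r * (2 * (κ' * q)) ^ (r + r) * (2 * Λ) ^ r))))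
   contradiction₁₂ {y₁} {y₂} {m₂} {n} {Λ} {q} {κ'} {A} hy₂ hy₁ hm hκ hn hΛ hq hP hA H = <⇒≱ strictly (*-monoʳ-≤ 2 H)
     where
     open ≤-Reasoning
     Z₁ = (6144 * y₁) ^ r * (κ' * m₂ * Λ)
     Z₂ = n ^ r * (Λ * (96 ^ r * (2 * (κ' * q)) ^ (r + r) * (2 * Λ) ^ r))
     t₁ : 2 * Z₁ < y₂
     t₁ = term₁ hy₂ hy₁ (*-mono-≤ hκ hm) hΛ hP
     t₂ : 2 * Z₂ < y₂ ^ r
     t₂ = term₂ hy₂ hΛ hq hn hκ (≤-trans (m≤m+n 768 5376) hP)
     y₂≥1 : 1 ≤ y₂
     y₂≥1 = ≤-trans (s≤s z≤n) t₁
     e₁ : 2 ^ thrice r * (96 ^ r * (κ' * m₂ * (4 ^ r * y₂ ^ r) * (Λ * (2 * y₁) ^ r))) ≡ Z₁ * y₂ ^ r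
     e₁ = begin-equality
       2 ^ thrice r * (96 ^ r * (κ' * m₂ * (4 ^ r * y₂ ^ r) * (Λ * (2 * y₁) ^ r))) ≡⟨ cong (λ t → t * (96 ^ r * (κ' * m₂ * (4 ^ r * y₂ ^ r) * (Λ * (2 * y₁) ^ r)))) (2^thrice r) ⟩
       8 ^ r * (96 ^ r * (κ' * m₂ * (4 ^ r * y₂ ^ r) * (Λ * (2 * y₁) ^ r))) ≡⟨ l (8 ^ r) (96 ^ r) (κ' * m₂) (4 ^ r) (y₂ ^ r) Λ ((2 * y₁) ^ r) ⟩
       8 ^ r * 96 ^ r * 4 ^ r * (2 * y₁) ^ r * (κ' * m₂ * Λ) * y₂ ^ r
         ≡⟨ cong (λ t → t * (κ' * m₂ * Λ) * y₂ ^ r) (trans (cong (_* (2 * y₁) ^ r) (trans (cong (_* 4 ^ r) (sym (*-^ r 8 96))) (sym (*-^ r 768 4)))) (trans (sym (*-^ r 3072 (2 * y₁))) (cong (_^ r) (l' y₁)))) ⟩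
       Z₁ * y₂ ^ r ∎
       where
       l : ∀ a b e f y L x → a * (b * (e * (f * y) * (L * x))) ≡ a * b * f * x * (e * L) * y
       l = NS.solve-∀
       l' : ∀ y → 3072 * (2 * y) ≡ 6144 * y
       l' = NS.solve-∀
     W' = A ^ r * y₂ ^ r
     strictly : 2 * (A ^ r * (2 ^ thrice r * (96 ^ r * (κ' * m₂ * (4 ^ r * y₂ ^ r) * (Λ * (2 * y₁) ^ r)))) + y₂ * Z₂) < 2 * (y₂ * W')
     strictly = begin-strict
       2 * (A ^ r * (2 ^ thrice r * (96 ^ r * (κ' * m₂ * (4 ^ r * y₂ ^ r) * (Λ * (2 * y₁) ^ r)))) + y₂ * Z₂) ≡⟨ cong (λ t → 2 * (A ^ r * t + y₂ * Z₂)) e₁ ⟩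
       2 * (A ^ r * (Z₁ * y₂ ^ r) + y₂ * Z₂) ≡⟨ l (A ^ r) Z₁ (y₂ ^ r) y₂ Z₂ ⟩
       2 * Z₁ * W' + y₂ * (2 * Z₂) <⟨ +-mono-<-≤ (*-monoˡ-< W' {{>-nonZero (*-mono-≤ (^-pos r hA) (^-pos r y₂≥1))}} t₁) (*-monoʳ-≤ y₂ (≤-trans (<⇒≤ t₂) (m≤n*m (y₂ ^ r) (A ^ r) {{>-nonZero (^-pos r hA)}}))) ⟩
       y₂ * W' + y₂ * W' ≡⟨ l' (y₂ * W') ⟩
       2 * (y₂ * W') ∎
       where
       l : ∀ a z y s w → 2 * (a * (z * y) + s * w) ≡ 2 * z * (a * y) + s * (2 * w)
       l = NS.solve-∀
       l' : ∀ a → a + a ≡ 2 * a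
       l' = NS.solve-∀

 -- Points in the cusp and the gap principle

 IsNat : ℤ → Set
 IsNat x = ∃[ n ] (x ≡ + n)

 isNat-+ : ∀ {x y} → IsNat x → IsNat y → IsNat (x ⊕ y)
 isNat-+ (m , refl) (n , refl) = m + n , refl

 isNat-* : ∀ {x y} → IsNat x → IsNat y → IsNat (x · y)
 isNat-* (m , refl) (n , refl) = m * n , sym (ℤP.pos-* m n)

 negative? : ℤ → ℕ
 negative? (+ _) = 0
 negative? -[1+ _ ] = 1

 negative?<2 : ∀ x → negative? x < 2
 negative?<2 (+ _) = s≤s z≤n
 negative?<2 -[1+ _ ] = s≤s (s≤s z≤n)

 same-sign : ∀ x y → negative? x ≡ negative? y → IsNat (x · y)
 same-sign (+ m) (+ n) _ = m * n , sym (ℤP.pos-* m n)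
 same-sign -[1+ m ] -[1+ n ] _ = suc m * suc n , refl

 square-nat : ∀ x → IsNat (x · x)
 square-nat x = same-sign x x refl

 -- Since ξ² = (re² + k im²) + 2 re im √k, these record, for negative k, the quadrant of ξ².
 sector₁ sector₂ : Q → ℕ
 sector₁ ξ = negative? (re ξ · re ξ ⊕ k · im ξ · im ξ)
 sector₂ ξ = negative? (re ξ · im ξ)

 opaque
   unfolding _⊞_

   -- The bracket is the norm plus twice the rational part of x². Where `sector-nat` makes that part
   -- nonnegative, im (x³) is at least im x times a positive norm in absolute value.
   im-cube : ∀ x → im (x ↑ 3) ≡ im x · (norm x ⊕ (+ 2) · (re x · re x ⊕ k · im x · im x))
   im-cube (p ,√ q) = l k p q
     where
     l : ∀ k p q → p · (p · (p · 0ℤ ⊕ q · 1ℤ) ⊕ q · (p · 1ℤ ⊕ k · q · 0ℤ)) ⊕ q · (p · (p · 1ℤ ⊕ k · q · 0ℤ) ⊕ k · q · (p · 0ℤ ⊕ q · 1ℤ))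
       ≡ q · ((p · p ⊖ k · q · q) ⊕ (+ 2) · (p · p ⊕ k · q · q))
     l = ZS.solve-∀

   -- For negative k, a common sector keeps the argument of conj ξ₁ ⊠ ξ₂ within 45° of the real axis.
   sector-nat : ∀ ξ₁ ξ₂ → sector₁ ξ₁ ≡ sector₁ ξ₂ → sector₂ ξ₁ ≡ sector₂ ξ₂ →
     IsNat (re (conj ξ₁ ⊠ ξ₂) · re (conj ξ₁ ⊠ ξ₂) ⊕ k · im (conj ξ₁ ⊠ ξ₂) · im (conj ξ₁ ⊠ ξ₂))
   sector-nat (a ,√ b) (c ,√ d) h₁ h₂ = go k refl
     where
     p q : ℤ
     p = a · c ⊕ k · (⊖ b) · d
     q = a · d ⊕ (⊖ b) · c
     l : ∀ k a b c d → (a · c ⊕ k · (⊖ b) · d) · (a · c ⊕ k · (⊖ b) · d) ⊕ k · (a · d ⊕ (⊖ b) · c) · (a · d ⊕ (⊖ b) · c)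
       ≡ (a · a ⊕ k · b · b) · (c · c ⊕ k · d · d) ⊕ ((+ 4) · (⊖ k)) · ((a · b) · (c · d))
     l = ZS.solve-∀
     go : ∀ j → k ≡ j → IsNat (p · p ⊕ k · q · q)
     go (+ j) e = isNat-+ (square-nat p) (subst IsNat (sym (ℤP.*-assoc k q q)) (isNat-* (j , e) (square-nat q)))
     go -[1+ j ] e = subst IsNat (sym (l k a b c d)) (isNat-+ (same-sign _ _ h₁) (isNat-* (isNat-* (4 , refl) (suc j , cong ⊖_ e)) (same-sign (a · b) (c · d) h₂)))

   im-conj-⊠ : ∀ y₁ m₁ y₂ m₂ → im (conj (y₁ ,√ m₁) ⊠ (y₂ ,√ m₂)) ≡ y₁ · m₂ ⊖ m₁ · y₂
   im-conj-⊠ y₁ m₁ y₂ m₂ = l y₁ m₁ y₂ m₂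
     where
     l : ∀ y₁ m₁ y₂ m₂ → y₁ · m₂ ⊕ (⊖ m₁) · y₂ ≡ y₁ · m₂ ⊖ m₁ · y₂
     l = ZS.solve-∀

   im-⋆ : ∀ n x → im (n ⋆ x) ≡ n · im x
   im-⋆ n (a ,√ b) = refl

   norm-0Q : norm 0Q ≡ 0ℤ
   norm-0Q = l k
     where
     l : ∀ k → 0ℤ · 0ℤ ⊖ k · 0ℤ · 0ℤ ≡ 0ℤ
     l = ZS.solve-∀

   size≤ : ∀ x s → abs (re x) ≤ s → abs (im x) ≤ s → size x ≤ (1 + κ) * s
   size≤ (a ,√ b) s p q = +-mono-≤ p (*-monoʳ-≤ κ q)

 -- A reduced solution y² = n u³ + k m² in the cusp, with the factorisation c³ β = α ξ³ of β = y + m √k.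
 record Cusp : Set where
   field
     n m y u s : ℕ
     c : ℤ
     ξ α : Q
     n≥1 : 1 ≤ n
     m≥1 : 1 ≤ m
     u≥1 : 1 ≤ u
     yeq : (+ y) · (+ y) ≡ (+ n) · ((+ u) · (+ u) · (+ u)) ⊕ k · (+ m) · (+ m)
     s²≤u : s * s ≤ u
     u<s² : u < suc s * suc s
     ξ-re : abs (re ξ) ≤ s
     ξ-im : abs (im ξ) ≤ s
     normξ : norm ξ ≡ c · (+ u)
     c≢0 : c ≢ 0ℤ
     c≤ : abs c ≤ 1 + κ
     normα : norm α ≡ (+ n) · pow c 3
     rel : pow c 3 ⋆ ((+ y) ,√ (+ m)) ≡ α ⊠ ξ ↑ 3
     cusp : 4 * (κ * κ) * (m * m) ≤ n * (u * u * u)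

   β : Q
   β = (+ y) ,√ (+ m)

 scale-square : ∀ a b → a * (b * b) ≤ a * b * (a * b)
 scale-square a b = ≤-trans (*-monoˡ-≤ (b * b) (m≤m*m a)) (≤-reflexive (l a b))
   where
   l : ∀ a b → a * a * (b * b) ≡ a * b * (a * b)
   l = NS.solve-∀

 abs≥1 : ∀ {c} → c ≢ 0ℤ → 1 ≤ abs c
 abs≥1 {+ zero} h = ⊥-elim (h refl)
 abs≥1 {+ suc n} h = s≤s z≤n
 abs≥1 { -[1+ n ]} h = s≤s z≤n

 pow≢0 : ∀ {c} n → c ≢ 0ℤ → pow c n ≢ 0ℤ
 pow≢0 zero h ()
 pow≢0 {c} (suc n) h e with ℤP.i*j≡0⇒i≡0∨j≡0 c e
 ... | inj₁ p = h p
 ... | inj₂ p = pow≢0 n h p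

 -- In the cusp the term k m² is dominated, and everything is measured by s ≈ √u: the results place
 -- y between s³ / 2 and 128 n s³.
 module CuspBounds (E : Cusp) where
   open Cusp E

   private
     pos-cube : + (n * (u * u * u)) ≡ (+ n) · ((+ u) · (+ u) · (+ u))
     pos-cube = trans (ℤP.pos-* n (u * u * u)) (cong ((+ n) ·_) (trans (ℤP.pos-* (u * u) u) (cong (ℤ._* (+ u)) (ℤP.pos-* u u))))
     abs-km : abs (k · (+ m) · (+ m)) ≡ κ * (m * m)
     abs-km = trans (ℤP.abs-* (k · (+ m)) (+ m)) (trans (cong (_* m) (ℤP.abs-* k (+ m))) (*-assoc κ m m))

   y²≤ : y * y ≤ n * (u * u * u) + κ * (m * m)
   y²≤ = begin
     y * y ≡⟨ sym (ℤP.abs-* (+ y) (+ y)) ⟩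
     abs ((+ y) · (+ y)) ≡⟨ cong abs (trans yeq (cong (λ t → t ⊕ k · (+ m) · (+ m)) (sym pos-cube))) ⟩
     abs ((+ (n * (u * u * u))) ⊕ k · (+ m) · (+ m)) ≤⟨ ℤP.∣i+j∣≤∣i∣+∣j∣ (+ (n * (u * u * u))) (k · (+ m) · (+ m)) ⟩
     n * (u * u * u) + abs (k · (+ m) · (+ m)) ≡⟨ cong (λ i → n * (u * u * u) + i) abs-km ⟩
     n * (u * u * u) + κ * (m * m) ∎
     where open ≤-Reasoning

   nu³≤ : n * (u * u * u) ≤ y * y + κ * (m * m)
   nu³≤ = begin
     n * (u * u * u) ≡⟨ cong abs (trans pos-cube (trans (l ((+ n) · ((+ u) · (+ u) · (+ u))) (k · (+ m) · (+ m))) (cong (λ t → t ⊖ k · (+ m) · (+ m)) (sym yeq)))) ⟩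
     abs ((+ y) · (+ y) ⊖ k · (+ m) · (+ m)) ≤⟨ ℤP.∣i-j∣≤∣i∣+∣j∣ ((+ y) · (+ y)) (k · (+ m) · (+ m)) ⟩
     abs ((+ y) · (+ y)) + abs (k · (+ m) · (+ m)) ≡⟨ cong₂ _+_ (ℤP.abs-* (+ y) (+ y)) abs-km ⟩
     y * y + κ * (m * m) ∎
     where
     open ≤-Reasoning
     l : ∀ a b → a ≡ (a ⊕ b) ⊖ b
     l = ZS.solve-∀

   private
     κm²≤ : κ * (m * m) ≤ κ * κ * (m * m)
     κm²≤ = *-monoˡ-≤ (m * m) (m≤m*m κ)
     4a≤⇒ : ∀ a x → 4 * a ≤ x → a ≤ x
     4a≤⇒ a x p = ≤-trans (m≤m+n a (a + (a + (a + 0)))) p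

   y²≤2nu³ : y * y ≤ 2 * (n * (u * u * u))
   y²≤2nu³ = ≤-trans y²≤ (≤-trans (+-monoʳ-≤ _ (≤-trans κm²≤ (4a≤⇒ _ _ (≤-trans (≤-reflexive (sym (*-assoc 4 (κ * κ) (m * m)))) cusp)))) (≤-reflexive (l (n * (u * u * u)))))
     where
     l : ∀ a → a + a ≡ 2 * a
     l = NS.solve-∀

   κm≤y : κ * m ≤ y
   κm≤y = sq-cancel-≤ (+-cancelʳ-≤ (κ * κ * (m * m)) _ _ (begin
     κ * m * (κ * m) + κ * κ * (m * m) ≡⟨ l κ m ⟩
     2 * (κ * κ * (m * m)) ≤⟨ *-monoˡ-≤ (κ * κ * (m * m)) (s≤s (s≤s (z≤n {2}))) ⟩
     4 * (κ * κ * (m * m)) ≡⟨ sym (*-assoc 4 (κ * κ) (m * m)) ⟩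
     4 * (κ * κ) * (m * m) ≤⟨ cusp ⟩
     n * (u * u * u) ≤⟨ nu³≤ ⟩
     y * y + κ * (m * m) ≤⟨ +-monoʳ-≤ (y * y) κm²≤ ⟩
     y * y + κ * κ * (m * m) ∎))
     where
     open ≤-Reasoning
     l : ∀ κ m → κ * m * (κ * m) + κ * κ * (m * m) ≡ 2 * (κ * κ * (m * m))
     l = NS.solve-∀

   nu³≤2y² : n * (u * u * u) ≤ 2 * (y * y)
   nu³≤2y² = ≤-trans nu³≤ (≤-trans (+-monoʳ-≤ (y * y) (≤-trans κm²≤ (≤-trans (≤-reflexive (l κ m)) (*-mono-≤ κm≤y κm≤y)))) (≤-reflexive (l' (y * y))))
     where
     l : ∀ κ m → κ * κ * (m * m) ≡ κ * m * (κ * m)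
     l = NS.solve-∀
     l' : ∀ a → a + a ≡ 2 * a
     l' = NS.solve-∀

   s≥1 : 1 ≤ s
   s≥1 = n≢0⇒n>0 (λ e → <⇒≱ u<s² (≤-trans (≤-reflexive (cong (λ i → suc i * suc i) e)) u≥1))

   u≤4s² : u ≤ 4 * (s * s)
   u≤4s² = ≤-trans (<⇒≤ u<s²) (≤-trans (*-mono-≤ (+-monoˡ-≤ s s≥1) (+-monoˡ-≤ s s≥1)) (≤-reflexive (l s)))
     where
     l : ∀ s → (s + s) * (s + s) ≡ 4 * (s * s)
     l = NS.solve-∀

   y≤s³ : y ≤ 128 * n * (s * s * s)
   y≤s³ = sq-cancel-≤ (begin
     y * y ≤⟨ y²≤2nu³ ⟩
     2 * (n * (u * u * u)) ≤⟨ *-monoʳ-≤ 2 (*-monoʳ-≤ n (*-mono-≤ (*-mono-≤ u≤4s² u≤4s²) u≤4s²)) ⟩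
     2 * (n * (4 * (s * s) * (4 * (s * s)) * (4 * (s * s)))) ≡⟨ l n s ⟩
     128 * n * (s * s * s * (s * s * s)) ≤⟨ scale-square (128 * n) (s * s * s) ⟩
     128 * n * (s * s * s) * (128 * n * (s * s * s)) ∎)
     where
     open ≤-Reasoning
     l : ∀ n s → 2 * (n * (4 * (s * s) * (4 * (s * s)) * (4 * (s * s)))) ≡ 128 * n * (s * s * s * (s * s * s))
     l = NS.solve-∀

   s³≤2y : s * s * s ≤ 2 * y
   s³≤2y = sq-cancel-≤ (begin
     s * s * s * (s * s * s) ≡⟨ l s ⟩
     s * s * (s * s) * (s * s) ≤⟨ *-mono-≤ (*-mono-≤ s²≤u s²≤u) s²≤u ⟩
     u * u * u ≤⟨ m≤n*m (u * u * u) n {{>-nonZero n≥1}} ⟩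
     n * (u * u * u) ≤⟨ nu³≤2y² ⟩
     2 * (y * y) ≤⟨ *-monoˡ-≤ (y * y) (s≤s (s≤s (z≤n {2}))) ⟩
     4 * (y * y) ≡⟨ l' y ⟩
     2 * y * (2 * y) ∎)
     where
     open ≤-Reasoning
     l : ∀ s → s * s * s * (s * s * s) ≡ s * s * (s * s) * (s * s)
     l = NS.solve-∀
     l' : ∀ y → 4 * (y * y) ≡ 2 * y * (2 * y)
     l' = NS.solve-∀

   size-ξ : size ξ ≤ (1 + κ) * s
   size-ξ = size≤ ξ s ξ-re ξ-im

 open CuspBounds

 opaque
   bigConst : ℕ
   bigConst = 12288

   bigConst≥ : 12288 ≤ bigConst
   bigConst≥ = ≤-refl

 -- Equal α and c make the quotient of two solutions a cube up to rational factors. Equal sectors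
 -- keep its cube root λ away from the non-real cube roots.
 record SameClass (E F : Cusp) : Set where
   field
     sameα : Cusp.α E ≡ Cusp.α F
     samec : Cusp.c E ≡ Cusp.c F
     sec₁ : sector₁ (Cusp.ξ E) ≡ sector₁ (Cusp.ξ F)
     sec₂ : sector₂ (Cusp.ξ E) ≡ sector₂ (Cusp.ξ F)

 module Pair (E F : Cusp) (S : SameClass E F) where
   open SameClass S
   open Cusp E using (c; α; n; n≥1; c≢0; c≤) renaming (y to y₁; m to m₁; u to u₁; s to s₁; ξ to ξ₁; β to β₁)
   open Cusp F using () renaming (y to y₂; m to m₂; u to u₂; s to s₂; ξ to ξ₂; β to β₂)

   lam : Q
   lam = conj ξ₁ ⊠ ξ₂

   q : ℕ
   q = abs (im lam)

   C : ℤ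
   C = pow c 3

   C≢0 : C ≢ 0ℤ
   C≢0 = pow≢0 3 c≢0

   same-n : Cusp.n F ≡ n
   same-n = ℤP.+-injective (ℤP.*-cancelʳ-≡ (+ Cusp.n F) (+ n) C {{ℤ.≢-nonZero C≢0}}
     (trans (cong (λ d → (+ Cusp.n F) · pow d 3) samec) (trans (sym (Cusp.normα F)) (trans (cong norm (sym sameα)) (Cusp.normα E)))))

   -- In conj (C β₁) · C β₂ the two factors α combine to norm α = n C. One C cancels, the other
   -- stays on the left.
   relation : C ⋆ (conj β₁ ⊠ β₂) ≡ (+ n) ⋆ (lam ↑ 3)
   relation = ⋆-cancel C _ _ C≢0 (begin
     C ⋆ (C ⋆ (conj β₁ ⊠ β₂)) ≡⟨ trans (cong (C ⋆_) (sym (⋆-⊠ʳ C (conj β₁) β₂))) (sym (⋆-⊠ˡ C (conj β₁) _)) ⟩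
     (C ⋆ conj β₁) ⊠ (C ⋆ β₂) ≡⟨ cong₂ _⊠_ (trans (sym (conj-⋆ C β₁)) (cong conj (Cusp.rel E))) (trans (cong (λ d → pow d 3 ⋆ β₂) samec) (trans (Cusp.rel F) (cong (_⊠ ξ₂ ↑ 3) (sym sameα)))) ⟩
     conj (α ⊠ ξ₁ ↑ 3) ⊠ (α ⊠ ξ₂ ↑ 3) ≡⟨ cong (_⊠ (α ⊠ ξ₂ ↑ 3)) (trans (conj-⊠ α _) (cong (conj α ⊠_) (conj-↑ ξ₁ 3))) ⟩
     (conj α ⊠ conj ξ₁ ↑ 3) ⊠ (α ⊠ ξ₂ ↑ 3) ≡⟨ ⊠-interchange (conj α) _ α _ ⟩
     (conj α ⊠ α) ⊠ (conj ξ₁ ↑ 3 ⊠ ξ₂ ↑ 3) ≡⟨ cong₂ _⊠_ (trans (⊠-comm (conj α) α) (⊠-conj α)) (sym (↑-⊠ (conj ξ₁) ξ₂ 3)) ⟩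
     (norm α ⋆ 1Q) ⊠ lam ↑ 3 ≡⟨ trans (⋆-⊠ˡ (norm α) 1Q _) (cong (norm α ⋆_) (⊠-identityˡ _)) ⟩
     norm α ⋆ (lam ↑ 3) ≡⟨ ⋆-congˡ (lam ↑ 3) (trans (Cusp.normα E) (ℤP.*-comm (+ n) C)) ⟩
     (C · (+ n)) ⋆ (lam ↑ 3) ≡⟨ ⋆-assoc C (+ n) _ ⟩
     C ⋆ ((+ n) ⋆ (lam ↑ 3)) ∎)
     where open ≡-Reasoning

   c² : ℕ
   c² = abs c * abs c

   norm-lam : norm lam ≡ + (c² * (u₁ * u₂))
   norm-lam = begin
     norm (conj ξ₁ ⊠ ξ₂) ≡⟨ norm-⊠ (conj ξ₁) ξ₂ ⟩
     norm (conj ξ₁) · norm ξ₂ ≡⟨ cong₂ _·_ (trans (norm-conj ξ₁) (Cusp.normξ E)) (trans (Cusp.normξ F) (cong (ℤ._* (+ u₂)) (sym samec))) ⟩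
     c · (+ u₁) · (c · (+ u₂)) ≡⟨ l c (+ u₁) (+ u₂) ⟩
     c · c · ((+ u₁) · (+ u₂)) ≡⟨ cong₂ _·_ (abs-sq c) (sym (ℤP.pos-* u₁ u₂)) ⟩
     (+ c²) · (+ (u₁ * u₂)) ≡⟨ sym (ℤP.pos-* c² (u₁ * u₂)) ⟩
     + (c² * (u₁ * u₂)) ∎
     where
     open ≡-Reasoning
     l : ∀ c u v → c · u · (c · v) ≡ c · c · (u · v)
     l = ZS.solve-∀
     abs-sq : ∀ c → c · c ≡ + (abs c * abs c)
     abs-sq (+ n) = sym (ℤP.pos-* n n)
     abs-sq -[1+ n ] = refl

   c²≥1 : 1 ≤ c²
   c²≥1 = *-mono-≤ (abs≥1 c≢0) (abs≥1 c≢0)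

   lam≢0 : lam ≢ 0Q
   lam≢0 e = n>0⇒n≢0 (*-mono-≤ c²≥1 (*-mono-≤ (Cusp.u≥1 E) (Cusp.u≥1 F))) (ℤP.+-injective (trans (sym norm-lam) (trans (cong norm e) norm-0Q)))

   -- The difference of the slopes m₁/y₁ and m₂/y₂, cleared of denominators.
   δ : ℕ
   δ = abs ((+ y₁) · (+ m₂) ⊖ (+ m₁) · (+ y₂))

   private
     im-rel : C · ((+ y₁) · (+ m₂) ⊖ (+ m₁) · (+ y₂)) ≡ (+ n) · im (lam ↑ 3)
     im-rel = trans (cong (C ·_) (sym (im-conj-⊠ (+ y₁) (+ m₁) (+ y₂) (+ m₂)))) (trans (sym (im-⋆ C _)) (trans (cong im relation) (im-⋆ (+ n) _)))

     abs-rel : abs c * (c² * δ) ≡ n * (q * abs (norm lam ⊕ (+ 2) · (re lam · re lam ⊕ k · im lam · im lam)))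
     abs-rel = begin
       abs c * (c² * δ) ≡⟨ l (abs c) δ ⟩
       abs c ^ 3 * δ ≡⟨ trans (cong (_* δ) (sym (abs-pow c 3))) (sym (ℤP.abs-* C _)) ⟩
       abs (C · ((+ y₁) · (+ m₂) ⊖ (+ m₁) · (+ y₂))) ≡⟨ cong abs im-rel ⟩
       abs ((+ n) · im (lam ↑ 3)) ≡⟨ trans (ℤP.abs-* (+ n) _) (cong (n *_) (trans (cong abs (im-cube lam)) (ℤP.abs-* (im lam) _))) ⟩
       n * (q * abs (norm lam ⊕ (+ 2) · (re lam · re lam ⊕ k · im lam · im lam))) ∎
       where
       open ≡-Reasoning
       l : ∀ a d → a * (a * a * d) ≡ a * (a * (a * 1)) * d
       l = NS.solve-∀

   -- Compares coefficients of √k in `relation`: |C| δ = n |im λ³| ≥ n q norm λ, with norm λ = c² u₁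
   -- u₂. Slopes within a class that are not equal cannot be close.
   gap : n * q * (u₁ * u₂) ≤ abs c * δ
   gap with sector-nat ξ₁ ξ₂ sec₁ sec₂
   ... | w , ew = *-cancelˡ-≤ c² {{>-nonZero c²≥1}} (begin
     c² * (n * q * (u₁ * u₂)) ≡⟨ l c² n q (u₁ * u₂) ⟩
     n * (q * (c² * (u₁ * u₂))) ≤⟨ *-monoʳ-≤ n (*-monoʳ-≤ q (m≤m+n _ (2 * w))) ⟩
     n * (q * (c² * (u₁ * u₂) + 2 * w)) ≡⟨ cong (λ t → n * (q * abs t)) (sym (cong₂ (λ a b → a ⊕ b) norm-lam (trans (cong ((+ 2) ·_) ew) (sym (ℤP.pos-* 2 w))))) ⟩
     n * (q * abs (norm lam ⊕ (+ 2) · (re lam · re lam ⊕ k · im lam · im lam))) ≡⟨ sym abs-rel ⟩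
     abs c * (c² * δ) ≡⟨ l' (abs c) c² δ ⟩
     c² * (abs c * δ) ∎)
     where
     open ≤-Reasoning
     l : ∀ a b c d → a * (b * c * d) ≡ b * (c * (a * d))
     l = NS.solve-∀
     l' : ∀ a b c → a * (b * c) ≡ b * (a * c)
     l' = NS.solve-∀

   q≡0⇒δ≡0 : q ≡ 0 → δ ≡ 0
   q≡0⇒δ≡0 e = m*n≡0⇒n≡0 c² δ {{>-nonZero c²≥1}} (m*n≡0⇒n≡0 (abs c) (c² * δ) {{>-nonZero (abs≥1 c≢0)}} (trans abs-rel (trans (cong (λ t → n * (t * abs (norm lam ⊕ (+ 2) · (re lam · re lam ⊕ k · im lam · im lam)))) e) (*-zeroʳ n))))
     where
     m*n≡0⇒n≡0 : ∀ m n → {{NonZero m}} → m * n ≡ 0 → n ≡ 0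
     m*n≡0⇒n≡0 (suc m) zero _ = refl

   δ≤ : δ ≤ y₁ * m₂ + m₁ * y₂
   δ≤ = ≤-trans (ℤP.∣i-j∣≤∣i∣+∣j∣ ((+ y₁) · (+ m₂)) ((+ m₁) · (+ y₂))) (≤-reflexive (cong₂ _+_ (ℤP.abs-* (+ y₁) (+ m₂)) (ℤP.abs-* (+ m₁) (+ y₂))))

   y₁≤2y₂ : u₁ ≤ u₂ → y₁ ≤ 2 * y₂
   y₁≤2y₂ p = sq-cancel-≤ (begin
     y₁ * y₁ ≤⟨ y²≤2nu³ E ⟩
     2 * (n * (u₁ * u₁ * u₁)) ≤⟨ *-monoʳ-≤ 2 (*-mono-≤ (≤-reflexive (sym same-n)) (*-mono-≤ (*-mono-≤ p p) p)) ⟩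
     2 * (Cusp.n F * (u₂ * u₂ * u₂)) ≤⟨ *-monoʳ-≤ 2 (nu³≤2y² F) ⟩
     2 * (2 * (y₂ * y₂)) ≡⟨ l y₂ ⟩
     2 * y₂ * (2 * y₂) ∎)
     where
     open ≤-Reasoning
     l : ∀ y → 2 * (2 * (y * y)) ≡ 2 * y * (2 * y)
     l = NS.solve-∀

   module Exclusion (k≢0 : k ≢ 0ℤ) (κ≥1 : 1 ≤ κ) (N : ℕ) (n≤N : n ≤ N) (m₁≤N : m₁ ≤ N) (m₂≤N : m₂ ≤ N) where

     P : ℕ
     P = bigConst * ((1 + κ) * (1 + κ)) * (N * N)

     private
       N≥1 : 1 ≤ N
       N≥1 = ≤-trans n≥1 n≤N
       sqκ≥1 : 1 ≤ (1 + κ) * (1 + κ)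
       sqκ≥1 = *-mono-≤ (s≤s (z≤n {κ})) (s≤s (z≤n {κ}))
       K*≤P : ∀ {K a b} → K ≤ 12288 → a ≤ (1 + κ) * (1 + κ) → b ≤ N * N → K * a * b ≤ P
       K*≤P p q r = *-mono-≤ (*-mono-≤ (≤-trans p bigConst≥) q) r
       1≤NN : 1 ≤ N * N
       1≤NN = *-mono-≤ N≥1 N≥1
       K≤P : ∀ {K} → K ≤ 12288 → K ≤ P
       K≤P {K} p = ≤-trans (≤-reflexive (l K)) (K*≤P p sqκ≥1 1≤NN)
         where
         l : ∀ a → a ≡ a * 1 * 1
         l = NS.solve-∀
       1≤12288 : 1 ≤ 12288
       1≤12288 = s≤s z≤n
       κ≤P : κ ≤ P
       κ≤P = ≤-trans (≤-reflexive (l κ)) (K*≤P 1≤12288 (≤-trans (n≤1+n κ) (m≤m*m (1 + κ))) 1≤NN)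
         where
         l : ∀ a → a ≡ 1 * a * 1
         l = NS.solve-∀
       N≤P : N ≤ P
       N≤P = ≤-trans (≤-reflexive (l N)) (K*≤P 1≤12288 sqκ≥1 (m≤m*m N))
         where
         l : ∀ a → a ≡ 1 * 1 * a
         l = NS.solve-∀

     -- The windows from u₁^(2r) to u₁^(2r+2), r ≥ 6, cover everything from u₁^12 on. So beyond the
     -- threshold a second solution of the class that is not smaller must lie below u₁^12.
     excluded : u₁ ≤ u₂ → 4 * (P ^ 24 * P ^ 24) ≤ u₁ → ∀ r → 6 ≤ r → u₁ ^ (r + r) ≤ u₂ → u₂ ≤ u₁ ^ (r + r + 2) → ⊥
     excluded u₁≤u₂ big r r≥6 lo hi =
       T.contradiction₁₂ hy₂ hy₁ (≤-trans m₂≤N N≤P) κ≤P (≤-trans n≤N N≤P) ≤-refl hq (K≤P (m≤m+n 6144 6144)) (abs≥1 C≢0)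
         (thue-inequality k≢0 κ≥1 y₁ m₁ y₂ m₂ n c lam Λ (Cusp.m≥1 E) (κm≤y E) (κm≤y F) lam≢0 hΛ relation r (≤-trans (s≤s z≤n) r≥6))
       where
       open ≤-Reasoning
       Λ = P * (s₁ * s₂)
       hΛ : size lam ≤ Λ
       hΛ = begin
         size lam ≤⟨ ≤-trans (size-⊠ (conj ξ₁) ξ₂) (*-mono-≤ (≤-trans (≤-reflexive (size-conj ξ₁)) (size-ξ E)) (size-ξ F)) ⟩
         (1 + κ) * s₁ * ((1 + κ) * s₂) ≡⟨ l (1 + κ) s₁ s₂ ⟩
         1 * ((1 + κ) * (1 + κ)) * 1 * (s₁ * s₂) ≤⟨ *-monoˡ-≤ (s₁ * s₂) (K*≤P 1≤12288 ≤-refl 1≤NN) ⟩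
         P * (s₁ * s₂) ∎
         where
         l : ∀ a s t → a * s * (a * t) ≡ 1 * (a * a) * 1 * (s * t)
         l = NS.solve-∀
       P≥2 : 2 ≤ P
       P≥2 = K≤P (s≤s (s≤s z≤n))
       hy₂ : s₂ * s₂ * s₂ ≤ P * y₂
       hy₂ = ≤-trans (s³≤2y F) (*-monoˡ-≤ y₂ P≥2)
       128n≤P : 128 * n ≤ P
       128n≤P = ≤-trans (≤-reflexive (l 128 n)) (K*≤P (m≤m+n 128 12160) sqκ≥1 (≤-trans n≤N (m≤m*m N)))
         where
         l : ∀ c n → c * n ≡ c * 1 * n
         l = NS.solve-∀
       hy₁ : y₁ ≤ P * (s₁ * s₁ * s₁)
       hy₁ = ≤-trans (y≤s³ E) (*-monoˡ-≤ (s₁ * s₁ * s₁) 128n≤P)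
       hq : q * (s₁ * s₁) ≤ P * s₂
       hq = *-cancelʳ-≤ _ _ (s₂ * s₂) {{>-nonZero (*-mono-≤ (s≥1 F) (s≥1 F))}} (begin
         q * (s₁ * s₁) * (s₂ * s₂) ≡⟨ *-assoc q _ _ ⟩
         q * (s₁ * s₁ * (s₂ * s₂)) ≤⟨ *-monoʳ-≤ q (*-mono-≤ (Cusp.s²≤u E) (Cusp.s²≤u F)) ⟩
         q * (u₁ * u₂) ≤⟨ *-monoˡ-≤ (u₁ * u₂) (m≤n*m q n {{>-nonZero n≥1}}) ⟩
         n * q * (u₁ * u₂) ≤⟨ gap ⟩
         abs c * δ ≤⟨ *-mono-≤ c≤ δ≤ ⟩
         (1 + κ) * (y₁ * m₂ + m₁ * y₂) ≤⟨ *-monoʳ-≤ (1 + κ) (+-mono-≤ (*-mono-≤ (y₁≤2y₂ u₁≤u₂) m₂≤N) (*-monoˡ-≤ y₂ m₁≤N)) ⟩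
         (1 + κ) * (2 * y₂ * N + N * y₂) ≡⟨ l (1 + κ) y₂ N ⟩
         (1 + κ) * (3 * N) * y₂ ≤⟨ *-monoʳ-≤ ((1 + κ) * (3 * N)) (≤-trans (y≤s³ F) (*-monoˡ-≤ (s₂ * s₂ * s₂) (*-monoʳ-≤ 128 (≤-trans (≤-reflexive same-n) n≤N)))) ⟩
         (1 + κ) * (3 * N) * (128 * N * (s₂ * s₂ * s₂)) ≡⟨ l' (1 + κ) N s₂ ⟩
         384 * (1 + κ) * (N * N) * s₂ * (s₂ * s₂) ≤⟨ *-monoˡ-≤ (s₂ * s₂) (*-monoˡ-≤ s₂ (K*≤P (m≤m+n 384 11904) (m≤m*m (1 + κ)) ≤-refl)) ⟩
         P * s₂ * (s₂ * s₂) ∎)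
         where
         l : ∀ a y N → a * (2 * y * N + N * y) ≡ a * (3 * N) * y
         l = NS.solve-∀
         l' : ∀ a N s → a * (3 * N) * (128 * N * (s * s * s)) ≡ 384 * a * (N * N) * s * (s * s)
         l' = NS.solve-∀
       sq2 : ∀ a → 4 * (a * a) ≡ 2 * a * (2 * a)
       sq2 = NS.solve-∀
       s₁≥ : P ^ 24 ≤ s₁
       s₁≥ = sq-cancel-≤ (*-cancelˡ-≤ 4 (≤-trans big (u≤4s² E)))
       sqpow : ∀ a i → (a * a) ^ i ≡ a ^ i * a ^ i
       sqpow a i = *-^ i a a
       low : s₁ ^ (r + r) ≤ P * s₂
       low = ≤-trans (sq-cancel-≤ (begin
         s₁ ^ (r + r) * s₁ ^ (r + r) ≡⟨ sym (sqpow s₁ (r + r)) ⟩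
         (s₁ * s₁) ^ (r + r) ≤⟨ ^-monoˡ-≤ (r + r) (Cusp.s²≤u E) ⟩
         u₁ ^ (r + r) ≤⟨ lo ⟩
         u₂ ≤⟨ u≤4s² F ⟩
         4 * (s₂ * s₂) ≡⟨ sq2 s₂ ⟩
         2 * s₂ * (2 * s₂) ∎)) (*-monoˡ-≤ s₂ P≥2)
       high : s₂ ≤ (P * s₁) ^ (r + r + 2)
       high = ≤-trans (sq-cancel-≤ (begin
         s₂ * s₂ ≤⟨ Cusp.s²≤u F ⟩
         u₂ ≤⟨ hi ⟩
         u₁ ^ (r + r + 2) ≤⟨ ^-monoˡ-≤ (r + r + 2) (≤-trans (u≤4s² E) (≤-reflexive (sq2 s₁))) ⟩
         (2 * s₁ * (2 * s₁)) ^ (r + r + 2) ≡⟨ sqpow (2 * s₁) (r + r + 2) ⟩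
         (2 * s₁) ^ (r + r + 2) * (2 * s₁) ^ (r + r + 2) ∎)) (^-monoˡ-≤ (r + r + 2) (*-monoˡ-≤ s₁ P≥2))
       module T = ThueNumeric P s₁ s₂ r P≥2 s₁≥ (s≥1 F) r≥6 low high

 -- Short vectors and the factorisation of y + m√k

 isqrt : ∀ n → ∃[ s ] (s * s ≤ n × n < suc s * suc s)
 isqrt zero = 0 , z≤n , s≤s z≤n
 isqrt (suc n) with isqrt n
 ... | s , lo , hi with suc s * suc s ≤? suc n
 ...   | yes p = suc s , p , ≤-trans (s≤s hi) (*-mono-< (n<1+n (suc s)) (n<1+n (suc s)))
 ...   | no p = s , ≤-trans lo (n≤1+n n) , ≰⇒> p

 private
   nonsquare-suc : NonSquareRational k → ∀ (a : ℤ) b → a · a ≢ k · (+ suc b) · (+ suc b)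
   nonsquare-suc ns a b e = ns r (ℚP.toℚᵘ-injective (ℚᵘP.≃-trans (ℚP.toℚᵘ-homo-* r r) (ℚᵘP.≃-trans (ℚᵘP.*-cong (ℚP.toℚᵘ-fromℚᵘ p) (ℚP.toℚᵘ-fromℚᵘ p)) (ℚᵘP.≃-trans (ℚᵘ.*≡* eq) (ℚᵘP.≃-sym (ℚP.toℚᵘ-fromℚᵘ (ℚᵘ.mkℚᵘ k 0)))))))
     where
     p = ℚᵘ.mkℚᵘ a b
     r = ℚ.fromℚᵘ p
     eq : (a · a) · (+ 1) ≡ k · ℚᵘ.↧ (p ℚᵘ.* p)
     eq = trans (ℤP.*-identityʳ (a · a)) (trans e (ℤP.*-assoc k (+ suc b) (+ suc b)))

 nonsquare-int : NonSquareRational k → ∀ a b → a · a ≡ k · b · b → b ≡ 0ℤ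
 nonsquare-int ns a (+ zero) e = refl
 nonsquare-int ns a (+ suc b) e = ⊥-elim (nonsquare-suc ns a b e)
 nonsquare-int ns a -[1+ b ] e = ⊥-elim (nonsquare-suc ns a b (trans e (l k (+ suc b))))
   where
   l : ∀ k b → k · (⊖ b) · (⊖ b) ≡ k · b · b
   l = ZS.solve-∀

 opaque
   unfolding _⊞_

   norm≡0 : NonSquareRational k → ∀ x → norm x ≡ 0ℤ → x ≡ 0Q
   norm≡0 ns (a ,√ b) e = Q-ext a0 b0
     where
     eq : a · a ≡ k · b · b
     eq = ℤP.i-j≡0⇒i≡j _ _ e
     b0 : b ≡ 0ℤ
     b0 = nonsquare-int ns a b eq
     a0 : a ≡ 0ℤ
     a0 with ℤP.i*j≡0⇒i≡0∨j≡0 a (trans eq (trans (cong (λ t → k · b · t) b0) (ℤP.*-zeroʳ (k · b))))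
     ... | inj₁ p = p
     ... | inj₂ p = p

 ZDiv : ℤ → ℤ → Set
 ZDiv d x = ∃[ q ] (x ≡ q · d)

 zdiv⇒∣ : ∀ {d x} → ZDiv d x → abs d ∣ abs x
 zdiv⇒∣ {d} {x} (q , e) = divides (abs q) (trans (cong abs e) (ℤP.abs-* q d))

 ∣⇒zdiv : ∀ {d x} → abs d ∣ abs x → ZDiv d x
 ∣⇒zdiv {d} {x} p with ℤS.∣ᵤ⇒∣ {d} {x} p
 ... | ℤS.divides q e = q , e

 coprime-cancel : ∀ {d x} m → Coprime (abs d) m → ZDiv d ((+ m) · x) → ZDiv d x
 coprime-cancel {d} {x} m cop z = ∣⇒zdiv (coprime-divisor cop (subst (abs d ∣_) (ℤP.abs-* (+ m) x) (zdiv⇒∣ z)))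

 abs-diff≤ : ∀ m n s → m ≤ s → n ≤ s → abs ((+ m) ⊖ (+ n)) ≤ s
 abs-diff≤ m n s p q = ≤-trans (≤-reflexive (cong abs (ℤP.m-n≡m⊖n m n))) (≤-trans (ℤP.∣m⊝n∣≤m⊔n m n) (⊔-lub p q))

 -- Thue's lemma: the pigeonhole principle on 0 ≤ a, b ≤ s.
 short-solution : ∀ d s → 1 ≤ d → d < suc s * suc s → ∀ p q →
   ∃[ a ] ∃[ b ] (¬ (a ≡ 0ℤ × b ≡ 0ℤ) × abs a ≤ s × abs b ≤ s × ZDiv (+ d) (a · p ⊖ b · q))
 short-solution d s d≥1 d<s² p q with FinP.pigeonhole d<s² f
   where
   instance _ = >-nonZero d≥1
   val : Fin (suc s * suc s) → ℤ
   val x = (+ toℕ (proj₁ (remQuot {suc s} (suc s) x))) · p ⊖ (+ toℕ (proj₂ (remQuot {suc s} (suc s) x))) · q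
   f : Fin (suc s * suc s) → Fin d
   f x = fromℕ< (ℤD.n%ℕd<d (val x) d)
 ... | x , x' , x<x' , e = (+ i) ⊖ (+ i') , (+ j) ⊖ (+ j') , nz , abs-diff≤ i i' s (FinP.toℕ≤pred[n] (proj₁ xy)) (FinP.toℕ≤pred[n] (proj₁ xy')) , abs-diff≤ j j' s (FinP.toℕ≤pred[n] (proj₂ xy)) (FinP.toℕ≤pred[n] (proj₂ xy')) ,
       ((val x ℤD./ℕ d) ⊖ (val x' ℤD./ℕ d)) , eq
   where
   instance _ = >-nonZero d≥1
   val : Fin (suc s * suc s) → ℤ
   val x = (+ toℕ (proj₁ (remQuot {suc s} (suc s) x))) · p ⊖ (+ toℕ (proj₂ (remQuot {suc s} (suc s) x))) · q
   xy = remQuot {suc s} (suc s) x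
   xy' = remQuot {suc s} (suc s) x'
   i = toℕ (proj₁ xy)
   j = toℕ (proj₂ xy)
   i' = toℕ (proj₁ xy')
   j' = toℕ (proj₂ xy')
   rem≡ : val x ℤD.%ℕ d ≡ val x' ℤD.%ℕ d
   rem≡ = trans (sym (FinP.toℕ-fromℕ< _)) (trans (cong toℕ e) (FinP.toℕ-fromℕ< _))
   eq : ((+ i) ⊖ (+ i')) · p ⊖ ((+ j) ⊖ (+ j')) · q ≡ ((val x ℤD./ℕ d) ⊖ (val x' ℤD./ℕ d)) · (+ d)
   eq = trans (l (+ i) (+ i') (+ j) (+ j') p q) (trans (cong₂ _⊖_ (ℤD.a≡a%ℕn+[a/ℕn]*n (val x) d) (trans (ℤD.a≡a%ℕn+[a/ℕn]*n (val x') d) (cong (λ t → (+ t) ⊕ (val x' ℤD./ℕ d) · (+ d)) (sym rem≡))))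
         (l' (+ (val x ℤD.%ℕ d)) (val x ℤD./ℕ d) (val x' ℤD./ℕ d) (+ d)))
     where
     l : ∀ i i' j j' p q → (i ⊖ i') · p ⊖ (j ⊖ j') · q ≡ (i · p ⊖ j · q) ⊖ (i' · p ⊖ j' · q)
     l = ZS.solve-∀
     l' : ∀ r a b d → (r ⊕ a · d) ⊖ (r ⊕ b · d) ≡ (a ⊖ b) · d
     l' = ZS.solve-∀
   inj : proj₁ xy ≡ proj₁ xy' → proj₂ xy ≡ proj₂ xy' → x ≡ x'
   inj e₁ e₂ = trans (sym (FinP.combine-remQuot {suc s} (suc s) x)) (trans (cong₂ Fin.combine e₁ e₂) (FinP.combine-remQuot {suc s} (suc s) x'))
   nz : ¬ ((+ i) ⊖ (+ i') ≡ 0ℤ × (+ j) ⊖ (+ j') ≡ 0ℤ)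
   nz (e₁ , e₂) = FinP.<⇒≢ x<x' (inj (FinP.toℕ-injective (ℤP.+-injective (ℤP.i-j≡0⇒i≡j _ _ e₁))) (FinP.toℕ-injective (ℤP.+-injective (ℤP.i-j≡0⇒i≡j _ _ e₂))))

 record Reduced : Set where
   field
     n m y : ℕ
     u : ℤ
     n≥1 : 1 ≤ n
     m≥1 : 1 ≤ m
     u≢0 : u ≢ 0ℤ
     yeq : (+ y) · (+ y) ≡ (+ n) · (u · u · u) ⊕ k · (+ m) · (+ m)
     cop : Coprime y m

   β : Q
   β = (+ y) ,√ (+ m)

 opaque
   unfolding _⊞_

   norm-pair : ∀ a b → norm (a ,√ b) ≡ a · a ⊖ k · b · b
   norm-pair a b = refl

   -- Turns the congruence a m ≡ b y modulo d into an identity: up to the factor m, the conjugate of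
   -- a + b√k is a multiple t of d plus b conj β. The divisibilities in `Factor` are read off from
   -- this shape.
   mξ̄ : ∀ a b y (m : ℤ) t → a · m ⊖ b · y ≡ t → m ⋆ conj (a ,√ b) ≡ t ⋆ 1Q ⊞ b ⋆ conj (y ,√ m)
   mξ̄ a b y m t refl = Q-ext (l a b y m) (l' a b y m)
     where
     l : ∀ a b y m → m · a ≡ (a · m ⊖ b · y) · 1ℤ ⊕ b · y
     l = ZS.solve-∀
     l' : ∀ a b y m → m · (⊖ b) ≡ (a · m ⊖ b · y) · 0ℤ ⊕ b · (⊖ m)
     l' = ZS.solve-∀

   norm-shift : ∀ t b x → norm (t ⋆ 1Q ⊞ b ⋆ conj x) ≡ t · (t ⊕ (+ 2) · b · re x) ⊕ b · b · norm x
   norm-shift t b (y ,√ m) = l k t b y m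
     where
     l : ∀ k t b y m → (t · 1ℤ ⊕ b · y) · (t · 1ℤ ⊕ b · y) ⊖ k · (t · 0ℤ ⊕ b · (⊖ m)) · (t · 0ℤ ⊕ b · (⊖ m))
       ≡ t · (t ⊕ (+ 2) · b · y) ⊕ b · b · (y · y ⊖ k · m · m)
     l = ZS.solve-∀

   -- After expanding the cube and multiplying by x, every term other than t³ x contains x conj x =
   -- norm x.
   cube-shift : ∀ t b x → x ⊠ (t ⋆ 1Q ⊞ b ⋆ conj x) ↑ 3
     ≡ (t · t · t) ⋆ x ⊞ norm x ⋆ (((+ 3) · t · t · b) ⋆ 1Q ⊞ ((+ 3) · t · b · b) ⋆ conj x ⊞ (b · b · b) ⋆ (conj x ⊠ conj x))
   cube-shift t b x = begin
     x ⊠ (w ⊠ (w ⊠ (w ⊠ 1Q))) ≡⟨ cong (λ s → x ⊠ (w ⊠ (w ⊠ s))) (⊠-identityʳ w) ⟩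
     x ⊠ (w ⊠ (w ⊠ w)) ≡⟨ cong (λ s → x ⊠ (w ⊠ s)) (sq x) ⟩
     x ⊠ (w ⊠ S) ≡⟨ cong (x ⊠_) (cu x) ⟩
     x ⊠ ((t · t · t) ⋆ 1Q ⊞ conj x ⊠ R) ≡⟨ trans (⊠-distribˡ-⊞ x _ _) (cong₂ _⊞_ (trans (⋆-⊠ʳ (t · t · t) x 1Q) (cong ((t · t · t) ⋆_) (⊠-identityʳ x))) (trans (sym (⊠-assoc x (conj x) R)) (trans (cong (_⊠ R) (⊠-conj x)) (trans (⋆-⊠ˡ (norm x) 1Q R) (cong (norm x ⋆_) (⊠-identityˡ R)))))) ⟩
     (t · t · t) ⋆ x ⊞ norm x ⋆ R ∎
     where
     open ≡-Reasoning
     w S R : Q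
     w = t ⋆ 1Q ⊞ b ⋆ conj x
     S = (t · t) ⋆ 1Q ⊞ ((+ 2) · t · b) ⋆ conj x ⊞ (b · b) ⋆ (conj x ⊠ conj x)
     R = ((+ 3) · t · t · b) ⋆ 1Q ⊞ ((+ 3) · t · b · b) ⋆ conj x ⊞ (b · b · b) ⋆ (conj x ⊠ conj x)
     sq : ∀ x → (t ⋆ 1Q ⊞ b ⋆ conj x) ⊠ (t ⋆ 1Q ⊞ b ⋆ conj x) ≡ (t · t) ⋆ 1Q ⊞ ((+ 2) · t · b) ⋆ conj x ⊞ (b · b) ⋆ (conj x ⊠ conj x)
     sq (y ,√ m) = Q-ext (l k t b y m) (l' t b y m)
       where
       l : ∀ k t b y m → (t · 1ℤ ⊕ b · y) · (t · 1ℤ ⊕ b · y) ⊕ k · (t · 0ℤ ⊕ b · (⊖ m)) · (t · 0ℤ ⊕ b · (⊖ m))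
         ≡ t · t · 1ℤ ⊕ (+ 2) · t · b · y ⊕ b · b · (y · y ⊕ k · (⊖ m) · (⊖ m))
       l = ZS.solve-∀
       l' : ∀ t b y m → (t · 1ℤ ⊕ b · y) · (t · 0ℤ ⊕ b · (⊖ m)) ⊕ (t · 0ℤ ⊕ b · (⊖ m)) · (t · 1ℤ ⊕ b · y)
         ≡ t · t · 0ℤ ⊕ (+ 2) · t · b · (⊖ m) ⊕ b · b · (y · (⊖ m) ⊕ (⊖ m) · y)
       l' = ZS.solve-∀
     cu : ∀ x → (t ⋆ 1Q ⊞ b ⋆ conj x) ⊠ ((t · t) ⋆ 1Q ⊞ ((+ 2) · t · b) ⋆ conj x ⊞ (b · b) ⋆ (conj x ⊠ conj x))
       ≡ (t · t · t) ⋆ 1Q ⊞ conj x ⊠ (((+ 3) · t · t · b) ⋆ 1Q ⊞ ((+ 3) · t · b · b) ⋆ conj x ⊞ (b · b · b) ⋆ (conj x ⊠ conj x))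
     cu (y ,√ m) = Q-ext (l k t b y (⊖ m)) (l' k t b y (⊖ m))
       where
       l : ∀ k t b y m → (t · 1ℤ ⊕ b · y) · (t · t · 1ℤ ⊕ (+ 2) · t · b · y ⊕ b · b · (y · y ⊕ k · m · m))
           ⊕ k · (t · 0ℤ ⊕ b · m) · (t · t · 0ℤ ⊕ (+ 2) · t · b · m ⊕ b · b · (y · m ⊕ m · y))
         ≡ t · t · t · 1ℤ ⊕ (y · ((+ 3) · t · t · b · 1ℤ ⊕ (+ 3) · t · b · b · y ⊕ b · b · b · (y · y ⊕ k · m · m))
           ⊕ k · m · ((+ 3) · t · t · b · 0ℤ ⊕ (+ 3) · t · b · b · m ⊕ b · b · b · (y · m ⊕ m · y)))
       l = ZS.solve-∀
       l' : ∀ k t b y m → (t · 1ℤ ⊕ b · y) · (t · t · 0ℤ ⊕ (+ 2) · t · b · m ⊕ b · b · (y · m ⊕ m · y))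
           ⊕ (t · 0ℤ ⊕ b · m) · (t · t · 1ℤ ⊕ (+ 2) · t · b · y ⊕ b · b · (y · y ⊕ k · m · m))
         ≡ t · t · t · 0ℤ ⊕ (y · ((+ 3) · t · t · b · 0ℤ ⊕ (+ 3) · t · b · b · m ⊕ b · b · b · (y · m ⊕ m · y))
           ⊕ m · ((+ 3) · t · t · b · 1ℤ ⊕ (+ 3) · t · b · b · y ⊕ b · b · b · (y · y ⊕ k · m · m)))
       l' = ZS.solve-∀

 opaque
   unfolding _⊞_

   re-⋆ : ∀ n x → re (n ⋆ x) ≡ n · re x
   re-⋆ n (a ,√ b) = refl

 Q-div : ∀ d x → ZDiv d (re x) → ZDiv d (im x) → ∃[ y ] (x ≡ d ⋆ y)
 Q-div d x (p , ep) (q , eq) = (p ,√ q) , Q-ext (trans ep (trans (ℤP.*-comm p d) (sym (re-⋆ d (p ,√ q))))) (trans eq (trans (ℤP.*-comm q d) (sym (im-⋆ d (p ,√ q)))))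

 Q-cancel : ∀ {d} m x y → Coprime (abs d) m → (+ m) ⋆ x ≡ d ⋆ y → ∃[ z ] (x ≡ d ⋆ z)
 Q-cancel {d} m x y cop e = Q-div d x
   (coprime-cancel m cop (re y , trans (sym (re-⋆ (+ m) x)) (trans (cong re e) (trans (re-⋆ d y) (ℤP.*-comm d (re y))))))
   (coprime-cancel m cop (im y , trans (sym (im-⋆ (+ m) x)) (trans (cong im e) (trans (im-⋆ d y) (ℤP.*-comm d (im y))))))

 coprime-∣ : ∀ {d h m} → d ∣ h → Coprime h m → Coprime d m
 coprime-∣ p c (a , b) = c (ND.∣-trans a p , b)

 abs-cube : ∀ u → abs (u · u · u) ≡ abs u * abs u * abs u
 abs-cube u = trans (ℤP.abs-* (u · u) u) (cong (_* abs u) (ℤP.abs-* u u))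

 -- d is u or n below: a divisor of the norm of β prime to m.
 record Short (d : ℤ) (β : Q) (m : ℕ) : Set where
   field
     x : Q
     c z : ℤ
     s : ℕ
     s²≤ : s * s ≤ abs d
     <s² : abs d < suc s * suc s
     x-re : abs (re x) ≤ s
     x-im : abs (im x) ≤ s
     x-norm : norm x ≡ c · d
     c≢0 : c ≢ 0ℤ
     c≤ : abs c ≤ 1 + κ
     shift : (+ m) ⋆ conj x ≡ (z · d) ⋆ 1Q ⊞ im x ⋆ conj β

 module Factorisation (ns : NonSquareRational k) where

   private
     module ShortVector (d y : ℤ) (m : ℕ) (d≢0 : d ≢ 0ℤ) (cop : Coprime (abs d) m) (w : ℤ) (ew : norm (y ,√ (+ m)) ≡ w · d)
       (s : ℕ) (lo : s * s ≤ abs d) (hi : abs d < suc s * suc s) (a b z : ℤ) (nz : ¬ (a ≡ 0ℤ × b ≡ 0ℤ))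
       (ha : abs a ≤ s) (hb : abs b ≤ s) (ez : a · (+ m) ⊖ b · y ≡ z · d) where
       x β : Q
       x = a ,√ b
       β = y ,√ (+ m)
       f : ℤ
       f = z · d ⊕ (+ 2) · b · y
       sh : (+ m) ⋆ conj x ≡ (z · d) ⋆ 1Q ⊞ b ⋆ conj β
       sh = mξ̄ a b y (+ m) (z · d) ez
       -- m² norm x is the norm of z d + b conj β, and d divides both z d and norm β. As m is prime
       -- to d, d divides norm x; the quotient `c` is bounded because the coordinates of x are at
       -- most √d.
       eq : (+ m) · ((+ m) · norm x) ≡ (z · f ⊕ b · b · w) · d
       eq = begin
         (+ m) · ((+ m) · norm x) ≡⟨ trans (sym (ℤP.*-assoc (+ m) (+ m) (norm x))) (trans (cong (λ i → (+ m) · (+ m) · i) (sym (norm-conj x))) (sym (norm-⋆ (+ m) (conj x)))) ⟩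
         norm ((+ m) ⋆ conj x) ≡⟨ trans (cong norm sh) (norm-shift (z · d) b β) ⟩
         z · d · f ⊕ b · b · norm β ≡⟨ cong (λ t → z · d · f ⊕ b · b · t) ew ⟩
         z · d · f ⊕ b · b · (w · d) ≡⟨ l z d f b w ⟩
         (z · f ⊕ b · b · w) · d ∎
         where
         open ≡-Reasoning
         l : ∀ z d f b w → z · d · f ⊕ b · b · (w · d) ≡ (z · f ⊕ b · b · w) · d
         l = ZS.solve-∀
       div : ZDiv d (norm x)
       div = coprime-cancel {d} {norm x} m cop (coprime-cancel {d} {(+ m) · norm x} m cop (z · f ⊕ b · b · w , eq))
       c : ℤ
       c = proj₁ div
       ec : norm x ≡ c · d
       ec = proj₂ div
       c≢0 : c ≢ 0ℤ
       c≢0 e = nz (cong re x0 , cong im x0)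
         where
         x0 : x ≡ 0Q
         x0 = norm≡0 ns x (trans ec (trans (cong (ℤ._* d) e) (ℤP.*-zeroˡ d)))
       c≤ : abs c ≤ 1 + κ
       c≤ = *-cancelʳ-≤ (abs c) (1 + κ) (abs d) {{>-nonZero (abs≥1 d≢0)}} (begin
         abs c * abs d ≡⟨ trans (sym (ℤP.abs-* c d)) (cong abs (sym ec)) ⟩
         abs (norm x) ≤⟨ ∣norm∣≤ x ⟩
         abs a * abs a + κ * (abs b * abs b) ≤⟨ +-mono-≤ (≤-trans (*-mono-≤ ha ha) lo) (*-monoʳ-≤ κ (≤-trans (*-mono-≤ hb hb) lo)) ⟩
         abs d + κ * abs d ∎)
         where open ≤-Reasoning
       result : Short d β m
       result = record { x = x ; c = c ; z = z ; s = s ; s²≤ = lo ; <s² = hi ; x-re = ha ; x-im = hb ; x-norm = ec ; c≢0 = c≢0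
                       ; c≤ = c≤ ; shift = sh }

   opaque
     short : ∀ (d y : ℤ) (m : ℕ) → d ≢ 0ℤ → Coprime (abs d) m → ZDiv d (norm (y ,√ (+ m))) → Short d (y ,√ (+ m)) m
     short d y m d≢0 cop (w , ew) = go (isqrt (abs d))
       where
       go : ∃[ s ] (s * s ≤ abs d × abs d < suc s * suc s) → Short d (y ,√ (+ m)) m
       go (s , lo , hi) = go₂ (short-solution (abs d) s (abs≥1 d≢0) hi (+ m) y)
         where
         go₂ : ∃[ a ] ∃[ b ] (¬ (a ≡ 0ℤ × b ≡ 0ℤ) × abs a ≤ s × abs b ≤ s × ZDiv (+ abs d) (a · (+ m) ⊖ b · y)) → Short d (y ,√ (+ m)) m
         go₂ (a , b , nz , ha , hb , zd) = go₃ (∣⇒zdiv {d} {a · (+ m) ⊖ b · y} (zdiv⇒∣ {+ abs d} {a · (+ m) ⊖ b · y} zd))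
           where
           go₃ : ZDiv d (a · (+ m) ⊖ b · y) → Short d (y ,√ (+ m)) m
           go₃ (z , ez) = ShortVector.result d y m d≢0 cop w ew s lo hi a b z nz ha hb ez

   module Factor (R : Reduced) where
     open Reduced R

     u³ : ℤ
     u³ = u · u · u

     normβ : norm β ≡ (+ n) · u³
     normβ = trans (norm-pair (+ y) (+ m)) (trans (cong (ℤ._- k · (+ m) · (+ m)) yeq) (l ((+ n) · u³) (k · (+ m) · (+ m))))
       where
       l : ∀ a b → (a ⊕ b) ⊖ b ≡ a
       l = ZS.solve-∀

     u³≢0 : u³ ≢ 0ℤ
     u³≢0 e with ℤP.i*j≡0⇒i≡0∨j≡0 (u · u) e
     ... | inj₂ p = u≢0 p
     ... | inj₁ p with ℤP.i*j≡0⇒i≡0∨j≡0 u p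
     ...   | inj₁ q = u≢0 q
     ...   | inj₂ q = u≢0 q

     n≢0 : + n ≢ 0ℤ
     n≢0 e = n>0⇒n≢0 n≥1 (ℤP.+-injective e)

     -- A common divisor of norm β and m divides y² = norm β + k m². This is what permits cancelling
     -- m modulo u and modulo n.
     coprime-norm : Coprime (abs (norm β)) m
     coprime-norm {d} (p , q) = cop (d∣y , q)
       where
       d∣y² : d ∣ y * y
       d∣y² = subst (d ∣_) (trans (cong abs eq) (ℤP.abs-* (+ y) (+ y))) (∣m+n d p (ND.∣n⇒∣m*n (abs (k · (+ m))) q))
         where
         eq : norm β ⊕ k · (+ m) · (+ m) ≡ (+ y) · (+ y)
         eq = trans (cong (ℤ._+ k · (+ m) · (+ m)) (norm-pair (+ y) (+ m))) (l ((+ y) · (+ y)) (k · (+ m) · (+ m)))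
           where
           l : ∀ a b → (a ⊖ b) ⊕ b ≡ a
           l = ZS.solve-∀
         ∣m+n : ∀ d → d ∣ abs (norm β) → d ∣ abs (k · (+ m)) * m → d ∣ abs (norm β ⊕ k · (+ m) · (+ m))
         ∣m+n d p q = ℤS.∣⇒∣ᵤ {+ d} (ℤS.∣m∣n⇒∣m+n {+ d} (ℤS.∣ᵤ⇒∣ {+ d} {norm β} p) (ℤS.∣ᵤ⇒∣ {+ d} {k · (+ m) · (+ m)} (subst (d ∣_) (sym (ℤP.abs-* (k · (+ m)) (+ m))) q)))
       d∣y : d ∣ y
       d∣y = coprime-divisor (λ {e} (a , b) → cop (b , ND.∣-trans a q)) d∣y²

     cop-u³ : Coprime (abs u³) m
     cop-u³ = coprime-∣ (subst (abs u³ ∣_) (trans (sym (ℤP.abs-* (+ n) u³)) (cong abs (sym normβ))) (ND.∣n⇒∣m*n n ND.∣-refl)) coprime-norm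

     cop-u : Coprime (abs u) m
     cop-u = coprime-∣ (subst (abs u ∣_) (sym (abs-cube u)) (ND.∣n⇒∣m*n (abs u * abs u) ND.∣-refl)) cop-u³

     cop-n : Coprime (abs (+ n)) m
     cop-n = coprime-∣ (subst (n ∣_) (trans (sym (ℤP.abs-* (+ n) u³)) (cong abs (sym normβ))) (ND.∣m⇒∣m*n (abs u³) ND.∣-refl)) coprime-norm

     Ξ : Short u β m
     Ξ = short u (+ y) m u≢0 cop-u ((+ n) · (u · u) , trans normβ (l (+ n) u))
       where
       l : ∀ n u → n · (u · u · u) ≡ n · (u · u) · u
       l = ZS.solve-∀

     Γ : Short (+ n) β m
     Γ = short (+ n) (+ y) m n≢0 cop-n (u³ , trans normβ (ℤP.*-comm (+ n) u³))

     open Short Ξ using (c; c≢0) renaming (x to ξ; z to zξ; x-norm to normξ)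
     open Short Γ using () renaming (x to γ; c to c′; z to zγ; x-norm to normγ; c≢0 to c′≢0)

     C : ℤ
     C = pow c 3

     private
       t b : ℤ
       t = zξ · u
       b = im ξ
       Ω : Q
       Ω = ((+ 3) · t · t · b) ⋆ 1Q ⊞ ((+ 3) · t · b · b) ⋆ conj β ⊞ (b · b · b) ⋆ (conj β ⊠ conj β)
       T : Q
       T = (zξ · zξ · zξ) ⋆ β ⊞ (+ n) ⋆ Ω
       m³ : ℤ
       m³ = pow (+ m) 3
       -- Since t = zξ u and norm β = n u³, both summands of `cube-shift` are multiples of u³. Then
       -- `div₃` removes m³, and the quotient is `α`.
       key : m³ ⋆ (β ⊠ conj ξ ↑ 3) ≡ u³ ⋆ T
       key = begin
         m³ ⋆ (β ⊠ conj ξ ↑ 3) ≡⟨ trans (sym (⋆-⊠ʳ m³ β _)) (cong (β ⊠_) (sym (⋆-↑ (+ m) (conj ξ) 3))) ⟩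
         β ⊠ ((+ m) ⋆ conj ξ) ↑ 3 ≡⟨ cong (λ s → β ⊠ s ↑ 3) (Short.shift Ξ) ⟩
         β ⊠ (t ⋆ 1Q ⊞ b ⋆ conj β) ↑ 3 ≡⟨ cube-shift t b β ⟩
         (t · t · t) ⋆ β ⊞ norm β ⋆ Ω ≡⟨ cong₂ _⊞_ (trans (⋆-congˡ β (l zξ u)) (⋆-assoc u³ (zξ · zξ · zξ) β)) (trans (⋆-congˡ Ω (trans normβ (ℤP.*-comm (+ n) u³))) (⋆-assoc u³ (+ n) Ω)) ⟩
         u³ ⋆ ((zξ · zξ · zξ) ⋆ β) ⊞ u³ ⋆ ((+ n) ⋆ Ω) ≡⟨ sym (⋆-distrib-⊞ u³ _ _) ⟩
         u³ ⋆ T ∎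
         where
         open ≡-Reasoning
         l : ∀ z u → z · u · (z · u) · (z · u) ≡ u · u · u · (z · z · z)
         l = ZS.solve-∀
       pow3 : ∀ x → m³ ⋆ x ≡ (+ m) ⋆ ((+ m) ⋆ ((+ m) ⋆ x))
       pow3 x = trans (⋆-congˡ x (cong (λ s → (+ m) · ((+ m) · s)) (ℤP.*-identityʳ (+ m)))) (⋆-assoc₃ (+ m) (+ m) (+ m) x)
       div₃ : ∀ {d} x y → Coprime (abs d) m → m³ ⋆ x ≡ d ⋆ y → ∃[ z ] (x ≡ d ⋆ z)
       div₃ {d} x y cp e with Q-cancel m _ y cp (trans (sym (pow3 x)) e)
       ... | y₁ , e₁ with Q-cancel m _ y₁ cp e₁
       ... | y₂ , e₂ = Q-cancel m x y₂ cp e₂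
       opaque
         αdata : ∃[ z ] (β ⊠ conj ξ ↑ 3 ≡ u³ ⋆ z)
         αdata = div₃ _ T cop-u³ key

     α : Q
     α = proj₁ αdata

     α-eq : β ⊠ conj ξ ↑ 3 ≡ u³ ⋆ α
     α-eq = proj₂ αdata

     private
       m³α : m³ ⋆ α ≡ T
       m³α = ⋆-cancel u³ _ _ u³≢0 (trans (⋆-comm u³ m³ α) (trans (cong (m³ ⋆_) (sym α-eq)) key))

     norm-↑3 : ∀ x → norm (x ↑ 3) ≡ pow (norm x) 3
     norm-↑3 x = trans (norm-⊠ x _) (cong (norm x ·_) (trans (norm-⊠ x _) (cong (norm x ·_) (trans (norm-⊠ x 1Q) (cong (norm x ·_) (norm1)))))) 
       where
       norm1 : norm 1Q ≡ 1ℤ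
       norm1 = trans (norm-pair 1ℤ 0ℤ) (l k)
         where
         l : ∀ k → 1ℤ · 1ℤ ⊖ k · 0ℤ · 0ℤ ≡ 1ℤ
         l = ZS.solve-∀

     normα : norm α ≡ (+ n) · C
     normα = ℤP.*-cancelˡ-≡ (u³ · u³) _ _ {{ℤ.≢-nonZero (λ e → [ u³≢0 , u³≢0 ]′ (ℤP.i*j≡0⇒i≡0∨j≡0 u³ e))}} (begin
       u³ · u³ · norm α ≡⟨ trans (sym (norm-⋆ u³ α)) (cong norm (sym α-eq)) ⟩
       norm (β ⊠ conj ξ ↑ 3) ≡⟨ trans (norm-⊠ β _) (cong₂ _·_ normβ (trans (norm-↑3 (conj ξ)) (cong (λ s → pow s 3) (trans (norm-conj ξ) normξ)))) ⟩
       (+ n) · u³ · pow (c · u) 3 ≡⟨ l (+ n) u c ⟩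
       u³ · u³ · ((+ n) · C) ∎)
       where
       open ≡-Reasoning
       l : ∀ n u c → n · (u · u · u) · (c · u · (c · u · (c · u · 1ℤ))) ≡ u · u · u · (u · u · u) · (n · (c · (c · (c · 1ℤ))))
       l = ZS.solve-∀

     rel : C ⋆ β ≡ α ⊠ ξ ↑ 3
     rel = ⋆-cancel u³ _ _ u³≢0 (begin
       u³ ⋆ (C ⋆ β) ≡⟨ trans (sym (⋆-assoc u³ C β)) (⋆-congˡ β (l u c)) ⟩
       pow (c · u) 3 ⋆ β ≡⟨ ⋆-congˡ β (cong (λ s → pow s 3) (sym normξ)) ⟩
       pow (norm ξ) 3 ⋆ β ≡⟨ cong (pow (norm ξ) 3 ⋆_) (sym (⊠-identityʳ β)) ⟩
       pow (norm ξ) 3 ⋆ (β ⊠ 1Q) ≡⟨ sym (⋆-⊠ʳ (pow (norm ξ) 3) β 1Q) ⟩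
       β ⊠ (pow (norm ξ) 3 ⋆ 1Q) ≡⟨ cong (β ⊠_) nx ⟩
       β ⊠ (conj ξ ↑ 3 ⊠ ξ ↑ 3) ≡⟨ sym (⊠-assoc β _ _) ⟩
       (β ⊠ conj ξ ↑ 3) ⊠ ξ ↑ 3 ≡⟨ trans (cong (_⊠ ξ ↑ 3) α-eq) (⋆-⊠ˡ u³ α _) ⟩
       u³ ⋆ (α ⊠ ξ ↑ 3) ∎)
       where
       open ≡-Reasoning
       l : ∀ u c → u · u · u · (c · (c · (c · 1ℤ))) ≡ c · u · (c · u · (c · u · 1ℤ))
       l = ZS.solve-∀
       nx : pow (norm ξ) 3 ⋆ 1Q ≡ conj ξ ↑ 3 ⊠ ξ ↑ 3
       nx = sym (trans (sym (↑-⊠ (conj ξ) ξ 3)) (trans (cong (_↑ 3) (trans (⊠-comm (conj ξ) ξ) (⊠-conj ξ))) (trans (⋆-↑ (norm ξ) 1Q 3) (cong (pow (norm ξ) 3 ⋆_) one³))))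
         where
         one³ : 1Q ↑ 3 ≡ 1Q
         one³ = trans (⊠-identityˡ _) (trans (⊠-identityˡ _) (⊠-identityˡ _))

     private
       G : Q
       G = ((zξ · zξ · zξ) · zγ) ⋆ β ⊞ Ω ⊠ ((+ m) ⋆ conj γ) ⊞ ((zξ · zξ · zξ) · im γ · u³) ⋆ 1Q
       -- The same device for n. In the product of m³ α = zξ³ β + n Ω and m conj γ = zγ n + im γ
       -- conj β, the only term without a visible factor n contains β conj β = n u³.
       δkey : m³ ⋆ ((+ m) ⋆ (α ⊠ conj γ)) ≡ (+ n) ⋆ G
       δkey = begin
         m³ ⋆ ((+ m) ⋆ (α ⊠ conj γ)) ≡⟨ trans (cong (m³ ⋆_) (sym (⋆-⊠ʳ (+ m) α _))) (sym (⋆-⊠ˡ m³ α _)) ⟩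
         (m³ ⋆ α) ⊠ M ≡⟨ cong (_⊠ M) m³α ⟩
         (Z ⋆ β ⊞ (+ n) ⋆ Ω) ⊠ M ≡⟨ trans (⊠-comm _ M) (trans (⊠-distribˡ-⊞ M _ _) (cong₂ _⊞_ (trans (⋆-⊠ʳ Z M β) (cong (Z ⋆_) (⊠-comm M β))) (trans (⋆-⊠ʳ (+ n) M Ω) (cong ((+ n) ⋆_) (⊠-comm M Ω))))) ⟩
         Z ⋆ (β ⊠ M) ⊞ (+ n) ⋆ (Ω ⊠ M) ≡⟨ cong (λ s → Z ⋆ s ⊞ (+ n) ⋆ (Ω ⊠ M)) βM ⟩
         Z ⋆ ((zγ · (+ n)) ⋆ β ⊞ (im γ · ((+ n) · u³)) ⋆ 1Q) ⊞ (+ n) ⋆ (Ω ⊠ M) ≡⟨ rearr Z zγ (+ n) (im γ) u³ β (Ω ⊠ M) ⟩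
         (+ n) ⋆ G ∎
         where
         open ≡-Reasoning
         M = (+ m) ⋆ conj γ
         Z = zξ · zξ · zξ
         βM : β ⊠ M ≡ (zγ · (+ n)) ⋆ β ⊞ (im γ · ((+ n) · u³)) ⋆ 1Q
         βM = trans (cong (β ⊠_) (Short.shift Γ)) (trans (⊠-distribˡ-⊞ β _ _) (cong₂ _⊞_ (trans (⋆-⊠ʳ (zγ · (+ n)) β 1Q) (cong ((zγ · (+ n)) ⋆_) (⊠-identityʳ β)))
           (trans (⋆-⊠ʳ (im γ) β _) (trans (cong (im γ ⋆_) (trans (⊠-conj β) (⋆-congˡ 1Q normβ))) (sym (⋆-assoc (im γ) ((+ n) · u³) 1Q))))))
         rearr : ∀ Z z n g w x y → Z ⋆ ((z · n) ⋆ x ⊞ (g · (n · w)) ⋆ 1Q) ⊞ n ⋆ y ≡ n ⋆ ((Z · z) ⋆ x ⊞ y ⊞ (Z · g · w) ⋆ 1Q)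
         rearr Z z n g w x y = Q-rearr Z z n g w x y
           where
           opaque
             unfolding _⊞_
             Q-rearr : ∀ Z z n g w x y → Z ⋆ ((z · n) ⋆ x ⊞ (g · (n · w)) ⋆ 1Q) ⊞ n ⋆ y ≡ n ⋆ ((Z · z) ⋆ x ⊞ y ⊞ (Z · g · w) ⋆ 1Q)
             Q-rearr Z z n g w (a ,√ b) (c ,√ d) = Q-ext (l Z z n g w a c 1ℤ) (l Z z n g w b d 0ℤ)
               where
               l : ∀ Z z n g w a c o → Z · (z · n · a ⊕ g · (n · w) · o) ⊕ n · c ≡ n · (Z · z · a ⊕ c ⊕ Z · g · w · o)
               l = ZS.solve-∀
       δ⁺ : ∃[ z ] ((+ m) ⋆ (α ⊠ conj γ) ≡ (+ n) ⋆ z)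
       δ⁺ = div₃ ((+ m) ⋆ (α ⊠ conj γ)) G cop-n δkey
       opaque
         δdata : ∃[ z ] (α ⊠ conj γ ≡ (+ n) ⋆ z)
         δdata = Q-cancel m _ (proj₁ δ⁺) cop-n (proj₂ δ⁺)

     -- The unit-like factor: c′ C β = δ γ ξ³, and by `normδ` its norm is C c′, bounded in terms of
     -- k.
     δ : Q
     δ = proj₁ δdata

     δ-eq : α ⊠ conj γ ≡ (+ n) ⋆ δ
     δ-eq = proj₂ δdata

     δγ : δ ⊠ γ ≡ c′ ⋆ α
     δγ = ⋆-cancel (+ n) _ _ n≢0 (begin
       (+ n) ⋆ (δ ⊠ γ) ≡⟨ trans (sym (⋆-⊠ˡ (+ n) δ γ)) (cong (_⊠ γ) (sym δ-eq)) ⟩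
       (α ⊠ conj γ) ⊠ γ ≡⟨ trans (⊠-assoc α _ _) (cong (α ⊠_) (trans (⊠-comm (conj γ) γ) (⊠-conj γ))) ⟩
       α ⊠ (norm γ ⋆ 1Q) ≡⟨ trans (⋆-⊠ʳ (norm γ) α 1Q) (cong₂ _⋆_ (trans normγ (ℤP.*-comm c′ (+ n))) (⊠-identityʳ α)) ⟩
       ((+ n) · c′) ⋆ α ≡⟨ ⋆-assoc (+ n) c′ α ⟩
       (+ n) ⋆ (c′ ⋆ α) ∎)
       where open ≡-Reasoning

     rel′ : c′ ⋆ (C ⋆ β) ≡ (δ ⊠ γ) ⊠ ξ ↑ 3
     rel′ = trans (cong (c′ ⋆_) rel) (trans (sym (⋆-⊠ˡ c′ α _)) (cong (_⊠ ξ ↑ 3) (sym δγ)))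

     normδ : norm δ ≡ C · c′
     normδ = ℤP.*-cancelˡ-≡ ((+ n) · (+ n)) _ _ {{ℤ.≢-nonZero (λ e → [ n≢0 , n≢0 ]′ (ℤP.i*j≡0⇒i≡0∨j≡0 (+ n) e))}} (begin
       (+ n) · (+ n) · norm δ ≡⟨ trans (sym (norm-⋆ (+ n) δ)) (cong norm (sym δ-eq)) ⟩
       norm (α ⊠ conj γ) ≡⟨ trans (norm-⊠ α _) (cong₂ _·_ normα (trans (norm-conj γ) normγ)) ⟩
       (+ n) · C · (c′ · (+ n)) ≡⟨ l (+ n) C c′ ⟩
       (+ n) · (+ n) · (C · c′) ∎)
       where
       open ≡-Reasoning
       l : ∀ n C c → n · C · (c · n) ≡ n · n · (C · c)
       l = ZS.solve-∀

 open Factorisation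

 -- Reduction of integral points

 gcd-split : ∀ a b → 1 ≤ b → ∃[ g ] ∃[ a' ] ∃[ b' ] (a ≡ a' * g × b ≡ b' * g × 1 ≤ g × Coprime a' b')
 gcd-split a b b≥1 = go (gcd[m,n]∣m a b) (gcd[m,n]∣n a b)
   where
   g = gcd a b
   g≥1 : 1 ≤ g
   g≥1 = n≢0⇒n>0 (gcd[m,n]≢0 a b (inj₂ (n>0⇒n≢0 b≥1)))
   go : g ∣ a → g ∣ b → ∃[ g ] ∃[ a' ] ∃[ b' ] (a ≡ a' * g × b ≡ b' * g × 1 ≤ g × Coprime a' b')
   go (divides a' ea) (divides b' eb) = g , a' , b' , ea , eb , g≥1 , cop
     where
     cop : Coprime a' b'
     cop {d} (p , q) = ND.∣1⇒≡1 (ND.*-cancelʳ-∣ g {{>-nonZero g≥1}} (subst (d * g ∣_) (sym (*-identityˡ g)) (gcd-greatest (subst (d * g ∣_) (sym ea) (ND.*-monoˡ-∣ g p)) (subst (d * g ∣_) (sym eb) (ND.*-monoˡ-∣ g q)))))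

 coprime-square : ∀ {u v} → Coprime u v → Coprime (v * v) u
 coprime-square {u} {v} cop {e} (p , q) = cop (q , coprime-divisor {e} {v} (λ (a , b) → cop (ND.∣-trans a q , b)) p)

 record PointData (B : ℕ) : Set where
   field
     R : Reduced
     v absx : ℕ
     v≥1 : 1 ≤ v
   open Reduced R public
   field
     B≡ : B ≡ n * (v * v * v) * m
     absx≡ : absx ≡ n * (v * v) * abs u

 -- With g = gcd(y₀, B) the equation reads x³ = g² w, where w = y² - k m² ≠ 0. With d = gcd(x, g), x
 -- = u d and g = v d it becomes d u³ = v² w. As v is prime to u, v² divides d, say d = n v², and w
 -- = n u³ follows.
 reduce : NonSquareRational k → ∀ B → 1 ≤ B → HasIntegralPoint k B → PointData B
 reduce ns B B≥1 (x , y₀ , e₀) = go₁ (gcd-split (abs y₀) B B≥1)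
   where
   go₁ : ∃[ g ] ∃[ y ] ∃[ m ] (abs y₀ ≡ y * g × B ≡ m * g × 1 ≤ g × Coprime y m) → PointData B
   go₁ (g , y , m , ey , eB , g≥1 , cop) = go₂ (gcd-split (abs x) g g≥1)
     where
     w : ℤ
     w = (+ y) · (+ y) ⊖ k · (+ m) · (+ m)
     m≥1 : 1 ≤ m
     m≥1 = n≢0⇒n>0 (λ e → n>0⇒n≢0 B≥1 (trans eB (cong (_* g) e)))
     sq : y₀ · y₀ ≡ (+ y) · (+ g) · ((+ y) · (+ g))
     sq = trans (abs-sq y₀) (trans (cong (λ t → + (t * t)) ey) (trans (ℤP.pos-* (y * g) (y * g)) (cong₂ _·_ (ℤP.pos-* y g) (ℤP.pos-* y g))))
       where
       abs-sq : ∀ c → c · c ≡ + (abs c * abs c)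
       abs-sq (+ n) = sym (ℤP.pos-* n n)
       abs-sq -[1+ n ] = refl
     x³ : x · x · x ≡ (+ g) · (+ g) · w
     x³ = begin
       x · x · x ≡⟨ l₁ (x · x · x) (k · (+ B) · (+ B)) ⟩
       (x · x · x ⊕ k · (+ B) · (+ B)) ⊖ k · (+ B) · (+ B) ≡⟨ cong₂ (λ s t → s ⊖ k · t · t) (trans (sym e₀) sq) (trans (cong +_ eB) (ℤP.pos-* m g)) ⟩
       (+ y) · (+ g) · ((+ y) · (+ g)) ⊖ k · ((+ m) · (+ g)) · ((+ m) · (+ g)) ≡⟨ l₂ (+ y) (+ g) k (+ m) ⟩
       (+ g) · (+ g) · w ∎
       where
       open ≡-Reasoning
       l₁ : ∀ a b → a ≡ (a ⊕ b) ⊖ b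
       l₁ = ZS.solve-∀
       l₂ : ∀ y g k m → y · g · (y · g) ⊖ k · (m · g) · (m · g) ≡ g · g · (y · y ⊖ k · m · m)
       l₂ = ZS.solve-∀
     nonzero-prod : ∀ {a b : ℤ} → a ≢ 0ℤ → b ≢ 0ℤ → a · b ≢ 0ℤ
     nonzero-prod {a} p q e = [ p , q ]′ (ℤP.i*j≡0⇒i≡0∨j≡0 a e)
     pos≢0 : ∀ {n} → 1 ≤ n → + n ≢ 0ℤ
     pos≢0 p e = n>0⇒n≢0 p (ℤP.+-injective e)
     w≢0 : w ≢ 0ℤ
     w≢0 e = pos≢0 m≥1 (cong im (norm≡0 ns ((+ y) ,√ (+ m)) (trans (norm-pair (+ y) (+ m)) e)))
     x≢0 : x ≢ 0ℤ
     x≢0 refl = nonzero-prod (nonzero-prod (pos≢0 g≥1) (pos≢0 g≥1)) w≢0 (sym x³)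
     go₂ : ∃[ d ] ∃[ u' ] ∃[ v ] (abs x ≡ u' * d × g ≡ v * d × 1 ≤ d × Coprime u' v) → PointData B
     go₂ (d , u' , v , ex , eg , d≥1 , cop') = go₃ (∣⇒zdiv {+ d} {x} (divides u' ex))
       where
       go₃ : ZDiv (+ d) x → PointData B
       go₃ (u , eu) = go₄ vv∣d
         where
         absu : abs u ≡ u'
         absu = *-cancelʳ-≡ (abs u) u' d {{>-nonZero d≥1}} (trans (sym (ℤP.abs-* u (+ d))) (trans (cong abs (sym eu)) ex))
         main : (+ d) · (u · u · u) ≡ (+ v) · (+ v) · w
         main = ℤP.*-cancelˡ-≡ ((+ d) · (+ d)) _ _ {{ℤ.≢-nonZero (nonzero-prod (pos≢0 d≥1) (pos≢0 d≥1))}} (begin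
           (+ d) · (+ d) · ((+ d) · (u · u · u)) ≡⟨ l₁ (+ d) u ⟩
           u · (+ d) · (u · (+ d)) · (u · (+ d)) ≡⟨ cong (λ t → t · t · t) (sym eu) ⟩
           x · x · x ≡⟨ x³ ⟩
           (+ g) · (+ g) · w ≡⟨ cong (λ t → t · t · w) (trans (cong +_ eg) (ℤP.pos-* v d)) ⟩
           (+ v) · (+ d) · ((+ v) · (+ d)) · w ≡⟨ l₂ (+ v) (+ d) w ⟩
           (+ d) · (+ d) · ((+ v) · (+ v) · w) ∎)
           where
           open ≡-Reasoning
           l₁ : ∀ d u → d · d · (d · (u · u · u)) ≡ u · d · (u · d) · (u · d)
           l₁ = ZS.solve-∀
           l₂ : ∀ v d w → v · d · (v · d) · w ≡ d · d · (v · v · w)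
           l₂ = ZS.solve-∀
         main-abs : u' * (u' * (u' * d)) ≡ abs w * (v * v)
         main-abs = begin
           u' * (u' * (u' * d)) ≡⟨ l u' d ⟩
           d * (u' * u' * u') ≡⟨ cong (λ t → d * (t * t * t)) (sym absu) ⟩
           d * (abs u * abs u * abs u) ≡⟨ trans (cong (d *_) (sym (abs-cube u))) (sym (ℤP.abs-* (+ d) (u · u · u))) ⟩
           abs ((+ d) · (u · u · u)) ≡⟨ cong abs main ⟩
           abs ((+ v) · (+ v) · w) ≡⟨ trans (ℤP.abs-* ((+ v) · (+ v)) w) (trans (cong (_* abs w) (ℤP.abs-* (+ v) (+ v))) (*-comm (v * v) (abs w))) ⟩
           abs w * (v * v) ∎
           where
           open ≡-Reasoning
           l : ∀ u d → u * (u * (u * d)) ≡ d * (u * u * u)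
           l = NS.solve-∀
         cv : Coprime (v * v) u'
         cv = coprime-square cop'
         vv∣d : v * v ∣ d
         vv∣d = coprime-divisor cv (coprime-divisor cv (coprime-divisor cv (divides (abs w) main-abs)))
         v≥1 : 1 ≤ v
         v≥1 = n≢0⇒n>0 (λ e → n>0⇒n≢0 g≥1 (trans eg (cong (_* d) e)))
         go₄ : v * v ∣ d → PointData B
         go₄ (divides n en) = record
           { R = record { n = n ; m = m ; y = y ; u = u ; n≥1 = n≥1 ; m≥1 = m≥1 ; u≢0 = u≢0 ; yeq = yeq ; cop = cop }
           ; v = v ; absx = abs x ; v≥1 = v≥1
           ; B≡ = trans eB (trans (cong (m *_) (trans eg (cong (v *_) en))) (lB m v n))
           ; absx≡ = trans ex (trans (cong₂ _*_ (sym absu) en) (*-comm (abs u) (n * (v * v)))) }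
           where
           lB : ∀ m v n → m * (v * (n * (v * v))) ≡ n * (v * v * v) * m
           lB = NS.solve-∀
           n≥1 : 1 ≤ n
           n≥1 = n≢0⇒n>0 (λ e → n>0⇒n≢0 d≥1 (trans en (cong (_* (v * v)) e)))
           u≢0 : u ≢ 0ℤ
           u≢0 e = x≢0 (trans eu (trans (cong (ℤ._* (+ d)) e) (ℤP.*-zeroˡ (+ d))))
           w≡ : w ≡ (+ n) · (u · u · u)
           w≡ = ℤP.*-cancelˡ-≡ ((+ v) · (+ v)) _ _ {{ℤ.≢-nonZero (nonzero-prod (pos≢0 v≥1) (pos≢0 v≥1))}}
             (trans (sym main) (trans (cong (ℤ._* (u · u · u)) (trans (cong +_ en) (trans (ℤP.pos-* n (v * v)) (cong ((+ n) ·_) (ℤP.pos-* v v))))) (l (+ n) (+ v) (u · u · u))))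
             where
             l : ∀ n v u → n · (v · v) · u ≡ v · v · (n · u)
             l = ZS.solve-∀
           yeq : (+ y) · (+ y) ≡ (+ n) · (u · u · u) ⊕ k · (+ m) · (+ m)
           yeq = trans (l ((+ y) · (+ y)) (k · (+ m) · (+ m))) (cong (ℤ._+ k · (+ m) · (+ m)) w≡)
             where
             l : ∀ a b → a ≡ (a ⊖ b) ⊕ b
             l = ZS.solve-∀

 toCusp : NonSquareRational k → (R : Reduced) (u : ℕ) → Reduced.u R ≡ + u →
   4 * (κ * κ) * (Reduced.m R * Reduced.m R) ≤ Reduced.n R * (u * u * u) → Cusp
 toCusp ns R u e cu = record
   { n = n ; m = m ; y = y ; u = u ; s = Short.s Ξ ; c = Short.c Ξ ; ξ = Short.x Ξ ; α = α
   ; n≥1 = n≥1 ; m≥1 = m≥1 ; u≥1 = n≢0⇒n>0 (λ z → Reduced.u≢0 R (trans e (cong +_ z)))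
   ; yeq = trans yeq (cong (λ t → (+ n) · (t · t · t) ⊕ k · (+ m) · (+ m)) e)
   ; s²≤u = subst (λ t → Short.s Ξ * Short.s Ξ ≤ t) (cong abs e) (Short.s²≤ Ξ)
   ; u<s² = subst (λ t → t < suc (Short.s Ξ) * suc (Short.s Ξ)) (cong abs e) (Short.<s² Ξ)
   ; ξ-re = Short.x-re Ξ ; ξ-im = Short.x-im Ξ
   ; normξ = trans (Short.x-norm Ξ) (cong (Short.c Ξ ·_) e)
   ; c≢0 = Short.c≢0 Ξ ; c≤ = Short.c≤ Ξ ; normα = normα ; rel = rel ; cusp = cu }
   where
   open Reduced R using (n; m; y; n≥1; m≥1; yeq)
   open Factor ns R

 -- Separating elements of equal norm

 abs-sign-injective : ∀ x y → abs x ≡ abs y → negative? x ≡ negative? y → x ≡ y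
 abs-sign-injective (+ m) (+ n) e _ = cong +_ e
 abs-sign-injective -[1+ m ] -[1+ n ] e _ = cong -[1+_] (suc-injective e)

 abs-+-same : ∀ x y → IsNat (x · y) → abs (x ⊕ y) ≡ abs x + abs y
 abs-+-same (+ m) (+ n) _ = refl
 abs-+-same -[1+ m ] -[1+ n ] _ = cong suc (sym (+-suc m n))
 abs-+-same (+ zero) -[1+ n ] _ = refl
 abs-+-same (+ suc m) -[1+ n ] (j , ())
 abs-+-same -[1+ m ] (+ zero) _ = sym (+-identityʳ (suc m))
 abs-+-same -[1+ m ] (+ suc n) (j , ())

 sq-abs : ∀ x → x · x ≡ + (abs x * abs x)
 sq-abs (+ n) = sym (ℤP.pos-* n n)
 sq-abs -[1+ n ] = refl

 abs-sq-injective : ∀ {x y} → x · x ≡ y · y → abs x ≡ abs y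
 abs-sq-injective {x} {y} e = ≤-antisym (sq-cancel-≤ (≤-reflexive h)) (sq-cancel-≤ (≤-reflexive (sym h)))
   where
   h : abs x * abs x ≡ abs y * abs y
   h = ℤP.+-injective (trans (sym (sq-abs x)) (trans e (sq-abs y)))

 private
   -- The unit δ₁/δ₂ is too close to 1 to be a nontrivial unit of norm one.
   unit-trivial : ∀ {a₁ a₂ b₁ b₂ j : ℕ} → 1 ≤ b₁ → b₁ ≤ a₁ → b₂ ≤ a₂ → b₂ < 2 * b₁ → b₁ ≤ b₂ →
     j * (a₁ * b₂ + a₂ * b₁) ≤ b₂ * b₂ → j ≡ 0
   unit-trivial {j = zero} _ _ _ _ _ _ = refl
   unit-trivial {a₁} {a₂} {b₁} {b₂} {suc j} b≥1 h₁ h₂ lt le p = ⊥-elim (<⇒≱ (begin-strict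
     b₂ * b₂ <⟨ *-monoʳ-< b₂ {{>-nonZero (≤-trans b≥1 le)}} lt ⟩
     b₂ * (2 * b₁) ≡⟨ l b₁ b₂ ⟩
     b₁ * b₂ + b₂ * b₁ ≤⟨ +-mono-≤ (*-monoˡ-≤ b₂ h₁) (*-monoˡ-≤ b₁ h₂) ⟩
     a₁ * b₂ + a₂ * b₁ ≤⟨ m≤m+n _ _ ⟩
     suc j * (a₁ * b₂ + a₂ * b₁) ∎) p)
     where
     open ≤-Reasoning
     l : ∀ b c → c * (2 * b) ≡ b * c + c * b
     l = NS.solve-∀

 -- Elements of norm ν congruent modulo ν differ by a unit of norm 1, and distinct ones cannot share
 -- signs and a dyadic range. `cap` records |B| exactly below V. For negative k always |B| ≤ V; for
 -- k ≥ 2 and |B| ≥ V one has |B| ≤ |A|, as `unit-trivial` requires.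
 module NormClass (ns : NonSquareRational k) (ν : ℤ) (V : ℕ) (ν≢0 : ν ≢ 0ℤ) (ν≤V : abs ν ≤ V)
   (A₁ B₁ A₂ B₂ : ℤ) (e₁ : A₁ · A₁ ⊖ k · B₁ · B₁ ≡ ν) (e₂ : A₂ · A₂ ⊖ k · B₂ · B₂ ≡ ν)
   (dA : ZDiv ν (A₁ ⊖ A₂)) (dB : ZDiv ν (B₁ ⊖ B₂)) (sA : negative? A₁ ≡ negative? A₂) (sB : negative? B₁ ≡ negative? B₂)
   (cap : abs B₁ ℕ.⊓ V ≡ abs B₂ ℕ.⊓ V) (lt₁ : 1 ≤ abs B₁ → abs B₂ < 2 * abs B₁) (lt₂ : 1 ≤ abs B₂ → abs B₁ < 2 * abs B₂) where

   private
     A²≡ : ∀ A B → A · A ⊖ k · B · B ≡ ν → A · A ≡ k · B · B ⊕ ν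
     A²≡ A B e = trans (l (A · A) (k · B · B)) (cong (λ t → k · B · B ⊕ t) e)
       where
       l : ∀ a b → a ≡ b ⊕ (a ⊖ b)
       l = ZS.solve-∀

   from-|B| : abs B₁ ≡ abs B₂ → A₁ ≡ A₂ × B₁ ≡ B₂
   from-|B| e = abs-sign-injective A₁ A₂ (abs-sq-injective {A₁} {A₂} (trans (A²≡ A₁ B₁ e₁) (trans (cong (λ t → k · t · t ⊕ ν) eB) (sym (A²≡ A₂ B₂ e₂))))) sA , eB
     where
     eB : B₁ ≡ B₂
     eB = abs-sign-injective B₁ B₂ e sB

   private
     small⇒ : abs B₁ < V → abs B₁ ≡ abs B₂
     small⇒ lt with ≤-total V (abs B₂)
     ... | inj₁ p = ⊥-elim (<-irrefl (trans (sym (m≤n⇒m⊓n≡m (<⇒≤ lt))) (trans cap (m≥n⇒m⊓n≡n p))) lt)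
     ... | inj₂ p = trans (sym (m≤n⇒m⊓n≡m (<⇒≤ lt))) (trans cap (m≤n⇒m⊓n≡m p))
     large⇒ : V ≤ abs B₁ → V ≤ abs B₂
     large⇒ p = ≤-trans (≤-reflexive (trans (sym (m≥n⇒m⊓n≡n p)) cap)) (m⊓n≤m (abs B₂) V)
     V≥1 : 1 ≤ V
     V≥1 = ≤-trans (abs≥1 ν≢0) ν≤V
     neg-bound : ∀ j → k ≡ -[1+ j ] → ∀ A B → A · A ⊖ k · B · B ≡ ν → abs B ≤ V
     neg-bound j ek A B e = ≤-trans (≤-trans (m≤m*m (abs B)) (≤-trans (m≤n*m (abs B * abs B) (suc j)) (≤-trans (m≤n+m (suc j * (abs B * abs B)) (abs A * abs A)) (≤-reflexive (sym h))))) ν≤V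
       where
       h : abs ν ≡ abs A * abs A + suc j * (abs B * abs B)
       h = cong abs {ν} {+ (abs A * abs A + suc j * (abs B * abs B))} (trans (sym e) (trans (cong (λ t → A · A ⊖ t · B · B) ek) (trans (l (A · A) (+ suc j) B) (cong₂ _⊕_ (sq-abs A) (trans (cong ((+ suc j) ·_) (sq-abs B)) (sym (ℤP.pos-* (suc j) (abs B * abs B))))))))
         where
         l : ∀ a j b → a ⊖ (⊖ j) · b · b ≡ a ⊕ j · (b · b)
         l = ZS.solve-∀
     pos-bound : ∀ j → k ≡ + suc (suc j) → ∀ A B → A · A ⊖ k · B · B ≡ ν → V ≤ abs B → abs B ≤ abs A
     pos-bound j ek A B e p = sq-cancel-≤ (+-cancelʳ-≤ (abs B * abs B) _ _ (begin
       abs B * abs B + abs B * abs B ≡⟨ l (abs B * abs B) ⟩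
       2 * (abs B * abs B) ≤⟨ *-monoˡ-≤ (abs B * abs B) (s≤s (s≤s (z≤n {j}))) ⟩
       suc (suc j) * (abs B * abs B) ≡⟨ cong abs eq ⟩
       abs (A · A ⊖ ν) ≤⟨ ℤP.∣i-j∣≤∣i∣+∣j∣ (A · A) ν ⟩
       abs (A · A) + abs ν ≤⟨ +-mono-≤ (≤-reflexive (ℤP.abs-* A A)) (≤-trans ν≤V (≤-trans p (m≤m*m (abs B)))) ⟩
       abs A * abs A + abs B * abs B ∎))
       where
       open ≤-Reasoning
       l : ∀ a → a + a ≡ 2 * a
       l = NS.solve-∀
       eq : + (suc (suc j) * (abs B * abs B)) ≡ A · A ⊖ ν
       eq = trans (ℤP.pos-* (suc (suc j)) (abs B * abs B)) (trans (cong₂ _·_ (sym ek) (sym (sq-abs B))) (trans (l' (A · A) k B) (cong (λ t → A · A ⊖ t) e)))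
         where
         l' : ∀ a k b → k · (b · b) ≡ a ⊖ (a ⊖ k · b · b)
         l' = ZS.solve-∀
     J : ℤ
     J = A₁ · B₂ ⊖ A₂ · B₁
     q : ℤ
     q = proj₁ dA · B₂ ⊖ A₂ · proj₁ dB
     J≡ : J ≡ q · ν
     J≡ = trans (l A₁ A₂ B₁ B₂) (trans (cong₂ (λ s t → s · B₂ ⊖ A₂ · t) (proj₂ dA) (proj₂ dB)) (l' (proj₁ dA) (proj₁ dB) B₂ A₂ ν))
       where
       l : ∀ A₁ A₂ B₁ B₂ → A₁ · B₂ ⊖ A₂ · B₁ ≡ (A₁ ⊖ A₂) · B₂ ⊖ A₂ · (B₁ ⊖ B₂)
       l = ZS.solve-∀
       l' : ∀ p r b a ν → p · ν · b ⊖ a · (r · ν) ≡ (p · b ⊖ a · r) · ν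
       l' = ZS.solve-∀
     -- `J` is the coefficient of √k in the conjugate of the first element times the second, so `q`
     -- is that of their quotient, a unit. Substituting the norm equations for A₁² and A₂² makes the
     -- terms with k cancel.
     main : q · (A₁ · B₂ ⊕ A₂ · B₁) ≡ B₂ · B₂ ⊖ B₁ · B₁
     main = ℤP.*-cancelˡ-≡ ν _ _ {{ℤ.≢-nonZero ν≢0}} (begin
       ν · (q · S) ≡⟨ trans (l₁ ν q S) (cong (ℤ._* S) (sym J≡)) ⟩
       J · S ≡⟨ l₂ A₁ A₂ B₁ B₂ ⟩
       A₁ · A₁ · (B₂ · B₂) ⊖ A₂ · A₂ · (B₁ · B₁) ≡⟨ cong₂ (λ s t → s · (B₂ · B₂) ⊖ t · (B₁ · B₁)) (A²≡ A₁ B₁ e₁) (A²≡ A₂ B₂ e₂) ⟩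
       (k · B₁ · B₁ ⊕ ν) · (B₂ · B₂) ⊖ (k · B₂ · B₂ ⊕ ν) · (B₁ · B₁) ≡⟨ l₃ k ν B₁ B₂ ⟩
       ν · (B₂ · B₂ ⊖ B₁ · B₁) ∎)
       where
       open ≡-Reasoning
       S = A₁ · B₂ ⊕ A₂ · B₁
       l₁ : ∀ ν q s → ν · (q · s) ≡ q · ν · s
       l₁ = ZS.solve-∀
       l₂ : ∀ a c b d → (a · d ⊖ c · b) · (a · d ⊕ c · b) ≡ a · a · (d · d) ⊖ c · c · (b · b)
       l₂ = ZS.solve-∀
       l₃ : ∀ k ν b d → (k · b · b ⊕ ν) · (d · d) ⊖ (k · d · d ⊕ ν) · (b · b) ≡ ν · (d · d ⊖ b · b)
       l₃ = ZS.solve-∀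
     main-abs : abs q * (abs A₁ * abs B₂ + abs A₂ * abs B₁) ≡ abs (B₂ · B₂ ⊖ B₁ · B₁)
     main-abs = trans (cong (abs q *_) (sym (trans (abs-+-same (A₁ · B₂) (A₂ · B₁) nn) (cong₂ _+_ (ℤP.abs-* A₁ B₂) (ℤP.abs-* A₂ B₁))))) (trans (sym (ℤP.abs-* q (A₁ · B₂ ⊕ A₂ · B₁))) (cong abs main))
       where
       nn : IsNat (A₁ · B₂ · (A₂ · B₁))
       nn = subst IsNat (l A₁ A₂ B₁ B₂) (isNat-* (same-sign A₁ A₂ sA) (same-sign B₁ B₂ sB))
         where
         l : ∀ a c b d → a · c · (b · d) ≡ a · d · (c · b)
         l = ZS.solve-∀
     diff≤ : ∀ b c → b ≤ c → abs ((+ (c * c)) ⊖ (+ (b * b))) ≤ c * c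
     diff≤ b c p = abs-diff≤ (c * c) (b * b) (c * c) ≤-refl (*-mono-≤ p p)
     rhs : B₂ · B₂ ⊖ B₁ · B₁ ≡ (+ (abs B₂ * abs B₂)) ⊖ (+ (abs B₁ * abs B₁))
     rhs = cong₂ _⊖_ (sq-abs B₂) (sq-abs B₁)
     q≡0⇒ : abs q ≡ 0 → abs B₁ ≡ abs B₂
     q≡0⇒ e = sym (abs-sq-injective {B₂} {B₁} (ℤP.i-j≡0⇒i≡j _ _ (trans (sym main) (trans (cong (ℤ._* (A₁ · B₂ ⊕ A₂ · B₁)) (ℤP.∣i∣≡0⇒i≡0 {q} e)) (ℤP.*-zeroˡ (A₁ · B₂ ⊕ A₂ · B₁))))))
     large : ∀ j → k ≡ j → V ≤ abs B₁ → abs B₁ ≡ abs B₂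
     large -[1+ j ] ek p = trans (≤-antisym (neg-bound j ek A₁ B₁ e₁) p) (≤-antisym (large⇒ p) (neg-bound j ek A₂ B₂ e₂))
     large (+ zero) ek p = ⊥-elim (ns ℚ.0ℚ (subst (λ t → ℚ.0ℚ ℚ.* ℚ.0ℚ ≡ ℚ._/_ t 1) (sym ek) refl))
     large (+ suc zero) ek p = ⊥-elim (ns ℚ.1ℚ (subst (λ t → ℚ.1ℚ ℚ.* ℚ.1ℚ ≡ ℚ._/_ t 1) (sym ek) refl))
     large (+ suc (suc j)) ek p = q≡0⇒ (go (≤-total (abs B₁) (abs B₂)))
       where
       b₁≤ = pos-bound j ek A₁ B₁ e₁ p
       b₂≤ = pos-bound j ek A₂ B₂ e₂ (large⇒ p)
       B₁≥1 = ≤-trans V≥1 p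
       B₂≥1 = ≤-trans V≥1 (large⇒ p)
       go : abs B₁ ≤ abs B₂ ⊎ abs B₂ ≤ abs B₁ → abs q ≡ 0
       go (inj₁ le) = unit-trivial {abs A₁} {abs A₂} {abs B₁} {abs B₂} {abs q} B₁≥1 b₁≤ b₂≤ (lt₁ B₁≥1) le
         (≤-trans (≤-reflexive (trans main-abs (cong abs rhs))) (diff≤ (abs B₁) (abs B₂) le))
       go (inj₂ le) = unit-trivial {abs A₂} {abs A₁} {abs B₂} {abs B₁} {abs q} B₂≥1 b₂≤ b₁≤ (lt₂ B₂≥1) le
         (≤-trans (≤-reflexive (trans (cong (abs q *_) (+-comm (abs A₂ * abs B₁) (abs A₁ * abs B₂))) (trans main-abs (trans (cong abs rhs) (trans (ℤP.∣i-j∣≡∣j-i∣ (+ (abs B₂ * abs B₂)) (+ (abs B₁ * abs B₁))) refl))))) (diff≤ (abs B₂) (abs B₁) le))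

   equal : A₁ ≡ A₂ × B₁ ≡ B₂
   equal with ≤-total V (abs B₁)
   ... | inj₁ p = from-|B| (large k refl p)
   ... | inj₂ p with m≤n⇒m<n∨m≡n p
   ...   | inj₁ lt = from-|B| (small⇒ lt)
   ...   | inj₂ e = from-|B| (large k refl (≤-reflexive (sym e)))

 -- Case (B): small x

 residue-div : ∀ (M : ℕ) .{{_ : NonZero M}} x y → x ℤD.%ℕ M ≡ y ℤD.%ℕ M → ZDiv (+ M) (x ⊖ y)
 residue-div M x y e = (x ℤD./ℕ M) ⊖ (y ℤD./ℕ M) ,
   trans (cong₂ _⊖_ (ℤD.a≡a%ℕn+[a/ℕn]*n x M) (trans (ℤD.a≡a%ℕn+[a/ℕn]*n y M) (cong (λ t → (+ t) ⊕ (y ℤD./ℕ M) · (+ M)) (sym e))))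
     (l (+ (x ℤD.%ℕ M)) (x ℤD./ℕ M) (y ℤD./ℕ M) (+ M))
   where
   l : ∀ r a b d → (r ⊕ a · d) ⊖ (r ⊕ b · d) ≡ (a ⊖ b) · d
   l = ZS.solve-∀

 rootBound : ℕ → ℕ
 rootBound i = proj₁ (isqrt (2 ^ suc i))

 ≤rootBound : ∀ {s n i} → s * s ≤ n → ilog n ≡ i → s ≤ rootBound i
 ≤rootBound {s} {n} {i} h refl = ℕ.s≤s⁻¹ (≰⇒> (λ p → <⇒≱ (<-trans (≤-<-trans h (<2^ilog n)) (proj₂ (proj₂ (isqrt (2 ^ suc (ilog n)))))) (*-mono-≤ p p)))

 rootBound-sq : ∀ i → (2 * rootBound i + 1) * (2 * rootBound i + 1) ≤ 18 * 2 ^ i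
 rootBound-sq i = begin
   (2 * S + 1) * (2 * S + 1) ≤⟨ *-mono-≤ (+-monoʳ-≤ (2 * S) S≥1) (+-monoʳ-≤ (2 * S) S≥1) ⟩
   (2 * S + S) * (2 * S + S) ≡⟨ l S ⟩
   9 * (S * S) ≤⟨ *-monoʳ-≤ 9 (proj₁ (proj₂ (isqrt (2 ^ suc i)))) ⟩
   9 * (2 * 2 ^ i) ≡⟨ l' (2 ^ i) ⟩
   18 * 2 ^ i ∎
   where
   open ≤-Reasoning
   S = rootBound i
   S≥1 : 1 ≤ S
   S≥1 = n≢0⇒n>0 (λ e → <⇒≱ (proj₂ (proj₂ (isqrt (2 ^ suc i)))) (≤-trans (≤-reflexive (cong (λ t → suc t * suc t) e)) (m^n>0 2 (suc i))))
   l : ∀ s → (2 * s + s) * (2 * s + s) ≡ 9 * (s * s)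
   l = NS.solve-∀
   l' : ∀ a → 9 * (2 * a) ≡ 18 * a
   l' = NS.solve-∀

 opaque
   unfolding _⊞_

   abs-im≤size : 1 ≤ κ → ∀ x → abs (im x) ≤ size x
   abs-im≤size κ≥1 (a ,√ b) = ≤-trans (m≤n*m (abs b) κ {{>-nonZero κ≥1}}) (m≤n+m _ _)

   abs-re≤size : ∀ x → abs (re x) ≤ size x
   abs-re≤size (a ,√ b) = m≤m+n _ _

 -- `V` bounds |norm δ| = |c|³ |c′|. In `constB`, 648 = 2 · 18 · 18 collects the ranges of v, γ and
 -- ξ.
 V constB : ℕ
 V = (1 + κ) ^ 4
 constB = 648 * ((2 * (1 + κ) + 1) * (2 * (1 + κ) + 1) * (V ! * V ! * 4 * suc V) * (9 + (1 + 2 * κ) * (1 + κ) ^ 4))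

 module CaseB (ns : NonSquareRational k) (κ≥1 : 1 ≤ κ) (N X₀ : ℕ) (X₀≤N : X₀ ≤ N) where

   record BElem : Set where
     field
       B : ℕ
       pd : PointData B
       B≤N : B ≤ N
       x≤X₀ : PointData.absx pd ≤ X₀
     open PointData pd public
     open Factor ns R public

     private
       n≤B : n ≤ B
       n≤B = ≤-trans (m≤m*n n (v * v * v * m) {{>-nonZero (*-mono-≤ (*-mono-≤ (*-mono-≤ v≥1 v≥1) v≥1) m≥1)}}) (≤-reflexive (trans (sym (*-assoc n (v * v * v) m)) (sym B≡)))
       m≤B : m ≤ B
       m≤B = ≤-trans (m≤n*m m (n * (v * v * v)) {{>-nonZero (*-mono-≤ n≥1 (*-mono-≤ (*-mono-≤ v≥1 v≥1) v≥1))}}) (≤-reflexive (sym B≡))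
       v≤B : v ≤ B
       v≤B = ≤-trans (m≤n*m v (n * (v * v) * m) {{>-nonZero (*-mono-≤ (*-mono-≤ n≥1 (*-mono-≤ v≥1 v≥1)) m≥1)}}) (≤-reflexive (trans (l n v m) (sym B≡)))
         where
         l : ∀ n v m → n * (v * v) * m * v ≡ n * (v * v * v) * m
         l = NS.solve-∀

     n≤N : n ≤ N
     n≤N = ≤-trans n≤B B≤N
     m≤N : m ≤ N
     m≤N = ≤-trans m≤B B≤N
     v≤N : v ≤ N
     v≤N = ≤-trans v≤B B≤N
     nvu≤X₀ : n * (v * v) * abs u ≤ X₀
     nvu≤X₀ = ≤-trans (≤-reflexive (sym absx≡)) x≤X₀
     u≤N : abs u ≤ N
     u≤N = ≤-trans (≤-trans (m≤n*m (abs u) (n * (v * v)) {{>-nonZero (*-mono-≤ n≥1 (*-mono-≤ v≥1 v≥1))}}) nvu≤X₀) X₀≤N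
     N≥1 : 1 ≤ N
     N≥1 = ≤-trans n≥1 n≤N

     -- Crude on purpose: it only serves to bound size δ by a power of N, of which just the
     -- logarithm matters.
     y≤ : y ≤ (1 + κ) * (N * N * N * N)
     y≤ = begin
       y ≤⟨ m≤m*m y ⟩
       y * y ≡⟨ sym (ℤP.abs-* (+ y) (+ y)) ⟩
       abs ((+ y) · (+ y)) ≡⟨ cong abs yeq ⟩
       abs ((+ n) · u³ ⊕ k · (+ m) · (+ m)) ≤⟨ ℤP.∣i+j∣≤∣i∣+∣j∣ ((+ n) · u³) (k · (+ m) · (+ m)) ⟩
       abs ((+ n) · u³) + abs (k · (+ m) · (+ m))
         ≡⟨ cong₂ _+_ (trans (ℤP.abs-* (+ n) u³) (cong (n *_) (abs-cube u))) (trans (ℤP.abs-* (k · (+ m)) (+ m)) (cong (_* m) (ℤP.abs-* k (+ m)))) ⟩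
       n * (abs u * abs u * abs u) + κ * m * m ≤⟨ +-mono-≤ (*-mono-≤ n≤N (*-mono-≤ (*-mono-≤ u≤N u≤N) u≤N)) (*-mono-≤ (*-monoʳ-≤ κ m≤N) m≤N) ⟩
       N * (N * N * N) + κ * N * N ≤⟨ +-monoʳ-≤ (N * (N * N * N)) (m≤m*n (κ * N * N) (N * N) {{>-nonZero (*-mono-≤ N≥1 N≥1)}}) ⟩
       N * (N * N * N) + κ * N * N * (N * N) ≡⟨ l κ N ⟩
       (1 + κ) * (N * N * N * N) ∎
       where
       open ≤-Reasoning
       l : ∀ κ N → N * (N * N * N) + κ * N * N * (N * N) ≡ (1 + κ) * (N * N * N * N)
       l = NS.solve-∀

     size-β≤ : size β ≤ (1 + 2 * κ) * (N * N * N * N)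
     size-β≤ = begin
       size β ≡⟨ pair-size y m ⟩
       y + κ * m ≤⟨ +-mono-≤ y≤ (*-monoʳ-≤ κ (≤-trans m≤N (m≤n*m N (N * N * N) {{>-nonZero (*-mono-≤ (*-mono-≤ N≥1 N≥1) N≥1)}}))) ⟩
       (1 + κ) * (N * N * N * N) + κ * (N * N * N * N) ≡⟨ l κ (N * N * N * N) ⟩
       (1 + 2 * κ) * (N * N * N * N) ∎
       where
       open ≤-Reasoning
       l : ∀ κ a → (1 + κ) * a + κ * a ≡ (1 + 2 * κ) * a
       l = NS.solve-∀

     size-short : ∀ {d} (S : Short d β m) → abs d ≤ N → size (Short.x S) ≤ (1 + κ) * N
     size-short S p = ≤-trans (size≤ (Short.x S) (Short.s S) (Short.x-re S) (Short.x-im S)) (*-monoʳ-≤ (1 + κ) (≤-trans (m≤m*m (Short.s S)) (≤-trans (Short.s²≤ S) p)))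

     size-α≤ : size α ≤ size β * size (Short.x Ξ) ^ 3
     size-α≤ = begin
       size α ≤⟨ m≤n*m (size α) (abs u³) {{>-nonZero (abs≥1 u³≢0)}} ⟩
       abs u³ * size α ≡⟨ trans (sym (size-⋆ u³ α)) (cong size (sym α-eq)) ⟩
       size (β ⊠ conj (Short.x Ξ) ↑ 3) ≤⟨ ≤-trans (size-⊠ β _) (*-monoʳ-≤ (size β) (≤-trans (size-↑ (conj (Short.x Ξ)) 3) (≤-reflexive (cong (_^ 3) (size-conj (Short.x Ξ)))))) ⟩
       size β * size (Short.x Ξ) ^ 3 ∎
       where open ≤-Reasoning

     size-δ≤ : size δ ≤ (1 + 2 * κ) * (1 + κ) ^ 4 * N ^ 8
     size-δ≤ = begin
       size δ ≤⟨ m≤n*m (size δ) n {{>-nonZero n≥1}} ⟩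
       n * size δ ≡⟨ trans (sym (size-⋆ (+ n) δ)) (cong size (sym δ-eq)) ⟩
       size (α ⊠ conj (Short.x Γ)) ≤⟨ ≤-trans (size-⊠ α _) (*-mono-≤ size-α≤ (≤-reflexive (size-conj (Short.x Γ)))) ⟩
       size β * size (Short.x Ξ) ^ 3 * size (Short.x Γ) ≤⟨ *-mono-≤ (*-mono-≤ size-β≤ (^-monoˡ-≤ 3 (size-short Ξ u≤N))) (size-short Γ n≤N) ⟩
       (1 + 2 * κ) * (N * N * N * N) * ((1 + κ) * N) ^ 3 * ((1 + κ) * N) ≡⟨ l (1 + 2 * κ) (1 + κ) N ⟩
       (1 + 2 * κ) * (1 + κ) ^ 4 * N ^ 8 ∎
       where
       open ≤-Reasoning
       l : ∀ a b N → a * (N * N * N * N) * (b * N * (b * N * (b * N * 1))) * (b * N) ≡ a * (b * (b * (b * (b * 1)))) * (N * (N * (N * (N * (N * (N * (N * (N * 1))))))))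
       l = NS.solve-∀

   open BElem using (pd; n; m; v; u; y; n≥1; m≥1; v≥1)
   open Counting BElem.B

   private
     instance _ = V !≢0
     γ ξ δ : BElem → Q
     γ x = Short.x (BElem.Γ x)
     ξ x = Short.x (BElem.Ξ x)
     δ x = BElem.δ x
     c c′ : BElem → ℤ
     c x = Short.c (BElem.Ξ x)
     c′ x = Short.c (BElem.Γ x)
     li lj ll : BElem → ℕ
     li x = ilog (n x)
     lj x = ilog (abs (u x))
     ll x = ilog (v x)
     ℓδ : ℕ
     ℓδ = suc ((1 + 2 * κ) * (1 + κ) ^ 4 + 8 * suc (ilog N))
     -- c, c′, γ, ξ and δ determine n and β, hence m, and with v also B. Residues of δ modulo `V !`
     -- serve all possible norms at once, as their absolute values are at most V. Besides v, γ and ξ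
     -- only the last label, the dyadic size of a unit, has a range growing with N.
     labels : ℕ → ℕ → ℕ → Labels
     labels i j l =
       (v , 2 ^ suc l) ∷ ((λ x → zlabel (re (γ x))) , 2 * rootBound i + 1) ∷ ((λ x → zlabel (im (γ x))) , 2 * rootBound i + 1)
       ∷ ((λ x → zlabel (re (ξ x))) , 2 * rootBound j + 1) ∷ ((λ x → zlabel (im (ξ x))) , 2 * rootBound j + 1)
       ∷ ((λ x → zlabel (c x)) , 2 * (1 + κ) + 1) ∷ ((λ x → zlabel (c′ x)) , 2 * (1 + κ) + 1)
       ∷ ((λ x → re (δ x) ℤD.%ℕ (V !)) , V !) ∷ ((λ x → im (δ x) ℤD.%ℕ (V !)) , V !)
       ∷ ((λ x → negative? (re (δ x))) , 2) ∷ ((λ x → negative? (im (δ x))) , 2)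
       ∷ ((λ x → abs (im (δ x)) ℕ.⊓ V) , suc V) ∷ ((λ x → ilog (abs (im (δ x)))) , ℓδ) ∷ []
     P₃ : ℕ → ℕ → ℕ → BElem → Set
     P₃ i j l x = ((⊤ × li x ≡ i) × lj x ≡ j) × ll x ≡ l
     within : ∀ i j l x → P₃ i j l x → All (λ f → proj₁ f x < proj₂ f) (labels i j l)
     within i j l x (((_ , refl) , refl) , refl) =
       <2^ilog (v x)
       ∷ zlabel< (re (γ x)) _ (≤-trans (Short.x-re Γ) (≤rootBound {Short.s Γ} {n x} (Short.s²≤ Γ) refl)) ∷ zlabel< (im (γ x)) _ (≤-trans (Short.x-im Γ) (≤rootBound {Short.s Γ} {n x} (Short.s²≤ Γ) refl))
       ∷ zlabel< (re (ξ x)) _ (≤-trans (Short.x-re Ξ) (≤rootBound {Short.s Ξ} {abs (u x)} (Short.s²≤ Ξ) refl)) ∷ zlabel< (im (ξ x)) _ (≤-trans (Short.x-im Ξ) (≤rootBound {Short.s Ξ} {abs (u x)} (Short.s²≤ Ξ) refl))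
       ∷ zlabel< (c x) _ (Short.c≤ Ξ) ∷ zlabel< (c′ x) _ (Short.c≤ Γ)
       ∷ ℤD.n%ℕd<d (re (δ x)) (V !) ∷ ℤD.n%ℕd<d (im (δ x)) (V !) ∷ negative?<2 (re (δ x)) ∷ negative?<2 (im (δ x)) ∷ s≤s (m⊓n≤n (abs (im (δ x))) V)
       ∷ s≤s (ilog-poly ((1 + 2 * κ) * (1 + κ) ^ 4) 8 N (abs (im (δ x))) (≤-trans (abs-im≤size κ≥1 (δ x)) (BElem.size-δ≤ x))) ∷ []
       where
       open BElem x using (Γ; Ξ)
     Q-lab : ∀ a b → zlabel (re a) ≡ zlabel (re b) → zlabel (im a) ≡ zlabel (im b) → a ≡ b
     Q-lab a b p q = Q-ext (zlabel-injective (re a) (re b) p) (zlabel-injective (im a) (im b) q)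
     ilog-close : ∀ a b → 1 ≤ a → ilog a ≡ ilog b → b < 2 * a
     ilog-close a b a≥1 e = ≤-trans (<2^ilog b) (*-monoʳ-≤ 2 (≤-trans (≤-reflexive (cong (2 ^_) (sym e))) (2^ilog≤ a a≥1)))
     determined : ∀ i j l x z → P₃ i j l x → P₃ i j l z → All (λ f → proj₁ f x ≡ proj₁ f z) (labels i j l) → BElem.B x ≡ BElem.B z
     determined i j l x z _ _ (ev ∷ eγ₁ ∷ eγ₂ ∷ eξ₁ ∷ eξ₂ ∷ ec ∷ ec′ ∷ r₁ ∷ r₂ ∷ s₁ ∷ s₂ ∷ cp ∷ lg ∷ []) =
       trans (PointData.B≡ (pd x)) (trans (cong₂ _*_ (cong₂ (λ a b → a * (b * b * b)) n≡ ev) m≡) (sym (PointData.B≡ (pd z))))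
       where
       γ≡ : γ x ≡ γ z
       γ≡ = Q-lab (γ x) (γ z) eγ₁ eγ₂
       ξ≡ : ξ x ≡ ξ z
       ξ≡ = Q-lab (ξ x) (ξ z) eξ₁ eξ₂
       c≡ : c x ≡ c z
       c≡ = zlabel-injective (c x) (c z) ec
       c′≡ : c′ x ≡ c′ z
       c′≡ = zlabel-injective (c′ x) (c′ z) ec′
       n≡ : n x ≡ n z
       n≡ = ℤP.+-injective (ℤP.*-cancelˡ-≡ (c′ x) (+ n x) (+ n z) {{ℤ.≢-nonZero (Short.c≢0 (BElem.Γ x))}}
         (trans (sym (Short.x-norm (BElem.Γ x))) (trans (cong norm γ≡) (trans (Short.x-norm (BElem.Γ z)) (cong (ℤ._* (+ n z)) (sym c′≡))))))
       ν : ℤ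
       ν = pow (c x) 3 · c′ x
       ν≢0 : ν ≢ 0ℤ
       ν≢0 e = [ pow≢0 3 (Short.c≢0 (BElem.Ξ x)) , Short.c≢0 (BElem.Γ x) ]′ (ℤP.i*j≡0⇒i≡0∨j≡0 (pow (c x) 3) e)
       ν≤V : abs ν ≤ V
       ν≤V = ≤-trans (≤-reflexive (trans (ℤP.abs-* (pow (c x) 3) (c′ x)) (cong (_* abs (c′ x)) (abs-pow (c x) 3))))
         (≤-trans (*-mono-≤ (^-monoˡ-≤ 3 (Short.c≤ (BElem.Ξ x))) (Short.c≤ (BElem.Γ x))) (≤-reflexive (*-comm ((1 + κ) ^ 3) (1 + κ))))
       νdiv : ∀ a b → a ℤD.%ℕ (V !) ≡ b ℤD.%ℕ (V !) → ZDiv ν (a ⊖ b)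
       νdiv a b e = ∣⇒zdiv {ν} {a ⊖ b} (ND.∣-trans (m∣n! (abs ν) V (abs≥1 ν≢0) ν≤V) (zdiv⇒∣ {+ (V !)} {a ⊖ b} (residue-div (V !) a b e)))
       norm-at : ∀ w → pow (c w) 3 · c′ w ≡ ν → re (δ w) · re (δ w) ⊖ k · im (δ w) · im (δ w) ≡ ν
       norm-at w e = trans (sym (norm-pair (re (δ w)) (im (δ w)))) (trans (BElem.normδ w) e)
       δ≡ : δ x ≡ δ z
       δ≡ = Q-ext (proj₁ eq) (proj₂ eq)
         where
         eq = NormClass.equal ns ν V ν≢0 ν≤V (re (δ x)) (im (δ x)) (re (δ z)) (im (δ z)) (norm-at x refl) (norm-at z (cong₂ (λ a b → pow a 3 · b) (sym c≡) (sym c′≡)))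
                (νdiv (re (δ x)) (re (δ z)) r₁) (νdiv (im (δ x)) (im (δ z)) r₂) s₁ s₂ cp (λ h → ilog-close (abs (im (δ x))) (abs (im (δ z))) h lg) (λ h → ilog-close (abs (im (δ z))) (abs (im (δ x))) h (sym lg))
       β≡ : BElem.β x ≡ BElem.β z
       β≡ = ⋆-cancel (pow (c x) 3) _ _ (pow≢0 3 (Short.c≢0 (BElem.Ξ x))) (⋆-cancel (c′ x) _ _ (Short.c≢0 (BElem.Γ x)) (begin
         c′ x ⋆ (pow (c x) 3 ⋆ BElem.β x) ≡⟨ BElem.rel′ x ⟩
         (δ x ⊠ γ x) ⊠ ξ x ↑ 3 ≡⟨ cong₂ (λ a b → a ⊠ b ↑ 3) (cong₂ _⊠_ δ≡ γ≡) ξ≡ ⟩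
         (δ z ⊠ γ z) ⊠ ξ z ↑ 3 ≡⟨ sym (BElem.rel′ z) ⟩
         c′ z ⋆ (pow (c z) 3 ⋆ BElem.β z) ≡⟨ cong₂ (λ a b → a ⋆ (pow b 3 ⋆ BElem.β z)) (sym c′≡) (sym c≡) ⟩
         c′ x ⋆ (pow (c x) 3 ⋆ BElem.β z) ∎))
         where open ≡-Reasoning
       m≡ : m x ≡ m z
       m≡ = ℤP.+-injective (cong im β≡)

   private
     T : ℕ
     T = suc (ilog N)
     Kin : ℕ
     Kin = constB * X₀ * T
     ℓδ≤ : ℓδ ≤ (9 + (1 + 2 * κ) * (1 + κ) ^ 4) * T
     ℓδ≤ = begin
       1 + (E + 8 * T) ≤⟨ +-mono-≤ {1} {T} (s≤s z≤n) (+-monoˡ-≤ (8 * T) (m≤m*n E T)) ⟩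
       T + (E * T + 8 * T) ≡⟨ l E T ⟩
       (9 + E) * T ∎
       where
       open ≤-Reasoning
       E = (1 + 2 * κ) * (1 + κ) ^ 4
       l : ∀ E T → T + (E * T + 8 * T) ≡ (9 + E) * T
       l = NS.solve-∀
     -- In a dyadic box γ takes O(n) values, ξ takes O(u) and v takes O(v). Their product is at most
     -- a constant times n v² u = |x| ≤ X₀.
     feasible : ∀ i j l → 2 ^ i * (2 ^ l * 2 ^ l) * 2 ^ j ≤ X₀ → count (labels i j l) ≤ Kin
     feasible i j l h = begin
       count (labels i j l) ≡⟨ l₁ (2 ^ l) A₁ A₂ cc (V !) (suc V) ℓδ ⟩
       2 * (2 ^ l * (A₁ * A₁) * (A₂ * A₂)) * (cc * cc * (V ! * V ! * 4 * suc V) * ℓδ)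
         ≤⟨ *-mono-≤ (*-monoʳ-≤ 2 (*-mono-≤ (*-monoʳ-≤ (2 ^ l) (rootBound-sq i)) (rootBound-sq j))) (*-monoʳ-≤ (cc * cc * (V ! * V ! * 4 * suc V)) ℓδ≤) ⟩
       2 * (2 ^ l * (18 * 2 ^ i) * (18 * 2 ^ j)) * (cc * cc * (V ! * V ! * 4 * suc V) * (E * T))
         ≤⟨ *-monoˡ-≤ _ (*-monoʳ-≤ 2 (*-monoˡ-≤ (18 * 2 ^ j) (*-monoˡ-≤ (18 * 2 ^ i) (m≤m*m (2 ^ l))))) ⟩
       2 * (2 ^ l * 2 ^ l * (18 * 2 ^ i) * (18 * 2 ^ j)) * (cc * cc * (V ! * V ! * 4 * suc V) * (E * T))
         ≡⟨ l₂ (2 ^ l) (2 ^ i) (2 ^ j) (cc * cc * (V ! * V ! * 4 * suc V)) E T ⟩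
       648 * (cc * cc * (V ! * V ! * 4 * suc V) * E) * (2 ^ i * (2 ^ l * 2 ^ l) * 2 ^ j) * T
         ≤⟨ *-monoˡ-≤ T (*-monoʳ-≤ (648 * (cc * cc * (V ! * V ! * 4 * suc V) * E)) h) ⟩
       Kin ∎
       where
       open ≤-Reasoning
       A₁ = 2 * rootBound i + 1
       A₂ = 2 * rootBound j + 1
       cc = 2 * (1 + κ) + 1
       E = 9 + (1 + 2 * κ) * (1 + κ) ^ 4
       l₁ : ∀ p a b c f v w → 2 * p * (a * (a * (b * (b * (c * (c * (f * (f * (2 * (2 * (v * (w * 1))))))))))))
         ≡ 2 * (p * (a * a) * (b * b)) * (c * c * (f * f * 4 * v) * w)
       l₁ = NS.solve-∀
       l₂ : ∀ p i j c e t → 2 * (p * p * (18 * i) * (18 * j)) * (c * (e * t)) ≡ 648 * (c * e) * (i * (p * p) * j) * t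
       l₂ = NS.solve-∀
     inner : ∀ i j l → Bdd (P₃ i j l) Kin
     inner i j l = go (2 ^ i * (2 ^ l * 2 ^ l) * 2 ^ j ≤? X₀)
       where
       cell≤X₀ : ∀ x → 2 ^ li x * (2 ^ ll x * 2 ^ ll x) * 2 ^ lj x ≤ X₀
       cell≤X₀ x = ≤-trans (*-mono-≤ (*-mono-≤ (2^ilog≤ (n x) (n≥1 x)) (*-mono-≤ (2^ilog≤ (v x) (v≥1 x)) (2^ilog≤ (v x) (v≥1 x)))) (2^ilog≤ (abs (u x)) (abs≥1 (PointData.u≢0 (pd x))))) (BElem.nvu≤X₀ x)
       go : Dec (2 ^ i * (2 ^ l * 2 ^ l) * 2 ^ j ≤ X₀) → Bdd (P₃ i j l) Kin
       go (yes h) = bdd-mono (λ x p → p) (feasible i j l h) (bdd-labels (labels i j l) (within i j l) (determined i j l))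
       go (no h) = bdd-empty Kin (λ x (((_ , e₁) , e₂) , e₃) → h (subst (λ i → 2 ^ i * (2 ^ l * 2 ^ l) * 2 ^ j ≤ X₀) e₁ (subst₂ (λ j l → 2 ^ li x * (2 ^ l * 2 ^ l) * 2 ^ j ≤ X₀) e₂ e₃ (cell≤X₀ x))))

   case-B : Bdd (λ _ → ⊤) (T * (T * (T * (constB * X₀ * T))))
   case-B = bdd-fibre li T (λ x _ → s≤s (ilog-mono (BElem.n≤N x))) (λ i _ → bdd-fibre lj T (λ x _ → s≤s (ilog-mono (BElem.u≤N x)))
     (λ j _ → bdd-fibre ll T (λ x _ → s≤s (ilog-mono (BElem.v≤N x))) (λ l _ → inner i j l)))

 -- Case (C): large x

 cube-cancel-≤ : ∀ {a b} → a * a * a ≤ b * b * b → a ≤ b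
 cube-cancel-≤ {a} {b} p with a ≤? b
 ... | yes q = q
 ... | no q = ⊥-elim (<⇒≱ (*-mono-< (*-mono-< (≰⇒> q) (≰⇒> q)) (≰⇒> q)) p)

 abs-diff< : ∀ a b t → a < b + t → b < a + t → abs ((+ a) ⊖ (+ b)) < t
 abs-diff< a b t p q with ≤-total a b
 ... | inj₁ le = ≤-trans (s≤s (≤-reflexive (trans (cong abs (ℤP.m-n≡m⊖n a b)) (ℤP.∣⊖∣-≤ le)))) (+-cancelˡ-< a (b ∸ a) t (≤-trans (s≤s (≤-reflexive (m+[n∸m]≡n le))) q))
 ... | inj₂ le = ≤-trans (s≤s (≤-reflexive (trans (cong abs (ℤP.m-n≡m⊖n a b)) (trans (ℤP.∣m⊖n∣≡∣n⊖m∣ a b) (ℤP.∣⊖∣-≤ le))))) (+-cancelˡ-< b (a ∸ b) t (≤-trans (s≤s (≤-reflexive (m+[n∸m]≡n le))) p))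

 coprime-ratio : ∀ {y₁ m₁ y₂ m₂} → Coprime y₁ m₁ → Coprime y₂ m₂ → y₁ * m₂ ≡ m₁ * y₂ → m₁ ≡ m₂
 coprime-ratio {y₁} {m₁} {y₂} {m₂} c₁ c₂ e = ND.∣-antisym
   (coprime-divisor (coprime-sym c₁) (divides y₂ (trans e (*-comm m₁ y₂))))
   (coprime-divisor (coprime-sym c₂) (divides y₁ (trans (*-comm y₂ m₁) (sym e))))

 Gα cc Ebig constC : ℕ
 Gα = 8 * (1 + κ) ^ 6
 cc = 2 * (1 + κ) + 1
 Ebig = 4 * (bigConst * ((1 + κ) * (1 + κ))) ^ 48
 constC = 144 * Gα * cc * (97 + Ebig) + 144 * Gα * cc * 24

 -- `HX` places every point in the cusp, `HY` bounds the slope buckets by Y / (n v²), and `HM` turns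
 -- n v w² ≤ N into a bound for the number of classes.
 module CaseC (ns : NonSquareRational k) (k≢0 : k ≢ 0ℤ) (κ≥1 : 1 ≤ κ) (N X₀ w M Y : ℕ)
   (HX : 4 * (κ * κ) * (N * N) ≤ X₀ * X₀ * X₀) (HY : 8 * (1 + κ) * N * (8 * (1 + κ) * N) ≤ Y * Y * X₀) (HM : ∀ t → t * (w * w) ≤ N → t ≤ M) where

   record CElem : Set where
     field
       B : ℕ
       pd : PointData B
       B≤N : B ≤ N
       X₀<x : X₀ < PointData.absx pd
     open PointData pd public
     field
       z<vm : w * w * w < v * v * v * m

     U : ℕ
     U = abs u

     nv³ : ℕ
     nv³ = n * (v * v * v)

     nv³≥1 : 1 ≤ nv³
     nv³≥1 = *-mono-≤ n≥1 (*-mono-≤ (*-mono-≤ v≥1 v≥1) v≥1)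

     -- Uses |x|³ = (n v² u)³ = n u³ (n v³)² and n v³ m = B ≤ N.
     cusp : 4 * (κ * κ) * (m * m) ≤ n * (U * U * U)
     cusp = *-cancelʳ-≤ _ _ (nv³ * nv³) {{>-nonZero (*-mono-≤ nv³≥1 nv³≥1)}} (begin
       4 * (κ * κ) * (m * m) * (nv³ * nv³) ≡⟨ l (4 * (κ * κ)) m nv³ ⟩
       4 * (κ * κ) * (nv³ * m * (nv³ * m)) ≤⟨ *-monoʳ-≤ (4 * (κ * κ)) (*-mono-≤ h h) ⟩
       4 * (κ * κ) * (N * N) ≤⟨ HX ⟩
       X₀ * X₀ * X₀ ≤⟨ *-mono-≤ (*-mono-≤ h' h') h' ⟩
       n * (v * v) * U * (n * (v * v) * U) * (n * (v * v) * U) ≡⟨ l' n v U ⟩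
       n * (U * U * U) * (nv³ * nv³) ∎)
       where
       open ≤-Reasoning
       h : nv³ * m ≤ N
       h = ≤-trans (≤-reflexive (sym B≡)) B≤N
       h' : X₀ ≤ n * (v * v) * U
       h' = ≤-trans (<⇒≤ X₀<x) (≤-reflexive absx≡)
       l : ∀ a m b → a * (m * m) * (b * b) ≡ a * (b * m * (b * m))
       l = NS.solve-∀
       l' : ∀ n v u → n * (v * v) * u * (n * (v * v) * u) * (n * (v * v) * u) ≡ n * (u * u * u) * (n * (v * v * v) * (n * (v * v * v)))
       l' = NS.solve-∀

     -- For negative u the equation gives n |u|³ + y² = k m², which contradicts 4 κ² m² ≤ n |u|³.
     u≡ : u ≡ + U
     u≡ = go u refl
       where
       go : ∀ t → u ≡ t → u ≡ + U
       go (+ t) e = trans e (cong (λ s → + abs s) (sym e))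
       go -[1+ j ] e = ⊥-elim (<⇒≱ (*-mono-≤ (*-mono-≤ κ≥1 κ≥1) (*-mono-≤ m≥1 m≥1)) contra)
         where
         eq : (+ (n * (U * U * U))) ≡ k · (+ m) · (+ m) ⊖ (+ y) · (+ y)
         eq = sym (trans (cong (λ s → k · (+ m) · (+ m) ⊖ s) yeq) (trans (l (k · (+ m) · (+ m)) (+ n) u) (trans (cong (λ t → (+ n) · (t · t · t)) (trans (cong ⊖_ e) (cong (λ t → + abs t) (sym e)))) (sym (trans (ℤP.pos-* n (U * U * U)) (cong ((+ n) ·_) (trans (ℤP.pos-* (U * U) U) (cong (ℤ._* (+ U)) (ℤP.pos-* U U)))))))))
           where
           l : ∀ a n u → a ⊖ (n · (u · u · u) ⊕ a) ≡ n · ((⊖ u) · (⊖ u) · (⊖ u))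
           l = ZS.solve-∀
         step : n * (U * U * U) + y * y ≤ κ * (m * m)
         step = ≤-reflexive (trans (cong abs {+ (n * (U * U * U) + y * y)} {k · (+ m) · (+ m)} (trans (cong₂ _⊕_ eq (ℤP.pos-* y y)) (l (k · (+ m) · (+ m)) ((+ y) · (+ y)))))
           (trans (ℤP.abs-* (k · (+ m)) (+ m)) (trans (cong (_* m) (ℤP.abs-* k (+ m))) (*-assoc κ m m))))
           where
           l : ∀ a b → (a ⊖ b) ⊕ b ≡ a
           l = ZS.solve-∀
         contra : κ * κ * (m * m) ≤ 0
         contra = +-cancelʳ-≤ (κ * κ * (m * m)) _ _ (begin
           κ * κ * (m * m) + κ * κ * (m * m) ≤⟨ m≤m+n _ (2 * (κ * κ * (m * m))) ⟩
           κ * κ * (m * m) + κ * κ * (m * m) + 2 * (κ * κ * (m * m)) ≡⟨ l (κ * κ) (m * m) ⟩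
           4 * (κ * κ) * (m * m) ≤⟨ cusp ⟩
           n * (U * U * U) ≤⟨ ≤-trans (m≤m+n _ (y * y)) step ⟩
           κ * (m * m) ≤⟨ *-monoˡ-≤ (m * m) (m≤m*m κ) ⟩
           0 + κ * κ * (m * m) ∎)
           where
           open ≤-Reasoning
           l : ∀ a b → a * b + a * b + 2 * (a * b) ≡ 4 * a * b
           l = NS.solve-∀

     E : Cusp
     E = toCusp ns R U u≡ cusp

     open Factor ns R public using (α; α-eq; u³; u³≢0; Ξ)

     n≤N : n ≤ N
     n≤N = ≤-trans (≤-trans (m≤m*n n (v * v * v * m) {{>-nonZero (*-mono-≤ (*-mono-≤ (*-mono-≤ v≥1 v≥1) v≥1) m≥1)}}) (≤-reflexive (trans (sym (*-assoc n (v * v * v) m)) (sym B≡)))) B≤N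
     m≤N : m ≤ N
     m≤N = ≤-trans (≤-trans (m≤n*m m nv³ {{>-nonZero nv³≥1}}) (≤-reflexive (sym B≡))) B≤N
     nv³≤N : nv³ ≤ N
     nv³≤N = ≤-trans (≤-trans (m≤m*n nv³ m {{>-nonZero m≥1}}) (≤-reflexive (sym B≡))) B≤N
     v≤N : v ≤ N
     v≤N = ≤-trans (m≤n*m v (n * (v * v)) {{>-nonZero (*-mono-≤ n≥1 (*-mono-≤ v≥1 v≥1))}}) (≤-trans (≤-reflexive (l n v)) nv³≤N)
       where
       l : ∀ n v → n * (v * v) * v ≡ n * (v * v * v)
       l = NS.solve-∀
     nw³≤N : n * (w * w * w) ≤ N
     nw³≤N = ≤-trans (*-monoʳ-≤ n (<⇒≤ z<vm)) (≤-trans (≤-reflexive (trans (sym (*-assoc n (v * v * v) m)) (sym B≡))) B≤N)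
     y≥1 : 1 ≤ y
     y≥1 = ≤-trans (*-mono-≤ κ≥1 m≥1) (κm≤y E)

     -- From u³ α = β conj ξ³, where ξ has size O(√u) and β has size O(y) = O(√n u^(3/2)). So α has
     -- size O(√n) and takes O(n) values in a dyadic range of n.
     size-α² : size α * size α ≤ 8 * (1 + κ) ^ 6 * n
     size-α² = *-cancelˡ-≤ (U * U * U * (U * U * U)) {{>-nonZero (*-mono-≤ U³≥1 U³≥1)}} (begin
       U * U * U * (U * U * U) * (size α * size α) ≡⟨ l (U * U * U) (size α) ⟩
       U * U * U * size α * (U * U * U * size α) ≤⟨ *-mono-≤ h h ⟩
       2 * y * ((1 + κ) * s) ^ 3 * (2 * y * ((1 + κ) * s) ^ 3) ≡⟨ l' y (1 + κ) s ⟩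
       4 * (y * y) * (1 + κ) ^ 6 * (s * s * (s * s) * (s * s)) ≤⟨ *-mono-≤ (*-monoˡ-≤ ((1 + κ) ^ 6) (*-monoʳ-≤ 4 (y²≤2nu³ E))) (*-mono-≤ (*-mono-≤ (Cusp.s²≤u E) (Cusp.s²≤u E)) (Cusp.s²≤u E)) ⟩
       4 * (2 * (n * (U * U * U))) * (1 + κ) ^ 6 * (U * U * U) ≡⟨ l″ n (U * U * U) ((1 + κ) ^ 6) ⟩
       U * U * U * (U * U * U) * (8 * (1 + κ) ^ 6 * n) ∎)
       where
       open ≤-Reasoning
       s = Short.s Ξ
       U³≥1 : 1 ≤ U * U * U
       U³≥1 = *-mono-≤ (*-mono-≤ (Cusp.u≥1 E) (Cusp.u≥1 E)) (Cusp.u≥1 E)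
       h : U * U * U * size α ≤ 2 * y * ((1 + κ) * s) ^ 3
       h = begin
         U * U * U * size α ≡⟨ cong (_* size α) (sym (abs-cube u)) ⟩
         abs u³ * size α ≡⟨ trans (sym (size-⋆ u³ α)) (cong size (sym α-eq)) ⟩
         size (β ⊠ conj (Short.x Ξ) ↑ 3) ≤⟨ ≤-trans (size-⊠ β _) (*-mono-≤ (≤-trans (≤-reflexive (pair-size y m)) (≤-trans (+-monoʳ-≤ y (κm≤y E)) (≤-reflexive (l₀ y)))) (≤-trans (size-↑ (conj (Short.x Ξ)) 3) (^-monoˡ-≤ 3 (≤-trans (≤-reflexive (size-conj (Short.x Ξ))) (size-ξ E))))) ⟩
         2 * y * ((1 + κ) * s) ^ 3 ∎
         where
         l₀ : ∀ y → y + y ≡ 2 * y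
         l₀ = NS.solve-∀
       l : ∀ a b → a * a * (b * b) ≡ a * b * (a * b)
       l = NS.solve-∀
       l' : ∀ y a s → 2 * y * (a * s * (a * s * (a * s * 1))) * (2 * y * (a * s * (a * s * (a * s * 1)))) ≡ 4 * (y * y) * (a * (a * (a * (a * (a * (a * 1)))))) * (s * s * (s * s) * (s * s))
       l' = NS.solve-∀
       l″ : ∀ n u a → 4 * (2 * (n * u)) * a * u ≡ u * u * (8 * a * n)
       l″ = NS.solve-∀

   open Counting CElem.B
   open CElem using (n; m; v; y; U; E; α)

   private
     T : ℕ
     T = suc (ilog N)
     αBound : ℕ → ℕ
     αBound i = proj₁ (isqrt (Gα * 2 ^ suc i))
     ≤αBound : ∀ x a → a ≤ size (α x) → a ≤ αBound (ilog (n x))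
     ≤αBound x a h = ℕ.s≤s⁻¹ (≰⇒> (λ p → <⇒≱ (proj₂ (proj₂ (isqrt (Gα * 2 ^ suc (ilog (n x)))))) (begin
       suc (αBound (ilog (n x))) * suc (αBound (ilog (n x))) ≤⟨ *-mono-≤ (≤-trans p h) (≤-trans p h) ⟩
       size (α x) * size (α x) ≤⟨ CElem.size-α² x ⟩
       Gα * n x ≤⟨ *-monoʳ-≤ Gα (<⇒≤ (<2^ilog (n x))) ⟩
       Gα * 2 ^ suc (ilog (n x)) ∎)))
       where open ≤-Reasoning
     αBound-sq : ∀ i → (2 * αBound i + 1) * (2 * αBound i + 1) ≤ 18 * Gα * 2 ^ i
     αBound-sq i = begin
       (2 * S + 1) * (2 * S + 1) ≤⟨ *-mono-≤ (+-monoʳ-≤ (2 * S) S≥1) (+-monoʳ-≤ (2 * S) S≥1) ⟩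
       (2 * S + S) * (2 * S + S) ≡⟨ l S ⟩
       9 * (S * S) ≤⟨ *-monoʳ-≤ 9 (proj₁ (proj₂ (isqrt (Gα * 2 ^ suc i)))) ⟩
       9 * (Gα * (2 * 2 ^ i)) ≡⟨ l' Gα (2 ^ i) ⟩
       18 * Gα * 2 ^ i ∎
       where
       open ≤-Reasoning
       S = αBound i
       S≥1 : 1 ≤ S
       S≥1 = n≢0⇒n>0 (λ e → <⇒≱ (proj₂ (proj₂ (isqrt (Gα * 2 ^ suc i)))) (≤-trans (≤-reflexive (cong (λ t → suc t * suc t) e)) (*-mono-≤ (*-mono-≤ (s≤s (z≤n {7})) (^-pos 6 (s≤s (z≤n {κ})))) (m^n>0 2 (suc i)))))
       l : ∀ s → (2 * s + s) * (2 * s + s) ≡ 9 * (s * s)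
       l = NS.solve-∀
       l' : ∀ g a → 9 * (g * (2 * a)) ≡ 18 * g * a
       l' = NS.solve-∀

     li ll lj : CElem → ℕ
     li x = ilog (n x)
     ll x = ilog (v x)
     lj x = ilog (U x)
     c : CElem → ℤ
     c x = Cusp.c (E x)
     class : ℕ → ℕ → Labels
     class i l = (v , 2 ^ suc l) ∷ ((λ x → zlabel (re (α x))) , 2 * αBound i + 1) ∷ ((λ x → zlabel (im (α x))) , 2 * αBound i + 1)
       ∷ ((λ x → zlabel (c x)) , cc) ∷ ((λ x → sector₁ (Cusp.ξ (E x))) , 2) ∷ ((λ x → sector₂ (Cusp.ξ (E x))) , 2) ∷ []
     P₂ : ℕ → ℕ → CElem → Set
     P₂ i l x = (⊤ × li x ≡ i) × ll x ≡ l
     within : ∀ i l x → P₂ i l x → All (λ f → proj₁ f x < proj₂ f) (class i l)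
     within i l x ((_ , refl) , refl) = <2^ilog (v x) ∷ zlabel< (re (α x)) _ (≤αBound x _ (abs-re≤size (α x))) ∷ zlabel< (im (α x)) _ (≤αBound x _ (abs-im≤size κ≥1 (α x)))
       ∷ zlabel< (c x) _ (Cusp.c≤ (E x)) ∷ negative?<2 (re ξ · re ξ ⊕ k · im ξ · im ξ) ∷ negative?<2 (re ξ · im ξ) ∷ []
       where
       ξ = Cusp.ξ (E x)
     Agree : CElem → CElem → ℕ → ℕ → Set
     Agree x z i l = All (λ f → proj₁ f x ≡ proj₁ f z) (class i l)
     same : ∀ i l x z → Agree x z i l → SameClass (E x) (E z)
     same i l x z (_ ∷ e₁ ∷ e₂ ∷ e₃ ∷ e₄ ∷ e₅ ∷ []) = record { sameα = Q-ext (zlabel-injective (re (α x)) (re (α z)) e₁) (zlabel-injective (im (α x)) (im (α z)) e₂)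
       ; samec = zlabel-injective (c x) (c z) e₃ ; sec₁ = e₄ ; sec₂ = e₅ }
     module _ (x z : CElem) (S : SameClass (E x) (E z)) where
       open Pair (E x) (E z) S using (q; gap; q≡0⇒δ≡0; same-n; δ≤; y₁≤2y₂) renaming (δ to Δ)

       same-key : v x ≡ v z → q ≡ 0 → CElem.B x ≡ CElem.B z
       same-key ev e = trans (CElem.B≡ x) (trans (cong₂ _*_ (cong₂ (λ a b → a * (b * b * b)) (sym same-n) ev) m≡) (sym (CElem.B≡ z)))
         where
         m≡ : m x ≡ m z
         m≡ = coprime-ratio (CElem.cop x) (CElem.cop z) (ℤP.+-injective (trans (ℤP.pos-* (y x) (m z)) (trans (ℤP.i-j≡0⇒i≡j _ _ (ℤP.∣i∣≡0⇒i≡0 (q≡0⇒δ≡0 e))) (sym (ℤP.pos-* (m x) (y z))))))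

       gap₁ : q ≢ 0 → n x * (U x * U z) ≤ (1 + κ) * Δ
       gap₁ ne = ≤-trans (*-monoˡ-≤ (U x * U z) (m≤m*n (n x) q {{≢-nonZero ne}})) (≤-trans gap (*-monoˡ-≤ Δ (Cusp.c≤ (E x))))

     -- `bucket` is the slope m/y in units of 1 / `scale`, the mesh below which `gap` allows no two
     -- different slopes within a dyadic shell of u.
     scale : CElem → ℕ
     scale x = 4 * (1 + κ) * 2 ^ lj x
     bucket : CElem → ℕ
     bucket x = DM._/_ (m x * scale x) (y x) {{>-nonZero (CElem.y≥1 x)}}
     bucket-lo : ∀ x → bucket x * y x ≤ m x * scale x
     bucket-lo x = DM.m/n*n≤m (m x * scale x) (y x) {{>-nonZero (CElem.y≥1 x)}}
     bucket-hi : ∀ x → m x * scale x < suc (bucket x) * y x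
     bucket-hi x = ≤-trans (s≤s (≤-reflexive (DM.m≡m%n+[m/n]*n (m x * scale x) (y x) {{>-nonZero (CElem.y≥1 x)}}))) (+-monoˡ-≤ (bucket x * y x) (DM.m%n<n (m x * scale x) (y x) {{>-nonZero (CElem.y≥1 x)}}))

     -- The bucket is O(m u / y) and y² ≥ n u³ / 2, so the square of bucket · n v² is O(n v⁴ m² / u)
     -- = O(B² / |x|), which is O(N² / X₀).
     bucket-bound : ∀ x → bucket x * (n x * (v x * v x)) ≤ Y
     bucket-bound x = sq-cancel-≤ (*-cancelʳ-≤ _ _ X₀ {{>-nonZero X₀≥1}} (begin
       b * (n' * (v' * v')) * (b * (n' * (v' * v'))) * X₀ ≤⟨ *-monoʳ-≤ (b * (n' * (v' * v')) * (b * (n' * (v' * v')))) (≤-trans (<⇒≤ (CElem.X₀<x x)) (≤-reflexive (CElem.absx≡ x))) ⟩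
       b * (n' * (v' * v')) * (b * (n' * (v' * v'))) * (n' * (v' * v') * u') ≡⟨ l₁ b n' v' u' ⟩
       b * b * n' * u' * (n' * (v' * v' * v') * (n' * (v' * v' * v'))) ≤⟨ *-monoˡ-≤ _ core ⟩
       32 * ((1 + κ) * (1 + κ)) * (m' * m') * (n' * (v' * v' * v') * (n' * (v' * v' * v'))) ≡⟨ l₂ (1 + κ) m' (n' * (v' * v' * v')) ⟩
       32 * ((1 + κ) * (1 + κ)) * (n' * (v' * v' * v') * m' * (n' * (v' * v' * v') * m')) ≤⟨ *-mono-≤ (*-monoˡ-≤ ((1 + κ) * (1 + κ)) (m≤m+n 32 32)) (*-mono-≤ B≤ B≤) ⟩
       64 * ((1 + κ) * (1 + κ)) * (N * N) ≡⟨ l₃ (1 + κ) N ⟩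
       8 * (1 + κ) * N * (8 * (1 + κ) * N) ≤⟨ HY ⟩
       Y * Y * X₀ ∎))
       where
       open ≤-Reasoning
       b = bucket x
       n' = n x
       v' = v x
       m' = m x
       u' = U x
       y' = y x
       N≥1 : 1 ≤ N
       N≥1 = ≤-trans (CElem.n≥1 x) (CElem.n≤N x)
       X₀≥1 : 1 ≤ X₀
       X₀≥1 = n≢0⇒n>0 (λ e → <⇒≱ (*-mono-≤ (*-mono-≤ (s≤s (z≤n {3})) (*-mono-≤ κ≥1 κ≥1)) (*-mono-≤ N≥1 N≥1)) (≤-trans HX (≤-reflexive (cong (λ t → t * t * t) e))))
       B≤ : n' * (v' * v' * v') * m' ≤ N
       B≤ = ≤-trans (≤-reflexive (sym (CElem.B≡ x))) (CElem.B≤N x)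
       R≤ : 2 ^ lj x ≤ u'
       R≤ = 2^ilog≤ u' (Cusp.u≥1 (E x))
       core : b * b * n' * u' ≤ 32 * ((1 + κ) * (1 + κ)) * (m' * m')
       core = *-cancelʳ-≤ _ _ (u' * u') {{>-nonZero (*-mono-≤ (Cusp.u≥1 (E x)) (Cusp.u≥1 (E x)))}} (begin
         b * b * n' * u' * (u' * u') ≡⟨ k₁ b n' u' ⟩
         b * b * (n' * (u' * u' * u')) ≤⟨ *-monoʳ-≤ (b * b) (nu³≤2y² (E x)) ⟩
         b * b * (2 * (y' * y')) ≡⟨ k₂ b y' ⟩
         2 * (b * y' * (b * y')) ≤⟨ *-monoʳ-≤ 2 (*-mono-≤ (bucket-lo x) (bucket-lo x)) ⟩
         2 * (m' * (4 * (1 + κ) * 2 ^ lj x) * (m' * (4 * (1 + κ) * 2 ^ lj x))) ≤⟨ *-monoʳ-≤ 2 (*-mono-≤ (*-monoʳ-≤ m' (*-monoʳ-≤ (4 * (1 + κ)) R≤)) (*-monoʳ-≤ m' (*-monoʳ-≤ (4 * (1 + κ)) R≤))) ⟩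
         2 * (m' * (4 * (1 + κ) * u') * (m' * (4 * (1 + κ) * u'))) ≡⟨ k₃ m' (1 + κ) u' ⟩
         32 * ((1 + κ) * (1 + κ)) * (m' * m') * (u' * u') ∎)
         where
         k₁ : ∀ b n u → b * b * n * u * (u * u) ≡ b * b * (n * (u * u * u))
         k₁ = NS.solve-∀
         k₂ : ∀ b y → b * b * (2 * (y * y)) ≡ 2 * (b * y * (b * y))
         k₂ = NS.solve-∀
         k₃ : ∀ m a u → 2 * (m * (4 * a * u) * (m * (4 * a * u))) ≡ 32 * (a * a) * (m * m) * (u * u)
         k₃ = NS.solve-∀
       l₁ : ∀ b n v u → b * (n * (v * v)) * (b * (n * (v * v))) * (n * (v * v) * u) ≡ b * b * n * u * (n * (v * v * v) * (n * (v * v * v)))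
       l₁ = NS.solve-∀
       l₂ : ∀ a m b → 32 * (a * a) * (m * m) * (b * b) ≡ 32 * (a * a) * (b * m * (b * m))
       l₂ = NS.solve-∀
       l₃ : ∀ a N → 64 * (a * a) * (N * N) ≡ 8 * a * N * (8 * a * N)
       l₃ = NS.solve-∀

     module ShellPair (x z : CElem) (S : SameClass (E x) (E z)) (ev : v x ≡ v z) (ej : lj x ≡ lj z) (eb : bucket x ≡ bucket z) where
       open ≤-Reasoning
       open Pair (E x) (E z) S using (same-n; q) renaming (δ to Δ)
       n₁ = n x
       u₁ = U x
       u₂ = U z
       y₁ = y x
       y₂ = y z
       m₁ = m x
       m₂ = m z
       Wt = scale x
       Wt≡ : scale z ≡ Wt
       Wt≡ = cong (λ t → 4 * (1 + κ) * 2 ^ t) (sym ej)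
       b = bucket x
       lo₂ : b * y₂ ≤ m₂ * Wt
       lo₂ = subst₂ (λ s t → s * y₂ ≤ m₂ * t) (sym eb) Wt≡ (bucket-lo z)
       hi₂ : m₂ * Wt < suc b * y₂
       hi₂ = subst₂ (λ s t → m₂ * t < suc s * y₂) (sym eb) Wt≡ (bucket-hi z)
       l : ∀ a t r → a * (4 * t * r) ≡ t * (4 * a * r)
       l = NS.solve-∀
       ΔW : Δ * Wt < y₁ * y₂
       ΔW = ≤-trans (s≤s (≤-reflexive (trans (sym (ℤP.abs-* ((+ y₁) · (+ m₂) ⊖ (+ m₁) · (+ y₂)) (+ Wt))) (cong abs (trans (l₁ (+ y₁) (+ m₂) (+ m₁) (+ y₂) (+ Wt)) (cong₂ _⊖_ (p3 y₁ m₂ Wt) (p3 y₂ m₁ Wt)))))))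
         (abs-diff< (y₁ * (m₂ * Wt)) (y₂ * (m₁ * Wt)) (y₁ * y₂) c₁ c₂)
         where
         l₁ : ∀ y₁ m₂ m₁ y₂ Wt → (y₁ · m₂ ⊖ m₁ · y₂) · Wt ≡ y₁ · (m₂ · Wt) ⊖ y₂ · (m₁ · Wt)
         l₁ = ZS.solve-∀
         p3 : ∀ a b c → (+ a) · ((+ b) · (+ c)) ≡ + (a * (b * c))
         p3 a b c = sym (trans (ℤP.pos-* a (b * c)) (cong ((+ a) ·_) (ℤP.pos-* b c)))
         c₁ : y₁ * (m₂ * Wt) < y₂ * (m₁ * Wt) + y₁ * y₂
         c₁ = begin-strict
           y₁ * (m₂ * Wt) <⟨ *-monoʳ-< y₁ {{>-nonZero (CElem.y≥1 x)}} hi₂ ⟩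
           y₁ * (suc b * y₂) ≡⟨ q₁ y₁ b y₂ ⟩
           y₂ * (b * y₁) + y₁ * y₂ ≤⟨ +-monoˡ-≤ (y₁ * y₂) (*-monoʳ-≤ y₂ (bucket-lo x)) ⟩
           y₂ * (m₁ * Wt) + y₁ * y₂ ∎
           where
           q₁ : ∀ y b z → y * (suc b * z) ≡ z * (b * y) + y * z
           q₁ = NS.solve-∀
         c₂ : y₂ * (m₁ * Wt) < y₁ * (m₂ * Wt) + y₁ * y₂
         c₂ = begin-strict
           y₂ * (m₁ * Wt) <⟨ *-monoʳ-< y₂ {{>-nonZero (CElem.y≥1 z)}} (bucket-hi x) ⟩
           y₂ * (suc b * y₁) ≡⟨ q₁ y₂ b y₁ ⟩
           y₁ * (b * y₂) + y₁ * y₂ ≤⟨ +-monoˡ-≤ (y₁ * y₂) (*-monoʳ-≤ y₁ lo₂) ⟩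
           y₁ * (m₂ * Wt) + y₁ * y₂ ∎
           where
           q₁ : ∀ y b z → y * (suc b * z) ≡ z * (b * y) + z * y
           q₁ = NS.solve-∀
       u≤2R : ∀ t → lj t ≡ lj x → U t ≤ 2 * 2 ^ lj x
       u≤2R t e = ≤-trans (<⇒≤ (<2^ilog (U t))) (≤-reflexive (cong (λ i → 2 * 2 ^ i) e))
       yy : y₁ * y₂ ≤ 4 * (n₁ * (u₁ * u₂)) * 2 ^ lj x
       yy = sq-cancel-≤ (begin
         y₁ * y₂ * (y₁ * y₂) ≡⟨ q₁ y₁ y₂ ⟩
         y₁ * y₁ * (y₂ * y₂) ≤⟨ *-mono-≤ (y²≤2nu³ (E x)) (≤-trans (y²≤2nu³ (E z)) (≤-reflexive (cong (λ t → 2 * (t * (u₂ * u₂ * u₂))) same-n))) ⟩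
         2 * (n₁ * (u₁ * u₁ * u₁)) * (2 * (n₁ * (u₂ * u₂ * u₂))) ≡⟨ q₂ n₁ u₁ u₂ ⟩
         4 * (n₁ * (u₁ * u₂) * (n₁ * (u₁ * u₂))) * (u₁ * u₂) ≤⟨ *-monoʳ-≤ (4 * (n₁ * (u₁ * u₂) * (n₁ * (u₁ * u₂)))) (*-mono-≤ (u≤2R x refl) (u≤2R z (sym ej))) ⟩
         4 * (n₁ * (u₁ * u₂) * (n₁ * (u₁ * u₂))) * (2 * 2 ^ lj x * (2 * 2 ^ lj x)) ≡⟨ q₃ (n₁ * (u₁ * u₂)) (2 ^ lj x) ⟩
         4 * (n₁ * (u₁ * u₂)) * 2 ^ lj x * (4 * (n₁ * (u₁ * u₂)) * 2 ^ lj x) ∎)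
         where
         q₁ : ∀ y z → y * z * (y * z) ≡ y * y * (z * z)
         q₁ = NS.solve-∀
         q₂ : ∀ n u v → 2 * (n * (u * u * u)) * (2 * (n * (v * v * v))) ≡ 4 * (n * (u * v) * (n * (u * v))) * (u * v)
         q₂ = NS.solve-∀
         q₃ : ∀ a r → 4 * (a * a) * (2 * r * (2 * r)) ≡ 4 * a * r * (4 * a * r)
         q₃ = NS.solve-∀
       -- Equal buckets give δ · scale < y₁ y₂ ≤ 4 n u₁ u₂ 2^j, whereas `gap` gives n u₁ u₂ ≤ (1 +
       -- κ) δ. The factor 4 (1 + κ) in `scale` makes the two incompatible.
       apart : q ≢ 0 → ⊥
       apart ne = <-irrefl refl (begin-strict
         n₁ * (u₁ * u₂) * Wt ≤⟨ *-monoˡ-≤ Wt (gap₁ x z S ne) ⟩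
         (1 + κ) * Δ * Wt ≡⟨ *-assoc (1 + κ) Δ Wt ⟩
         (1 + κ) * (Δ * Wt) <⟨ *-monoʳ-< (1 + κ) ΔW ⟩
         (1 + κ) * (y₁ * y₂) ≤⟨ *-monoʳ-≤ (1 + κ) yy ⟩
         (1 + κ) * (4 * (n₁ * (u₁ * u₂)) * 2 ^ lj x) ≡⟨ l (1 + κ) (n₁ * (u₁ * u₂)) (2 ^ lj x) ⟩
         n₁ * (u₁ * u₂) * Wt ∎)
       result : CElem.B x ≡ CElem.B z
       result = same-key x z S ev (decidable-stable (q ≟ 0) apart)

     shell-unique : ∀ x z (S : SameClass (E x) (E z)) → v x ≡ v z → lj x ≡ lj z → bucket x ≡ bucket z → CElem.B x ≡ CElem.B z
     shell-unique x z S ev ej eb = ShellPair.result x z S ev ej eb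

     Pbase : ℕ
     Pbase = bigConst * ((1 + κ) * (1 + κ)) * (N * N)
     -- The threshold from which `excluded` applies. It is a fixed power of N up to a constant, so
     -- O(T) dyadic shells of u lie below it.
     U₁ : ℕ
     U₁ = 4 * (Pbase ^ 24 * Pbase ^ 24)

     module Huge (a : CElem) (big : U₁ ≤ U a) where
       Pbase≥1 : 1 ≤ Pbase
       Pbase≥1 = *-mono-≤ (*-mono-≤ (≤-trans (s≤s z≤n) bigConst≥) (*-mono-≤ (s≤s (z≤n {κ})) (s≤s (z≤n {κ})))) (*-mono-≤ N≥1 N≥1)
         where
         N≥1 : 1 ≤ N
         N≥1 = ≤-trans (CElem.n≥1 a) (CElem.n≤N a)
       P²≤U : Pbase * Pbase ≤ U a
       P²≤U = ≤-trans (≤-trans (*-mono-≤ (p24) p24) (m≤n*m _ 4)) big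
         where
         p24 : Pbase ≤ Pbase ^ 24
         p24 = ≤-trans (≤-reflexive (sym (*-identityʳ Pbase))) (*-monoʳ-≤ Pbase (^-pos 23 Pbase≥1))
       Ua≥2 : 2 ≤ U a
       Ua≥2 = ≤-trans (s≤s (s≤s z≤n)) (≤-trans (*-monoʳ-≤ 4 (*-mono-≤ (^-pos 24 Pbase≥1) (^-pos 24 Pbase≥1))) big)

       -- Twice the logarithm of U x to base U a, rounded down. Two elements with equal exponent
       -- differ by a factor below √(U a), and `U<12` leaves 24 values.
       exponent : CElem → ℕ
       exponent x = proj₁ (plog (U a) (U x * U x) Ua≥2 (*-mono-≤ (Cusp.u≥1 (E x)) (Cusp.u≥1 (E x))))
       exponent-lo : ∀ x → U a ^ exponent x ≤ U x * U x
       exponent-lo x = proj₁ (proj₂ (plog (U a) (U x * U x) Ua≥2 (*-mono-≤ (Cusp.u≥1 (E x)) (Cusp.u≥1 (E x)))))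
       exponent-hi : ∀ x → U x * U x < U a ^ suc (exponent x)
       exponent-hi x = proj₂ (proj₂ (plog (U a) (U x * U x) Ua≥2 (*-mono-≤ (Cusp.u≥1 (E x)) (Cusp.u≥1 (E x)))))

       U<12 : ∀ x → SameClass (E a) (E x) → U a ≤ U x → U x < U a ^ 12
       U<12 x S le = ≰⇒> (λ h → go (even-exponent (U a) (U x) Ua≥2 (Cusp.u≥1 (E x)) h))
         where
         go : ∃[ r ] (6 ≤ r × U a ^ (r + r) ≤ U x × U x ≤ U a ^ (r + r + 2)) → ⊥
         go (r , r≥6 , lo , hi) = Pair.Exclusion.excluded (E a) (E x) S k≢0 κ≥1 N (CElem.n≤N a) (CElem.m≤N a) (CElem.m≤N x) le big r r≥6 lo hi

       exponent<24 : ∀ x → SameClass (E a) (E x) → U a ≤ U x → exponent x < 24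
       exponent<24 x S le = ^-cancel-< (U a) (exponent x) 24 Ua≥2 (≤-<-trans (exponent-lo x) (square-<-pow (U a) (U x) (U<12 x S le)))

       module Close (x z : CElem) (S : SameClass (E x) (E z)) (ev : v x ≡ v z) (ax : U a ≤ U x) (xz : U x ≤ U z) (ee : exponent x ≡ exponent z) where
         open ≤-Reasoning
         open Pair (E x) (E z) S using (same-n; δ≤; y₁≤2y₂; q) renaming (δ to Δ)
         u₁ = U x
         u₂ = U z
         n₁ = n x
         n₁≥1 = CElem.n≥1 x
         G = 18 * ((1 + κ) * (1 + κ)) * (N * N)
         G≤P : G ≤ Pbase
         G≤P = *-monoˡ-≤ (N * N) (*-monoˡ-≤ ((1 + κ) * (1 + κ)) (≤-trans (m≤m+n 18 12270) bigConst≥))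
         s₁ : q ≢ 0 → n₁ * (u₁ * u₂) ≤ (1 + κ) * (3 * N) * y z
         s₁ ne = begin
           n₁ * (u₁ * u₂) ≤⟨ gap₁ x z S ne ⟩
           (1 + κ) * Δ ≤⟨ *-monoʳ-≤ (1 + κ) (≤-trans δ≤ (+-mono-≤ (*-mono-≤ (y₁≤2y₂ xz) (CElem.m≤N z)) (*-monoˡ-≤ (y z) (CElem.m≤N x)))) ⟩
           (1 + κ) * (2 * y z * N + N * y z) ≡⟨ l (1 + κ) (y z) N ⟩
           (1 + κ) * (3 * N) * y z ∎
           where
           l : ∀ a y N → a * (2 * y * N + N * y) ≡ a * (3 * N) * y
           l = NS.solve-∀
         s₂ : q ≢ 0 → u₁ * u₁ ≤ G * u₂
         s₂ ne = *-cancelʳ-≤ _ _ (n₁ * (u₂ * u₂)) {{>-nonZero (*-mono-≤ n₁≥1 (*-mono-≤ (Cusp.u≥1 (E z)) (Cusp.u≥1 (E z))))}} (begin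
           u₁ * u₁ * (n₁ * (u₂ * u₂)) ≤⟨ m≤n*m _ n₁ {{>-nonZero n₁≥1}} ⟩
           n₁ * (u₁ * u₁ * (n₁ * (u₂ * u₂))) ≡⟨ l n₁ u₁ u₂ ⟩
           n₁ * (u₁ * u₂) * (n₁ * (u₁ * u₂)) ≤⟨ *-mono-≤ (s₁ ne) (s₁ ne) ⟩
           (1 + κ) * (3 * N) * y z * ((1 + κ) * (3 * N) * y z) ≡⟨ l' (1 + κ) N (y z) ⟩
           9 * ((1 + κ) * (1 + κ)) * (N * N) * (y z * y z) ≤⟨ *-monoʳ-≤ (9 * ((1 + κ) * (1 + κ)) * (N * N)) (≤-trans (y²≤2nu³ (E z)) (≤-reflexive (cong (λ t → 2 * (t * (u₂ * u₂ * u₂))) same-n))) ⟩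
           9 * ((1 + κ) * (1 + κ)) * (N * N) * (2 * (n₁ * (u₂ * u₂ * u₂))) ≡⟨ l″ ((1 + κ) * (1 + κ)) (N * N) n₁ u₂ ⟩
           G * u₂ * (n₁ * (u₂ * u₂)) ∎)
           where
           l : ∀ n u v → n * (u * u * (n * (v * v))) ≡ n * (u * v) * (n * (u * v))
           l = NS.solve-∀
           l' : ∀ a N y → a * (3 * N) * y * (a * (3 * N) * y) ≡ 9 * (a * a) * (N * N) * (y * y)
           l' = NS.solve-∀
           l″ : ∀ a b n u → 9 * a * b * (2 * (n * (u * u * u))) ≡ 18 * a * b * u * (n * (u * u))
           l″ = NS.solve-∀
         u₂² : u₂ * u₂ < u₁ * u₁ * U a
         u₂² = <-≤-trans (exponent-hi z) (≤-trans (≤-reflexive (cong (λ t → U a * U a ^ t) (sym ee))) (≤-trans (*-monoʳ-≤ (U a) (exponent-lo x)) (≤-reflexive (*-comm (U a) (u₁ * u₁)))))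
         -- The gap gives u₁² ≤ G u₂ and equal exponents give u₂² < u₁² U a. Hence u₁⁴ < P² u₁² U a
         -- ≤ P² u₁³, with P = `Pbase` ≥ G, whereas u₁ ≥ U a ≥ P².
         fin : q ≢ 0 → u₁ < Pbase * Pbase
         fin ne = *-cancelʳ-< (u₁ * u₁ * u₁) u₁ (Pbase * Pbase) (begin-strict
           u₁ * (u₁ * u₁ * u₁) ≡⟨ l u₁ ⟩
           u₁ * u₁ * (u₁ * u₁) ≤⟨ *-mono-≤ (s₂ ne) (s₂ ne) ⟩
           G * u₂ * (G * u₂) ≡⟨ l' G u₂ ⟩
           G * G * (u₂ * u₂) ≤⟨ *-monoˡ-≤ (u₂ * u₂) (*-mono-≤ G≤P G≤P) ⟩
           Pbase * Pbase * (u₂ * u₂) <⟨ *-monoʳ-< (Pbase * Pbase) {{>-nonZero (*-mono-≤ Pbase≥1 Pbase≥1)}} u₂² ⟩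
           Pbase * Pbase * (u₁ * u₁ * U a) ≤⟨ *-monoʳ-≤ (Pbase * Pbase) (*-monoʳ-≤ (u₁ * u₁) ax) ⟩
           Pbase * Pbase * (u₁ * u₁ * u₁) ∎)
           where
           l : ∀ u → u * (u * u * u) ≡ u * u * (u * u)
           l = NS.solve-∀
           l' : ∀ g u → g * u * (g * u) ≡ g * g * (u * u)
           l' = NS.solve-∀
         result : CElem.B x ≡ CElem.B z
         result = same-key x z S ev (decidable-stable (q ≟ 0) (λ ne → <⇒≱ (fin ne) (≤-trans P²≤U ax)))

       close-equal : ∀ x z (S : SameClass (E x) (E z)) → v x ≡ v z → U a ≤ U x → U x ≤ U z → exponent x ≡ exponent z → CElem.B x ≡ CElem.B z
       close-equal x z S ev ax xz ee = Close.result x z S ev ax xz ee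

     -- `bdd-min` provides the element of the class with smallest `U` as base `a`; each of the 24
     -- exponents then carries at most one B.
     huge-bound : ∀ i l a → P₂ i l a × ¬ (U a < U₁) → Bdd (λ x → (P₂ i l x × ¬ (U x < U₁)) × Agree x a i l) 24
     huge-bound i l a₀ _ = bdd-min U (λ a ((pa , ha) , aga) → bdd-mono (λ x p → p) ≤-refl (step a ha aga))
       where
       trans-agree : ∀ x z → Agree x a₀ i l → Agree z a₀ i l → Agree x z i l
       trans-agree x z p q = All.zipWith (λ (e , e') → trans e (sym e')) (p , q)
       step : ∀ a → ¬ (U a < U₁) → Agree a a₀ i l → Bdd (λ x → ((P₂ i l x × ¬ (U x < U₁)) × Agree x a₀ i l) × U a ≤ U x) 24
       step a ha aga = bdd-mono (λ x p → p) ≤-refl (bdd-labels {λ x → ((P₂ i l x × ¬ (U x < U₁)) × Agree x a₀ i l) × U a ≤ U x} ((H.exponent , 24) ∷ [])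
         (λ x ((_ , ag) , le) → H.exponent<24 x (same i l a x (trans-agree a x aga ag)) le ∷ [])
         (λ { x z ((_ , agx) , lex) ((_ , agz) , lez) (e ∷ []) → fin x z agx agz lex lez e (≤-total (U x) (U z)) }))
         where
         module H = Huge a (≮⇒≥ ha)
         fin : ∀ x z → Agree x a₀ i l → Agree z a₀ i l → U a ≤ U x → U a ≤ U z → H.exponent x ≡ H.exponent z → U x ≤ U z ⊎ U z ≤ U x → CElem.B x ≡ CElem.B z
         fin x z agx agz lex lez e (inj₁ le) = H.close-equal x z (same i l x z (trans-agree x z agx agz)) (All.head (trans-agree x z agx agz)) lex le e
         fin x z agx agz lex lez e (inj₂ le) = sym (H.close-equal z x (same i l z x (trans-agree z x agz agx)) (All.head (trans-agree z x agz agx)) lez le (sym e))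

     J : ℕ
     J = suc (Ebig + 96 * T)
     U₁≡ : U₁ ≡ Ebig * N ^ 96
     U₁≡ = power-split (bigConst * ((1 + κ) * (1 + κ))) N
     J≤ : J ≤ (97 + Ebig) * T
     J≤ = begin
       1 + (Ebig + 96 * T) ≤⟨ +-mono-≤ {1} {T} (s≤s z≤n) (+-monoˡ-≤ (96 * T) (m≤m*n Ebig T)) ⟩
       T + (Ebig * T + 96 * T) ≡⟨ l Ebig T ⟩
       (97 + Ebig) * T ∎
       where
       open ≤-Reasoning
       l : ∀ E T → T + (E * T + 96 * T) ≡ (97 + E) * T
       l = NS.solve-∀

     cell : ℕ → ℕ → ℕ
     cell i l = 2 ^ i * (2 ^ l * 2 ^ l)
     cell≥1 : ∀ i l → 1 ≤ cell i l
     cell≥1 i l = *-mono-≤ (m^n>0 2 i) (*-mono-≤ (m^n>0 2 l) (m^n>0 2 l))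
     Lb : ℕ → ℕ → ℕ
     Lb i l = suc (DM._/_ Y (cell i l) {{>-nonZero (cell≥1 i l)}})
     shell-labels : ℕ → ℕ → Labels
     shell-labels i l = (lj , J) ∷ (bucket , Lb i l) ∷ []
     shell-bound : ∀ i l a → P₂ i l a × U a < U₁ → Bdd (λ x → (P₂ i l x × U x < U₁) × Agree x a i l) (J * (Lb i l * 1))
     shell-bound i l a _ = bdd-labels (shell-labels i l) within′ (λ { x z (_ , agx) (_ , agz) (e₁ ∷ e₂ ∷ []) →
         shell-unique x z (same i l x z (ta x z agx agz)) (All.head (ta x z agx agz)) e₁ e₂ })
       where
       ta : ∀ x z → Agree x a i l → Agree z a i l → Agree x z i l
       ta x z p q = All.zipWith (λ (e , e') → trans e (sym e')) (p , q)
       within′ : ∀ x → (P₂ i l x × U x < U₁) × Agree x a i l → All (λ f → proj₁ f x < proj₂ f) (shell-labels i l)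
       within′ x ((((_ , refl) , refl) , lt) , _) = s≤s (ilog-poly Ebig 96 N (U x) (≤-trans (<⇒≤ lt) (≤-reflexive U₁≡)))
         ∷ s≤s (≤-trans (≤-reflexive (sym (DM.m*n/n≡m (bucket x) (cell (li x) (ll x)) {{nz}}))) (DM./-monoˡ-≤ (cell (li x) (ll x)) {{nz}}
              (≤-trans (*-monoʳ-≤ (bucket x) (*-mono-≤ (2^ilog≤ (n x) (CElem.n≥1 x)) (*-mono-≤ (2^ilog≤ (v x) (CElem.v≥1 x)) (2^ilog≤ (v x) (CElem.v≥1 x))))) (bucket-bound x)))) ∷ []
         where
         nz = >-nonZero (cell≥1 (li x) (ll x))

   private
     class-count : ∀ i l → count (class i l) ≤ 144 * Gα * cc * (2 ^ i * 2 ^ l)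
     class-count i l = begin
       count (class i l) ≡⟨ l₁ (2 ^ l) (2 * αBound i + 1) cc ⟩
       2 ^ l * ((2 * αBound i + 1) * (2 * αBound i + 1)) * (8 * cc) ≤⟨ *-monoˡ-≤ (8 * cc) (*-monoʳ-≤ (2 ^ l) (αBound-sq i)) ⟩
       2 ^ l * (18 * Gα * 2 ^ i) * (8 * cc) ≡⟨ l₂ (2 ^ l) Gα (2 ^ i) cc ⟩
       144 * Gα * cc * (2 ^ i * 2 ^ l) ∎
       where
       open ≤-Reasoning
       l₁ : ∀ p a c → 2 * p * (a * (a * (c * (2 * (2 * 1))))) ≡ p * (a * a) * (8 * c)
       l₁ = NS.solve-∀
       l₂ : ∀ p g i c → p * (18 * g * i) * (8 * c) ≡ 144 * g * c * (i * p)
       l₂ = NS.solve-∀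
     Kin : ℕ
     Kin = constC * ((M + Y) * T)
     inner : ∀ i l → Bdd (P₂ i l) Kin
     inner i l = go (2 ^ i * 2 ^ l * (w * w) ≤? N)
       where
       -- (n v w²)³ = (n w³)² (n v³), and both n w³ and n v³ are at most N, the former because w³ <
       -- v³ m.
       infeasible : ∀ x → 2 ^ li x * 2 ^ ll x * (w * w) * (2 ^ li x * 2 ^ ll x * (w * w)) * (2 ^ li x * 2 ^ ll x * (w * w)) ≤ N * N * N
       infeasible x = begin
         2 ^ li x * 2 ^ ll x * (w * w) * (2 ^ li x * 2 ^ ll x * (w * w)) * (2 ^ li x * 2 ^ ll x * (w * w)) ≡⟨ l₁ (2 ^ li x) (2 ^ ll x) w ⟩
         2 ^ li x * (w * w * w) * (2 ^ li x * (w * w * w)) * (2 ^ li x * (2 ^ ll x * 2 ^ ll x * 2 ^ ll x)) ≤⟨ *-mono-≤ (*-mono-≤ h₁ h₁) h₂ ⟩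
         N * N * N ∎
         where
         open ≤-Reasoning
         a≤ = 2^ilog≤ (n x) (CElem.n≥1 x)
         b≤ = 2^ilog≤ (v x) (CElem.v≥1 x)
         h₁ : 2 ^ li x * (w * w * w) ≤ N
         h₁ = ≤-trans (*-monoˡ-≤ (w * w * w) a≤) (CElem.nw³≤N x)
         h₂ : 2 ^ li x * (2 ^ ll x * 2 ^ ll x * 2 ^ ll x) ≤ N
         h₂ = ≤-trans (*-mono-≤ a≤ (*-mono-≤ (*-mono-≤ b≤ b≤) b≤)) (CElem.nv³≤N x)
         l₁ : ∀ a b w → a * b * (w * w) * (a * b * (w * w)) * (a * b * (w * w)) ≡ a * (w * w * w) * (a * (w * w * w)) * (a * (b * b * b))
         l₁ = NS.solve-∀
       go : Dec (2 ^ i * 2 ^ l * (w * w) ≤ N) → Bdd (P₂ i l) Kin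
       go (no h) = bdd-empty Kin (λ x ((_ , e₁) , e₂) → h (cube-cancel-≤ (subst₂ (λ i l → 2 ^ i * 2 ^ l * (w * w) * (2 ^ i * 2 ^ l * (w * w)) * (2 ^ i * 2 ^ l * (w * w)) ≤ N * N * N) e₁ e₂ (infeasible x))))
       go (yes h) = bdd-mono (λ x p → p) fin (bdd-split (λ x → U x <? U₁)
         (bdd-labels-ref (class i l) (λ x (p , _) → within i l x p) (shell-bound i l))
         (bdd-labels-ref (class i l) (λ x (p , _) → within i l x p) (huge-bound i l)))
         where
         open ≤-Reasoning
         ab = 2 ^ i * 2 ^ l
         ab≤M : ab ≤ M
         ab≤M = HM ab h
         Yq = DM._/_ Y (cell i l) {{>-nonZero (cell≥1 i l)}}
         abY : ab * Yq ≤ Y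
         abY = begin
           ab * Yq ≤⟨ *-monoˡ-≤ Yq (*-monoʳ-≤ (2 ^ i) (m≤m*m (2 ^ l))) ⟩
           cell i l * Yq ≡⟨ *-comm (cell i l) Yq ⟩
           Yq * cell i l ≤⟨ DM.m/n*n≤m Y (cell i l) {{>-nonZero (cell≥1 i l)}} ⟩
           Y ∎
         g = 144 * Gα * cc
         fin : count (class i l) * (J * (Lb i l * 1)) + count (class i l) * 24 ≤ Kin
         fin = begin
           count (class i l) * (J * (Lb i l * 1)) + count (class i l) * 24
             ≤⟨ +-mono-≤ (*-mono-≤ (class-count i l) (*-monoˡ-≤ (Lb i l * 1) J≤)) (*-monoˡ-≤ 24 (class-count i l)) ⟩
           g * ab * ((97 + Ebig) * T * (suc Yq * 1)) + g * ab * 24 ≡⟨ l₁ g ab (97 + Ebig) T Yq ⟩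
           g * (97 + Ebig) * ((ab + ab * Yq) * T) + g * 24 * ab
             ≤⟨ +-mono-≤ (*-monoʳ-≤ (g * (97 + Ebig)) (*-monoˡ-≤ T (+-mono-≤ ab≤M abY))) (*-monoʳ-≤ (g * 24) (≤-trans ab≤M (≤-trans (m≤m+n M Y) (m≤m*n (M + Y) T)))) ⟩
           g * (97 + Ebig) * ((M + Y) * T) + g * 24 * ((M + Y) * T) ≡⟨ sym (*-distribʳ-+ ((M + Y) * T) (g * (97 + Ebig)) (g * 24)) ⟩
           Kin ∎
           where
           l₁ : ∀ g a e t y → g * a * (e * t * (suc y * 1)) + g * a * 24 ≡ g * e * ((a + a * y) * t) + g * 24 * a
           l₁ = NS.solve-∀

   case-C : Bdd (λ _ → ⊤) (T * (T * (constC * ((M + Y) * T))))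
   case-C = bdd-fibre li T (λ x _ → s≤s (ilog-mono (CElem.n≤N x))) (λ i _ → bdd-fibre ll T (λ x _ → s≤s (ilog-mono (CElem.v≤N x))) (λ l _ → inner i l))

 -- Case (A): the sum over s-numbers from above

 Split : ℕ → Set
 Split p = ∃[ t ] (t < p × p ∣ abs ((+ t) · (+ t) ⊖ k))

 split? : Decidable Split
 split? p = anyUpTo? (λ t → p ∣? abs ((+ t) · (+ t) ⊖ k)) p

 split-root : ∀ p x → 1 ≤ p → p ∣ abs (x · x ⊖ k) → Split p
 split-root p x p≥1 d = t , ℤD.n%ℕd<d x p , subst (λ i → p ∣ abs i) eq (∣-abs-+ (x · x ⊖ k) (c · (+ p)) d (∣-abs-*ˡ c (+ p) ND.∣-refl))
   where
   instance _ = >-nonZero p≥1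
   t = x ℤD.%ℕ p
   q = x ℤD./ℕ p
   c = ⊖ (q · (x ⊕ (+ t)))
   l : ∀ t q p k → ((t ⊕ q · p) · (t ⊕ q · p) ⊖ k) ⊕ ⊖ (q · ((t ⊕ q · p) ⊕ t)) · p ≡ t · t ⊖ k
   l = ZS.solve-∀
   eq : (x · x ⊖ k) ⊕ c · (+ p) ≡ (+ t) · (+ t) ⊖ k
   eq = trans (cong (λ y → (y · y ⊖ k) ⊕ ⊖ (q · (y ⊕ (+ t))) · (+ p)) (ℤD.a≡a%ℕn+[a/ℕn]*n x p)) (l (+ t) q (+ p) k)

 -- One fixed square root of k for each split prime, relative to which signs are recorded.
 root : ℕ → ℤ
 root p with split? p
 ... | yes (t , _) = + t
 ... | no _ = 0ℤ

 root-correct : ∀ p → Split p → p ∣ abs (root p · root p ⊖ k)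
 root-correct p sp with split? p
 ... | yes (t , _ , d) = d
 ... | no ns = ⊥-elim (ns sp)

 squareFree-* : ∀ {a b} → Coprime a b → SquareFree a → SquareFree b → SquareFree (a * b)
 squareFree-* {a} {b} cop (a≥1 , fa) (b≥1 , fb) = *-mono-≤ a≥1 b≥1 , free
   where
   free : ∀ p → Prime p → ¬ p * p ∣ a * b
   free p pp d with p ∣? a
   ... | no na = fb p pp (coprime-divisor (coprime-square (coprime-sym (prime-coprime pp na))) d)
   ... | yes pa = fa p pp (coprime-divisor (coprime-square (coprime-sym (prime-coprime pp (λ pb → ¬prime[1] (subst Prime (cop (pa , pb)) pp))))) (subst (p * p ∣_) (*-comm a b) d))

 all-product : ∀ {A B : Set} {P : A → Set} {R : B → Set} {xs ys} → All P xs → All R ys → All (λ x → P (proj₁ x) × R (proj₂ x)) (cartesianProduct xs ys)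
 all-product [] rs = []
 all-product (p ∷ ps) rs = AllP.++⁺ (AllP.map⁺ (All.map (λ r → p , r) rs)) (all-product ps rs)

 ⊔⊓-determine : ∀ a b a' b' → a ℕ.⊔ b ≡ a' ℕ.⊔ b' → a ℕ.⊓ b ≡ a' ℕ.⊓ b' → ⟦ a ≤? b ⟧ ≡ ⟦ a' ≤? b' ⟧ → a ≡ a' × b ≡ b'
 ⊔⊓-determine a b a' b' mx mn e with a ≤? b | a' ≤? b'
 ... | yes p | yes q = trans (sym (m≤n⇒m⊓n≡m p)) (trans mn (m≤n⇒m⊓n≡m q)) , trans (sym (m≤n⇒m⊔n≡n p)) (trans mx (m≤n⇒m⊔n≡n q))
 ... | no p | no q = trans (sym (m≥n⇒m⊔n≡m (≰⇒≥ p))) (trans mx (m≥n⇒m⊔n≡m (≰⇒≥ q))) , trans (sym (m≥n⇒m⊓n≡n (≰⇒≥ p))) (trans mn (m≥n⇒m⊓n≡n (≰⇒≥ q)))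
 ⊔⊓-determine a b a' b' mx mn () | yes p | no q
 ⊔⊓-determine a b a' b' mx mn () | no p | yes q

 sign-determine : ∀ x y → abs x ≡ abs y → negative? x ≡ negative? y → x ≡ y
 sign-determine (+ m) (+ n) e _ = cong +_ e
 sign-determine -[1+ m ] -[1+ n ] e _ = cong -[1+_] (suc-injective e)

 abs-norm≤ : ∀ a b → abs (a · a ⊖ k · b · b) ≤ abs a * abs a + κ * (abs b * abs b)
 abs-norm≤ a b = ≤-trans (ℤP.∣i-j∣≤∣i∣+∣j∣ (a · a) (k · b · b)) (≤-reflexive (cong₂ _+_ (ℤP.abs-* a a) (trans (ℤP.abs-* (k · b) b) (trans (cong (_* abs b) (ℤP.abs-* k b)) (*-assoc κ (abs b) (abs b))))))

 norm-nonzero : NonSquareRational k → ∀ a b → ¬ (a ≡ 0ℤ × b ≡ 0ℤ) → a · a ⊖ k · b · b ≢ 0ℤ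
 norm-nonzero ns a b nz e = nz (a≡0 , b≡0)
   where
   eq : a · a ≡ k · b · b
   eq = ℤP.i-j≡0⇒i≡j (a · a) (k · b · b) e
   b≡0 : b ≡ 0ℤ
   b≡0 = nonsquare-int ns a b eq
   a≡0 : a ≡ 0ℤ
   a≡0 = [ id , id ]′ (ℤP.i*j≡0⇒i≡0∨j≡0 a (trans eq (trans (cong (λ i → k · b · i) b≡0) (ℤP.*-zeroʳ (k · b)))))

 prime∤-abs-small : ∀ {p} x → x ≢ 0ℤ → abs x < p → ¬ p ∣ abs x
 prime∤-abs-small x nz lt d = <⇒≱ lt (ND.∣⇒≤ {{>-nonZero (abs≥1 nz)}} d)

 open Decompose split? public

 -- The short vector attached to a pair with common part `g`. It satisfies a ≡ r b modulo the primes
 -- of a₁ and a ≡ -r b modulo those of a₂, where r² ≡ k. The opposite signs let (a , b) remember how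
 -- the product a₁ a₂ was split.
 record PairVector (m₁ m₂ : ℕ) : Set where
   field
     g a₁ a₂ : ℕ
     e₁ : m₁ ≡ a₁ * g
     e₂ : m₂ ≡ a₂ * g
     g≥1 : 1 ≤ g
     sf₁ : SquareFree a₁
     sf₂ : SquareFree a₂
     sf : SquareFree (a₁ * a₂)
     a b c : ℤ
     short² : (abs a ℕ.⊔ abs b) * (abs a ℕ.⊔ abs b) ≤ a₁ * a₂
     nonzero : 1 ≤ abs a ℕ.⊔ abs b
     norm≡ : a · a ⊖ k · b · b ≡ c · (+ (a₁ * a₂))
     c≢0 : c ≢ 0ℤ
     c≤ : abs c ≤ 1 + κ
     cong₁ : ∀ p → Prime p → p ∣ a₁ → p ∣ abs (a ⊖ root p · b)
     cong₂' : ∀ p → Prime p → p ∣ a₂ → p ∣ abs (a ⊕ root p · b)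
     split : ∀ p → Prime p → p ∣ a₁ * a₂ → Split p
   h = abs a ℕ.⊔ abs b

 pairVector : NonSquareRational k → ∀ m₁ m₂ → SquareFree m₁ → GoodNum m₁ → SquareFree m₂ → GoodNum m₂ → PairVector m₁ m₂
 pairVector ns m₁ m₂ s₁ g₁ s₂ g₂ = go (gcd-split m₁ m₂ (proj₁ g₂))
   where
   go : ∃[ g ] ∃[ a₁ ] ∃[ a₂ ] (m₁ ≡ a₁ * g × m₂ ≡ a₂ * g × 1 ≤ g × Coprime a₁ a₂) → PairVector m₁ m₂
   go (g , a₁ , a₂ , e₁ , e₂ , g≥1 , cop) = go₁ (chinese-remainder n sfn τ) (isqrt n)
     where
     n = a₁ * a₂
     a₁∣ : a₁ ∣ m₁
     a₁∣ = divides g (trans e₁ (*-comm a₁ g))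
     a₂∣ : a₂ ∣ m₂
     a₂∣ = divides g (trans e₂ (*-comm a₂ g))
     sfn : SquareFree n
     sfn = squareFree-* cop (squareFree-∣ a₁∣ s₁) (squareFree-∣ a₂∣ s₂)
     splitn : ∀ p → Prime p → p ∣ n → Split p
     splitn p pp d = [ (λ x → proj₂ g₁ p pp (ND.∣-trans x a₁∣)) , (λ x → proj₂ g₂ p pp (ND.∣-trans x a₂∣)) ]′ (euclidsLemma a₁ a₂ pp d)
     signed : ∀ p → Dec (p ∣ a₁) → ℤ
     signed p (yes _) = root p
     signed p (no _) = ⊖ root p
     τ : ℕ → ℤ
     τ p = signed p (p ∣? a₁)
     τ-yes : ∀ p (d : Dec (p ∣ a₁)) → p ∣ a₁ → signed p d ≡ root p
     τ-yes p (yes _) x = refl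
     τ-yes p (no nx) x = ⊥-elim (nx x)
     τ-no : ∀ p (d : Dec (p ∣ a₁)) → ¬ p ∣ a₁ → signed p d ≡ ⊖ root p
     τ-no p (yes x) nx = ⊥-elim (nx x)
     τ-no p (no _) nx = refl
     go₁ : ∃[ t ] (∀ p → Prime p → p ∣ n → p ∣ abs (t ⊖ τ p)) → ∃[ s ] (s * s ≤ n × n < suc s * suc s) → PairVector m₁ m₂
     go₁ (t , ht) (s , s²≤ , <s²) = go₂ (short-solution n s (proj₁ sfn) <s² 1ℤ t)
       where
       go₂ : ∃[ a ] ∃[ b ] (¬ (a ≡ 0ℤ × b ≡ 0ℤ) × abs a ≤ s × abs b ≤ s × ZDiv (+ n) (a · 1ℤ ⊖ b · t)) → PairVector m₁ m₂
       go₂ (a , b , nz , a≤ , b≤ , zd) = go₃ (∣⇒zdiv {+ n} {norm′} n∣norm)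
         where
         norm′ = a · a ⊖ k · b · b
         h≤ : abs a ℕ.⊔ abs b ≤ s
         h≤ = ⊔-lub a≤ b≤
         l₁ : ∀ a b t r → (a · 1ℤ ⊖ b · t) ⊕ b · (t ⊖ r) ≡ a ⊖ r · b
         l₁ = ZS.solve-∀
         l₂ : ∀ a b r → a ⊖ (⊖ r) · b ≡ a ⊕ r · b
         l₂ = ZS.solve-∀
         base : ∀ p → Prime p → p ∣ n → p ∣ abs (a ⊖ τ p · b)
         base p pp d = subst (λ i → p ∣ abs i) (l₁ a b t (τ p)) (∣-abs-+ (a · 1ℤ ⊖ b · t) (b · (t ⊖ τ p)) (ND.∣-trans d (zdiv⇒∣ {+ n} {a · 1ℤ ⊖ b · t} zd)) (∣-abs-*ˡ b (t ⊖ τ p) (ht p pp d)))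
         c₁ : ∀ p → Prime p → p ∣ a₁ → p ∣ abs (a ⊖ root p · b)
         c₁ p pp d = subst (λ r → p ∣ abs (a ⊖ r · b)) (τ-yes p (p ∣? a₁) d) (base p pp (ND.∣m⇒∣m*n a₂ d))
         c₂ : ∀ p → Prime p → p ∣ a₂ → p ∣ abs (a ⊕ root p · b)
         c₂ p pp d = subst (λ i → p ∣ abs i) (l₂ a b (root p)) (subst (λ r → p ∣ abs (a ⊖ r · b)) (τ-no p (p ∣? a₁) (λ x → ¬prime[1] (subst Prime (cop (x , d)) pp))) (base p pp (ND.∣n⇒∣m*n a₁ d)))
         l₃ : ∀ a b r k → (a ⊖ r · b) · (a ⊕ r · b) ⊕ (r · r ⊖ k) · (b · b) ≡ a · a ⊖ k · b · b
         l₃ = ZS.solve-∀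
         p∣norm : ∀ p → Prime p → p ∣ n → p ∣ abs norm′
         p∣norm p pp d = subst (λ i → p ∣ abs i) (l₃ a b (root p) k) (∣-abs-+ ((a ⊖ root p · b) · (a ⊕ root p · b)) ((root p · root p ⊖ k) · (b · b))
           ([ (λ x → ∣-abs-*ʳ (a ⊖ root p · b) (a ⊕ root p · b) (c₁ p pp x)) , (λ x → ∣-abs-*ˡ (a ⊖ root p · b) (a ⊕ root p · b) (c₂ p pp x)) ]′ (euclidsLemma a₁ a₂ pp d))
           (∣-abs-*ʳ (root p · root p ⊖ k) (b · b) (root-correct p (splitn p pp d))))
         n∣norm : n ∣ abs norm′
         n∣norm = squareFree-by-primes n sfn (abs norm′) p∣norm
         nonzero′ : 1 ≤ abs a ℕ.⊔ abs b
         nonzero′ = n≢0⇒n>0 (λ e → nz (ℤP.∣i∣≡0⇒i≡0 (n≤0⇒n≡0 (≤-trans (m≤m⊔n (abs a) (abs b)) (≤-reflexive e))) , ℤP.∣i∣≡0⇒i≡0 (n≤0⇒n≡0 (≤-trans (m≤n⊔m (abs a) (abs b)) (≤-reflexive e)))))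
         go₃ : ZDiv (+ n) norm′ → PairVector m₁ m₂
         go₃ (c , ec) = record
           { g = g ; a₁ = a₁ ; a₂ = a₂ ; e₁ = e₁ ; e₂ = e₂ ; g≥1 = g≥1 ; sf₁ = squareFree-∣ a₁∣ s₁ ; sf₂ = squareFree-∣ a₂∣ s₂ ; sf = sfn
           ; a = a ; b = b ; c = c ; short² = ≤-trans (*-mono-≤ h≤ h≤) s²≤ ; nonzero = nonzero′ ; norm≡ = ec
           ; c≢0 = λ { refl → norm-nonzero ns a b nz (trans ec (ℤP.*-zeroˡ (+ n))) }
           ; c≤ = *-cancelʳ-≤ (abs c) (1 + κ) n {{>-nonZero (proj₁ sfn)}} c-bound
           ; cong₁ = c₁ ; cong₂' = c₂ ; split = splitn }
           where
           open ≤-Reasoning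
           l₄ : ∀ κ s → s + κ * s ≡ (1 + κ) * s
           l₄ = NS.solve-∀
           c-bound : abs c * n ≤ (1 + κ) * n
           c-bound = begin
             abs c * n ≡⟨ sym (trans (cong abs ec) (ℤP.abs-* c (+ n))) ⟩
             abs norm′ ≤⟨ abs-norm≤ a b ⟩
             abs a * abs a + κ * (abs b * abs b) ≤⟨ +-mono-≤ (*-mono-≤ a≤ a≤) (*-monoʳ-≤ κ (*-mono-≤ b≤ b≤)) ⟩
             s * s + κ * (s * s) ≡⟨ l₄ κ (s * s) ⟩
             (1 + κ) * (s * s) ≤⟨ *-monoʳ-≤ (1 + κ) s²≤ ⟩
             (1 + κ) * n ∎

 -- Primes up to 2 + κ may divide 2, k or c, where the sign argument fails; the gcd of a₁ with P₀!
 -- records them instead.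
 P₀ smallPart : ℕ
 P₀ = 2 + κ
 smallPart = P₀ !

 module _ (k≢0 : k ≢ 0ℤ) {m₁ m₂ m₁′ m₂′ : ℕ} (V : PairVector m₁ m₂) (V′ : PairVector m₁′ m₂′) where
   private
     module V = PairVector V
     module V′ = PairVector V′

   -- A prime p > P₀ dividing both a − rb and a + rb, where r² ≡ k, divides a and b, so p² ∣ cn.
   pairVector-∣ : V.c ≡ V′.c → V.a ≡ V′.a → V.b ≡ V′.b → gcd V.a₁ smallPart ≡ gcd V′.a₁ smallPart → V.a₁ * V.a₂ ≡ V′.a₁ * V′.a₂ → V.a₁ ∣ V′.a₁
   pairVector-∣ ec ea eb eg en = squareFree-by-primes V.a₁ V.sf₁ V′.a₁ each
     where
     each : ∀ p → Prime p → p ∣ V.a₁ → p ∣ V′.a₁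
     each p pp d = small (p ≤? P₀)
       where
       small : Dec (p ≤ P₀) → p ∣ V′.a₁
       small (yes le) = ND.∣-trans (subst (p ∣_) eg (gcd-greatest d (m∣n! p P₀ (≤-trans (s≤s z≤n) (prime≥2 pp)) le))) (gcd[m,n]∣m V′.a₁ smallPart)
       small (no gt) = [ id , (λ x → ⊥-elim (bad x)) ]′ (euclidsLemma V′.a₁ V′.a₂ pp (subst (p ∣_) en (ND.∣m⇒∣m*n V.a₂ d)))
         where
         p> : P₀ < p
         p> = ≰⇒> gt
         r = root p
         a = V.a
         b = V.b
         two : ¬ p ∣ 2
         two x = <⇒≱ p> (≤-trans (ND.∣⇒≤ x) (m≤m+n 2 κ))
         cancel2 : ∀ x → p ∣ abs ((+ 2) · x) → p ∣ abs x
         cancel2 x y = [ (λ z → ⊥-elim (two z)) , id ]′ (euclidsLemma 2 (abs x) pp (subst (p ∣_) (ℤP.abs-* (+ 2) x) y))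
         l₁ : ∀ a r b → (a ⊖ r · b) ⊕ (a ⊕ r · b) ≡ (+ 2) · a
         l₁ = ZS.solve-∀
         l₂ : ∀ a r b → (⊖ 1ℤ) · (a ⊖ r · b) ⊕ (a ⊕ r · b) ≡ (+ 2) · (r · b)
         l₂ = ZS.solve-∀
         l₃ : ∀ r k → r · r ⊕ (⊖ 1ℤ) · (r · r ⊖ k) ≡ k
         l₃ = ZS.solve-∀
         bad : p ∣ V′.a₂ → ⊥
         bad x = finish ([ (λ z → ⊥-elim (p∤r z)) , id ]′ (euclidsLemma (abs r) (abs b) pp (subst (p ∣_) (ℤP.abs-* r b) p∣rb)))
           where
           y₁ : p ∣ abs (a ⊖ r · b)
           y₁ = V.cong₁ p pp d
           y₂ : p ∣ abs (a ⊕ r · b)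
           y₂ = subst₂ (λ s t → p ∣ abs (s ⊕ r · t)) (sym ea) (sym eb) (V′.cong₂' p pp x)
           p∣a : p ∣ abs a
           p∣a = cancel2 a (subst (λ i → p ∣ abs i) (l₁ a r b) (∣-abs-+ (a ⊖ r · b) (a ⊕ r · b) y₁ y₂))
           p∣rb : p ∣ abs (r · b)
           p∣rb = cancel2 (r · b) (subst (λ i → p ∣ abs i) (l₂ a r b) (∣-abs-+ ((⊖ 1ℤ) · (a ⊖ r · b)) (a ⊕ r · b) (∣-abs-*ˡ (⊖ 1ℤ) (a ⊖ r · b) y₁) y₂))
           p∤r : ¬ p ∣ abs r
           p∤r z = prime∤-abs-small k k≢0 (≤-<-trans (m≤n+m κ 2) p>) (subst (λ i → p ∣ abs i) (l₃ r k) (∣-abs-+ (r · r) ((⊖ 1ℤ) · (r · r ⊖ k)) (∣-abs-*ˡ r r z)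
             (∣-abs-*ˡ (⊖ 1ℤ) (r · r ⊖ k) (root-correct p (V.split p pp (ND.∣m⇒∣m*n V.a₂ d))))))
           finish : p ∣ abs b → ⊥
           finish p∣b = proj₂ V.sf p pp (coprime-divisor (coprime-square (coprime-sym (prime-coprime pp (prime∤-abs-small V.c V.c≢0 (≤-<-trans V.c≤ (≤-<-trans (n≤1+n (1 + κ)) p>)))))) pp∣)
             where
             sq : ∀ x y → p ∣ abs x → p ∣ abs y → p * p ∣ abs (x · y)
             sq x y dx dy = subst (p * p ∣_) (sym (ℤP.abs-* x y)) (ND.*-pres-∣ dx dy)
             l₄ : ∀ a b k → a · a ⊕ (⊖ k) · (b · b) ≡ a · a ⊖ k · b · b
             l₄ = ZS.solve-∀
             pp∣ : p * p ∣ abs V.c * (V.a₁ * V.a₂)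
             pp∣ = subst (p * p ∣_) (trans (cong abs (trans (l₄ a b k) V.norm≡)) (ℤP.abs-* V.c (+ (V.a₁ * V.a₂)))) (∣-abs-+ (a · a) ((⊖ k) · (b · b)) (sq a a p∣a p∣a) (∣-abs-*ˡ (⊖ k) (b · b) (sq b b p∣b p∣b)))

 SFG : ℕ → Set
 SFG m = SquareFree m × GoodNum m

 sfg? : Decidable SFG
 sfg? m = squareFree? m ×-dec goodNum? m

 constS : ℕ
 constS = (2 * (1 + κ) + 1) * (suc smallPart * 8)

 module UpperSum (ns : NonSquareRational k) (k≢0 : k ≢ 0ℤ) (N : ℕ) where
   open ReciprocalSums N

   goodSum sfSum : ℕ
   goodSum = sumTo (λ s → ⟦ goodNum? s ⟧ * inv s) (suc N)
   sfSum = sumTo (λ m → ⟦ sfg? m ⟧ * inv m) (suc N)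

   private
     Λ = N !
     instance
       Λ≢0 : NonZero Λ
       Λ≢0 = N !≢0

   -- Writes s = m f² with m squarefree and sums 1/f² first.
   goodSum≤ : goodSum ≤ 2 * sfSum
   goodSum≤ = *-cancelˡ-≤ (Λ * Λ) {{m*n≢0 Λ Λ}} (begin
     Λ * Λ * goodSum ≡⟨ cong (Λ * Λ *_) (sym (weight-filter-downFrom goodNum? inv (suc N))) ⟩
     Λ * Λ * Weighted.weight inv L ≡⟨ sym (weight-*ˡ (Λ * Λ) inv L) ⟩
     Weighted.weight (λ s → Λ * Λ * inv s) L ≤⟨ weight-witnessed (λ s → Λ * Λ * inv s) bound L (All.zip (AllP.all-filter goodNum? (downFrom (suc N)) , All.map ℕ.s≤s⁻¹ (AllP.filter⁺ goodNum? (∈-downFrom (suc N))))) (UP.filter⁺ goodNum? (downFrom-unique (suc N))) ⟩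
     sumTo (λ m → ⟦ sfg? m ⟧ * sumTo (λ f → inv m * inv² f) (suc N)) (suc N) ≤⟨ sumTo-mono (suc N) (λ m _ → row m) ⟩
     sumTo (λ m → (⟦ sfg? m ⟧ * inv m) * (2 * (Λ * Λ))) (suc N) ≡⟨ sumTo-*ʳ (2 * (Λ * Λ)) (λ m → ⟦ sfg? m ⟧ * inv m) (suc N) ⟩
     sfSum * (2 * (Λ * Λ)) ≡⟨ l₁ sfSum Λ ⟩
     Λ * Λ * (2 * sfSum) ∎)
     where
     open ≤-Reasoning
     L = filter goodNum? (downFrom (suc N))
     l₁ : ∀ s q → s * (2 * (q * q)) ≡ q * q * (2 * s)
     l₁ = NS.solve-∀
     row : ∀ m → ⟦ sfg? m ⟧ * sumTo (λ f → inv m * inv² f) (suc N) ≤ (⟦ sfg? m ⟧ * inv m) * (2 * (Λ * Λ))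
     row m = ≤-trans (≤-reflexive (trans (cong (⟦ sfg? m ⟧ *_) (sumTo-*ˡ (inv m) inv² (suc N))) (sym (*-assoc ⟦ sfg? m ⟧ (inv m) _)))) (*-monoʳ-≤ (⟦ sfg? m ⟧ * inv m) (inv²-sum N ≤-refl))
     P : ℕ → Set
     P s = GoodNum s × s ≤ N
     open Keyed {Σ ℕ P} {ℕ} proj₁ (λ a → Λ * Λ * inv (proj₁ a))
     dec : ∀ (x : Σ ℕ P) → ∃[ m ] ∃[ f ] (proj₁ x ≡ m * (f * f) × SquareFree m × 1 ≤ f)
     dec (s , gs , _) = squareFree-decompose s (proj₁ gs)
     mOf fOf : Σ ℕ P → ℕ
     mOf x = proj₁ (dec x)
     fOf x = proj₁ (proj₂ (dec x))
     eqn : ∀ x → proj₁ x ≡ mOf x * (fOf x * fOf x)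
     eqn x = proj₁ (proj₂ (proj₂ (dec x)))
     sfm : ∀ x → SquareFree (mOf x)
     sfm x = proj₁ (proj₂ (proj₂ (proj₂ (dec x))))
     f≥1 : ∀ x → 1 ≤ fOf x
     f≥1 x = proj₂ (proj₂ (proj₂ (proj₂ (dec x))))
     m≤N : ∀ x → mOf x ≤ N
     m≤N x = ≤-trans (m≤m*n (mOf x) (fOf x * fOf x) {{>-nonZero (*-mono-≤ (f≥1 x) (f≥1 x))}}) (≤-trans (≤-reflexive (sym (eqn x))) (proj₂ (proj₂ x)))
     f≤N : ∀ x → fOf x ≤ N
     f≤N x = ≤-trans (m≤m*n (fOf x) (fOf x) {{>-nonZero (f≥1 x)}}) (≤-trans (m≤n*m (fOf x * fOf x) (mOf x) {{>-nonZero (proj₁ (sfm x))}}) (≤-trans (≤-reflexive (sym (eqn x))) (proj₂ (proj₂ x))))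
     weight≤ : ∀ x → Λ * Λ * inv (proj₁ x) ≤ inv (mOf x) * inv² (fOf x)
     weight≤ x@(s , gs , s≤N) = *-cancelˡ-≤ s {{>-nonZero (proj₁ gs)}} (≤-reflexive (begin-equality
       s * (Λ * Λ * inv s) ≡⟨ l₂ s Λ (inv s) ⟩
       (s * inv s) * (Λ * Λ) ≡⟨ cong (_* (Λ * Λ)) (inv-* (proj₁ gs) s≤N) ⟩
       Λ * (Λ * Λ) ≡⟨ cong₂ (λ a b → a * (b * b)) (sym (inv-* (proj₁ (sfm x)) (m≤N x))) (sym (inv-* (f≥1 x) (f≤N x))) ⟩
       m * inv m * (f * inv f * (f * inv f)) ≡⟨ l₃ m f (inv m) (inv f) ⟩
       m * (f * f) * (inv m * inv² f) ≡⟨ cong (_* (inv m * inv² f)) (sym (eqn x)) ⟩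
       s * (inv m * inv² f) ∎))
       where
       m = mOf x
       f = fOf x
       l₂ : ∀ s q i → s * (q * q * i) ≡ (s * i) * (q * q)
       l₂ = NS.solve-∀
       l₃ : ∀ m f i j → m * i * (f * j * (f * j)) ≡ m * (f * f) * (i * (j * j))
       l₃ = NS.solve-∀
     bound : WB (λ _ → ⊤) (sumTo (λ m → ⟦ sfg? m ⟧ * sumTo (λ f → inv m * inv² f) (suc N)) (suc N))
     bound = wb-fibre? sfg? mOf _ (suc N) (λ x _ → s≤s (m≤N x)) (λ x _ → sfm x , good-∣ (divides (fOf x * fOf x) (trans (eqn x) (*-comm (mOf x) _))) (proj₁ (proj₂ x)))
       (λ m _ → wb-fibre fOf _ (suc N) (λ x _ → s≤s (f≤N x))
         (λ f _ → wb-unique _ (λ { x ((_ , refl) , refl) → weight≤ x }) (λ { x y ((_ , e₁) , e₂) ((_ , e₁') , e₂') → trans (eqn x) (trans (cong₂ (λ a b → a * (b * b)) (trans e₁ (sym e₁')) (trans e₂ (sym e₂'))) (sym (eqn y))) })))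

   -- 1/(m₁ m₂) = 1/(g² a₁ a₂) ≤ 1/(g² h²) with h the larger of |a| and |b|. Given g and h, O(h + 1)
   -- labels determine the pair. The sum over g converges, and that of (h + 1)/h² over h is the one
   -- logarithm.
   sfSum² : sfSum * sfSum ≤ 4 * constS * (suc (ilog N) * (Λ * Λ))
   sfSum² = *-cancelˡ-≤ (Λ * Λ) {{m*n≢0 Λ Λ}} (begin
     Λ * Λ * (sfSum * sfSum) ≡⟨ cong (λ i → Λ * Λ * (i * i)) (sym (weight-filter-downFrom sfg? inv (suc N))) ⟩
     Λ * Λ * (Weighted.weight inv L * Weighted.weight inv L) ≡⟨ cong (Λ * Λ *_) (sym (weight-product inv inv L L)) ⟩
     Λ * Λ * Weighted.weight pairInv (cartesianProduct L L) ≡⟨ sym (weight-*ˡ (Λ * Λ) pairInv (cartesianProduct L L)) ⟩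
     Weighted.weight (λ x → Λ * Λ * pairInv x) (cartesianProduct L L)
       ≤⟨ weight-witnessed (λ x → Λ * Λ * pairInv x) bound (cartesianProduct L L) (all-product allL allL) (UP.cartesianProduct⁺ uniqueL uniqueL) ⟩
     sumTo (λ g → sumTo (λ h → count (rest h) * (inv² g * inv² h)) (suc N)) (suc N) ≤⟨ sumTo-mono (suc N) (λ g _ → row g) ⟩
     sumTo (λ g → inv² g * (constS * (2 * Λ * (suc (ilog N) * Λ)))) (suc N) ≡⟨ sumTo-*ʳ (constS * (2 * Λ * (suc (ilog N) * Λ))) inv² (suc N) ⟩
     sumTo inv² (suc N) * (constS * (2 * Λ * (suc (ilog N) * Λ))) ≤⟨ *-monoˡ-≤ _ (inv²-sum N ≤-refl) ⟩
     2 * (Λ * Λ) * (constS * (2 * Λ * (suc (ilog N) * Λ))) ≡⟨ l₁ Λ constS (suc (ilog N)) ⟩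
     Λ * Λ * (4 * constS * (suc (ilog N) * (Λ * Λ))) ∎)
     where
     open ≤-Reasoning
     l₁ : ∀ q c t → 2 * (q * q) * (c * (2 * q * (t * q))) ≡ q * q * (4 * c * (t * (q * q)))
     l₁ = NS.solve-∀
     L = filter sfg? (downFrom (suc N))
     pairInv : ℕ × ℕ → ℕ
     pairInv x = inv (proj₁ x) * inv (proj₂ x)
     R : ℕ → Set
     R m = SFG m × m ≤ N
     allL : All R L
     allL = All.zip (AllP.all-filter sfg? (downFrom (suc N)) , All.map ℕ.s≤s⁻¹ (AllP.filter⁺ sfg? (∈-downFrom (suc N))))
     uniqueL : Unique L
     uniqueL = UP.filter⁺ sfg? (downFrom-unique (suc N))
     P : ℕ × ℕ → Set
     P x = R (proj₁ x) × R (proj₂ x)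
     Elem : Set
     Elem = Σ (ℕ × ℕ) P
     open Keyed {Elem} {ℕ × ℕ} proj₁ (λ a → Λ * Λ * pairInv (proj₁ a))
     opaque
       vec : (x : Elem) → PairVector (proj₁ (proj₁ x)) (proj₂ (proj₁ x))
       vec ((m₁ , m₂) , ((s₁ , g₁) , _) , ((s₂ , g₂) , _)) = pairVector ns m₁ m₂ s₁ g₁ s₂ g₂
     module V (x : Elem) = PairVector (vec x)
     rest : ℕ → Labels
     rest h = ((λ x → zlabel (V.c x)) , 2 * (1 + κ) + 1) ∷ ((λ x → gcd (V.a₁ x) smallPart) , suc smallPart) ∷ ((λ x → ⟦ abs (V.a x) ≤? abs (V.b x) ⟧) , 2) ∷
       ((λ x → negative? (V.a x)) , 2) ∷ ((λ x → negative? (V.b x)) , 2) ∷ ((λ x → abs (V.a x) ℕ.⊓ abs (V.b x)) , suc h) ∷ []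
     count-rest : ∀ h → count (rest h) ≡ constS * suc h
     count-rest h = l (2 * (1 + κ) + 1) (suc smallPart) h
       where
       l : ∀ a b h → a * (b * (2 * (2 * (2 * (suc h * 1))))) ≡ a * (b * 8) * suc h
       l = NS.solve-∀
     term : ∀ h → suc h * inv² h ≤ 2 * Λ * inv h
     term zero = z≤n
     term h@(suc _) = begin
       suc h * (inv h * inv h) ≤⟨ *-monoˡ-≤ (inv h * inv h) (≤-trans (+-monoˡ-≤ h (s≤s z≤n)) (≤-reflexive (cong (λ i → h + i) (sym (+-identityʳ h))))) ⟩
       2 * h * (inv h * inv h) ≡⟨ l h (inv h) ⟩
       2 * (h * inv h) * inv h ≤⟨ *-monoˡ-≤ (inv h) (*-monoʳ-≤ 2 (inv-≤ h)) ⟩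
       2 * Λ * inv h ∎
       where
       l : ∀ h i → 2 * h * (i * i) ≡ 2 * (h * i) * i
       l = NS.solve-∀
     row : ∀ g → sumTo (λ h → count (rest h) * (inv² g * inv² h)) (suc N) ≤ inv² g * (constS * (2 * Λ * (suc (ilog N) * Λ)))
     row g = begin
       sumTo (λ h → count (rest h) * (inv² g * inv² h)) (suc N) ≡⟨ sumTo-cong (suc N) (λ h _ → trans (cong (_* (inv² g * inv² h)) (count-rest h)) (l constS (suc h) (inv² g) (inv² h))) ⟩
       sumTo (λ h → inv² g * constS * (suc h * inv² h)) (suc N) ≤⟨ sumTo-mono (suc N) (λ h _ → *-monoʳ-≤ (inv² g * constS) (term h)) ⟩
       sumTo (λ h → inv² g * constS * (2 * Λ * inv h)) (suc N) ≡⟨ sumTo-*ˡ (inv² g * constS) _ (suc N) ⟩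
       inv² g * constS * sumTo (λ h → 2 * Λ * inv h) (suc N) ≡⟨ cong (inv² g * constS *_) (sumTo-*ˡ (2 * Λ) inv (suc N)) ⟩
       inv² g * constS * (2 * Λ * sumTo inv (suc N)) ≤⟨ *-monoʳ-≤ (inv² g * constS) (*-monoʳ-≤ (2 * Λ) (harmonic-≤ N)) ⟩
       inv² g * constS * (2 * Λ * (suc (ilog N) * Λ)) ≡⟨ *-assoc (inv² g) constS _ ⟩
       inv² g * (constS * (2 * Λ * (suc (ilog N) * Λ))) ∎
       where
       l : ∀ c s g h → c * s * (g * h) ≡ g * c * (s * h)
       l = NS.solve-∀
     m₁≥1 : ∀ x → 1 ≤ proj₁ (proj₁ x)
     m₁≥1 (_ , ((s₁ , _) , _) , _) = proj₁ s₁
     m₂≥1 : ∀ x → 1 ≤ proj₂ (proj₁ x)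
     m₂≥1 (_ , _ , ((s₂ , _) , _)) = proj₁ s₂
     g≤N : ∀ x → V.g x ≤ N
     g≤N x@((m₁ , m₂) , (_ , m₁≤) , _) = ≤-trans (m≤n*m (V.g x) (V.a₁ x) {{>-nonZero (proj₁ (V.sf₁ x))}}) (≤-trans (≤-reflexive (sym (V.e₁ x))) m₁≤)
     a₁≤N : ∀ x → V.a₁ x ≤ N
     a₁≤N x@((m₁ , m₂) , (_ , m₁≤) , _) = ≤-trans (m≤m*n (V.a₁ x) (V.g x) {{>-nonZero (V.g≥1 x)}}) (≤-trans (≤-reflexive (sym (V.e₁ x))) m₁≤)
     a₂≤N : ∀ x → V.a₂ x ≤ N
     a₂≤N x@((m₁ , m₂) , _ , (_ , m₂≤)) = ≤-trans (m≤m*n (V.a₂ x) (V.g x) {{>-nonZero (V.g≥1 x)}}) (≤-trans (≤-reflexive (sym (V.e₂ x))) m₂≤)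
     h≤N : ∀ x → V.h x ≤ N
     h≤N x = ≮⇒≥ (λ lt → <⇒≱ (*-mono-< lt lt) (≤-trans (V.short² x) (*-mono-≤ (a₁≤N x) (a₂≤N x))))
     weight≤ : ∀ x → Λ * Λ * pairInv (proj₁ x) ≤ inv² (V.g x) * inv² (V.h x)
     weight≤ x@((m₁ , m₂) , (_ , m₁≤) , (_ , m₂≤)) = *-cancelˡ-≤ (m₁ * m₂) {{>-nonZero (*-mono-≤ (m₁≥1 x) (m₂≥1 x))}} (begin
       m₁ * m₂ * (Λ * Λ * (inv m₁ * inv m₂)) ≡⟨ l₂ m₁ m₂ Λ (inv m₁) (inv m₂) ⟩
       Λ * Λ * ((m₁ * inv m₁) * (m₂ * inv m₂)) ≡⟨ cong₂ (λ a b → Λ * Λ * (a * b)) (inv-* (m₁≥1 x) m₁≤) (inv-* (m₂≥1 x) m₂≤) ⟩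
       Λ * Λ * (Λ * Λ) ≡⟨ cong₂ (λ a b → a * a * (b * b)) (sym (inv-* (V.g≥1 x) (g≤N x))) (sym (inv-* (V.nonzero x) (h≤N x))) ⟩
       (g * inv g) * (g * inv g) * ((h * inv h) * (h * inv h)) ≡⟨ l₃ g h (inv g) (inv h) ⟩
       g * g * (h * h) * (inv² g * inv² h) ≤⟨ *-monoˡ-≤ (inv² g * inv² h) (*-monoʳ-≤ (g * g) (V.short² x)) ⟩
       g * g * (V.a₁ x * V.a₂ x) * (inv² g * inv² h) ≡⟨ cong (_* (inv² g * inv² h)) (trans (l₄ g (V.a₁ x) (V.a₂ x)) (cong₂ _*_ (sym (V.e₁ x)) (sym (V.e₂ x)))) ⟩
       m₁ * m₂ * (inv² g * inv² h) ∎)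
       where
       g = V.g x
       h = V.h x
       l₂ : ∀ a b q i j → a * b * (q * q * (i * j)) ≡ q * q * ((a * i) * (b * j))
       l₂ = NS.solve-∀
       l₃ : ∀ g h i j → (g * i) * (g * i) * ((h * j) * (h * j)) ≡ g * g * (h * h) * ((i * i) * (j * j))
       l₃ = NS.solve-∀
       l₄ : ∀ g a b → g * g * (a * b) ≡ (a * g) * (b * g)
       l₄ = NS.solve-∀
     bounds : ∀ h x → (⊤ × V.g x ≡ V.g x) × V.h x ≡ h → All (λ l → proj₁ l x < proj₂ l) (rest h)
     bounds h x (_ , eh) = zlabel< (V.c x) (1 + κ) (V.c≤ x) ∷ s≤s (ND.∣⇒≤ {{P₀ !≢0}} (gcd[m,n]∣n (V.a₁ x) smallPart)) ∷ s≤s (⟦⟧≤1 (abs (V.a x) ≤? abs (V.b x))) ∷ negative?<2 (V.a x) ∷ negative?<2 (V.b x) ∷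
       s≤s (≤-trans (m⊓n≤m (abs (V.a x)) (abs (V.b x))) (≤-trans (m≤m⊔n (abs (V.a x)) (abs (V.b x))) (≤-reflexive eh))) ∷ []
     determine : ∀ h x y → V.g x ≡ V.g y → V.h x ≡ h → V.h y ≡ h → All (λ l → proj₁ l x ≡ proj₁ l y) (rest h) → proj₁ x ≡ proj₁ y
     determine h x y eg ehx ehy (lc ∷ le ∷ lw ∷ lsa ∷ lsb ∷ lo ∷ []) = cong₂ _,_
       (trans (V.e₁ x) (trans (cong₂ _*_ a₁≡ eg) (sym (V.e₁ y)))) (trans (V.e₂ x) (trans (cong₂ _*_ a₂≡ eg) (sym (V.e₂ y))))
       where
       c≡ : V.c x ≡ V.c y
       c≡ = zlabel-injective (V.c x) (V.c y) lc
       ab : abs (V.a x) ≡ abs (V.a y) × abs (V.b x) ≡ abs (V.b y)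
       ab = ⊔⊓-determine (abs (V.a x)) (abs (V.b x)) (abs (V.a y)) (abs (V.b y)) (trans ehx (sym ehy)) lo lw
       a≡ : V.a x ≡ V.a y
       a≡ = sign-determine (V.a x) (V.a y) (proj₁ ab) lsa
       b≡ : V.b x ≡ V.b y
       b≡ = sign-determine (V.b x) (V.b y) (proj₂ ab) lsb
       n≡ : V.a₁ x * V.a₂ x ≡ V.a₁ y * V.a₂ y
       n≡ = *-cancelˡ-≡ (V.a₁ x * V.a₂ x) (V.a₁ y * V.a₂ y) (abs (V.c x)) {{>-nonZero (abs≥1 (V.c≢0 x))}}
         (trans (sym (trans (cong abs (V.norm≡ x)) (ℤP.abs-* (V.c x) (+ (V.a₁ x * V.a₂ x))))) (trans (cong₂ (λ a b → abs (a · a ⊖ k · b · b)) a≡ b≡) (trans (trans (cong abs (V.norm≡ y)) (ℤP.abs-* (V.c y) (+ (V.a₁ y * V.a₂ y)))) (cong (λ c → abs c * (V.a₁ y * V.a₂ y)) (sym c≡)))))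
       a₁≡ : V.a₁ x ≡ V.a₁ y
       a₁≡ = ND.∣-antisym (pairVector-∣ k≢0 (vec x) (vec y) c≡ a≡ b≡ le n≡) (pairVector-∣ k≢0 (vec y) (vec x) (sym c≡) (sym a≡) (sym b≡) (sym le) (sym n≡))
       a₂≡ : V.a₂ x ≡ V.a₂ y
       a₂≡ = *-cancelˡ-≡ (V.a₂ x) (V.a₂ y) (V.a₁ x) {{>-nonZero (proj₁ (V.sf₁ x))}} (trans n≡ (cong (_* V.a₂ y) (sym a₁≡)))
     bound : WB (λ _ → ⊤) (sumTo (λ g → sumTo (λ h → count (rest h) * (inv² g * inv² h)) (suc N)) (suc N))
     bound = wb-fibre V.g _ (suc N) (λ x _ → s≤s (g≤N x)) (λ g _ → wb-fibre V.h _ (suc N) (λ x _ → s≤s (h≤N x)) (λ h _ →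
       wb-labels (rest h) (inv² g * inv² h) (λ x ((_ , e₁) , e₂) → subst₂ (λ g h → Λ * Λ * pairInv (proj₁ x) ≤ inv² g * inv² h) e₁ e₂ (weight≤ x)) (λ x ((_ , _) , eh) → bounds h x ((tt , refl) , eh))
         (λ x y ((_ , eg) , eh) ((_ , eg') , eh') → determine h x y (trans eg (sym eg')) eh eh')))

   goodSum² : goodSum * goodSum ≤ 16 * constS * (suc (ilog N) * (Λ * Λ))
   goodSum² = begin
     goodSum * goodSum ≤⟨ *-mono-≤ goodSum≤ goodSum≤ ⟩
     2 * sfSum * (2 * sfSum) ≡⟨ l₁ sfSum ⟩
     4 * (sfSum * sfSum) ≤⟨ *-monoʳ-≤ 4 sfSum² ⟩
     4 * (4 * constS * (suc (ilog N) * (Λ * Λ))) ≡⟨ l₂ constS (suc (ilog N) * (Λ * Λ)) ⟩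
     16 * constS * (suc (ilog N) * (Λ * Λ)) ∎
     where
     open ≤-Reasoning
     l₁ : ∀ s → 2 * s * (2 * s) ≡ 4 * (s * s)
     l₁ = NS.solve-∀
     l₂ : ∀ c x → 4 * (4 * c * x) ≡ 16 * c * x
     l₂ = NS.solve-∀

 -- Case (A): many s-numbers, hence few w-numbers

 Represents : ℕ → ℕ → ℕ → Set
 Represents n a b = (+ a) · (+ a) ⊖ k · (+ b) · (+ b) ≡ + n × 1 ≤ b × Coprime a b

 represents? : ∀ n a b → Dec (Represents n a b)
 represents? n a b = (((+ a) · (+ a) ⊖ k · (+ b) · (+ b)) ℤP.≟ (+ n)) ×-dec ((1 ≤? b) ×-dec coprime? a b)

 norm-divisor-coprime : ∀ {n a b} → n ∣ abs ((+ a) · (+ a) ⊖ k · (+ b) · (+ b)) → 1 ≤ b → Coprime a b → Coprime b n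
 norm-divisor-coprime {n} {a} {b} dv b≥1 cop = coprime-by-primes b≥1 (λ p pp pb pn → ¬prime[1] (subst Prime (cop ([ id , id ]′ (euclidsLemma a a pp (p∣a² p pb pn)) , pb)) pp))
   where
   F : ℤ
   F = (+ a) · (+ a) ⊖ k · (+ b) · (+ b)
   l : ∀ a b k → (a · a ⊖ k · b · b) ⊕ (k · b) · b ≡ a · a
   l = ZS.solve-∀
   p∣a² : ∀ p → p ∣ b → p ∣ n → p ∣ a * a
   p∣a² p pb pn = subst (p ∣_) (ℤP.abs-* (+ a) (+ a)) (subst (λ i → p ∣ abs i) (l (+ a) (+ b) k) (∣-abs-+ F ((k · (+ b)) · (+ b)) (ND.∣-trans pn dv) (∣-abs-*ˡ (k · (+ b)) (+ b) pb)))

 -- For p ∣ n, the root of k modulo p is a/b.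
 norm-divisor-good : ∀ {n a b} → n ∣ abs ((+ a) · (+ a) ⊖ k · (+ b) · (+ b)) → 1 ≤ b → Coprime a b → 1 ≤ n → GoodNum n
 norm-divisor-good {n} {a} {b} dv b≥1 cop n≥1 = n≥1 , λ p pp pn → go p pp pn (coprime-inverse (prime-coprime pp (λ pb → ¬prime[1] (subst Prime (norm-divisor-coprime dv b≥1 cop (pb , pn)) pp))))
   where
   F : ℤ
   F = (+ a) · (+ a) ⊖ k · (+ b) · (+ b)
   l : ∀ a b k x → (a · a ⊖ k · b · b) · (x · x) ⊕ (k · (b · x ⊕ 1ℤ)) · (b · x ⊖ 1ℤ) ≡ (a · x) · (a · x) ⊖ k
   l = ZS.solve-∀
   go : ∀ p → Prime p → p ∣ n → ∃[ x ] (p ∣ abs ((+ b) · x ⊖ 1ℤ)) → Split p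
   go p pp pn (x , hx) = split-root p ((+ a) · x) (≤-trans (s≤s z≤n) (prime≥2 pp))
     (subst (λ i → p ∣ abs i) (l (+ a) (+ b) k x)
       (∣-abs-+ (F · (x · x)) ((k · ((+ b) · x ⊕ 1ℤ)) · ((+ b) · x ⊖ 1ℤ)) (∣-abs-*ʳ F (x · x) (ND.∣-trans pn dv)) (∣-abs-*ˡ (k · ((+ b) · x ⊕ 1ℤ)) ((+ b) · x ⊖ 1ℤ) hx)))

 represents-coprime : ∀ {n a b} → Represents n a b → Coprime b n
 represents-coprime (e , b≥1 , cop) = norm-divisor-coprime (ND.∣-reflexive (cong abs (sym e))) b≥1 cop

 represents-good : ∀ {n a b} → 1 ≤ n → Represents n a b → GoodNum n
 represents-good n≥1 (e , b≥1 , cop) = norm-divisor-good (ND.∣-reflexive (cong abs (sym e))) b≥1 cop n≥1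

 -- The residue a/b modulo n, recorded relative to a reference representation (a₀, b₀):
 -- a/b is a₀/b₀ modulo d and −a₀/b₀ modulo e.
 record Residue (n a b a₀ b₀ : ℕ) : Set where
   field
     d e : ℕ
     n≡ : n ≡ e * d
     d∣ : d ∣ abs ((+ a) · (+ b₀) ⊖ (+ a₀) · (+ b))
     e∣ : e ∣ abs ((+ a) · (+ b₀) ⊕ (+ a₀) · (+ b))

 -- a/b and a₀/b₀ are both square roots of k modulo n, so n divides (a b₀ - a₀ b)(a b₀ + a₀ b). Here
 -- `d` is the gcd of n with the first factor.
 residue : ∀ {n a b a₀ b₀} → 1 ≤ n → Represents n a b → Represents n a₀ b₀ → Residue n a b a₀ b₀
 residue {n} {a} {b} {a₀} {b₀} n≥1 (e₁ , _) (e₀ , _) = go (gcd-split (abs X) n n≥1)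
   where
   X Y : ℤ
   X = (+ a) · (+ b₀) ⊖ (+ a₀) · (+ b)
   Y = (+ a) · (+ b₀) ⊕ (+ a₀) · (+ b)
   l : ∀ a b c d k → (a · d ⊖ c · b) · (a · d ⊕ c · b) ≡ (a · a ⊖ k · b · b) · (d · d) ⊖ (c · c ⊖ k · d · d) · (b · b)
   l = ZS.solve-∀
   l′ : ∀ n x y → n · x ⊖ n · y ≡ n · (x ⊖ y)
   l′ = ZS.solve-∀
   n∣XY : n ∣ abs X * abs Y
   n∣XY = subst (n ∣_) (trans (cong abs (sym (trans (l (+ a) (+ b) (+ a₀) (+ b₀) k) (trans (cong₂ (λ s t → s · ((+ b₀) · (+ b₀)) ⊖ t · ((+ b) · (+ b))) e₁ e₀) (l′ (+ n) ((+ b₀) · (+ b₀)) ((+ b) · (+ b))))))) (ℤP.abs-* X Y)) (∣-abs-*ʳ (+ n) ((+ b₀) · (+ b₀) ⊖ (+ b) · (+ b)) ND.∣-refl)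
   go : ∃[ d ] ∃[ x ] ∃[ e ] (abs X ≡ x * d × n ≡ e * d × 1 ≤ d × Coprime x e) → Residue n a b a₀ b₀
   go (d , x , e , eX , en , d≥1 , cop) = record { d = d ; e = e ; n≡ = en ; d∣ = divides x eX
     ; e∣ = coprime-divisor (coprime-sym cop) (ND.*-cancelʳ-∣ d {{>-nonZero d≥1}} (subst₂ _∣_ en (trans (cong (_* abs Y) eX) (l″ x d (abs Y))) n∣XY)) }
     where
     l″ : ∀ x d y → x * d * y ≡ x * y * d
     l″ = NS.solve-∀

 cross : ℕ → ℕ → ℕ → ℕ → ℤ
 cross a₁ b₁ a₂ b₂ = (+ a₁) · (+ b₂) ⊖ (+ a₂) · (+ b₁)

 -- The lattices cut out modulo d and e have common index at least n/|2k|, since (d, e) divides 2k.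
 same-residue : ∀ {n a₁ b₁ a₂ b₂ a₀ b₀} → Represents n a₁ b₁ → Represents n a₂ b₂ → Represents n a₀ b₀ →
   (r₁ : Residue n a₁ b₁ a₀ b₀) (r₂ : Residue n a₂ b₂ a₀ b₀) → 1 ≤ n → Residue.d r₁ ≡ Residue.d r₂ → Residue.e r₁ ≡ Residue.e r₂ →
   n ∣ 2 * κ * abs (cross a₁ b₁ a₂ b₂)
 same-residue {n} {a₁} {b₁} {a₂} {b₂} {a₀} {b₀} rep₁ rep₂ rep₀ r₁ r₂ n≥1 ed ee = go (gcd-split d e e≥1)
   where
   module r₁ = Residue r₁
   module r₂ = Residue r₂
   d = r₁.d
   e = r₁.e
   W = cross a₁ b₁ a₂ b₂
   X₁ Y₁ X₂ Y₂ : ℤ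
   X₁ = (+ a₁) · (+ b₀) ⊖ (+ a₀) · (+ b₁)
   Y₁ = (+ a₁) · (+ b₀) ⊕ (+ a₀) · (+ b₁)
   X₂ = (+ a₂) · (+ b₀) ⊖ (+ a₀) · (+ b₂)
   Y₂ = (+ a₂) · (+ b₀) ⊕ (+ a₀) · (+ b₂)
   e≥1 : 1 ≤ e
   e≥1 = n≢0⇒n>0 (λ z → n>0⇒n≢0 n≥1 (trans r₁.n≡ (cong (_* d) z)))
   d∣n : d ∣ n
   d∣n = divides e r₁.n≡
   e∣n : e ∣ n
   e∣n = divides d (trans r₁.n≡ (*-comm e d))
   strip : ∀ {c} x → c ∣ n → c ∣ abs ((+ b₀) · x) → c ∣ abs x
   strip {c} x cn h = coprime-divisor (λ (p , q) → represents-coprime rep₀ (q , ND.∣-trans p cn)) (subst (c ∣_) (ℤP.abs-* (+ b₀) x) h)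
   l₁ : ∀ a b c d u v → d · (a · v ⊖ u · b) ⊕ (⊖ b) · (c · v ⊖ u · d) ≡ v · (a · d ⊖ c · b)
   l₁ = ZS.solve-∀
   l₂ : ∀ a b c d u v → d · (a · v ⊕ u · b) ⊕ (⊖ b) · (c · v ⊕ u · d) ≡ v · (a · d ⊖ c · b)
   l₂ = ZS.solve-∀
   d∣W : d ∣ abs W
   d∣W = strip W d∣n (subst (λ i → d ∣ abs i) (l₁ (+ a₁) (+ b₁) (+ a₂) (+ b₂) (+ a₀) (+ b₀)) (∣-abs-+ ((+ b₂) · X₁) ((⊖ (+ b₁)) · X₂) (∣-abs-*ˡ (+ b₂) X₁ r₁.d∣) (∣-abs-*ˡ (⊖ (+ b₁)) X₂ (subst (_∣ abs X₂) (sym ed) r₂.d∣))))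
   e∣W : e ∣ abs W
   e∣W = strip W e∣n (subst (λ i → e ∣ abs i) (l₂ (+ a₁) (+ b₁) (+ a₂) (+ b₂) (+ a₀) (+ b₀)) (∣-abs-+ ((+ b₂) · Y₁) ((⊖ (+ b₁)) · Y₂) (∣-abs-*ˡ (+ b₂) Y₁ r₁.e∣) (∣-abs-*ˡ (⊖ (+ b₁)) Y₂ (subst (_∣ abs Y₂) (sym ee) r₂.e∣))))
   go : ∃[ c ] ∃[ d' ] ∃[ e' ] (d ≡ d' * c × e ≡ e' * c × 1 ≤ c × Coprime d' e') → n ∣ 2 * κ * abs W
   go (c , d' , e' , ed' , ee' , c≥1 , cop) = subst (n ∣_) (*-comm (abs W) (2 * κ)) (subst (_∣ abs W * (2 * κ)) (sym n≡′) (ND.*-pres-∣ lcm∣W c∣2k))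
     where
     c∣d : c ∣ d
     c∣d = divides d' ed'
     c∣e : c ∣ e
     c∣e = divides e' ee'
     c∣n : c ∣ n
     c∣n = ND.∣-trans c∣d d∣n
     n≡′ : n ≡ e' * (d' * c) * c
     n≡′ = trans r₁.n≡ (trans (cong₂ _*_ ee' ed') (l e' d' c))
       where
       l : ∀ e d c → e * c * (d * c) ≡ e * (d * c) * c
       l = NS.solve-∀
     lcm∣W : e' * (d' * c) ∣ abs W
     lcm∣W = from (subst (_∣ abs W) ed' d∣W)
       where
       l : ∀ w d c → w * (d * c) ≡ d * w * c
       l = NS.solve-∀
       from : d' * c ∣ abs W → e' * (d' * c) ∣ abs W
       from (divides w ew) = subst (e' * (d' * c) ∣_) (sym ew) (ND.*-monoˡ-∣ (d' * c) (coprime-divisor (coprime-sym cop) (ND.*-cancelʳ-∣ c {{>-nonZero c≥1}} (subst₂ _∣_ ee' (trans ew (l w d' c)) e∣W))))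
     l₃ : ∀ a v u b → (a · v ⊖ u · b) ⊕ (a · v ⊕ u · b) ≡ v · ((+ 2) · a)
     l₃ = ZS.solve-∀
     c∣2a : c ∣ abs ((+ 2) · (+ a₁))
     c∣2a = strip ((+ 2) · (+ a₁)) c∣n (subst (λ i → c ∣ abs i) (l₃ (+ a₁) (+ b₀) (+ a₀) (+ b₁)) (∣-abs-+ X₁ Y₁ (ND.∣-trans c∣d r₁.d∣) (ND.∣-trans c∣e r₁.e∣)))
     l₄ : ∀ a b k → a · ((+ 2) · a) ⊕ (⊖ (+ 2)) · (a · a ⊖ k · b · b) ≡ (b · b) · ((+ 2) · k)
     l₄ = ZS.solve-∀
     c∣2kb² : c ∣ b₁ * b₁ * (2 * κ)
     c∣2kb² = subst (c ∣_) (trans (ℤP.abs-* ((+ b₁) · (+ b₁)) ((+ 2) · k)) (cong₂ _*_ (ℤP.abs-* (+ b₁) (+ b₁)) (ℤP.abs-* (+ 2) k)))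
       (subst (λ i → c ∣ abs i) (trans (cong (λ i → (+ a₁) · ((+ 2) · (+ a₁)) ⊕ (⊖ (+ 2)) · i) (sym (proj₁ rep₁))) (l₄ (+ a₁) (+ b₁) k))
         (∣-abs-+ ((+ a₁) · ((+ 2) · (+ a₁))) ((⊖ (+ 2)) · (+ n)) (∣-abs-*ˡ (+ a₁) ((+ 2) · (+ a₁)) c∣2a) (∣-abs-*ˡ (⊖ (+ 2)) (+ n) c∣n)))
     copb : Coprime c b₁
     copb (p , q) = represents-coprime rep₁ (q , ND.∣-trans p c∣n)
     -- c divides both a₁ b₀ ∓ a₀ b₁, hence 2 a₁ b₀ and so 2 a₁; by the norm equation it then
     -- divides 2k b₁². It is prime to b₀ and b₁.
     c∣2k : c ∣ 2 * κ
     c∣2k = coprime-divisor copb (coprime-divisor copb (subst (c ∣_) (*-assoc b₁ b₁ (2 * κ)) c∣2kb²))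

 same-box : ∀ s D x y → (x * D) DM./ suc s ≡ (y * D) DM./ suc s → abs ((+ x) ⊖ (+ y)) * D ≤ s
 same-box s D x y e = ≤-trans (≤-reflexive (trans (sym (ℤP.abs-* ((+ x) ⊖ (+ y)) (+ D))) (cong abs eq)))
   (abs-diff≤ ((x * D) DM.% suc s) ((y * D) DM.% suc s) s (ℕ.s≤s⁻¹ (DM.m%n<n (x * D) (suc s))) (ℕ.s≤s⁻¹ (DM.m%n<n (y * D) (suc s))))
   where
   l₁ : ∀ x y d → (x ⊖ y) · d ≡ x · d ⊖ y · d
   l₁ = ZS.solve-∀
   l₂ : ∀ a b c → (a ⊕ c) ⊖ (b ⊕ c) ≡ a ⊖ b
   l₂ = ZS.solve-∀
   q = (y * D) DM./ suc s
   eq : ((+ x) ⊖ (+ y)) · (+ D) ≡ (+ ((x * D) DM.% suc s)) ⊖ (+ ((y * D) DM.% suc s))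
   eq = trans (l₁ (+ x) (+ y) (+ D)) (trans (cong₂ _⊖_ (trans (sym (ℤP.pos-* x D)) (trans (cong +_ (trans (DM.m≡m%n+[m/n]*n (x * D) (suc s)) (cong (λ i → (x * D) DM.% suc s + i * suc s) e))) (ℤP.pos-+ ((x * D) DM.% suc s) (q * suc s))))
     (trans (sym (ℤP.pos-* y D)) (trans (cong +_ (DM.m≡m%n+[m/n]*n (y * D) (suc s))) (ℤP.pos-+ ((y * D) DM.% suc s) (q * suc s)))))
     (l₂ (+ ((x * D) DM.% suc s)) (+ ((y * D) DM.% suc s)) (+ (q * suc s))))

 -- One more than 2κ (2κ + 2), the least fineness for which the estimate `W≤` yields 2κ |W| < n.
 boxes : ℕ
 boxes = 2 * κ * (2 * κ + 2) + 1

 -- Two vectors in one box of side about √n / boxes have a cross product W with 2κ |W| < n.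
 -- Divisibility by n forces W = 0, and proportional coprime vectors coincide.
 equal-representations : ∀ {n a₁ b₁ a₂ b₂} s → 1 ≤ κ → 1 ≤ n → s * s ≤ n → Represents n a₁ b₁ → Represents n a₂ b₂ → a₁ ≤ (2 * κ + 1) * b₁ → b₁ ≤ s →
   n ∣ 2 * κ * abs (cross a₁ b₁ a₂ b₂) → (a₁ * boxes) DM./ suc s ≡ (a₂ * boxes) DM./ suc s → (b₂ * boxes) DM./ suc s ≡ (b₁ * boxes) DM./ suc s → a₁ ≡ a₂ × b₁ ≡ b₂
 equal-representations {n} {a₁} {b₁} {a₂} {b₂} s κ≥1 n≥1 s²≤ (_ , b₁≥1 , cop₁) (_ , b₂≥1 , cop₂) a≤ b≤ dv ba bb = *-cancelʳ-≡ a₁ a₂ b₂ {{>-nonZero b₂≥1}} (trans cross-eq (cong (a₂ *_) b≡)) , b≡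
   where
   open ≤-Reasoning
   W = cross a₁ b₁ a₂ b₂
   l₁ : ∀ a b c d → a · d ⊖ c · b ≡ a · (d ⊖ b) ⊕ b · (a ⊖ c)
   l₁ = ZS.solve-∀
   W≤ : abs W * boxes ≤ (2 * κ + 2) * n
   W≤ = begin
     abs W * boxes ≡⟨ cong (λ i → abs i * boxes) (l₁ (+ a₁) (+ b₁) (+ a₂) (+ b₂)) ⟩
     abs ((+ a₁) · u ⊕ (+ b₁) · v) * boxes ≤⟨ *-monoˡ-≤ boxes (ℤP.∣i+j∣≤∣i∣+∣j∣ ((+ a₁) · u) ((+ b₁) · v)) ⟩
     (abs ((+ a₁) · u) + abs ((+ b₁) · v)) * boxes ≡⟨ cong₂ (λ i j → (i + j) * boxes) (ℤP.abs-* (+ a₁) u) (ℤP.abs-* (+ b₁) v) ⟩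
     (a₁ * abs u + b₁ * abs v) * boxes ≡⟨ l₂ a₁ (abs u) b₁ (abs v) boxes ⟩
     a₁ * (abs u * boxes) + b₁ * (abs v * boxes) ≤⟨ +-mono-≤ (*-mono-≤ (≤-trans a≤ (*-monoʳ-≤ (2 * κ + 1) b≤)) (same-box s boxes b₂ b₁ bb)) (*-mono-≤ b≤ (same-box s boxes a₁ a₂ ba)) ⟩
     (2 * κ + 1) * s * s + s * s ≡⟨ l₃ κ s ⟩
     (2 * κ + 2) * (s * s) ≤⟨ *-monoʳ-≤ (2 * κ + 2) s²≤ ⟩
     (2 * κ + 2) * n ∎
     where
     u = (+ b₂) ⊖ (+ b₁)
     v = (+ a₁) ⊖ (+ a₂)
     l₂ : ∀ a u b v D → (a * u + b * v) * D ≡ a * (u * D) + b * (v * D)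
     l₂ = NS.solve-∀
     l₃ : ∀ κ s → (2 * κ + 1) * s * s + s * s ≡ (2 * κ + 2) * (s * s)
     l₃ = NS.solve-∀
   small : 2 * κ * abs W < n
   small = *-cancelʳ-< boxes _ _ (begin-strict
     2 * κ * abs W * boxes ≡⟨ *-assoc (2 * κ) (abs W) boxes ⟩
     2 * κ * (abs W * boxes) ≤⟨ *-monoʳ-≤ (2 * κ) W≤ ⟩
     2 * κ * ((2 * κ + 2) * n) ≡⟨ l κ n ⟩
     n * (2 * κ * (2 * κ + 2)) <⟨ *-monoʳ-< n {{>-nonZero n≥1}} (≤-reflexive (+-comm 1 (2 * κ * (2 * κ + 2)))) ⟩
     n * boxes ∎)
     where
     l : ∀ κ n → 2 * κ * ((2 * κ + 2) * n) ≡ n * (2 * κ * (2 * κ + 2))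
     l = NS.solve-∀
   W0 : ∀ m → m ≡ abs W → abs W ≡ 0
   W0 zero e = sym e
   W0 (suc m) e = ⊥-elim (<⇒≱ small (ND.∣⇒≤ {{>-nonZero (*-mono-≤ (*-mono-≤ {1} {2} (s≤s z≤n) κ≥1) (≤-trans (s≤s z≤n) (≤-reflexive e)))}} dv))
   cross-eq : a₁ * b₂ ≡ a₂ * b₁
   cross-eq = ℤP.+-injective (trans (ℤP.pos-* a₁ b₂) (trans (ℤP.i-j≡0⇒i≡j ((+ a₁) · (+ b₂)) ((+ a₂) · (+ b₁)) (ℤP.∣i∣≡0⇒i≡0 (W0 (abs W) refl))) (sym (ℤP.pos-* a₂ b₁))))
   b≡ : b₁ ≡ b₂
   b≡ = ND.∣-antisym (coprime-divisor (coprime-sym cop₁) (subst (b₁ ∣_) (sym cross-eq) (ND.n∣m*n a₂))) (coprime-divisor (coprime-sym cop₂) (subst (b₂ ∣_) cross-eq (ND.n∣m*n a₁)))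

 abs-minus-nat : ∀ x → IsNat ((+ abs x) ⊖ x)
 abs-minus-nat (+ n) = 0 , ℤP.+-inverseʳ (+ n)
 abs-minus-nat -[1+ n ] = suc n + suc n , refl

 -- Starting at a = 2κ b keeps the form positive for either sign of k: a² - k b² - b² is a
 -- polynomial in κ - 1, b and j with nonnegative coefficients, plus (κ - k) b².
 norm-positive : 1 ≤ κ → ∀ j b → ∃[ m ] ((+ (2 * κ * b + j)) · (+ (2 * κ * b + j)) ⊖ k · (+ b) · (+ b) ≡ + (b * b + m))
 norm-positive κ≥1 j b = proj₁ extra , (begin
   (+ (2 * κ * b + j)) · (+ (2 * κ * b + j)) ⊖ k · (+ b) · (+ b) ≡⟨ cong (λ i → i · i ⊖ k · (+ b) · (+ b)) a≡ ⟩
   A · A ⊖ k · (+ b) · (+ b) ≡⟨ l (+ c) (+ b) (+ j) k ⟩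
   (+ b) · (+ b) ⊕ E ≡⟨ cong₂ _⊕_ (sym (ℤP.pos-* b b)) (proj₂ extra) ⟩
   + (b * b + proj₁ extra) ∎)
   where
   open ≡-Reasoning
   c = ℕ.pred κ
   K≡ : + κ ≡ 1ℤ ⊕ (+ c)
   K≡ = cong +_ (sym (suc-pred κ {{>-nonZero κ≥1}}))
   A E : ℤ
   A = (+ 2) · (1ℤ ⊕ (+ c)) · (+ b) ⊕ (+ j)
   E = ((+ 2) ⊕ (+ 7) · (+ c) ⊕ (+ 4) · ((+ c) · (+ c))) · ((+ b) · (+ b)) ⊕ (+ 4) · (1ℤ ⊕ (+ c)) · ((+ b) · (+ j)) ⊕ (+ j) · (+ j) ⊕ ((1ℤ ⊕ (+ c)) ⊖ k) · ((+ b) · (+ b))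
   a≡ : + (2 * κ * b + j) ≡ A
   a≡ = cong (λ i → i ⊕ (+ j)) (trans (ℤP.pos-* (2 * κ) b) (cong (λ i → i · (+ b)) (trans (ℤP.pos-* 2 κ) (cong (λ i → (+ 2) · i) K≡))))
   nat : ∀ n → IsNat (+ n)
   nat n = n , refl
   extra : IsNat E
   extra = isNat-+ {((+ 2) ⊕ (+ 7) · (+ c) ⊕ (+ 4) · ((+ c) · (+ c))) · ((+ b) · (+ b)) ⊕ (+ 4) · (1ℤ ⊕ (+ c)) · ((+ b) · (+ j)) ⊕ (+ j) · (+ j)} {((1ℤ ⊕ (+ c)) ⊖ k) · ((+ b) · (+ b))}
     (isNat-+ {((+ 2) ⊕ (+ 7) · (+ c) ⊕ (+ 4) · ((+ c) · (+ c))) · ((+ b) · (+ b)) ⊕ (+ 4) · (1ℤ ⊕ (+ c)) · ((+ b) · (+ j))} {(+ j) · (+ j)}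
       (isNat-+ {((+ 2) ⊕ (+ 7) · (+ c) ⊕ (+ 4) · ((+ c) · (+ c))) · ((+ b) · (+ b))} {(+ 4) · (1ℤ ⊕ (+ c)) · ((+ b) · (+ j))}
         (isNat-* {(+ 2) ⊕ (+ 7) · (+ c) ⊕ (+ 4) · ((+ c) · (+ c))} {(+ b) · (+ b)}
           (isNat-+ {(+ 2) ⊕ (+ 7) · (+ c)} {(+ 4) · ((+ c) · (+ c))} (isNat-+ {+ 2} {(+ 7) · (+ c)} (nat 2) (isNat-* {+ 7} {+ c} (nat 7) (nat c))) (isNat-* {+ 4} {(+ c) · (+ c)} (nat 4) (square-nat (+ c))))
           (square-nat (+ b)))
         (isNat-* {(+ 4) · (1ℤ ⊕ (+ c))} {(+ b) · (+ j)} (isNat-* {+ 4} {1ℤ ⊕ (+ c)} (nat 4) (nat (suc c))) (isNat-* {+ b} {+ j} (nat b) (nat j))))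
       (square-nat (+ j)))
     (isNat-* {(1ℤ ⊕ (+ c)) ⊖ k} {(+ b) · (+ b)} (subst (λ i → IsNat (i ⊖ k)) K≡ (abs-minus-nat k)) (square-nat (+ b)))
   l : ∀ c b j k → ((+ 2) · (1ℤ ⊕ c) · b ⊕ j) · ((+ 2) · (1ℤ ⊕ c) · b ⊕ j) ⊖ k · b · b ≡
     b · b ⊕ (((+ 2) ⊕ (+ 7) · c ⊕ (+ 4) · (c · c)) · (b · b) ⊕ (+ 4) · (1ℤ ⊕ c) · (b · j) ⊕ j · j ⊕ ((1ℤ ⊕ c) ⊖ k) · (b · b))
   l = ZS.solve-∀

 record NormData (b i : ℕ) : Set where
   field
     g a′ b′ n : ℕ
     a≡ : 2 * κ * b + i ≡ a′ * g
     b≡ : b ≡ b′ * g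
     g≥1 : 1 ≤ g
     rep : Represents n a′ b′
     a≤ : a′ ≤ (2 * κ + 1) * b′
     b²≤n : b′ * b′ ≤ n
     n≤ : n ≤ 10 * (κ * κ) * (b′ * b′)
   b′≥1 : 1 ≤ b′
   b′≥1 = proj₁ (proj₂ rep)
   n≥1 : 1 ≤ n
   n≥1 = ≤-trans (*-mono-≤ b′≥1 b′≥1) b²≤n

 normData : 1 ≤ κ → ∀ b i → i < b → NormData b i
 normData κ≥1 b i i<b = go (gcd-split (2 * κ * b + i) b b≥1)
   where
   b≥1 : 1 ≤ b
   b≥1 = ≤-trans (s≤s z≤n) i<b
   go : ∃[ g ] ∃[ a ] ∃[ b' ] (2 * κ * b + i ≡ a * g × b ≡ b' * g × 1 ≤ g × Coprime a b') → NormData b i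
   go (g , a , b' , ea , eb , g≥1 , cop) = go′ (m≤n⇒∃[o]m+o≡n lower)
     where
     instance _ = >-nonZero g≥1
     b'≥1 : 1 ≤ b'
     b'≥1 = n≢0⇒n>0 (λ e → n>0⇒n≢0 b≥1 (trans eb (cong (_* g) e)))
     lower : 2 * κ * b' ≤ a
     lower = *-cancelʳ-≤ (2 * κ * b') a g (≤-trans (≤-reflexive (trans (*-assoc (2 * κ) b' g) (cong (2 * κ *_) (sym eb)))) (≤-trans (m≤m+n (2 * κ * b) i) (≤-reflexive ea)))
     upper : a ≤ (2 * κ + 1) * b'
     upper = *-cancelʳ-≤ a ((2 * κ + 1) * b') g (begin
       a * g ≡⟨ sym ea ⟩
       2 * κ * b + i ≤⟨ +-monoʳ-≤ (2 * κ * b) (<⇒≤ i<b) ⟩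
       2 * κ * b + b ≡⟨ l κ b ⟩
       (2 * κ + 1) * b ≡⟨ cong ((2 * κ + 1) *_) eb ⟩
       (2 * κ + 1) * (b' * g) ≡⟨ sym (*-assoc (2 * κ + 1) b' g) ⟩
       (2 * κ + 1) * b' * g ∎)
       where
       open ≤-Reasoning
       l : ∀ κ b → 2 * κ * b + b ≡ (2 * κ + 1) * b
       l = NS.solve-∀
     go′ : ∃[ j ] (2 * κ * b' + j ≡ a) → NormData b i
     go′ (j , ej) = record { g = g ; a′ = a ; b′ = b' ; n = n ; a≡ = ea ; b≡ = eb ; g≥1 = g≥1 ; rep = norm≡ , b'≥1 , cop ; a≤ = upper ; b²≤n = m≤m+n (b' * b') m ; n≤ = bound }
       where
       pos = norm-positive κ≥1 j b'
       m = proj₁ pos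
       n = b' * b' + m
       norm≡ : (+ a) · (+ a) ⊖ k · (+ b') · (+ b') ≡ + n
       norm≡ = subst (λ i → (+ i) · (+ i) ⊖ k · (+ b') · (+ b') ≡ + n) ej (proj₂ pos)
       open ≤-Reasoning
       l₁ : ∀ c b → (2 * c + 1 * c) * b * ((2 * c + 1 * c) * b) + c * c * (b * b) ≡ 10 * (c * c) * (b * b)
       l₁ = NS.solve-∀
       up : a ≤ (2 * κ + 1 * κ) * b'
       up = ≤-trans upper (*-monoˡ-≤ b' (+-monoʳ-≤ (2 * κ) (≤-trans κ≥1 (≤-reflexive (sym (*-identityˡ κ))))))
       bound : n ≤ 10 * (κ * κ) * (b' * b')
       bound = begin
         n ≡⟨ cong abs (sym norm≡) ⟩
         abs ((+ a) · (+ a) ⊖ k · (+ b') · (+ b')) ≤⟨ abs-norm≤ (+ a) (+ b') ⟩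
         a * a + κ * (b' * b') ≤⟨ +-mono-≤ (*-mono-≤ up up) (*-monoˡ-≤ (b' * b') (m≤m*n κ κ {{>-nonZero κ≥1}})) ⟩
         (2 * κ + 1 * κ) * b' * ((2 * κ + 1 * κ) * b') + κ * κ * (b' * b') ≡⟨ l₁ κ b' ⟩
         10 * (κ * κ) * (b' * b') ∎

 Found : ℕ → Set
 Found n = ∃[ b ] (b < suc n × ∃[ a ] (a < suc ((2 * κ + 1) * n) × Represents n a b))

 found? : ∀ n → Dec (Found n)
 found? n = anyUpTo? (λ b → anyUpTo? (λ a → represents? n a b) (suc ((2 * κ + 1) * n))) (suc n)

 pick : ∀ {n} → Dec (Found n) → ℕ × ℕ
 pick (yes (b , _ , a , _)) = a , b
 pick (no _) = 0 , 0

 pick-represents : ∀ {n} (d : Dec (Found n)) → Found n → Represents n (proj₁ (pick d)) (proj₂ (pick d))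
 pick-represents (yes (_ , _ , _ , _ , r)) _ = r
 pick-represents (no nf) f = ⊥-elim (nf f)

 -- a representation of n depending on n only; (0 , 0) if there is none
 reference : ℕ → ℕ × ℕ
 reference n = pick (found? n)

 reference-represents : ∀ {b i} (x : NormData b i) → Represents (NormData.n x) (proj₁ (reference (NormData.n x))) (proj₂ (reference (NormData.n x)))
 reference-represents x = pick-represents (found? n) (b′ , s≤s b≤n , a′ , s≤s (≤-trans a≤ (*-monoʳ-≤ (2 * κ + 1) b≤n)) , rep)
   where
   open NormData x
   b≤n : b′ ≤ n
   b≤n = ≤-trans (m≤m*n b′ b′ {{>-nonZero b′≥1}}) b²≤n

 ResidueOf : ∀ {b i} → NormData b i → Set
 ResidueOf x = Residue n a′ b′ (proj₁ (reference n)) (proj₂ (reference n))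
   where open NormData x

 opaque
   residueOf : ∀ {b i} (x : NormData b i) → ResidueOf x
   residueOf x = residue (NormData.n≥1 x) (NormData.rep x) (reference-represents x)

 side : ℕ → ℕ
 side n = proj₁ (isqrt n)

 boxA boxB : ∀ {b i} → NormData b i → ℕ
 boxA x = (NormData.a′ x * boxes) DM./ suc (side (NormData.n x))
 boxB x = (NormData.b′ x * boxes) DM./ suc (side (NormData.n x))

 b′≤side : ∀ {b i} (x : NormData b i) → NormData.b′ x ≤ side (NormData.n x)
 b′≤side x = ≮⇒≥ (λ lt → <⇒≱ (proj₂ (proj₂ (isqrt n))) (≤-trans (*-mono-≤ lt lt) b²≤n))
   where open NormData x

 box-bound : ∀ c b s → b ≤ c * s → (b * boxes) DM./ suc s < suc (c * boxes)
 box-bound c b s h = s≤s (≤-trans (DM./-monoˡ-≤ (suc s) (≤-trans (*-monoˡ-≤ boxes (≤-trans h (*-monoʳ-≤ c (n≤1+n s)))) (≤-reflexive (l c (suc s) boxes)))) (≤-reflexive (DM.m*n/n≡m (c * boxes) (suc s))))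
   where
   l : ∀ c s D → c * s * D ≡ c * D * s
   l = NS.solve-∀

 determine-pair : 1 ≤ κ → ∀ {b i b' i'} (x : NormData b i) (y : NormData b' i') → NormData.g x ≡ NormData.g y →
   Residue.d (residueOf x) ≡ Residue.d (residueOf y) → Residue.e (residueOf x) ≡ Residue.e (residueOf y) → boxA x ≡ boxA y → boxB x ≡ boxB y → (b , i) ≡ (b' , i')
 determine-pair κ≥1 {b} {i} {b'} {i'} x y eg ed ee ea eb = cong₂ _,_ b≡b' (+-cancelˡ-≡ (2 * κ * b) i i' (trans X.a≡ (trans (cong₂ _*_ (proj₁ both) eg) (trans (sym Y.a≡) (cong (λ t → 2 * κ * t + i') (sym b≡b'))))))
   where
   module X = NormData x
   module Y = NormData y
   n≡ : X.n ≡ Y.n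
   n≡ = trans (Residue.n≡ (residueOf x)) (trans (cong₂ _*_ ee ed) (sym (Residue.n≡ (residueOf y))))
   core : ∀ {n₁ n₂} → n₁ ≡ n₂ → Represents n₁ X.a′ X.b′ → Represents n₂ Y.a′ Y.b′ → Represents n₁ (proj₁ (reference n₁)) (proj₂ (reference n₁)) → 1 ≤ n₁ → X.b′ ≤ side n₁ →
     (r₁ : Residue n₁ X.a′ X.b′ (proj₁ (reference n₁)) (proj₂ (reference n₁))) (r₂ : Residue n₂ Y.a′ Y.b′ (proj₁ (reference n₂)) (proj₂ (reference n₂))) → Residue.d r₁ ≡ Residue.d r₂ → Residue.e r₁ ≡ Residue.e r₂ →
     (X.a′ * boxes) DM./ suc (side n₁) ≡ (Y.a′ * boxes) DM./ suc (side n₂) → (X.b′ * boxes) DM./ suc (side n₁) ≡ (Y.b′ * boxes) DM./ suc (side n₂) → X.a′ ≡ Y.a′ × X.b′ ≡ Y.b′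
   core {n₁} refl r₁ r₂ r₀ n≥1 b≤ s₁ s₂ e₁ e₂ e₃ e₄ = equal-representations (side n₁) κ≥1 n≥1 (proj₁ (proj₂ (isqrt n₁))) r₁ r₂ X.a≤ b≤ (same-residue r₁ r₂ r₀ s₁ s₂ n≥1 e₁ e₂) e₃ (sym e₄)
   both : X.a′ ≡ Y.a′ × X.b′ ≡ Y.b′
   both = core n≡ X.rep Y.rep (reference-represents x) X.n≥1 (b′≤side x) (residueOf x) (residueOf y) ed ee ea eb
   b≡b' : b ≡ b'
   b≡b' = trans X.b≡ (trans (cong₂ _*_ (proj₂ both) eg) (sym Y.b≡))

 -- The pair (b , i) stands for the vector (2κ b + i , b). There are b values of i for each b, so
 -- the weights 1/b² add up to a harmonic sum.
 triangle : ℕ → List (ℕ × ℕ)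
 triangle zero = []
 triangle (suc R) = map (R ,_) (downFrom R) ++ triangle R

 triangle-all : ∀ R → All (λ x → proj₂ x < proj₁ x × proj₁ x < R) (triangle R)
 triangle-all zero = []
 triangle-all (suc R) = AllP.++⁺ (AllP.map⁺ (All.map (λ lt → lt , ≤-refl) (∈-downFrom R))) (All.map (λ (p , q) → p , m≤n⇒m≤1+n q) (triangle-all R))

 triangle-unique : ∀ R → Unique (triangle R)
 triangle-unique zero = []
 triangle-unique (suc R) = APP.++⁺ (UP.map⁺ (λ e → cong proj₂ e) (downFrom-unique R)) (triangle-unique R)
   (AllP.map⁺ (All.universal (λ i → All.map (λ { (_ , lt) e → <⇒≢ lt (cong proj₁ (sym e)) }) (triangle-all R)) (downFrom R)))

 triangle-weight : ∀ (f : ℕ → ℕ) R → Weighted.weight (λ x → f (proj₁ x)) (triangle R) ≡ sumTo (λ b → b * f b) R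
 triangle-weight f zero = refl
 triangle-weight f (suc R) = trans (go (downFrom R)) (cong₂ _+_ (cong (_* f R) (LP.length-downFrom R)) (triangle-weight f R))
   where
   go : ∀ is → Weighted.weight (λ x → f (proj₁ x)) (map (R ,_) is ++ triangle R) ≡ length is * f R + Weighted.weight (λ x → f (proj₁ x)) (triangle R)
   go [] = refl
   go (i ∷ is) = trans (cong (λ t → f R + t) (go is)) (sym (+-assoc (f R) _ _))

 boxCount constL : ℕ
 boxCount = suc ((2 * κ + 1) * boxes) * (suc (1 * boxes) * 1)
 constL = 4 * (boxCount * (10 * (κ * κ)))

 module LowerSum (κ≥1 : 1 ≤ κ) (N z r : ℕ) (z²≤N : z * z ≤ N) (r-small : 10 * (κ * κ) * (2 ^ r * 2 ^ r) ≤ z) where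
   open ReciprocalSums N

   goodSum badSum : ℕ
   goodSum = sumTo (λ s → ⟦ goodNum? s ⟧ * inv s) (suc z)
   badSum = sumTo (λ w → ⟦ Bad.goodNum? w ⟧ * inv w) (suc z)

   private
     Λ = N !
     instance
       Λ≢0 : NonZero Λ
       Λ≢0 = N !≢0
       Λ²≢0 : NonZero (Λ * Λ)
       Λ²≢0 = m*n≢0 Λ Λ
     R = 2 ^ r
     q = 10 * (κ * κ)

   z≤N : z ≤ N
   z≤N = ≤-trans (m≤m*m z) z²≤N

   R≤z : R ≤ z
   R≤z = ≤-trans (m≤m*n R R {{>-nonZero (m^n>0 2 r)}}) (≤-trans (m≤n*m (R * R) q {{>-nonZero (*-mono-≤ {1} {10} (s≤s z≤n) (*-mono-≤ κ≥1 κ≥1))}}) r-small)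

   -- The products s w are distinct, by uniqueness of the splitting, and at most z². So the product
   -- of the two sums is at most a single harmonic sum.
   goodSum*badSum : goodSum * badSum ≤ 2 * suc (ilog z) * (Λ * Λ)
   goodSum*badSum = begin
     goodSum * badSum ≡⟨ cong₂ _*_ (sym (weight-filter-downFrom goodNum? inv (suc z))) (sym (weight-filter-downFrom Bad.goodNum? inv (suc z))) ⟩
     Weighted.weight inv G * Weighted.weight inv B ≡⟨ sym (weight-product inv inv G B) ⟩
     weight (cartesianProduct G B) ≤⟨ bound (cartesianProduct G B) (all-product (allIn goodNum?) (allIn Bad.goodNum?)) (UP.cartesianProduct⁺ (UP.filter⁺ goodNum? (downFrom-unique (suc z))) (UP.filter⁺ Bad.goodNum? (downFrom-unique (suc z)))) ⟩
     sumTo (λ n → Λ * inv n) (suc (z * z)) ≡⟨ sumTo-*ˡ Λ inv (suc (z * z)) ⟩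
     Λ * sumTo inv (suc (z * z)) ≤⟨ *-monoʳ-≤ Λ (harmonic-≤ (z * z)) ⟩
     Λ * (suc (ilog (z * z)) * Λ) ≤⟨ *-monoʳ-≤ Λ (*-monoˡ-≤ Λ ilog²) ⟩
     Λ * (2 * suc (ilog z) * Λ) ≡⟨ l₁ Λ (suc (ilog z)) ⟩
     2 * suc (ilog z) * (Λ * Λ) ∎
     where
     open ≤-Reasoning
     l₁ : ∀ q t → q * (2 * t * q) ≡ 2 * t * (q * q)
     l₁ = NS.solve-∀
     G = filter goodNum? (downFrom (suc z))
     B = filter Bad.goodNum? (downFrom (suc z))
     open Weighted {ℕ × ℕ} (λ x → inv (proj₁ x) * inv (proj₂ x))
     allIn : ∀ {S : ℕ → Set} (S? : Decidable S) → All (λ m → S m × m ≤ z) (filter S? (downFrom (suc z)))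
     allIn S? = All.zip (AllP.all-filter S? (downFrom (suc z)) , All.map ℕ.s≤s⁻¹ (AllP.filter⁺ S? (∈-downFrom (suc z))))
     ilog² : suc (ilog (z * z)) ≤ 2 * suc (ilog z)
     ilog² = ≤-trans (s≤s (ilog-≤ (ilog z + suc (ilog z)) (<-≤-trans (*-mono-< (<2^ilog z) (<2^ilog z)) (≤-reflexive (sym (^-distribˡ-+-* 2 (suc (ilog z)) (suc (ilog z)))))))) (≤-reflexive (l₂ (ilog z)))
       where
       l₂ : ∀ t → suc (t + suc t) ≡ 2 * suc t
       l₂ = NS.solve-∀
     P : ℕ × ℕ → Set
     P x = (GoodNum (proj₁ x) × proj₁ x ≤ z) × (Bad.GoodNum (proj₂ x) × proj₂ x ≤ z)
     weight≤ : ∀ x → P x → inv (proj₁ x) * inv (proj₂ x) ≤ Λ * inv (proj₁ x * proj₂ x)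
     weight≤ (s , w) ((gs , s≤) , (gw , w≤)) = *-cancelˡ-≤ (s * w) {{>-nonZero sw≥1}} (≤-reflexive (begin-equality
       s * w * (inv s * inv w) ≡⟨ l₂ s w (inv s) (inv w) ⟩
       s * inv s * (w * inv w) ≡⟨ cong₂ _*_ (inv-* (proj₁ gs) (≤-trans s≤ z≤N)) (inv-* (proj₁ gw) (≤-trans w≤ z≤N)) ⟩
       Λ * Λ ≡⟨ cong (Λ *_) (sym (inv-* sw≥1 (≤-trans (*-mono-≤ s≤ w≤) z²≤N))) ⟩
       Λ * (s * w * inv (s * w)) ≡⟨ l₃ Λ (s * w) (inv (s * w)) ⟩
       s * w * (Λ * inv (s * w)) ∎))
       where
       sw≥1 : 1 ≤ s * w
       sw≥1 = *-mono-≤ (proj₁ gs) (proj₁ gw)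
       l₂ : ∀ s w i j → s * w * (i * j) ≡ s * i * (w * j)
       l₂ = NS.solve-∀
       l₃ : ∀ q m i → q * (m * i) ≡ m * (q * i)
       l₃ = NS.solve-∀
     bound : WB P (sumTo (λ n → Λ * inv n) (suc (z * z)))
     bound = wb-fibre (λ x → proj₁ x * proj₂ x) (λ n → Λ * inv n) (suc (z * z)) (λ { (s , w) ((_ , s≤) , (_ , w≤)) → s≤s (*-mono-≤ s≤ w≤) })
       (λ n _ → wb-unique _ (λ { x (p , refl) → weight≤ x p }) (λ { (s , w) (s' , w') (((gs , _) , (gw , _)) , e) (((gs' , _) , (gw' , _)) , e') → cong₂ _,_ (proj₁ (decompose-unique gs gw gs' gw' (trans e (sym e')))) (proj₂ (decompose-unique gs gw gs' gw' (trans e (sym e')))) }))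

   -- A vector with gcd g yields n = d e with d and e good and 1/b² = O(1/(g² d e)), and boundedly
   -- many vectors share g, d and e. Thus Σ 1/b is O((Σ 1/g²)(Σ 1/s)²).
   goodSum²-lower : r * (Λ * Λ) ≤ constL * (goodSum * goodSum)
   goodSum²-lower = *-cancelˡ-≤ (Λ * Λ) (begin
     Λ * Λ * (r * (Λ * Λ)) ≡⟨ l₁ Λ r ⟩
     Λ * Λ * Λ * (r * Λ) ≤⟨ *-monoʳ-≤ (Λ * Λ * Λ) (harmonic-≥ r (≤-trans R≤z z≤N)) ⟩
     Λ * Λ * Λ * (2 * sumTo inv R) ≡⟨ l₂ (Λ * Λ * Λ) (sumTo inv R) ⟩
     2 * (Λ * Λ * Λ * sumTo inv R) ≡⟨ cong (2 *_) (sym (sumTo-*ˡ (Λ * Λ * Λ) inv R)) ⟩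
     2 * sumTo (λ b → Λ * Λ * Λ * inv b) R ≡⟨ cong (2 *_) (sumTo-cong R term) ⟩
     2 * sumTo (λ b → b * (Λ * Λ * inv² b)) R ≡⟨ cong (2 *_) (sym (triangle-weight (λ b → Λ * Λ * inv² b) R)) ⟩
     2 * Weighted.weight (λ x → Λ * Λ * inv² (proj₁ x)) (triangle R) ≤⟨ *-monoʳ-≤ 2 (weight-witnessed (λ x → Λ * Λ * inv² (proj₁ x)) bound (triangle R) (triangle-all R) (triangle-unique R)) ⟩
     2 * sumTo (λ g → sumTo (λ d → ⟦ goodNum? d ⟧ * sumTo (λ e → ⟦ goodNum? e ⟧ * (boxCount * (q * (inv² g * (inv d * inv e))))) (suc z)) (suc z)) (suc N) ≡⟨ cong (2 *_) total ⟩
     2 * (sumTo inv² (suc N) * (boxCount * q * (goodSum * goodSum))) ≤⟨ *-monoʳ-≤ 2 (*-monoˡ-≤ _ (inv²-sum N ≤-refl)) ⟩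
     2 * (2 * (Λ * Λ) * (boxCount * q * (goodSum * goodSum))) ≡⟨ l₃ (Λ * Λ) (boxCount * q) (goodSum * goodSum) ⟩
     Λ * Λ * (4 * (boxCount * q) * (goodSum * goodSum)) ∎)
     where
     open ≤-Reasoning
     l₁ : ∀ q r → q * q * (r * (q * q)) ≡ q * q * q * (r * q)
     l₁ = NS.solve-∀
     l₂ : ∀ a b → a * (2 * b) ≡ 2 * (a * b)
     l₂ = NS.solve-∀
     l₃ : ∀ a b c → 2 * (2 * a * (b * c)) ≡ a * (4 * b * c)
     l₃ = NS.solve-∀
     term : ∀ b → b < R → Λ * Λ * Λ * inv b ≡ b * (Λ * Λ * inv² b)
     term zero _ = *-zeroʳ (Λ * Λ * Λ)
     term b@(suc _) lt = trans (cong (λ t → Λ * Λ * t * inv b) (sym (inv-* {b} (s≤s z≤n) (≤-trans (<⇒≤ lt) (≤-trans R≤z z≤N))))) (l₄ (Λ * Λ) b (inv b))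
       where
       l₄ : ∀ q b i → q * (b * i) * i ≡ b * (q * (i * i))
       l₄ = NS.solve-∀
     total : sumTo (λ g → sumTo (λ d → ⟦ goodNum? d ⟧ * sumTo (λ e → ⟦ goodNum? e ⟧ * (boxCount * (q * (inv² g * (inv d * inv e))))) (suc z)) (suc z)) (suc N) ≡ sumTo inv² (suc N) * (boxCount * q * (goodSum * goodSum))
     total = trans (sumTo-cong (suc N) (λ g _ → trans (sumTo-cong (suc z) (λ d _ → trans (cong (⟦ goodNum? d ⟧ *_)
         (trans (sumTo-cong (suc z) (λ e _ → l₅ ⟦ goodNum? e ⟧ boxCount q (inv² g) (inv d) (inv e))) (sumTo-*ˡ (boxCount * q * inv² g * inv d) (λ e → ⟦ goodNum? e ⟧ * inv e) (suc z))))
         (l₆ ⟦ goodNum? d ⟧ (boxCount * q) (inv² g) (inv d) goodSum))) (trans (sumTo-*ˡ (boxCount * q * inv² g * goodSum) (λ d → ⟦ goodNum? d ⟧ * inv d) (suc z)) (l₇ (boxCount * q) (inv² g) goodSum))))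
       (sumTo-*ʳ (boxCount * q * (goodSum * goodSum)) inv² (suc N))
       where
       l₅ : ∀ i c q g d e → i * (c * (q * (g * (d * e)))) ≡ c * q * g * d * (i * e)
       l₅ = NS.solve-∀
       l₆ : ∀ i c g d s → i * (c * g * d * s) ≡ c * g * s * (i * d)
       l₆ = NS.solve-∀
       l₇ : ∀ c g s → c * g * s * s ≡ g * (c * (s * s))
       l₇ = NS.solve-∀
     P : ℕ × ℕ → Set
     P x = proj₂ x < proj₁ x × proj₁ x < R
     Elem : Set
     Elem = Σ (ℕ × ℕ) P
     open Keyed {Elem} {ℕ × ℕ} proj₁ (λ a → Λ * Λ * inv² (proj₁ (proj₁ a)))
     opaque
       nd : (x : Elem) → NormData (proj₁ (proj₁ x)) (proj₂ (proj₁ x))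
       nd ((b , i) , lt , _) = normData κ≥1 b i lt
     module X (x : Elem) = NormData (nd x)
     dOf eOf : Elem → ℕ
     dOf x = Residue.d (residueOf (nd x))
     eOf x = Residue.e (residueOf (nd x))
     n≡ : ∀ x → X.n x ≡ eOf x * dOf x
     n≡ x = Residue.n≡ (residueOf (nd x))
     goodn : ∀ x → GoodNum (X.n x)
     goodn x = represents-good (X.n≥1 x) (X.rep x)
     goodd : ∀ x → GoodNum (dOf x)
     goodd x = good-∣ (divides (eOf x) (n≡ x)) (goodn x)
     goode : ∀ x → GoodNum (eOf x)
     goode x = good-∣ (divides (dOf x) (trans (n≡ x) (*-comm (eOf x) (dOf x)))) (goodn x)
     g≤b : ∀ x → X.g x ≤ proj₁ (proj₁ x)
     g≤b x = ≤-trans (m≤n*m (X.g x) (X.b′ x) {{>-nonZero (X.b′≥1 x)}}) (≤-reflexive (sym (X.b≡ x)))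
     b′≤b : ∀ x → X.b′ x ≤ proj₁ (proj₁ x)
     b′≤b x = ≤-trans (m≤m*n (X.b′ x) (X.g x) {{>-nonZero (X.g≥1 x)}}) (≤-reflexive (sym (X.b≡ x)))
     b≤R : ∀ x → proj₁ (proj₁ x) ≤ R
     b≤R (_ , _ , lt) = <⇒≤ lt
     b≤N : ∀ x → proj₁ (proj₁ x) ≤ N
     b≤N x = ≤-trans (b≤R x) (≤-trans R≤z z≤N)
     n≤z : ∀ x → X.n x ≤ z
     n≤z x = ≤-trans (X.n≤ x) (≤-trans (*-monoʳ-≤ q (*-mono-≤ (≤-trans (b′≤b x) (b≤R x)) (≤-trans (b′≤b x) (b≤R x)))) r-small)
     d≤z : ∀ x → dOf x ≤ z
     d≤z x = ≤-trans (ND.∣⇒≤ {{>-nonZero (X.n≥1 x)}} (divides (eOf x) (n≡ x))) (n≤z x)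
     e≤z : ∀ x → eOf x ≤ z
     e≤z x = ≤-trans (ND.∣⇒≤ {{>-nonZero (X.n≥1 x)}} (divides (dOf x) (trans (n≡ x) (*-comm (eOf x) (dOf x))))) (n≤z x)
     b≥1 : ∀ x → 1 ≤ proj₁ (proj₁ x)
     b≥1 (_ , lt , _) = ≤-trans (s≤s z≤n) lt
     weight≤ : ∀ x → Λ * Λ * inv² (proj₁ (proj₁ x)) ≤ q * (inv² (X.g x) * (inv (dOf x) * inv (eOf x)))
     weight≤ x = *-cancelˡ-≤ (b * b) {{>-nonZero (*-mono-≤ (b≥1 x) (b≥1 x))}} (begin
       b * b * (Λ * Λ * (inv b * inv b)) ≡⟨ l₄ b Λ (inv b) ⟩
       (b * inv b) * (b * inv b) * (Λ * Λ) ≡⟨ cong (λ t → t * t * (Λ * Λ)) (inv-* (b≥1 x) (b≤N x)) ⟩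
       Λ * Λ * (Λ * Λ) ≡⟨ cong₂ _*_ (cong (λ t → t * t) (sym (inv-* (X.g≥1 x) (≤-trans (g≤b x) (b≤N x))))) (cong₂ _*_ (sym (inv-* (proj₁ (goodd x)) (≤-trans (d≤z x) z≤N))) (sym (inv-* (proj₁ (goode x)) (≤-trans (e≤z x) z≤N)))) ⟩
       (g * inv g) * (g * inv g) * ((d * inv d) * (e * inv e)) ≡⟨ l₅ g (inv g) d (inv d) e (inv e) ⟩
       g * g * (e * d) * (inv² g * (inv d * inv e)) ≡⟨ cong (λ t → g * g * t * (inv² g * (inv d * inv e))) (sym (n≡ x)) ⟩
       g * g * X.n x * (inv² g * (inv d * inv e)) ≤⟨ *-monoˡ-≤ (inv² g * (inv d * inv e)) (*-monoʳ-≤ (g * g) (X.n≤ x)) ⟩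
       g * g * (q * (X.b′ x * X.b′ x)) * (inv² g * (inv d * inv e)) ≡⟨ l₆ g q (X.b′ x) (inv² g * (inv d * inv e)) ⟩
       (X.b′ x * g) * (X.b′ x * g) * (q * (inv² g * (inv d * inv e))) ≡⟨ cong (λ t → t * t * (q * (inv² g * (inv d * inv e)))) (sym (X.b≡ x)) ⟩
       b * b * (q * (inv² g * (inv d * inv e))) ∎)
       where
       b = proj₁ (proj₁ x)
       g = X.g x
       d = dOf x
       e = eOf x
       l₄ : ∀ b q i → b * b * (q * q * (i * i)) ≡ (b * i) * (b * i) * (q * q)
       l₄ = NS.solve-∀
       l₅ : ∀ g i d j e h → (g * i) * (g * i) * ((d * j) * (e * h)) ≡ g * g * (e * d) * ((i * i) * (j * h))
       l₅ = NS.solve-∀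
       l₆ : ∀ g q b w → g * g * (q * (b * b)) * w ≡ (b * g) * (b * g) * (q * w)
       l₆ = NS.solve-∀
     rest : Labels
     rest = ((λ x → boxA (nd x)) , suc ((2 * κ + 1) * boxes)) ∷ ((λ x → boxB (nd x)) , suc (1 * boxes)) ∷ []
     boxes-bound : ∀ x → All (λ l → proj₁ l x < proj₂ l) rest
     boxes-bound x = box-bound (2 * κ + 1) (X.a′ x) (side (X.n x)) (≤-trans (X.a≤ x) (*-monoʳ-≤ (2 * κ + 1) (b′≤side (nd x)))) ∷ box-bound 1 (X.b′ x) (side (X.n x)) (≤-trans (b′≤side (nd x)) (≤-reflexive (sym (*-identityˡ _)))) ∷ []
     bound : WB (λ _ → ⊤) (sumTo (λ g → sumTo (λ d → ⟦ goodNum? d ⟧ * sumTo (λ e → ⟦ goodNum? e ⟧ * (boxCount * (q * (inv² g * (inv d * inv e))))) (suc z)) (suc z)) (suc N))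
     bound = wb-fibre X.g _ (suc N) (λ x _ → s≤s (≤-trans (g≤b x) (b≤N x))) (λ g _ →
       wb-fibre? goodNum? dOf _ (suc z) (λ x _ → s≤s (d≤z x)) (λ x _ → goodd x) (λ d _ →
         wb-fibre? goodNum? eOf _ (suc z) (λ x _ → s≤s (e≤z x)) (λ x _ → goode x) (λ e _ →
           wb-labels rest (q * (inv² g * (inv d * inv e))) (λ x (((_ , e₁) , e₂) , e₃) → subst (λ e → Λ * Λ * inv² (proj₁ (proj₁ x)) ≤ q * (inv² g * (inv d * inv e))) e₃ (subst₂ (λ g d → Λ * Λ * inv² (proj₁ (proj₁ x)) ≤ q * (inv² g * (inv d * inv (eOf x)))) e₁ e₂ (weight≤ x))) (λ x _ → boxes-bound x)
             (λ { x y (((_ , eg) , ed) , ee) (((_ , eg') , ed') , ee') (ea ∷ eb ∷ []) → determine-pair κ≥1 (nd x) (nd y) (trans eg (sym eg')) (trans ed (sym ed')) (trans ee (sym ee')) ea eb }))))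

   badSum² : badSum * badSum * r ≤ 4 * constL * (suc (ilog z) * suc (ilog z) * (Λ * Λ))
   badSum² = *-cancelˡ-≤ (Λ * Λ) (begin
     Λ * Λ * (badSum * badSum * r) ≡⟨ l₁ (Λ * Λ) (badSum * badSum) r ⟩
     r * (Λ * Λ) * (badSum * badSum) ≤⟨ *-monoˡ-≤ (badSum * badSum) goodSum²-lower ⟩
     constL * (goodSum * goodSum) * (badSum * badSum) ≡⟨ l₂ constL goodSum badSum ⟩
     constL * ((goodSum * badSum) * (goodSum * badSum)) ≤⟨ *-monoʳ-≤ constL (*-mono-≤ goodSum*badSum goodSum*badSum) ⟩
     constL * ((2 * suc (ilog z) * (Λ * Λ)) * (2 * suc (ilog z) * (Λ * Λ))) ≡⟨ l₃ constL (suc (ilog z)) (Λ * Λ) ⟩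
     Λ * Λ * (4 * constL * (suc (ilog z) * suc (ilog z) * (Λ * Λ))) ∎)
     where
     open ≤-Reasoning
     l₁ : ∀ q b r → q * (b * r) ≡ r * q * b
     l₁ = NS.solve-∀
     l₂ : ∀ c g b → c * (g * g) * (b * b) ≡ c * ((g * b) * (g * b))
     l₂ = NS.solve-∀
     l₃ : ∀ c t q → c * ((2 * t * q) * (2 * t * q)) ≡ q * (4 * c * (t * t * q))
     l₃ = NS.solve-∀

 -- Opaque copies, since conversion must not unfold these large numerals.
 opaque
   cB cC cS cL : ℕ
   cB = constB
   cC = constC
   cS = constS
   cL = constL

   constB≡ : constB ≡ cB
   constB≡ = refl

   constC≡ : constC ≡ cC
   constC≡ = refl

   constS≡ : constS ≡ cS
   constS≡ = refl

   constL≡ : constL ≡ cL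
   constL≡ = refl

 -- Assembly of the three cases

 bigH constA constBC constLarge constSmall : ℕ
 bigH = 8 * 8 * 8 * ((1 + κ) * (1 + κ))
 constA = 2 * (4 * (48 * 48 * (16 * cS * (4 * cL * 144))))
 constBC = cB + 2 * cC
 constLarge = 2 * (2 * (constA + 4) + constBC * constBC)
 constSmall = threshold 15 (2 * bigH) + 10 * (κ * κ)

 fifth : ℕ → ℕ
 fifth T = T * T * (T * T) * T

 Elem : ℕ → Set
 Elem N = Σ ℕ (λ B → 1 ≤ B × B ≤ N × HasIntegralPoint k B)

 -- `N-large` reads N ≥ bigH · T^15; its factor 8 · 8 · 8 pays for the floors in X₀ and M and for
 -- the constant in `HY`. `T-large` is used for `r-small`, which keeps the norms in `LowerSum` below
 -- z.
 module Large (ns : NonSquareRational k) (k≢0 : k ≢ 0ℤ) (κ≥1 : 1 ≤ κ) (N : ℕ) (N≥3 : 3 ≤ N)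
   (N-large : bigH * (fifth (suc (ilog N)) * fifth (suc (ilog N)) * fifth (suc (ilog N))) ≤ N) (T-large : 10 * (κ * κ) ≤ suc (ilog N)) where

   private
     ℓ T w z t₄ t₅ X₀ M r LL : ℕ
     ℓ = ilog N
     T = suc ℓ
     w = T * T
     z = w * w * w
     t₄ = w * w
     t₅ = fifth T
     X₀ = N DM./ t₅
     M = N DM./ t₄
     r = ilog T
     LL = LgLg N

     t₅³≤N : t₅ * t₅ * t₅ ≤ N
     t₅³≤N = ≤-trans (m≤n*m (t₅ * t₅ * t₅) bigH) N-large
     t₅≤N : t₅ ≤ N
     t₅≤N = ≤-trans (≤-trans (m≤m*n t₅ t₅) (m≤m*n (t₅ * t₅) t₅)) t₅³≤N
     t₄≤N : t₄ ≤ N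
     t₄≤N = ≤-trans (m≤m*n t₄ T) t₅≤N
     z²≤N : z * z ≤ N
     z²≤N = ≤-trans (≤-trans (m≤m*n (z * z) (T * T * T)) (≤-reflexive (l T))) t₅³≤N
       where
       l : ∀ t → (t * t * (t * t) * (t * t)) * (t * t * (t * t) * (t * t)) * (t * t * t) ≡ (t * t * (t * t) * t) * (t * t * (t * t) * t) * (t * t * (t * t) * t)
       l = NS.solve-∀
     z≤N : z ≤ N
     z≤N = ≤-trans (m≤m*m z) z²≤N
     X₀≤N : X₀ ≤ N
     X₀≤N = DM.m/n≤m N t₅
     ℓ≥1 : 1 ≤ ℓ
     ℓ≥1 = ℕ.s≤s⁻¹ (^-cancel-< 2 1 T ≤-refl (≤-<-trans (≤-trans (s≤s (s≤s z≤n)) N≥3) (<2^ilog N)))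
     r≥1 : 1 ≤ r
     r≥1 = ℕ.s≤s⁻¹ (^-cancel-< 2 1 (suc r) ≤-refl (≤-<-trans (s≤s ℓ≥1) (<2^ilog T)))
     LL≥1 : 1 ≤ LL
     LL≥1 = 1≤LgLg N N≥3
     N≥1 : 1 ≤ N
     N≥1 = ≤-trans (s≤s z≤n) N≥3
     T≤N : T ≤ N
     T≤N = ≤-trans (<2^n ℓ) (2^ilog≤ N N≥1)

     cube : ∀ e d x → (e * (d * x)) * (e * (d * x)) * (e * (d * x)) ≡ e * e * e * (d * d * d) * (x * x * x)
     cube = NS.solve-∀

     HX : 4 * (κ * κ) * (N * N) ≤ X₀ * X₀ * X₀
     HX = *-cancelˡ-≤ (2 * 2 * 2 * (t₅ * t₅ * t₅)) (begin
       8 * (t₅ * t₅ * t₅) * (4 * (κ * κ) * (N * N)) ≡⟨ l₁ 8 4 (t₅ * t₅ * t₅) (κ * κ) (N * N) ⟩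
       8 * 4 * (κ * κ) * (t₅ * t₅ * t₅) * (N * N) ≤⟨ *-monoˡ-≤ (N * N) (≤-trans (*-monoˡ-≤ (t₅ * t₅ * t₅) (*-mono-≤ (m≤m+n 32 480) (*-mono-≤ (n≤1+n κ) (n≤1+n κ)))) N-large) ⟩
       N * (N * N) ≡⟨ sym (*-assoc N N N) ⟩
       N * N * N ≤⟨ *-mono-≤ (*-mono-≤ f f) f ⟩
       2 * (t₅ * X₀) * (2 * (t₅ * X₀)) * (2 * (t₅ * X₀)) ≡⟨ cube 2 t₅ X₀ ⟩
       2 * 2 * 2 * (t₅ * t₅ * t₅) * (X₀ * X₀ * X₀) ∎)
       where
       open ≤-Reasoning
       f : N ≤ 2 * (t₅ * X₀)
       f = floor-lower N t₅ t₅≤N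
       l₁ : ∀ e f d c n → e * d * (f * c * n) ≡ e * f * c * d * n
       l₁ = NS.solve-∀

     HY : 8 * (1 + κ) * N * (8 * (1 + κ) * N) ≤ M * M * X₀
     HY = *-cancelˡ-≤ (2 * 2 * 2 * (t₄ * t₄ * t₅)) (begin
       8 * (t₄ * t₄ * t₅) * (8 * (1 + κ) * N * (8 * (1 + κ) * N)) ≡⟨ l₁ 8 (t₄ * t₄ * t₅) (1 + κ) N ⟩
       bigH * (t₄ * t₄ * t₅) * (N * N) ≤⟨ *-monoˡ-≤ (N * N) (≤-trans (*-monoʳ-≤ bigH (≤-trans (m≤m*n (t₄ * t₄ * t₅) (T * T)) (≤-reflexive (l₂ T)))) N-large) ⟩
       N * (N * N) ≡⟨ sym (*-assoc N N N) ⟩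
       N * N * N ≤⟨ *-mono-≤ (*-mono-≤ f₄ f₄) (floor-lower N t₅ t₅≤N) ⟩
       2 * (t₄ * M) * (2 * (t₄ * M)) * (2 * (t₅ * X₀)) ≡⟨ l₃ 2 t₄ M t₅ X₀ ⟩
       2 * 2 * 2 * (t₄ * t₄ * t₅) * (M * M * X₀) ∎)
       where
       open ≤-Reasoning
       f₄ : N ≤ 2 * (t₄ * M)
       f₄ = floor-lower N t₄ t₄≤N
       l₁ : ∀ e d c n → e * d * (e * c * n * (e * c * n)) ≡ e * e * e * (c * c) * d * (n * n)
       l₁ = NS.solve-∀
       l₂ : ∀ t → (t * t * (t * t)) * (t * t * (t * t)) * (t * t * (t * t) * t) * (t * t) ≡ (t * t * (t * t) * t) * (t * t * (t * t) * t) * (t * t * (t * t) * t)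
       l₂ = NS.solve-∀
       l₃ : ∀ e d m f x → (e * (d * m)) * (e * (d * m)) * (e * (f * x)) ≡ e * e * e * (d * d * f) * (m * m * x)
       l₃ = NS.solve-∀

     HM : ∀ t → t * (w * w) ≤ N → t ≤ M
     HM t h = ≤-trans (≤-reflexive (sym (DM.m*n/n≡m t t₄))) (DM./-monoˡ-≤ t₄ h)

     r-small : 10 * (κ * κ) * (2 ^ r * 2 ^ r) ≤ z
     r-small = ≤-trans (*-mono-≤ T-large (*-mono-≤ 2^r≤T 2^r≤T)) (≤-trans (m≤m*n (T * (T * T)) (T * (T * T))) (≤-reflexive (l T)))
       where
       2^r≤T : 2 ^ r ≤ T
       2^r≤T = 2^ilog≤ T (s≤s z≤n)
       l : ∀ t → t * (t * t) * (t * (t * t)) ≡ t * t * (t * t) * (t * t)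
       l = NS.solve-∀

     ilog-z : suc (ilog z) ≤ 12 * r
     ilog-z = begin
       suc (ilog z) ≤⟨ s≤s (ilog-≤ (6 * r + 5) (<-≤-trans (*-mono-< (*-mono-< w< w<) w<) (≤-reflexive (sym 2^)))) ⟩
       suc (6 * r + 5) ≡⟨ sym (+-suc (6 * r) 5) ⟩
       6 * r + 6 * 1 ≤⟨ +-monoʳ-≤ (6 * r) (*-monoʳ-≤ 6 r≥1) ⟩
       6 * r + 6 * r ≡⟨ l r ⟩
       12 * r ∎
       where
       open ≤-Reasoning
       l : ∀ r → 6 * r + 6 * r ≡ 12 * r
       l = NS.solve-∀
       P = 2 ^ (suc r + suc r)
       w< : w < P
       w< = <-≤-trans (*-mono-< (<2^ilog T) (<2^ilog T)) (≤-reflexive (sym (^-distribˡ-+-* 2 (suc r) (suc r))))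
       l₂ : ∀ r → suc (6 * r + 5) ≡ suc r + suc r + (suc r + suc r) + (suc r + suc r)
       l₂ = NS.solve-∀
       2^ : 2 ^ suc (6 * r + 5) ≡ P * P * P
       2^ = trans (cong (2 ^_) (l₂ r)) (trans (^-distribˡ-+-* 2 (suc r + suc r + (suc r + suc r)) (suc r + suc r)) (cong (_* P) (^-distribˡ-+-* 2 (suc r + suc r) (suc r + suc r))))

     module HT = HallTenenbaum split? N z z≤N
     module US = UpperSum ns k≢0 N
     module LS = LowerSum κ≥1 N z r z²≤N r-small
     module CB = CaseB ns κ≥1 N X₀ X₀≤N
     -- The bound `Y` for slope buckets is taken to be M as well: `HY` only asks M √X₀ to exceed a
     -- multiple of N, and √X₀ is far larger than T⁴.
     module CC = CaseC ns k≢0 κ≥1 N X₀ w M M HX HY HM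

     -- `LowerSum` gives a bound of order (log z)² / r, and log z is O(r) because z is a fixed power
     -- of T and r = ilog T.
     badSum²≤ : HT.badSum * HT.badSum ≤ 4 * cL * 144 * (r * (N ! * N !))
     badSum²≤ = *-cancelʳ-≤ (HT.badSum * HT.badSum) (4 * cL * 144 * (r * (N ! * N !))) r {{>-nonZero r≥1}} (begin
       HT.badSum * HT.badSum * r ≤⟨ subst (λ c → HT.badSum * HT.badSum * r ≤ 4 * c * (suc (ilog z) * suc (ilog z) * (N ! * N !))) constL≡ LS.badSum² ⟩
       4 * cL * (suc (ilog z) * suc (ilog z) * (N ! * N !)) ≤⟨ *-monoʳ-≤ (4 * cL) (*-monoˡ-≤ (N ! * N !) (*-mono-≤ ilog-z ilog-z)) ⟩
       4 * cL * (12 * r * (12 * r) * (N ! * N !)) ≡⟨ l (4 * cL) 12 r (N ! * N !) ⟩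
       4 * cL * 144 * (r * (N ! * N !)) * r ∎)
       where
       open ≤-Reasoning
       l : ∀ c e r q → c * (e * r * (e * r) * q) ≡ c * (e * e) * (r * q) * r
       l = NS.solve-∀

     opaque
       pd : (x : Elem N) → PointData (proj₁ x)
       pd (B , B≥1 , _ , h) = reduce ns B B≥1 h
     module PD (x : Elem N) = PointData (pd x)

     A? : Decidable (λ x → PD.v x * PD.v x * PD.v x * PD.m x ≤ z)
     A? x = PD.v x * PD.v x * PD.v x * PD.m x ≤? z
     big? : Decidable (λ (x : Elem N) → N < proj₁ x * proj₁ x)
     big? x = N <? proj₁ x * proj₁ x

     -- n divides the norm y² - k m² with y prime to m, so it is good; every bad prime of B comes
     -- from v³ m ≤ z.
     member : ∀ x → PD.v x * PD.v x * PD.v x * PD.m x ≤ z → HT.Member (proj₁ x)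
     member x@(B , _ , B≤N , _) h = go (decompose vm vm≥1)
       where
       n = PD.n x
       m = PD.m x
       y = PD.y x
       u = PD.u x
       vm = PD.v x * PD.v x * PD.v x * m
       vm≥1 : 1 ≤ vm
       vm≥1 = *-mono-≤ (*-mono-≤ (*-mono-≤ (PD.v≥1 x) (PD.v≥1 x)) (PD.v≥1 x)) (PD.m≥1 x)
       l : ∀ a b → (a ⊕ b) ⊖ b ≡ a
       l = ZS.solve-∀
       n∣ : n ∣ abs ((+ y) · (+ y) ⊖ k · (+ m) · (+ m))
       n∣ = subst (λ i → n ∣ abs i) (sym (trans (cong (λ i → i ⊖ k · (+ m) · (+ m)) (PD.yeq x)) (l ((+ n) · (u · u · u)) (k · (+ m) · (+ m))))) (∣-abs-*ʳ (+ n) (u · u · u) ND.∣-refl)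
       go : ∃[ s ] ∃[ w' ] (vm ≡ s * w' × GoodNum s × Bad.GoodNum w') → HT.Member B
       go (s , w' , e , gs , gw) = n * s , w' , trans (PD.B≡ x) (trans (*-assoc n _ m) (trans (cong (n *_) e) (sym (*-assoc n s w')))) ,
         good-* (norm-divisor-good n∣ (PD.m≥1 x) (PD.cop x) (PD.n≥1 x)) gs , gw ,
         ≤-trans (m≤n*m w' s {{>-nonZero (proj₁ gs)}}) (≤-trans (≤-reflexive (sym e)) h) , B≤N

     open Counting {Elem N} proj₁

     case-A-big : ∀ xs → All (λ x → PD.v x * PD.v x * PD.v x * PD.m x ≤ z) xs → All (λ x → N < proj₁ x * proj₁ x) xs → Distinct xs → length xs * length xs * T ≤ constA * (N * N * LL)
     case-A-big xs as bs d = begin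
       length xs * length xs * T ≡⟨ cong (λ i → i * i * T) (sym (LP.length-map proj₁ xs)) ⟩
       length S * length S * T ≤⟨ sieve-numeric 48 (16 * cS) (4 * cL * 144) (N ! * N !) N (length S) ℓ T r HT.goodSum HT.badSum (*-mono-≤ (1≤n! N) (1≤n! N))
           (HT.hall-tenenbaum S (AllP.map⁺ (All.map (λ {x} → member x) as)) (APP.map⁺ d) (AllP.map⁺ bs)) (subst (λ c → HT.goodSum * HT.goodSum ≤ 16 * c * (T * (N ! * N !))) constS≡ US.goodSum²) badSum²≤ ℓ≥1 (≤-trans (+-monoˡ-≤ ℓ ℓ≥1) (≤-reflexive (cong (λ i → ℓ + i) (sym (+-identityʳ ℓ))))) ⟩
       c * (N * N * r) ≤⟨ *-monoʳ-≤ c (*-monoʳ-≤ (N * N) (ilog-ilog≤ N N≥3)) ⟩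
       c * (N * N * (2 * LL)) ≡⟨ l c (N * N) LL ⟩
       2 * c * (N * N * LL) ∎
       where
       open ≤-Reasoning
       S = map proj₁ xs
       c = 4 * (48 * 48 * (16 * cS * (4 * cL * 144)))
       l : ∀ c n t → c * (n * (2 * t)) ≡ 2 * c * (n * t)
       l = NS.solve-∀

     case-A-small : ∀ xs → All (λ x → ¬ N < proj₁ x * proj₁ x) xs → Distinct xs → length xs * length xs * T ≤ 4 * (N * N * LL)
     case-A-small xs bs d = go (isqrt N)
       where
       open ≤-Reasoning
       l : ∀ s → (s + s) * (s + s) ≡ 4 * (s * s)
       l = NS.solve-∀
       go : ∃[ s ] (s * s ≤ N × N < suc s * suc s) → length xs * length xs * T ≤ 4 * (N * N * LL)
       go (s , lo , hi) = begin
         length xs * length xs * T ≤⟨ *-monoˡ-≤ T (*-mono-≤ len≤ len≤) ⟩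
         (s + s) * (s + s) * T ≡⟨ cong (_* T) (l s) ⟩
         4 * (s * s) * T ≤⟨ *-mono-≤ (*-monoʳ-≤ 4 lo) T≤N ⟩
         4 * N * N ≡⟨ *-assoc 4 N N ⟩
         4 * (N * N) ≤⟨ *-monoʳ-≤ 4 (m≤m*n (N * N) LL {{>-nonZero LL≥1}}) ⟩
         4 * (N * N * LL) ∎
         where
         isqrt≥1 : 1 ≤ s
         isqrt≥1 = n≢0⇒n>0 (λ { refl → <⇒≱ hi N≥1 })
         len≤ : length xs ≤ s + s
         len≤ = ≤-trans (bdd-key proj₁ (suc s) xs (All.map (λ {x} nb → s≤s (≮⇒≥ (λ lt → <⇒≱ hi (≤-trans (*-mono-≤ lt lt) (≮⇒≥ nb))))) bs) d) (+-monoˡ-≤ s isqrt≥1)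

     boundBC : ℕ
     boundBC = T * (T * (T * (cB * X₀ * T))) + T * (T * (cC * ((M + M) * T)))

     case-BC : Bdd (λ x → ¬ PD.v x * PD.v x * PD.v x * PD.m x ≤ z) boundBC
     case-BC = bdd-split (λ x → PD.absx x ≤? X₀)
       (bdd-via proj₁ CB.BElem.B (λ x (_ , h) → record { B = proj₁ x ; pd = pd x ; B≤N = proj₁ (proj₂ (proj₂ x)) ; x≤X₀ = h }) (λ _ _ → refl) (subst (λ c → Counting.Bdd CB.BElem.B (λ _ → ⊤) (T * (T * (T * (c * X₀ * T))))) constB≡ CB.case-B))
       (bdd-via proj₁ CC.CElem.B (λ x (nz , h) → record { B = proj₁ x ; pd = pd x ; B≤N = proj₁ (proj₂ (proj₂ x)) ; X₀<x = ≰⇒> h ; z<vm = ≰⇒> nz }) (λ _ _ → refl) (subst (λ c → Counting.Bdd CC.CElem.B (λ _ → ⊤) (T * (T * (c * ((M + M) * T))))) constC≡ CC.case-C))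

     boundBC≤ : boundBC * T ≤ constBC * N
     boundBC≤ = begin
       boundBC * T ≡⟨ l cB cC X₀ M T ⟩
       cB * (X₀ * t₅) + 2 * cC * (M * t₄) ≤⟨ +-mono-≤ (*-monoʳ-≤ cB (DM.m/n*n≤m N t₅)) (*-monoʳ-≤ (2 * cC) (DM.m/n*n≤m N t₄)) ⟩
       cB * N + 2 * cC * N ≡⟨ sym (*-distribʳ-+ N cB (2 * cC)) ⟩
       constBC * N ∎
       where
       open ≤-Reasoning
       l : ∀ b c x m t → (t * (t * (t * (b * x * t))) + t * (t * (c * ((m + m) * t)))) * t ≡ b * (x * (t * t * (t * t) * t)) + 2 * c * (m * (t * t * (t * t)))
       l = NS.solve-∀

   large-bound : ∀ xs → Distinct xs → length xs * length xs * T ≤ constLarge * (N * N * LL)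
   large-bound xs d = ≤-trans (≤-reflexive (cong (λ i → i * i * T) (trans (length-filter-split A? xs) (cong (_+ length (filter (¬? ∘ A?) xs)) (length-filter-split big? (filter A? xs))))))
     (add-bound {length (filter big? (filter A? xs)) + length (filter (¬? ∘ big?) (filter A? xs))} {length (filter (¬? ∘ A?) xs)} {T} {2 * (constA + 4)} {constBC * constBC} {N * N * LL}
       (add-bound {length (filter big? (filter A? xs))} {length (filter (¬? ∘ big?) (filter A? xs))} {T} {constA} {4} {N * N * LL}
         (case-A-big (filter big? (filter A? xs)) (AllP.filter⁺ big? allA) (AllP.all-filter big? (filter A? xs)) (APP.filter⁺ big? dA))
         (case-A-small (filter (¬? ∘ big?) (filter A? xs)) (AllP.all-filter (¬? ∘ big?) (filter A? xs)) (APP.filter⁺ (¬? ∘ big?) dA)))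
       (linear-bound {length (filter (¬? ∘ A?) xs)} {T} {constBC} {N} {LL} (s≤s z≤n) LL≥1 (≤-trans (*-monoˡ-≤ T (case-BC (filter (¬? ∘ A?) xs) (AllP.all-filter (¬? ∘ A?) xs) (APP.filter⁺ (¬? ∘ A?) d))) boundBC≤)))
     where
     allA : All (λ x → PD.v x * PD.v x * PD.v x * PD.m x ≤ z) (filter A? xs)
     allA = AllP.all-filter A? xs
     dA : Distinct (filter A? xs)
     dA = APP.filter⁺ A? d

 -- While T is bounded in terms of k, the trivial bound by N + 1 is enough.
 small-bound : ∀ N → 3 ≤ N → suc (ilog N) ≤ constSmall → ∀ (xs : List (Elem N)) → Counting.Distinct proj₁ xs → length xs * length xs * suc (ilog N) ≤ 4 * constSmall * (N * N * LgLg N)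
 small-bound N N≥3 T≤ xs d = begin
   length xs * length xs * suc (ilog N) ≤⟨ *-mono-≤ (*-mono-≤ len≤ len≤) T≤ ⟩
   (N + N) * (N + N) * constSmall ≡⟨ l N constSmall ⟩
   4 * constSmall * (N * N) ≤⟨ *-monoʳ-≤ (4 * constSmall) (m≤m*n (N * N) (LgLg N) {{>-nonZero (1≤LgLg N N≥3)}}) ⟩
   4 * constSmall * (N * N * LgLg N) ∎
   where
   open ≤-Reasoning
   l : ∀ n c → (n + n) * (n + n) * c ≡ 4 * c * (n * n)
   l = NS.solve-∀
   len≤ : length xs ≤ N + N
   len≤ = ≤-trans (bdd-key proj₁ (suc N) xs (All.universal (λ x → s≤s (proj₁ (proj₂ (proj₂ x)))) xs) d) (+-monoˡ-≤ N (≤-trans (s≤s z≤n) N≥3))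

 not-large : ∀ H N → 3 ≤ N → ¬ (H * (fifth (suc (ilog N)) * fifth (suc (ilog N)) * fifth (suc (ilog N))) ≤ N) → suc (ilog N) ≤ threshold 15 (2 * H)
 not-large H N N≥3 h = exponential-beats-power 15 (2 * H) T (begin-strict
   2 * 2 ^ ilog N ≤⟨ *-monoʳ-≤ 2 (2^ilog≤ N (≤-trans (s≤s z≤n) N≥3)) ⟩
   2 * N <⟨ *-monoʳ-< 2 (≰⇒> h) ⟩
   2 * (H * (fifth T * fifth T * fifth T)) ≡⟨ sym (*-assoc 2 H (fifth T * fifth T * fifth T)) ⟩
   2 * H * (fifth T * fifth T * fifth T) ≡⟨ cong (2 * H *_) (l T) ⟩
   2 * H * T ^ 15 ∎)
   where
   open ≤-Reasoning
   T = suc (ilog N)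
   l : ∀ t → (t * t * (t * t) * t) * (t * t * (t * t) * t) * (t * t * (t * t) * t) ≡ t * (t * (t * (t * (t * (t * (t * (t * (t * (t * (t * (t * (t * (t * (t * 1))))))))))))))
   l = NS.solve-∀

 total-bound : NonSquareRational k → k ≢ 0ℤ → ∀ N → 3 ≤ N → ∀ (xs : List (Elem N)) → Counting.Distinct proj₁ xs →
   length xs * length xs * suc (ilog N) ≤ (constLarge + 4 * constSmall) * (N * N * LgLg N)
 total-bound ns k≢0 N N≥3 xs d = split₁ (10 * (κ * κ) ≤? suc (ilog N)) (bigH * (fifth (suc (ilog N)) * fifth (suc (ilog N)) * fifth (suc (ilog N))) ≤? N)
   where
   Goal : Set
   Goal = length xs * length xs * suc (ilog N) ≤ (constLarge + 4 * constSmall) * (N * N * LgLg N)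
   small : suc (ilog N) ≤ constSmall → Goal
   small h = ≤-trans (small-bound N N≥3 h xs d) (*-monoˡ-≤ (N * N * LgLg N) (m≤n+m (4 * constSmall) constLarge))
   split₁ : Dec (10 * (κ * κ) ≤ suc (ilog N)) → Dec (bigH * (fifth (suc (ilog N)) * fifth (suc (ilog N)) * fifth (suc (ilog N))) ≤ N) → Goal
   split₁ (no h) _ = small (≤-trans (≰⇒≥ h) (m≤n+m (10 * (κ * κ)) (threshold 15 (2 * bigH))))
   split₁ (yes _) (no h) = small (≤-trans (not-large bigH N N≥3 h) (m≤m+n (threshold 15 (2 * bigH)) (10 * (κ * κ))))
   split₁ (yes p) (yes q) = ≤-trans (Large.large-bound ns k≢0 (abs≥1 k≢0) N N≥3 q p xs d) (*-monoˡ-≤ (N * N * LgLg N) (m≤m+n constLarge (4 * constSmall)))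

theorem1p1 : (k : ℤ) → k ≢ 0ℤ → NonSquareRational k →
  ∃[ C ] ((N : ℕ) → 3 ≤ N → (S : List ℕ) → GoodList k N S →
    Bound C N (length S))
theorem1p1 k k≢0 ns = C , bound
  where
  open Curve k
  open ≤-Reasoning
  C = constLarge + 4 * constSmall
  l₁ : ∀ a b → a * (a * 1) * b ≡ a * a * b
  l₁ = NS.solve-∀
  l₂ : ∀ c n t → c * c * (n * n * t) ≡ c * (c * 1) * (n * (n * 1)) * t
  l₂ = NS.solve-∀
  bound : (N : ℕ) → 3 ≤ N → (S : List ℕ) → GoodList k N S → Bound C N (length S)
  bound N N≥3 S (u , all) = begin
    length S ^ 2 * Lg N ≡⟨ l₁ (length S) (Lg N) ⟩
    length S * length S * Lg N ≤⟨ *-monoʳ-≤ (length S * length S) (Lg≤ N) ⟩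
    length S * length S * suc (ilog N) ≡⟨ cong (λ i → i * i * suc (ilog N)) (sym (attach-length S all)) ⟩
    length xs * length xs * suc (ilog N) ≤⟨ total-bound ns k≢0 N N≥3 xs (attach-distinct S all u) ⟩
    -- The estimates bound the squared count with constant C, whereas `Bound` is stated with C².
    C * (N * N * LgLg N) ≤⟨ *-monoˡ-≤ (N * N * LgLg N) (m≤m*m C) ⟩
    C * C * (N * N * LgLg N) ≡⟨ l₂ C N (LgLg N) ⟩
    C ^ 2 * N ^ 2 * LgLg N ∎
    where
    xs = attach S all
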